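{- There is no deterministic algorithm for online graph exploration with competitive ratio smaller than $\frac{10}{3}$, even for planar graphs. That is, for every deterministic exploration algorithm $\mathrm{ALG}$, $$\sup_{G}\ \frac{\mathrm{ALG}(G)}{\mathrm{OPT}(G)}\ \ge\ \frac{10}{3},$$ where the supremum is taken over all instances $G$ whose underlying graph is planar.
   Context: Online graph exploration problem. An instance is a finite connected undirected graph $G$ with nonnegative real edge weights, unique vertex identifiers, and a designated start vertex called the origin. An agent starts at the origin. In each step it may move along any edge incident to its current vertex, at a cost equal to the weight of that edge. Initially the graph is unknown; at any time the agent knows exactly all edges incident to the vertices it has visited so far (the origin counts as visited), including the weights of these edges and the identifiers of both their endpoints (in particular of unvisited endpoints). The agent has to visit all vertices and return to the origin. A deterministic algorithm chooses each move (or the decision to stop) as a deterministic function of the information revealed so far and of its previous moves, and must on every instance visit all vertices and finally return to the origin. $\mathrm{ALG}(G)$ denotes the total cost of the edge traversals (counted with multiplicity) made by the algorithm on $G$. $\mathrm{OPT}(G)$ denotes the minimum total cost of a closed walk in $G$ that starts and ends at the origin and visits all vertices. The competitive ratio of an algorithm on a class of instances is the worst-case ratio (supremum) of $\mathrm{ALG}(G)/\mathrm{OPT}(G)$ over the instances $G$ of the class; instances are understood to satisfy $\mathrm{OPT}(G)>0$. -}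

module Defs where

open import Data.Bool using (Bool; false; T)
open import Data.Bool.Properties using (T?)
open import Data.Fin as Fin using (Fin)
open import Data.List using (List; []; _∷_; map; filter; allFin)
open import Data.List.Membership.Propositional using (_∈_)
open import Data.List.Relation.Binary.Pointwise using (Pointwise)
open import Data.List.Relation.Binary.Permutation.Homogeneous using (Permutation)
open import Data.Nat as ℕ using (ℕ; _⊔_)
import Data.Nat.Properties as ℕₚ
open import Data.Product using (∃-syntax; _×_; _,_; proj₁; proj₂)
open import Data.Rational as ℚ using (ℚ; 0ℚ; 1ℚ; ½; ∣_∣; 1/_)
import Data.Rational.Properties as ℚₚ
import Data.Rational.Solver as ℚSolver
open import Relation.Binary.PropositionalEquality
  using (_≡_; _≢_; refl; cong; cong₂; sym; trans)
open import Relation.Nullary using (¬_)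

------------------------------------------------------------------------
-- Real numbers: Cauchy sequences of rationals.  Distinct sequences may
-- represent the same real; equality of reals is _≈_, not _≡_.

Cauchy : (ℕ → ℚ) → Set
Cauchy x = ∀ ε → 0ℚ ℚ.< ε →
  ∃[ N ] (∀ m n → N ℕ.≤ m → N ℕ.≤ n → ∣ x m ℚ.- x n ∣ ℚ.≤ ε)

record ℝ : Set where
  constructor real
  field
    seq    : ℕ → ℚ
    cauchy : Cauchy seq

open ℝ public

private
  left : ∀ m n {o} → m ⊔ n ℕ.≤ o → m ℕ.≤ o
  left m n h = ℕₚ.m⊔n≤o⇒m≤o m n h

  right : ∀ m n {o} → m ⊔ n ℕ.≤ o → n ℕ.≤ o
  right m n h = ℕₚ.m⊔n≤o⇒n≤o m n h

  half-pos : ∀ {ε} → 0ℚ ℚ.< ε → 0ℚ ℚ.< ε ℚ.* ½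
  half-pos {ε} 0<ε =
    ℚₚ.positive⁻¹ _ {{ℚₚ.pos*pos⇒pos ε {{ℚ.positive 0<ε}} ½}}

  half+half : ∀ ε → ε ℚ.* ½ ℚ.+ ε ℚ.* ½ ≡ ε
  half+half ε = trans (sym (ℚₚ.*-distribˡ-+ ε ½ ½)) (ℚₚ.*-identityʳ ε)

  +-cauchy : ∀ x y → Cauchy x → Cauchy y → Cauchy (λ n → x n ℚ.+ y n)
  +-cauchy x y cx cy ε 0<ε
    with M , p ← cx _ (half-pos 0<ε)
       | N , q ← cy _ (half-pos 0<ε) =
    M ⊔ N , λ m n M⊔N≤m M⊔N≤n → let open ℚₚ.≤-Reasoning in begin
      ∣ (x m ℚ.+ y m) ℚ.- (x n ℚ.+ y n) ∣
        ≡⟨ cong ∣_∣ (identity (x m) (y m) (x n) (y n)) ⟩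
      ∣ (x m ℚ.- x n) ℚ.+ (y m ℚ.- y n) ∣
        ≤⟨ ℚₚ.∣p+q∣≤∣p∣+∣q∣ (x m ℚ.- x n) (y m ℚ.- y n) ⟩
      ∣ x m ℚ.- x n ∣ ℚ.+ ∣ y m ℚ.- y n ∣
        ≤⟨ ℚₚ.+-mono-≤
             (p m n (left M N M⊔N≤m) (left M N M⊔N≤n))
             (q m n (right M N M⊔N≤m) (right M N M⊔N≤n)) ⟩
      ε ℚ.* ½ ℚ.+ ε ℚ.* ½
        ≡⟨ half+half ε ⟩
      ε ∎
    where
    open ℚSolver.+-*-Solver
    identity : ∀ a b c d →
      (a ℚ.+ b) ℚ.- (c ℚ.+ d) ≡ (a ℚ.- c) ℚ.+ (b ℚ.- d)
    identity = solve 4 (λ a b c d →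
      (a :+ b) :- (c :+ d) := (a :- c) :+ (b :- d)) refl

  eventually-bounded : ∀ x → Cauchy x →
    ∃[ B ] 0ℚ ℚ.< B × ∃[ N ] (∀ n → N ℕ.≤ n → ∣ x n ∣ ℚ.≤ B)
  eventually-bounded x cx
    with N , p ← cx 1ℚ (ℚₚ.positive⁻¹ 1ℚ) =
    1ℚ ℚ.+ ∣ x N ∣
    , ℚₚ.positive⁻¹ _
        {{ℚₚ.pos+nonNeg⇒pos 1ℚ ∣ x N ∣ {{ℚₚ.∣-∣-nonNeg (x N)}}}}
    , N , λ n N≤n → let open ℚₚ.≤-Reasoning in begin
        ∣ x n ∣                       ≡⟨ cong ∣_∣ (identity (x n) (x N)) ⟩
        ∣ (x n ℚ.- x N) ℚ.+ x N ∣     ≤⟨ ℚₚ.∣p+q∣≤∣p∣+∣q∣ (x n ℚ.- x N) (x N) ⟩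
        ∣ x n ℚ.- x N ∣ ℚ.+ ∣ x N ∣   ≤⟨ ℚₚ.+-monoˡ-≤ ∣ x N ∣ (p n N N≤n ℕₚ.≤-refl) ⟩
        1ℚ ℚ.+ ∣ x N ∣                ∎
    where
    open ℚSolver.+-*-Solver
    identity : ∀ a b → a ≡ (a ℚ.- b) ℚ.+ b
    identity = solve 2 (λ a b → a := (a :- b) :+ b) refl

  divide : ∀ {η B} → 0ℚ ℚ.< η → 0ℚ ℚ.< B → ∃[ δ ] 0ℚ ℚ.< δ × δ ℚ.* B ≡ η
  divide {η} {B} 0<η 0<B =
    η ℚ.* 1/ B
    , ℚₚ.positive⁻¹ _ {{ℚₚ.pos*pos⇒pos η (1/ B) {{ℚₚ.1/pos⇒pos B}}}}
    , trans (ℚₚ.*-assoc η (1/ B) B)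
        (trans (cong (η ℚ.*_) (ℚₚ.*-inverseˡ B)) (ℚₚ.*-identityʳ η))
    where
    instance
      _ = ℚ.positive 0<η
      _ = ℚ.positive 0<B
      _ = ℚₚ.pos⇒nonZero B

  *-mono : ∀ a b c d → ∣ a ∣ ℚ.≤ c → ∣ b ∣ ℚ.≤ d → ∣ a ℚ.* b ∣ ℚ.≤ c ℚ.* d
  *-mono a b c d p q = let open ℚₚ.≤-Reasoning in begin
    ∣ a ℚ.* b ∣      ≡⟨ ℚₚ.∣p*q∣≡∣p∣*∣q∣ a b ⟩
    ∣ a ∣ ℚ.* ∣ b ∣  ≤⟨ ℚₚ.*-monoʳ-≤-nonNeg ∣ b ∣ {{ℚₚ.∣-∣-nonNeg b}} p ⟩
    c ℚ.* ∣ b ∣      ≤⟨ ℚₚ.*-monoˡ-≤-nonNeg c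
                         {{ℚ.nonNegative (ℚₚ.≤-trans (ℚₚ.0≤∣p∣ a) p)}} q ⟩
    c ℚ.* d          ∎

  *-close : ∀ a b c d δ η B C →
    ∣ a ℚ.- c ∣ ℚ.≤ δ → ∣ d ∣ ℚ.≤ C → ∣ b ℚ.- d ∣ ℚ.≤ η → ∣ a ∣ ℚ.≤ B →
    ∣ a ℚ.* b ℚ.- c ℚ.* d ∣ ℚ.≤ δ ℚ.* C ℚ.+ η ℚ.* B
  *-close a b c d δ η B C p q r s = let open ℚₚ.≤-Reasoning in begin
    ∣ a ℚ.* b ℚ.- c ℚ.* d ∣
      ≡⟨ cong ∣_∣ (identity a b c d) ⟩
    ∣ (a ℚ.- c) ℚ.* d ℚ.+ (b ℚ.- d) ℚ.* a ∣
      ≤⟨ ℚₚ.∣p+q∣≤∣p∣+∣q∣ ((a ℚ.- c) ℚ.* d) ((b ℚ.- d) ℚ.* a) ⟩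
    ∣ (a ℚ.- c) ℚ.* d ∣ ℚ.+ ∣ (b ℚ.- d) ℚ.* a ∣
      ≤⟨ ℚₚ.+-mono-≤ (*-mono (a ℚ.- c) d δ C p q) (*-mono (b ℚ.- d) a η B r s) ⟩
    δ ℚ.* C ℚ.+ η ℚ.* B ∎
    where
    open ℚSolver.+-*-Solver
    identity : ∀ a b c d →
      a ℚ.* b ℚ.- c ℚ.* d ≡ (a ℚ.- c) ℚ.* d ℚ.+ (b ℚ.- d) ℚ.* a
    identity = solve 4 (λ a b c d →
      a :* b :- c :* d := (a :- c) :* d :+ (b :- d) :* a) refl

  *-cauchy : ∀ x y → Cauchy x → Cauchy y → Cauchy (λ n → x n ℚ.* y n)
  *-cauchy x y cx cy ε 0<ε =
    let B , 0<B , K , bx = eventually-bounded x cx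
        C , 0<C , L , by = eventually-bounded y cy
        δ , 0<δ , δC≡ε/2 = divide (half-pos 0<ε) 0<C
        η , 0<η , ηB≡ε/2 = divide (half-pos 0<ε) 0<B
        M , p = cx δ 0<δ
        N , q = cy η 0<η
    in (K ⊔ L) ⊔ (M ⊔ N) , λ m n ≤m ≤n → ℚₚ.≤-trans
         (*-close (x m) (y m) (x n) (y n) δ η B C
           (p m n (left M N (right (K ⊔ L) (M ⊔ N) ≤m)) (left M N (right (K ⊔ L) (M ⊔ N) ≤n)))
           (by n (right K L (left (K ⊔ L) (M ⊔ N) ≤n)))
           (q m n (right M N (right (K ⊔ L) (M ⊔ N) ≤m)) (right M N (right (K ⊔ L) (M ⊔ N) ≤n)))
           (bx m (left K L (left (K ⊔ L) (M ⊔ N) ≤m))))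
         (ℚₚ.≤-reflexive
           (trans (cong₂ ℚ._+_ δC≡ε/2 ηB≡ε/2) (half+half ε)))

fromℚ : ℚ → ℝ
fromℚ q = real (λ _ → q) λ ε 0<ε →
  0 , λ _ _ _ _ → ℚₚ.≤-trans
    (ℚₚ.≤-reflexive (cong ∣_∣ (ℚₚ.+-inverseʳ q))) (ℚₚ.<⇒≤ 0<ε)

0ℝ 1ℝ : ℝ
0ℝ = fromℚ 0ℚ
1ℝ = fromℚ 1ℚ

infixl 6 _+_
infixl 7 _*_
infix  4 _≤_ _<_ _≈_

_+_ _*_ : ℝ → ℝ → ℝ
x + y = real (λ n → seq x n ℚ.+ seq y n) (+-cauchy (seq x) (seq y) (cauchy x) (cauchy y))
x * y = real (λ n → seq x n ℚ.* seq y n) (*-cauchy (seq x) (seq y) (cauchy x) (cauchy y))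

_≤_ _<_ _≈_ : ℝ → ℝ → Set
x ≤ y = ∀ ε → 0ℚ ℚ.< ε →
  ∃[ N ] (∀ n → N ℕ.≤ n → seq x n ℚ.≤ seq y n ℚ.+ ε)
x < y = ∃[ ε ] 0ℚ ℚ.< ε ×
  ∃[ N ] (∀ n → N ℕ.≤ n → seq x n ℚ.+ ε ℚ.≤ seq y n)
x ≈ y = x ≤ y × y ≤ x

-- ∣ x - y ∣ ≤ δ
Within : ℚ → ℝ → ℝ → Set
Within δ x y = x ≤ y + fromℚ δ × y ≤ x + fromℚ δ

------------------------------------------------------------------------

record Graph : Set where
  field
    order       : ℕ
    edge        : Fin order → Fin order → Bool
    edge-sym    : ∀ u v → edge u v ≡ edge v u
    edge-irrefl : ∀ v → edge v v ≡ false

  Vertex : Set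
  Vertex = Fin order

  Adj : Vertex → Vertex → Set
  Adj u v = T (edge u v)

  neighbours : Vertex → List Vertex
  neighbours v = filter (λ w → T? (edge v w)) (allFin order)

  infixl 5 _▷_

  data Walk (u : Vertex) : Vertex → Set where
    []  : Walk u u
    _▷_ : ∀ {v w} → Walk u v → Adj v w → Walk u w

  vertices : ∀ {u v} → Walk u v → List Vertex
  vertices {v = v} []      = v ∷ []
  vertices {v = v} (p ▷ _) = v ∷ vertices p

  Covers : ∀ {u v} → Walk u v → Set
  Covers p = ∀ w → w ∈ vertices p

  Connected : Set
  Connected = ∀ u v → Walk u v

------------------------------------------------------------------------

ℝ² : Set
ℝ² = ℝ × ℝ

_≈₂_ : ℝ² → ℝ² → Set
(x , y) ≈₂ (x′ , y′) = x ≈ x′ × y ≈ y′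

Within₂ : ℚ → ℝ² → ℝ² → Set
Within₂ δ (x , y) (x′ , y′) = Within δ x x′ × Within δ y y′

∈[0,1] ∈⟨0,1⟩ : ℝ → Set
∈[0,1] t = 0ℝ ≤ t × t ≤ 1ℝ
∈⟨0,1⟩ t = 0ℝ < t × t < 1ℝ

-- Only the restriction of γ to the unit interval matters.
record IsArc (P Q : ℝ²) (γ : ℝ → ℝ²) : Set where
  field
    start      : γ 0ℝ ≈₂ P
    end        : γ 1ℝ ≈₂ Q
    continuous : ∀ t → ∈[0,1] t → ∀ ε → 0ℚ ℚ.< ε →
                 ∃[ δ ] 0ℚ ℚ.< δ ×
                 (∀ s → ∈[0,1] s → Within δ s t → Within₂ ε (γ s) (γ t))
    injective  : ∀ s t → ∈[0,1] s → ∈[0,1] t → γ s ≈₂ γ t → s ≈ t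

record Planar (G : Graph) : Set where
  open Graph G

  -- Each undirected edge is drawn once, from its smaller endpoint; arc u v
  -- is unconstrained when (u , v) is not of this form.
  Edge : Vertex → Vertex → Set
  Edge u v = Adj u v × u Fin.< v

  field
    point          : Vertex → ℝ²
    point-distinct : ∀ u v → u ≢ v → ¬ point u ≈₂ point v
    arc            : Vertex → Vertex → ℝ → ℝ²
    arc-isArc      : ∀ u v → Edge u v → IsArc (point u) (point v) (arc u v)
    avoids-points  : ∀ u v w → Edge u v →
                     ∀ t → ∈⟨0,1⟩ t → ¬ arc u v t ≈₂ point w
    avoids-arcs    : ∀ u v u′ v′ → Edge u v → Edge u′ v′ →
                     (u , v) ≢ (u′ , v′) →
                     ∀ s t → ∈⟨0,1⟩ s → ∈[0,1] t →
                     ¬ arc u v s ≈₂ arc u′ v′ t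

------------------------------------------------------------------------

ID : Set
ID = ℕ

-- What is revealed on arriving at a vertex: its own identifier, and for
-- each incident edge the identifier of the other endpoint and the weight.
Observation : Set
Observation = ID × List (ID × ℝ)

-- Most recent observation first.  The first components record the moves
-- made so far (graphs are simple, so the endpoints determine the edge).
History : Set
History = List Observation

record Instance : Set where
  field
    graph : Graph

  open Graph graph public

  field
    connected     : Connected
    origin        : Vertex
    ident         : Vertex → ID
    ident-unique  : ∀ u v → ident u ≡ ident v → u ≡ v
    -- Only the weights of adjacent pairs matter.
    weight        : Vertex → Vertex → ℝ
    weight-sym    : ∀ u v → Adj u v → weight u v ≈ weight v u
    weight-nonNeg : ∀ u v → Adj u v → 0ℝ ≤ weight u v

  cost : ∀ {u v} → Walk u v → ℝ
  cost []                      = 0ℝ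
  cost (_▷_ {v = v} {w = w} p _) = cost p + weight v w

  observe : Vertex → Observation
  observe v = ident v , map (λ w → ident w , weight v w) (neighbours v)

  history : ∀ {u v} → Walk u v → History
  history {v = v} []      = observe v ∷ []
  history {v = v} (p ▷ _) = observe v ∷ history p

  record IsOPT (m : ℝ) : Set where
    field
      tour        : Walk origin origin
      tour-covers : Covers tour
      tour-cost   : cost tour ≈ m
      minimal     : (p : Walk origin origin) → Covers p → m ≤ cost p

------------------------------------------------------------------------

data Action : Set where
  stop : Action
  goto : ID → Action

Strategy : Set
Strategy = History → Action

-- Equality of information: the listing order of the edges at a vertex and
-- the representation of the real weights are irrelevant.
SameEdge : ID × ℝ → ID × ℝ → Set
SameEdge (i , x) (j , y) = i ≡ j × x ≈ y

SameObservation : Observation → Observation → Set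
SameObservation (i , es) (j , fs) = i ≡ j × Permutation SameEdge es fs

SameHistory : History → History → Set
SameHistory = Pointwise SameObservation

module _ (σ : Strategy) (G : Instance) where
  open Instance G

  data Follows : ∀ {v} → Walk origin v → Set where
    start : Follows []
    step  : ∀ {v w} {p : Walk origin v} → Follows p →
            σ (history p) ≡ goto (ident w) → (e : Adj v w) → Follows (p ▷ e)

  record CompleteRun : Set where
    field
      walk    : Walk origin origin
      follows : Follows walk
      stops   : σ (history walk) ≡ stop
      covers  : Covers walk

record Algorithm : Set where
  field
    strategy    : Strategy
    extensional : ∀ {h k} → SameHistory h k → strategy h ≡ strategy k
    explores    : (G : Instance) → CompleteRun strategy G

ALG : Algorithm → Instance → ℝ
ALG A G = Instance.cost G (CompleteRun.walk (Algorithm.explores A G))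

-- c is an upper bound for the ratios ALG(G) / OPT(G) over the instances G
-- in the class 𝒞 with OPT(G) > 0.
RatioBound : (Instance → Set) → Algorithm → ℝ → Set
RatioBound 𝒞 A c = ∀ G → 𝒞 G → ∀ opt → Instance.IsOPT G opt → 0ℝ < opt →
  ALG A G ≤ c * opt

-- r ≤ sup ALG(G) / OPT(G), with the supremum taken in [0, ∞]: every (finite)
-- upper bound is at least r.
_≤CompetitiveRatio[_]_ : ℝ → (Instance → Set) → Algorithm → Set
r ≤CompetitiveRatio[ 𝒞 ] A = ∀ c → RatioBound 𝒞 A c → r ≤ c

PlanarInstance : Instance → Set
PlanarInstance G = Planar (Instance.graph G)

{-# OPTIONS --safe #-}
-- The adversary builds the graph while the algorithm walks, keeping a potential Φ
-- that bounds the cost paid so far from below as a function of the position of the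
-- agent.  Its building blocks are graphs with an entry and an exit at distance rr
-- such that every algorithm pays at least X before it sees the exit, whereas the
-- optimum covers the block on its way through at cost cc, with 4 cc ≤ X + (1 + m/n) rr.
-- An edge of weight 1 satisfies this with m/n = 2.  From blocks with ratio m/n one
-- gets blocks with ratio 19m/20n: two strands, both of them chains of blocks, grow
-- at a common hub.  An agent that keeps changing between the strands wastes so much
-- that one of them may become a dead end, the exit being on the other one; against an
-- agent that pursues one strand much further, this strand is ended by two edges of
-- large equal weight, and an edge of weight 0 ties the first end that is reached
-- either to the end of the other strand or to the second end.
--
-- In the limit the agent pays at least 3L before it reaches the end of a chain of
-- blocks of length L.  Two strands that grow at the origin are finally tied together
-- by an edge of weight 0, so that the optimum goes once around the ring.  If the agent
-- changes between the strands late, it pays about 4 times the optimum.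
-- Otherwise the longer strand forks once more, and balancing the two new strands
-- against it gives the factor 10/3.
--
-- All these graphs have a book embedding with two pages, which is drawn with
-- parabolas on both sides of the real axis.
module Submission where

open import Data.Bool using (Bool; true; false; T; not; if_then_else_) renaming (_≟_ to _≟ᵇ_)
open import Data.Bool.Properties using (T?)
open import Data.Empty using (⊥; ⊥-elim)
open import Data.Fin using (Fin; toℕ) renaming (zero to fzero; suc to fsuc)
open import Data.Fin.Properties using (toℕ-injective)
open import Data.List using (List; []; _∷_; _++_; map; length; _∷ʳ_; lookup; filter; tabulate)
open import Data.List.Membership.Propositional using (_∈_)
open import Data.List.Membership.Propositional.Properties using (∈-++⁺ˡ; ∈-++⁺ʳ; ∈-++⁻; ∈-map⁺; ∈-map⁻; ∈-lookup)
open import Data.List.Properties using (++-assoc; ++-identityʳ)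
open import Data.List.Relation.Unary.AllPairs using ([]; _∷_)
open import Data.List.Relation.Unary.Any using (here; there; index)
open import Data.List.Relation.Unary.Any.Properties using (lookup-index)
open import Data.List.Relation.Unary.Unique.Propositional using (Unique)
open import Data.Maybe using (Maybe; just; nothing; maybe; is-just)
open import Data.Nat using (ℕ; zero; suc; _+_; _*_; _∸_; _≤_; _<_; z≤n; s≤s; _⊔_; _⊓_; _≤?_; NonZero; >-nonZero)
open import Data.Nat.Properties
open import Data.Nat.Solver using (module +-*-Solver)
open import Data.Product using (Σ; ∃-syntax; _×_; _,_; proj₁; proj₂)
open import Data.Sum using (_⊎_; inj₁; inj₂; [_,_]′)
open import Data.Unit using (⊤; tt)
open import Function using (_∘_; id)
open import Relation.Binary.Definitions using (tri<; tri≈; tri>)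
open import Relation.Binary.PropositionalEquality using (_≡_; _≢_; refl; sym; trans; cong; cong₂; subst; subst₂)
open import Relation.Nullary using (¬_; Dec; yes; no)
import Data.Fin as Fin
import Data.Integer.Properties as ℤₚ
import Data.List.Relation.Unary.All as All
import Data.List.Relation.Unary.Unique.Propositional.Properties as Uniqueₚ
import Data.Rational as ℚ
import Data.Rational.Properties as ℚₚ
import Data.Rational.Solver as ℚSolver
import Data.Rational.Unnormalised as ℚᵘ
import Data.Rational.Unnormalised.Properties as ℚᵘₚ
import Data.Integer as ℤ
import Defs as R
open +-*-Solver using () renaming (solve to solveℕ; _:+_ to _⊕_; _:*_ to _⊗_; _:=_ to _⊜_; con to lit)

-- The algorithm has to finish on every instance, so the adversary keeps a complete finite instance
-- at hand, lets the algorithm run on it up to the first vertex that still admits changes, and then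
-- replaces the instance by a larger one that looks the same from all vertices visited before. All
-- conditions on blocks are linear, with error terms of the size of one block, which long chains
-- make negligible. With m/n tending to 0 a chain satisfies X ≥ 4k - L, where k is the cost of
-- covering it and L its length; an agent that has to walk along L once more has then paid 4k. The
-- factor 10/3 is the common value of the two ways in which the last phase ends. Let p be the length
-- of the long strand, b ≤ c the lengths of the late arms and k ≥ p + b + c the total covering cost.
-- If the agent goes back to the short strand at the origin, it pays about 4k against k + b; if it
-- goes on along the arm of length c, it pays about 4k - p + c + 2b against k + b. For k = p + b + c
-- and b = c = p/3 both quotients are 10/3, which is why the arms are compared with a third of the
-- long strand.

lin : ∀ {l r a b} s → l + b + s ≡ r + a → a ≤ b → l ≤ r
-- Linear arithmetic by certificate: `a ≤ b` is a nonnegative combination of the hypotheses, `s` the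
-- slack left over, and the ring solver checks the identity. The numeric factors in the uses below
-- are the multipliers of such combinations.
lin {l} {r} {a} {b} s eq le = +-cancelʳ-≤ b l r
  (≤-trans (m≤m+n (l + b) s) (≤-trans (≤-reflexive eq) (+-monoʳ-≤ r le)))

-- Weighted graphs with a two-page book layout

record Edge (V : Set) : Set where
  constructor edge
  field
    src tgt : V
    wt      : ℕ
    low     : Bool
open Edge

mapE : ∀ {V W} → (V → W) → Edge V → Edge W
mapE f (edge a b w l) = edge (f a) (f b) w l

Lip : ∀ {V} → (V → ℕ) → Edge V → Set
Lip p e = p (src e) ≤ p (tgt e) + wt e × p (tgt e) ≤ p (src e) + wt e

Lips : ∀ {V} → (V → ℕ) → List (Edge V) → Set
Lips p E = ∀ {e} → e ∈ E → Lip p e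

-- Edges point to the right, so two arcs on one page cross exactly if this holds for the pair in one
-- of its two orders. Nested arcs and arcs with a common end do not cross.
Cross : ∀ {V} → (V → ℕ) → Edge V → Edge V → Set
Cross pos e f = pos (src e) < pos (src f) × pos (src f) < pos (tgt e) × pos (tgt e) < pos (tgt f)

-- The vertices are placed on a line in the order pos; an edge with low = false
-- is drawn above the line, any other edge below it.
record Shape (V : Set) (root : V) : Set where
  no-eta-equality
  field
    inV       : V → Bool
    edges     : List (Edge V)
    last      : V
    pos       : V → ℕ
    width     : ℕ
    root∈     : T (inV root)
    last∈     : T (inV last)
    src∈      : ∀ {e} → e ∈ edges → T (inV (src e))
    tgt∈      : ∀ {e} → e ∈ edges → T (inV (tgt e))
    fwd       : ∀ {e} → e ∈ edges → pos (src e) < pos (tgt e)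
    pos-root  : pos root ≡ 0
    pos-last  : suc (pos last) ≡ width
    pos-bound : ∀ {v} → T (inV v) → pos v < width
    pos-inj   : ∀ {u v} → T (inV u) → T (inV v) → pos u ≡ pos v → u ≡ v
    planar    : ∀ {e f} → e ∈ edges → f ∈ edges → low e ≡ low f → ¬ Cross pos e f
open Shape

-- No arc on page `l` passes over `v`, so an edge that leaves the shape from `v` on this page
-- crosses nothing inside.
Visible : ∀ {V r} → Shape V r → Bool → V → Set
Visible S l v = ∀ {e} → e ∈ edges S → low e ≡ l → ¬ (pos S (src e) < pos S v × pos S v < pos S (tgt e))

root-visible : ∀ {V r} (S : Shape V r) l → Visible S l r
root-visible S l {e} _ _ (p , _) = n≮0 (subst (pos S (src e) <_) (pos-root S) p)

last-visible : ∀ {V r} (S : Shape V r) l → Visible S l (last S)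
last-visible S l {e} e∈ _ (_ , q) =
  <⇒≱ (pos-bound S (tgt∈ S e∈)) (≤-trans (≤-reflexive (sym (pos-last S))) q)

record Bridge {V W r s} (S : Shape V r) (S′ : Shape W s) : Set where
  constructor bridge
  field
    bsrc : V
    btgt : W
    bwt  : ℕ
    blow : Bool
    bsrc∈ : T (inV S bsrc)
    btgt∈ : T (inV S′ btgt)
    bsrc-visible : Visible S blow bsrc
    btgt-visible : Visible S′ blow btgt
open Bridge

module _ {V W : Set} {r : V} {s : W} (S : Shape V r) (S′ : Shape W s) where

  bridgeE : Bridge S S′ → Edge (V ⊎ W)
  bridgeE b = edge (inj₁ (bsrc b)) (inj₂ (btgt b)) (bwt b) (blow b)

  joinEdges : List (Bridge S S′) → List (Edge (V ⊎ W))
  joinEdges F = map bridgeE F ++ map (mapE inj₁) (edges S) ++ map (mapE inj₂) (edges S′)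

  data JoinView (F : List (Bridge S S′)) : Edge (V ⊎ W) → Set where
    between : ∀ {b} → b ∈ F → JoinView F (bridgeE b)
    left    : ∀ {e} → e ∈ edges S → JoinView F (mapE inj₁ e)
    right   : ∀ {e} → e ∈ edges S′ → JoinView F (mapE inj₂ e)

  joinView : ∀ F {e} → e ∈ joinEdges F → JoinView F e
  joinView F e∈ with ∈-++⁻ (map bridgeE F) e∈
  ... | inj₁ p with _ , q , refl ← ∈-map⁻ bridgeE p = between q
  ... | inj₂ p with ∈-++⁻ (map (mapE inj₁) (edges S)) p
  ...   | inj₁ p′ with _ , q , refl ← ∈-map⁻ (mapE inj₁) p′ = left q
  ...   | inj₂ p′ with _ , q , refl ← ∈-map⁻ (mapE inj₂) p′ = right q

  private
    posJ : V ⊎ W → ℕ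
    posJ = [ pos S , (λ w → width S + pos S′ w) ]′

    inJ : V ⊎ W → Bool
    inJ = [ inV S , inV S′ ]′

    src-left : ∀ {v w} → T (inV S v) → pos S v < width S + pos S′ w
    src-left v∈ = m≤n⇒m≤n+o _ (pos-bound S v∈)

    injJ : ∀ {u v} → T (inJ u) → T (inJ v) → posJ u ≡ posJ v → u ≡ v
    injJ {inj₁ _} {inj₁ _} u∈ v∈ eq = cong inj₁ (pos-inj S u∈ v∈ eq)
    injJ {inj₁ _} {inj₂ w} u∈ v∈ eq = ⊥-elim (<⇒≢ (src-left {w = w} u∈) eq)
    injJ {inj₂ w} {inj₁ _} u∈ v∈ eq = ⊥-elim (<⇒≢ (src-left {w = w} v∈) (sym eq))
    injJ {inj₂ _} {inj₂ _} u∈ v∈ eq =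
      cong inj₂ (pos-inj S′ u∈ v∈ (+-cancelˡ-≡ (width S) _ _ eq))

    cancel : ∀ {a b} → width S + a < width S + b → a < b
    cancel = +-cancelˡ-< (width S) _ _

  -- All sources of bridges lie to the left of all targets, so two bridges on one page are free of
  -- crossings exactly if they are nested.
  Compatible : List (Bridge S S′) → Set
  Compatible F = ∀ {b c} → b ∈ F → c ∈ F → blow b ≡ blow c →
    ¬ (pos S (bsrc b) < pos S (bsrc c) × pos S′ (btgt b) < pos S′ (btgt c))

  private
    planarJ : ∀ F → Compatible F → ∀ {e f} → JoinView F e → JoinView F f →
      low e ≡ low f → ¬ Cross posJ e f
    planarJ F ok (between p) (between q) l (x , _ , z) = ok p q l (x , cancel z)
    planarJ F ok (between {b} p) (left {f} q) l (x , _ , z) =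
      <-asym z (src-left {w = btgt b} (tgt∈ S q))
    planarJ F ok (between {b} p) (right {f} q) l (_ , y , z) =
      btgt-visible b q (sym l) (cancel y , cancel z)
    planarJ F ok (left p) (between {b} q) l (x , y , _) = bsrc-visible b p l (x , y)
    planarJ F ok (left p) (left q) l c = planar S p q l c
    planarJ F ok (left p) (right {f} q) l (_ , y , _) =
      <-asym y (src-left {w = src f} (tgt∈ S p))
    planarJ F ok (right {e} p) (between {b} q) l (x , _ , _) =
      <-asym x (src-left {w = src e} (bsrc∈ b))
    planarJ F ok (right {e} p) (left {f} q) l (x , _ , _) =
      <-asym x (src-left {w = src e} (src∈ S q))
    planarJ F ok (right p) (right q) l (x , y , z) =
      planar S′ p q l (cancel x , cancel y , cancel z)

    ends : ∀ F {e} → JoinView F e → T (inJ (src e)) × T (inJ (tgt e)) × posJ (src e) < posJ (tgt e)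
    ends F (between {b} p) = bsrc∈ b , btgt∈ b , src-left {w = btgt b} (bsrc∈ b)
    ends F (left p) = src∈ S p , tgt∈ S p , fwd S p
    ends F (right p) = src∈ S′ p , tgt∈ S′ p , +-monoʳ-< (width S) (fwd S′ p)

    boundJ : ∀ {v} → T (inJ v) → posJ v < width S + width S′
    boundJ {inj₁ _} v∈ = m≤n⇒m≤n+o _ (pos-bound S v∈)
    boundJ {inj₂ _} v∈ = +-monoʳ-< (width S) (pos-bound S′ v∈)

  join : (F : List (Bridge S S′)) → Compatible F → Shape (V ⊎ W) (inj₁ r)
  join F ok .inV = inJ
  join F ok .edges = joinEdges F
  join F ok .last = inj₂ (last S′)
  join F ok .pos = posJ
  join F ok .width = width S + width S′
  join F ok .root∈ = root∈ S
  join F ok .last∈ = last∈ S′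
  join F ok .src∈ p = proj₁ (ends F (joinView F p))
  join F ok .tgt∈ p = proj₁ (proj₂ (ends F (joinView F p)))
  join F ok .fwd p = proj₂ (proj₂ (ends F (joinView F p)))
  join F ok .pos-root = pos-root S
  join F ok .pos-last = trans (sym (+-suc (width S) _)) (cong (width S +_) (pos-last S′))
  join F ok .pos-bound {v} = boundJ {v}
  join F ok .pos-inj {u} {v} = injJ {u} {v}
  join F ok .planar p q = planarJ F ok (joinView F p) (joinView F q)

single : Shape ⊤ tt
single .inV _ = true
single .edges = []
single .last = tt
single .pos _ = 0
single .width = 1
single .root∈ = tt
single .last∈ = tt
single .src∈ ()
single .tgt∈ ()
single .fwd ()
single .pos-root = refl
single .pos-last = refl
single .pos-bound _ = s≤s z≤n
single .pos-inj _ _ _ = refl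
single .planar ()

-- Transport along an injection f with partial inverse g.  The vertices and
-- edges are given anew since the same graph is obtained in several layouts.
module _ {U V : Set} {r : U} (J : Shape U r) (f : U → V) (g : V → Maybe U) (gf : ∀ u → g (f u) ≡ just u)
  (in′ : V → Bool) (E′ : List (Edge V))
  (image : ∀ {v} → T (in′ v) → ∃[ u ] f u ≡ v × T (inV J u))
  (keep : ∀ {u} → T (inV J u) → T (in′ (f u)))
  (sub : ∀ {e} → e ∈ E′ → ∃[ e₀ ] e₀ ∈ edges J × e ≡ mapE f e₀) where

  private
    Sub : Edge V → Set
    Sub e = ∃[ e₀ ] e₀ ∈ edges J × e ≡ mapE f e₀
    pos′ : V → ℕ
    pos′ v = maybe (pos J) 0 (g v)
    pos-f : ∀ u → pos′ (f u) ≡ pos J u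
    pos-f u = cong (maybe (pos J) 0) (gf u)
    case-src : ∀ {e} → Sub e → T (in′ (src e))
    case-src (_ , p , refl) = keep (src∈ J p)
    case-tgt : ∀ {e} → Sub e → T (in′ (tgt e))
    case-tgt (_ , p , refl) = keep (tgt∈ J p)
    case-fwd : ∀ {e} → Sub e → pos′ (src e) < pos′ (tgt e)
    case-fwd (e₀ , p , refl) = subst₂ _<_ (sym (pos-f (src e₀))) (sym (pos-f (tgt e₀))) (fwd J p)
    case-bound : ∀ {v} → (∃[ u ] f u ≡ v × T (inV J u)) → pos′ v < width J
    case-bound (u , refl , u∈) = subst (_< width J) (sym (pos-f u)) (pos-bound J u∈)
    case-inj : ∀ {u v} → (∃[ a ] f a ≡ u × T (inV J a)) → (∃[ b ] f b ≡ v × T (inV J b)) →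
      pos′ u ≡ pos′ v → u ≡ v
    case-inj (a , refl , a∈) (b , refl , b∈) eq =
      cong f (pos-inj J a∈ b∈ (trans (sym (pos-f a)) (trans eq (pos-f b))))
    case-planar : ∀ {e h} → Sub e → Sub h → low e ≡ low h → ¬ Cross pos′ e h
    case-planar (e₀ , p , refl) (h₀ , q , refl) l (x , y , z) = planar J p q l
      ( subst₂ _<_ (pos-f (src e₀)) (pos-f (src h₀)) x
      , subst₂ _<_ (pos-f (src h₀)) (pos-f (tgt e₀)) y
      , subst₂ _<_ (pos-f (tgt e₀)) (pos-f (tgt h₀)) z )

  reshape : Shape V (f r)
  reshape .inV = in′
  reshape .edges = E′
  reshape .last = f (last J)
  reshape .pos = pos′
  reshape .width = width J
  reshape .root∈ = keep (root∈ J)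
  reshape .last∈ = keep (last∈ J)
  reshape .src∈ p = case-src (sub p)
  reshape .tgt∈ p = case-tgt (sub p)
  reshape .fwd p = case-fwd (sub p)
  reshape .pos-root = trans (pos-f r) (pos-root J)
  reshape .pos-last = trans (cong suc (pos-f (last J))) (pos-last J)
  reshape .pos-bound v∈ = case-bound (image v∈)
  reshape .pos-inj u∈ v∈ = case-inj (image u∈) (image v∈)
  reshape .planar p q = case-planar (sub p) (sub q)

-- Walks

data Path {V : Set} (E : List (Edge V)) : V → V → ℕ → List V → Set where
  []  : ∀ {u} → Path E u u 0 (u ∷ [])
  go : ∀ {e v k vs} → e ∈ E → Path E (tgt e) v k vs → Path E (src e) v (wt e + k) (src e ∷ vs)
  back : ∀ {e v k vs} → e ∈ E → Path E (src e) v k vs → Path E (tgt e) v (wt e + k) (tgt e ∷ vs)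

costP : ∀ {V} {E : List (Edge V)} {u v k l vs} → k ≡ l → Path E u v k vs → Path E u v l vs
costP refl p = p

mapP : ∀ {V W} {E : List (Edge V)} {E′ : List (Edge W)} (f : V → W) →
  (∀ {e} → e ∈ E → mapE f e ∈ E′) → ∀ {u v k vs} → Path E u v k vs → Path E′ (f u) (f v) k (map f vs)
mapP f sub [] = []
mapP f sub (go e∈ p) = go (sub e∈) (mapP f sub p)
mapP f sub (back e∈ p) = back (sub e∈) (mapP f sub p)

infixr 5 _▸_
_▸_ : ∀ {V} {E : List (Edge V)} {u v w k l vs ws} → Path E u v k vs → Path E v w l ws →
  ∃[ xs ] Path E u w (k + l) xs × (∀ {x} → x ∈ vs ⊎ x ∈ ws → x ∈ xs)
[] ▸ q = _ , q , λ { (inj₁ (here refl)) → start∈ q ; (inj₂ m) → m }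
  where
  start∈ : ∀ {V} {E : List (Edge V)} {u v k vs} → Path E u v k vs → u ∈ vs
  start∈ [] = here refl
  start∈ (go _ _) = here refl
  start∈ (back _ _) = here refl
go {e} e∈ p ▸ q with xs , r , m ← p ▸ q = _ , costP (sym (+-assoc (wt e) _ _)) (go e∈ r) ,
  λ { (inj₁ (here eq)) → here eq ; (inj₁ (there i)) → there (m (inj₁ i)) ; (inj₂ i) → there (m (inj₂ i)) }
back {e} e∈ p ▸ q with xs , r , m ← p ▸ q = _ , costP (sym (+-assoc (wt e) _ _)) (back e∈ r) ,
  λ { (inj₁ (here eq)) → here eq ; (inj₁ (there i)) → there (m (inj₁ i)) ; (inj₂ i) → there (m (inj₂ i)) }

Tour : ∀ {V} → List (Edge V) → V → V → ℕ → (V → Set) → Set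
Tour E u v k C = ∃[ vs ] Path E u v k vs × (∀ {x} → C x → x ∈ vs)

module _ {V : Set} {E : List (Edge V)} where

  seqT : ∀ {u v w k l} {C D : V → Set} → Tour E u v k C → Tour E v w l D → Tour E u w (k + l) (λ x → C x ⊎ D x)
  seqT (_ , p , c) (_ , q , d) with xs , r , m ← p ▸ q =
    xs , r , λ { (inj₁ i) → m (inj₁ (c i)) ; (inj₂ i) → m (inj₂ (d i)) }

  weaken : ∀ {u v k} {C D : V → Set} → (∀ {x} → D x → C x) → Tour E u v k C → Tour E u v k D
  weaken f (xs , p , c) = xs , p , c ∘ f

  costT : ∀ {u v k l} {C : V → Set} → k ≡ l → Tour E u v k C → Tour E u v l C
  costT refl t = t

  stepT : ∀ {e} → e ∈ E → Tour E (src e) (tgt e) (wt e) (λ x → x ≡ src e ⊎ x ≡ tgt e)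
  stepT {e} e∈ = _ , costP (+-identityʳ (wt e)) (go e∈ []) ,
    λ { (inj₁ refl) → here refl ; (inj₂ refl) → there (here refl) }

  stayT : ∀ u → Tour E u u 0 (_≡ u)
  stayT u = _ , [] , λ { refl → here refl }

  private
    rev : ∀ {u v k vs} → Path E u v k vs → ∃[ xs ] Path E v u k xs × (∀ {x} → x ∈ vs → x ∈ xs)
    rev [] = _ , [] , id
    rev (go {e} {k = k} e∈ p) with rev p
    ... | xs , q , m with q ▸ back e∈ []
    ...   | ys , r , l =
      ys , costP (trans (cong (k +_) (+-identityʳ (wt e))) (+-comm k (wt e))) r ,
      λ { (here refl) → l (inj₂ (there (here refl))) ; (there i) → l (inj₁ (m i)) }
    rev (back {e} {k = k} e∈ p) with rev p
    ... | xs , q , m with q ▸ go e∈ []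
    ...   | ys , r , l =
      ys , costP (trans (cong (k +_) (+-identityʳ (wt e))) (+-comm k (wt e))) r ,
      λ { (here refl) → l (inj₂ (there (here refl))) ; (there i) → l (inj₁ (m i)) }

  revT : ∀ {u v k} {C : V → Set} → Tour E u v k C → Tour E v u k C
  revT (_ , p , c) with rev p
  ... | xs , q , m = xs , q , m ∘ c

mapT : ∀ {V W} {E : List (Edge V)} {E′ : List (Edge W)} (f : V → W) →
  (∀ {e} → e ∈ E → mapE f e ∈ E′) → ∀ {u v k C} → Tour E u v k C →
  Tour E′ (f u) (f v) k (λ y → ∃[ x ] f x ≡ y × C x)
mapT f sub (_ , p , c) = _ , mapP f sub p , λ { (x , refl , i) → ∈-map⁺ f (c i) }

-- Weak duality for shortest paths: a potential certifies distances from below.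
path-lip : ∀ {V} {E : List (Edge V)} {p : V → ℕ} → Lips p E → ∀ {u v k vs} → Path E u v k vs → p v ≤ p u + k
path-lip l [] = m≤m+n _ 0
path-lip {p = p} l (go {e} {v} {k} e∈ q) = ≤-trans (path-lip l q)
  (≤-trans (+-monoˡ-≤ k (proj₂ (l e∈))) (≤-reflexive (+-assoc (p (src e)) (wt e) k)))
path-lip {p = p} l (back {e} {v} {k} e∈ q) = ≤-trans (path-lip l q)
  (≤-trans (+-monoˡ-≤ k (proj₁ (l e∈))) (≤-reflexive (+-assoc (p (tgt e)) (wt e) k)))

-- The adversary's building blocks

In : ∀ {V r} → Shape V r → V → Set
In S v = T (inV S v)

Open : ∀ {V r} → Shape V r → (V → Bool) → V → Set
Open S pd v = T (pd v) ⊎ ¬ In S v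

-- New edges never touch a vertex whose neighbourhood has been revealed.
record Grow {V r} (S S′ : Shape V r) (pd : V → Bool) : Set where
  field
    inV-mono  : ∀ {v} → In S v → In S′ v
    edge-mono : ∀ {e} → e ∈ edges S → e ∈ edges S′
    edge-new  : ∀ {e} → e ∈ edges S′ → e ∈ edges S ⊎ (Open S pd (src e) × Open S pd (tgt e))
open Grow

grow-refl : ∀ {V r} (S : Shape V r) pd → Grow S S pd
grow-refl S pd = record { inV-mono = id ; edge-mono = id ; edge-new = inj₁ }

-- A completed block: every algorithm pays at least X inside it before reaching
-- its exit, whereas covering it on the way to the exit costs cc.  The quality
-- condition reads 4 cc ≤ X + (1 + m/n) rr, where rr is the distance from the
-- root to the exit.
record Done (V : Set) (r : V) (n m Λ : ℕ) : Set where
  field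
    shape   : Shape V r
    cc rr X : ℕ
    cover   : Tour (edges shape) r (last shape) cc (In shape)
    return  : Tour (edges shape) (last shape) r rr (λ _ → ⊥)
    h       : V → ℕ
    h-lip   : Lips h (edges shape)
    h-root  : h r ≡ 0
    h-last  : h (last shape) ≡ rr
    cc≤Λ    : cc ≤ Λ
    1≤rr    : 1 ≤ rr
    quality : 4 * (n * cc) ≤ n * X + (n + m) * rr

  rr≤cc : rr ≤ cc
  rr≤cc with cover
  ... | _ , p , _ = subst₂ _≤_ h-last (cong (_+ cc) h-root) (path-lip h-lip p)

-- A block under construction.  Φ bounds from below the cost spent inside the
-- block; pd marks the vertices at which the adversary will react.
record Core : Set₁ where
  field
    V         : Set
    dec       : (u v : V) → Dec (u ≡ v)
    root      : V
    n m Λ     : ℕ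
    1≤n       : 1 ≤ n
    1≤m       : 1 ≤ m
    m≤2n      : m ≤ 2 * n
    1≤Λ       : 1 ≤ Λ
    St        : Set
    start     : St
    sh        : St → Shape V root
    pd        : St → V → Bool
    pd⊆       : ∀ {s v} → T (pd s v) → In (sh s) v
    pd-last   : ∀ s → T (pd s (last (sh s)))
    Φ         : St → V → ℕ
    Φ-lip     : ∀ s → Lips (Φ s) (edges (sh s))
    Φ-start   : Φ start root ≡ 0
    cc rr     : St → ℕ
    cover     : ∀ s → Tour (edges (sh s)) root (last (sh s)) (cc s) (In (sh s))
    return    : ∀ s → Tour (edges (sh s)) (last (sh s)) root (rr s) (λ _ → ⊥)
    cc≤Λ      : ∀ s → cc s ≤ Λ
    rr≤Λ      : ∀ s → rr s ≤ Λ
    rank      : St → ℕ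

  D : Set
  D = Done V root n m Λ

module _ (P : Core) where
  open Core P

  -- The agent has just arrived at the pending vertex `x` and has paid at least `Φ s x`. The new
  -- potential is free elsewhere but must not exceed this value at `x`. In the case `done` the exit
  -- is `x` itself, so whatever is appended to the block starts where the agent stands.
  data Outcome (s : St) (x : V) : Set where
    next : (s′ : St) → Grow (sh s) (sh s′) (pd s) →
           (∀ {v} → T (pd s′ v) → (T (pd s v) × v ≢ x) ⊎ ¬ In (sh s) v) →
           Φ s′ x ≤ Φ s x → rank s′ < rank s → Outcome s x
    done : (δ : D) → Grow (sh s) (Done.shape δ) (pd s) → last (Done.shape δ) ≡ x →
           Done.X δ ≤ Φ s x → Outcome s x

record Proc : Set₁ where
  field
    core : Core
    step : ∀ s x → T (Core.pd core s x) → Outcome core s x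

lip-const : ∀ {V} {E : List (Edge V)} k → Lips (λ _ → k) E
lip-const k {e} _ = m≤m+n k (wt e) , m≤m+n k (wt e)

lip-shift : ∀ {V} {p : V → ℕ} k {e} → Lip p e → Lip (λ v → k + p v) e
lip-shift {p = p} k {e} (a , b) =
  ≤-trans (+-monoʳ-≤ k a) (≤-reflexive (sym (+-assoc k _ (wt e)))) ,
  ≤-trans (+-monoʳ-≤ k b) (≤-reflexive (sym (+-assoc k _ (wt e))))

lip-shiftʳ : ∀ {V} {p : V → ℕ} k {e} → Lip p e → Lip (λ v → p v + k) e
lip-shiftʳ {p = p} k {e} (a , b) =
  ≤-trans (+-monoˡ-≤ k a) (≤-reflexive (swap (p (tgt e)) (wt e) k)) ,
  ≤-trans (+-monoˡ-≤ k b) (≤-reflexive (swap (p (src e)) (wt e) k))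
  where
  swap : ∀ a b c → a + b + c ≡ a + c + b
  swap = solveℕ 3 (λ a b c → a ⊕ b ⊕ c ⊜ a ⊕ c ⊕ b) refl

lip-∸ : ∀ {V} {p : V → ℕ} k {e} → Lip p e → Lip (λ v → k ∸ p v) e
lip-∸ {p = p} k {e} (a , b) = go′ (p (src e)) (p (tgt e)) b , go′ (p (tgt e)) (p (src e)) a
  where
  go′ : ∀ x y → y ≤ x + wt e → k ∸ x ≤ (k ∸ y) + wt e
  go′ x y le = m≤n+o⇒m∸n≤o k x (≤-trans (m≤n+m∸n k y)
    (≤-trans (+-monoˡ-≤ (k ∸ y) le) (≤-reflexive (rot x (wt e) (k ∸ y)))))
    where
    rot : ∀ a b c → a + b + c ≡ a + (c + b)
    rot = solveℕ 3 (λ a b c → a ⊕ b ⊕ c ⊜ a ⊕ (c ⊕ b)) refl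

lip-⊓ : ∀ {V} {p : V → ℕ} k {e} → Lip p e → Lip (λ v → k ⊓ p v) e
lip-⊓ {p = p} k {e} (a , b) = go′ (p (src e)) (p (tgt e)) a , go′ (p (tgt e)) (p (src e)) b
  where
  go′ : ∀ x y → x ≤ y + wt e → k ⊓ x ≤ (k ⊓ y) + wt e
  go′ x y le with ≤-total k y
  ... | inj₁ k≤y = ≤-trans (m⊓n≤m k x) (≤-trans (≤-reflexive (sym (m≤n⇒m⊓n≡m k≤y))) (m≤m+n _ _))
  ... | inj₂ y≤k = ≤-trans (m⊓n≤n k x) (≤-trans le (≤-reflexive (cong (_+ wt e) (sym (m≥n⇒m⊓n≡n y≤k)))))

lip-map : ∀ {U V} {f : U → V} {p : V → ℕ} {E : List (Edge U)} → Lips (p ∘ f) E → Lips p (map (mapE f) E)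
lip-map {f = f} l e∈ with _ , q , refl ← ∈-map⁻ (mapE f) e∈ = l q

-- Chains of completed blocks followed by one more block

module Chain (P : Core) where
  open Core P

  -- The block number is part of the vertex, so the vertex type is the same for chains of every
  -- length, and vertices keep their names when a block is appended.
  C : Set
  C = ℕ × V

  croot : C
  croot = 0 , root

  sucC : C → C
  sucC (i , v) = suc i , v

  private
    to : V ⊎ C → C
    to = [ (0 ,_) , sucC ]′

    from : C → Maybe (V ⊎ C)
    from (zero , v) = just (inj₁ v)
    from (suc i , v) = just (inj₂ (i , v))

    from-to : ∀ u → from (to u) ≡ just u
    from-to (inj₁ _) = refl
    from-to (inj₂ _) = refl

    from₀ : C → Maybe V
    from₀ (zero , v) = just v
    from₀ (suc _ , _) = nothing

    in₀ : Shape V root → C → Bool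
    in₀ S (zero , v) = inV S v
    in₀ S (suc _ , _) = false

    in₊ : Shape V root → Shape C croot → C → Bool
    in₊ S R (zero , v) = inV S v
    in₊ S R (suc i , v) = inV R (i , v)

    link : (S : Shape V root) (R : Shape C croot) → Bridge S R
    link S R = bridge (last S) croot 0 false (last∈ S) (root∈ R) (last-visible S false) (root-visible R false)

    link-ok : ∀ S R → Compatible S R (link S R ∷ [])
    link-ok S R (here refl) (here refl) _ (p , _) = <-irrefl refl p

    consJ : Shape V root → Shape C croot → Shape (V ⊎ C) (inj₁ root)
    consJ S R = join S R (link S R ∷ []) (link-ok S R)

  cons : Shape V root → Shape C croot → Shape C croot
  cons S R = reshape (consJ S R) to from from-to (in₊ S R) (map (mapE to) (edges (consJ S R)))
    (λ { {zero , v} v∈ → inj₁ v , refl , v∈ ; {suc i , v} v∈ → inj₂ (i , v) , refl , v∈ })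
    (λ { {inj₁ _} p → p ; {inj₂ _} p → p })
    (λ p → ∈-map⁻ (mapE to) p)

  chain : List D → Shape V root → Shape C croot
  chain [] S = reshape S (0 ,_) from₀ (λ _ → refl) (in₀ S) (map (mapE (0 ,_)) (edges S))
    (λ { {zero , v} v∈ → v , refl , v∈ ; {suc _ , _} () }) id (λ p → ∈-map⁻ (mapE (0 ,_)) p)
  chain (δ ∷ ds) S = cons (Done.shape δ) (chain ds S)

  private
    module _ {S : Shape V root} {R : Shape C croot} where
      joint∈ : edge (0 , last S) (1 , root) 0 false ∈ edges (cons S R)
      joint∈ = here refl

      first∈ : ∀ {e} → e ∈ edges S → mapE (0 ,_) e ∈ edges (cons S R)
      first∈ p = there (∈-map⁺ (mapE to) (∈-++⁺ˡ (∈-map⁺ (mapE inj₁) p)))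

      rest∈ : ∀ {e} → e ∈ edges R → mapE sucC e ∈ edges (cons S R)
      rest∈ p = there (∈-map⁺ (mapE to) (∈-++⁺ʳ (map (mapE inj₁) (edges S)) (∈-map⁺ (mapE inj₂) p)))

    data View (S : Shape V root) (R : Shape C croot) : Edge C → Set where
      joint : View S R (edge (0 , last S) (1 , root) 0 false)
      first : ∀ {e} → e ∈ edges S → View S R (mapE (0 ,_) e)
      rest  : ∀ {e} → e ∈ edges R → View S R (mapE sucC e)

    view : ∀ S R {e} → e ∈ edges (cons S R) → View S R e
    view S R e∈ with _ , p , refl ← ∈-map⁻ (mapE to) e∈ with joinView S R (link S R ∷ []) p
    ... | between (here refl) = joint
    ... | left q = first q
    ... | right q = rest q

  len cost ccs : List D → ℕ
  len [] = 0
  len (δ ∷ ds) = Done.rr δ + len ds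
  cost [] = 0
  cost (δ ∷ ds) = Done.X δ + cost ds
  ccs [] = 0
  ccs (δ ∷ ds) = Done.cc δ + ccs ds

  len-snoc : ∀ ds δ → len (ds ∷ʳ δ) ≡ len ds + Done.rr δ
  len-snoc [] δ = +-identityʳ _
  len-snoc (ε ∷ ds) δ = trans (cong (Done.rr ε +_) (len-snoc ds δ)) (sym (+-assoc (Done.rr ε) _ _))

  cost-snoc : ∀ ds δ → cost (ds ∷ʳ δ) ≡ cost ds + Done.X δ
  cost-snoc [] δ = +-identityʳ _
  cost-snoc (ε ∷ ds) δ = trans (cong (Done.X ε +_) (cost-snoc ds δ)) (sym (+-assoc (Done.X ε) _ _))

  len≤ccs : ∀ ds → len ds ≤ ccs ds
  len≤ccs [] = z≤n
  len≤ccs (δ ∷ ds) = +-mono-≤ (Done.rr≤cc δ) (len≤ccs ds)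

  ccs≤len : ∀ ds → ccs ds ≤ Λ * len ds
  ccs≤len [] = z≤n
  ccs≤len (δ ∷ ds) = ≤-trans (+-mono-≤ (≤-trans (Done.cc≤Λ δ) (≤-trans (≤-reflexive (sym (*-identityʳ Λ)))
    (*-monoʳ-≤ Λ (Done.1≤rr δ)))) (ccs≤len ds)) (≤-reflexive (sym (*-distribˡ-+ Λ (Done.rr δ) (len ds))))

  -- The quality condition is linear in `cc`, `X` and `rr`, and all three add up along a chain
  -- because the joints have weight 0.
  chain-quality : ∀ ds → 4 * (n * ccs ds) ≤ n * cost ds + (n + m) * len ds
  chain-quality [] = ≤-trans (≤-reflexive (cong (4 *_) (*-zeroʳ n))) z≤n
  chain-quality (δ ∷ ds) = subst₂ _≤_
    (sym (trans (cong (4 *_) (*-distribˡ-+ n (Done.cc δ) (ccs ds))) (*-distribˡ-+ 4 (n * Done.cc δ) (n * ccs ds))))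
    (regroup n m (Done.X δ) (cost ds) (Done.rr δ) (len ds))
    (+-mono-≤ (Done.quality δ) (chain-quality ds))
    where
    regroup : ∀ n m a b c d → n * a + (n + m) * c + (n * b + (n + m) * d) ≡ n * (a + b) + (n + m) * (c + d)
    regroup = solveℕ 6 (λ n m a b c d → n ⊗ a ⊕ (n ⊕ m) ⊗ c ⊕ (n ⊗ b ⊕ (n ⊕ m) ⊗ d) ⊜ n ⊗ (a ⊕ b) ⊕ (n ⊕ m) ⊗ (c ⊕ d)) refl

  last-chain : ∀ ds S → last (chain ds S) ≡ (length ds , last S)
  last-chain [] S = refl
  last-chain (δ ∷ ds) S = cong sucC (last-chain ds S)

  -- Given a potential t on the final block: up measures the distance from the
  -- root of the chain, down the distance to the entry of the final block.
  up down : (V → ℕ) → List D → C → ℕ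
  up t [] (_ , v) = t v
  up t (δ ∷ ds) (zero , v) = Done.h δ v + t root
  up t (δ ∷ ds) (suc i , v) = Done.rr δ + up t ds (i , v)
  down t [] (_ , v) = t v
  down t (δ ∷ ds) (zero , v) = (Done.rr δ ∸ Done.h δ v) + down t ds croot
  down t (δ ∷ ds) (suc i , v) = down t ds (i , v)

  up-root : ∀ t ds → up t ds croot ≡ t root
  up-root t [] = refl
  up-root t (δ ∷ ds) = cong (_+ t root) (Done.h-root δ)

  down-root : ∀ t ds → down t ds croot ≡ len ds + t root
  down-root t [] = refl
  down-root t (δ ∷ ds) = trans (cong₂ _+_ (cong (Done.rr δ ∸_) (Done.h-root δ)) (down-root t ds))
    (sym (+-assoc (Done.rr δ) (len ds) (t root)))

  up-tip : ∀ t ds v → up t ds (length ds , v) ≡ len ds + t v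
  up-tip t [] v = refl
  up-tip t (δ ∷ ds) v = trans (cong (Done.rr δ +_) (up-tip t ds v)) (sym (+-assoc (Done.rr δ) _ _))

  down-tip : ∀ t ds v → down t ds (length ds , v) ≡ t v
  down-tip t [] v = refl
  down-tip t (δ ∷ ds) v = down-tip t ds v

  up-lip : ∀ {t S} → Lips t (edges S) → ∀ ds → Lips (up t ds) (edges (chain ds S))
  up-lip {t} l [] = lip-map {p = up t []} l
  up-lip {t} {S} l (δ ∷ ds) e∈ with view (Done.shape δ) (chain ds S) e∈
  ... | joint = ≤-trans (≤-reflexive eq) (m≤m+n _ 0) , ≤-trans (≤-reflexive (sym eq)) (m≤m+n _ 0)
    where
    eq : Done.h δ (last (Done.shape δ)) + t root ≡ Done.rr δ + up t ds croot
    eq = cong₂ _+_ (Done.h-last δ) (sym (up-root t ds))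
  ... | first {e} p = lip-shiftʳ {p = Done.h δ} (t root) {e} (Done.h-lip δ p)
  ... | rest {e} p = lip-shift {p = up t ds} (Done.rr δ) {e} (up-lip l ds p)

  down-lip : ∀ {t S} → Lips t (edges S) → ∀ ds → Lips (down t ds) (edges (chain ds S))
  down-lip {t} l [] = lip-map {p = down t []} l
  down-lip {t} {S} l (δ ∷ ds) e∈ with view (Done.shape δ) (chain ds S) e∈
  ... | joint = ≤-trans (≤-reflexive eq) (m≤m+n _ 0) , ≤-trans (≤-reflexive (sym eq)) (m≤m+n _ 0)
    where
    eq : (Done.rr δ ∸ Done.h δ (last (Done.shape δ))) + down t ds croot ≡ down t ds croot
    eq = cong (_+ down t ds croot) (trans (cong (Done.rr δ ∸_) (Done.h-last δ)) (n∸n≡0 (Done.rr δ)))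
  ... | first {e} p = lip-shiftʳ {p = λ v → Done.rr δ ∸ Done.h δ v} (down t ds croot) {e}
                        (lip-∸ {p = Done.h δ} (Done.rr δ) {e} (Done.h-lip δ p))
  ... | rest {e} p = down-lip l ds p

  chain-cover : ∀ {S k} → Tour (edges S) root (last S) k (In S) → ∀ ds →
    Tour (edges (chain ds S)) croot (last (chain ds S)) (ccs ds + k) (In (chain ds S))
  chain-cover c [] = weaken (λ { {zero , v} v∈ → v , refl , v∈ ; {suc _ , _} () }) (mapT (0 ,_) (∈-map⁺ (mapE (0 ,_))) c)
  chain-cover {S} {k} c (δ ∷ ds) = costT (sym (+-assoc (Done.cc δ) (ccs ds) k))
    (weaken (λ { {zero , v} v∈ → inj₁ (v , refl , v∈) ; {suc i , v} v∈ → inj₂ (inj₂ ((i , v) , refl , v∈)) })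
      (seqT (mapT (0 ,_) (first∈ {Done.shape δ} {chain ds S}) (Done.cover δ))
        (seqT (stepT (joint∈ {Done.shape δ} {chain ds S})) (mapT sucC (rest∈ {Done.shape δ} {chain ds S}) (chain-cover c ds)))))

  chain-return : ∀ {S k} → Tour (edges S) (last S) root k (λ _ → ⊥) → ∀ ds →
    Tour (edges (chain ds S)) (last (chain ds S)) croot (len ds + k) (λ _ → ⊥)
  chain-return c [] = weaken (λ ()) (mapT (0 ,_) (∈-map⁺ (mapE (0 ,_))) c)
  chain-return {S} {k} c (δ ∷ ds) = costT (rot (Done.rr δ) (len ds) k)
    (weaken (λ ()) (seqT (mapT sucC (rest∈ {Done.shape δ} {chain ds S}) (chain-return c ds))
      (seqT (revT (stepT (joint∈ {Done.shape δ} {chain ds S}))) (mapT (0 ,_) (first∈ {Done.shape δ} {chain ds S}) (Done.return δ)))))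
    where
    rot : ∀ a b c → b + c + (0 + a) ≡ a + b + c
    rot = solveℕ 3 (λ a b c → b ⊕ c ⊕ (lit 0 ⊕ a) ⊜ a ⊕ b ⊕ c) refl

  pdC : (V → Bool) → List D → C → Bool
  pdC p [] (zero , v) = p v
  pdC p [] (suc _ , _) = false
  pdC p (_ ∷ _) (zero , _) = false
  pdC p (_ ∷ ds) (suc i , v) = pdC p ds (i , v)

  pdC-tip : ∀ p ds {i v} → T (pdC p ds (i , v)) → i ≡ length ds × T (p v)
  pdC-tip p [] {zero} t = refl , t
  pdC-tip p (_ ∷ ds) {suc i} t with refl , q ← pdC-tip p ds t = refl , q

  tip-pdC : ∀ p ds {v} → T (p v) → T (pdC p ds (length ds , v))
  tip-pdC p [] t = t
  tip-pdC p (_ ∷ ds) t = tip-pdC p ds t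

  tip-in : ∀ {S} ds {v} → In S v → In (chain ds S) (length ds , v)
  tip-in [] t = t
  tip-in (_ ∷ ds) t = tip-in ds t

  in-tip : ∀ {S} ds {v} → In (chain ds S) (length ds , v) → In S v
  in-tip [] t = t
  in-tip (_ ∷ ds) t = in-tip ds t

  private
    grow-cons : ∀ {S R R′ pd pd′} → (∀ p → T (pd p) → T (pd′ (sucC p))) → Grow R R′ pd → Grow (cons S R) (cons S R′) pd′
    grow-cons {S} {R} {R′} {pd} {pd′} sub g = record
      { inV-mono = λ { {zero , _} p → p ; {suc _ , _} p → inV-mono g p }
      ; edge-mono = λ p → mono (view S R p)
      ; edge-new = λ p → new (view S R′ p)
      }
      where
      mono : ∀ {e} → View S R e → e ∈ edges (cons S R′)
      mono joint = joint∈ {S} {R′}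
      mono (first p) = first∈ {S} {R′} p
      mono (rest p) = rest∈ {S} {R′} (edge-mono g p)
      opn : ∀ v → Open R pd v → Open (cons S R) pd′ (sucC v)
      opn v (inj₁ p) = inj₁ (sub v p)
      opn v (inj₂ p) = inj₂ p
      new : ∀ {e} → View S R′ e → e ∈ edges (cons S R) ⊎ (Open (cons S R) pd′ (src e) × Open (cons S R) pd′ (tgt e))
      new joint = inj₁ (joint∈ {S} {R})
      new (first p) = inj₁ (first∈ {S} {R} p)
      new (rest {e} p) with edge-new g p
      ... | inj₁ q = inj₁ (rest∈ {S} {R} q)
      ... | inj₂ (a , b) = inj₂ (opn (src e) a , opn (tgt e) b)

  grow-chain : ∀ {S S′ pd} → Grow S S′ pd → ∀ ds → Grow (chain ds S) (chain ds S′) (pdC pd ds)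
  grow-chain {S} {S′} {pd} g [] = record
    { inV-mono = λ { {zero , _} p → inV-mono g p ; {suc _ , _} () }
    ; edge-mono = mono
    ; edge-new = new
    }
    where
    opn : ∀ v → Open S pd v → Open (chain [] S) (pdC pd []) (0 , v)
    opn v (inj₁ p) = inj₁ p
    opn v (inj₂ p) = inj₂ p
    mono : ∀ {e} → e ∈ edges (chain [] S) → e ∈ edges (chain [] S′)
    mono p with _ , q , refl ← ∈-map⁻ (mapE (0 ,_)) p = ∈-map⁺ (mapE (0 ,_)) (edge-mono g q)
    new : ∀ {e} → e ∈ edges (chain [] S′) →
      e ∈ edges (chain [] S) ⊎ (Open (chain [] S) (pdC pd []) (src e) × Open (chain [] S) (pdC pd []) (tgt e))
    new p with e₀ , q , refl ← ∈-map⁻ (mapE (0 ,_)) p with edge-new g q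
    ... | inj₁ r = inj₁ (∈-map⁺ (mapE (0 ,_)) r)
    ... | inj₂ (a , b) = inj₂ (opn (src e₀) a , opn (tgt e₀) b)
  grow-chain {S} {S′} g (δ ∷ ds) = grow-cons {R = chain ds S} {chain ds S′} (λ _ → id) (grow-chain g ds)

  -- The joint to the next block is a new edge at the exit of `δ`. It is allowed because the agent
  -- has only just reached the exit, which was still pending.
  grow-extend : ∀ {S S′ pd} {δ : D} → Grow S (Done.shape δ) pd → T (pd (last (Done.shape δ))) → ∀ ds →
    Grow (chain ds S) (chain (ds ∷ʳ δ) S′) (pdC pd ds)
  grow-extend {S} {S′} {pd} {δ} g x∈ [] = record
    { inV-mono = λ { {zero , _} p → inV-mono g p ; {suc _ , _} () }
    ; edge-mono = mono
    ; edge-new = λ p → new (view (Done.shape δ) (chain [] S′) p)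
    }
    where
    opn : ∀ v → Open S pd v → Open (chain [] S) (pdC pd []) (0 , v)
    opn v (inj₁ p) = inj₁ p
    opn v (inj₂ p) = inj₂ p
    mono : ∀ {e} → e ∈ edges (chain [] S) → e ∈ edges (cons (Done.shape δ) (chain [] S′))
    mono p with _ , q , refl ← ∈-map⁻ (mapE (0 ,_)) p = first∈ {Done.shape δ} {chain [] S′} (edge-mono g q)
    new : ∀ {e} → View (Done.shape δ) (chain [] S′) e →
      e ∈ edges (chain [] S) ⊎ (Open (chain [] S) (pdC pd []) (src e) × Open (chain [] S) (pdC pd []) (tgt e))
    new joint = inj₂ (inj₁ x∈ , inj₂ (λ ()))
    new (first {e} p) with edge-new g p
    ... | inj₁ r = inj₁ (∈-map⁺ (mapE (0 ,_)) r)
    ... | inj₂ (a , b) = inj₂ (opn (src e) a , opn (tgt e) b)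
    new (rest {e} p) = inj₂ (inj₂ (λ ()) , inj₂ (λ ()))
  grow-extend {S} {S′} {δ = δ} g x∈ (ε ∷ ds) =
    grow-cons {R = chain ds S} {chain (ds ∷ʳ δ) S′} (λ _ → id) (grow-extend g x∈ ds)

  extend-fresh : ∀ {S δ p} ds {v} → T (pdC p (ds ∷ʳ δ) v) → ¬ In (chain ds S) v
  extend-fresh [] {suc _ , _} _ ()
  extend-fresh (_ ∷ ds) {suc i , v} t = extend-fresh ds t

-- Two strands attached to a common hub

data Fork (X : Set) : Set where
  hub : Fork X
  arm : Bool → X → Fork X

arm-injective : ∀ {X s t} {x y : X} → arm s x ≡ arm t y → x ≡ y
arm-injective refl = refl

decFork : ∀ {X} → ((x y : X) → Dec (x ≡ y)) → (u v : Fork X) → Dec (u ≡ v)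
decFork d hub hub = yes refl
decFork d hub (arm _ _) = no λ ()
decFork d (arm _ _) hub = no λ ()
decFork d (arm s x) (arm t y) with s ≟ᵇ t | d x y
... | yes refl | yes refl = yes refl
... | no ne | _ = no λ { refl → ne refl }
... | _ | no ne = no λ { refl → ne refl }

-- A vertex at which an edge from the end of the other strand can be attached below the line.
record Target {X : Set} {r : X} (S : Shape X r) : Set where
  field
    target  : X
    target∈ : In S target
    exposed : Visible S true target
open Target

last-target : ∀ {X : Set} {r : X} (S : Shape X r) → Target S
last-target S = record { target = last S ; target∈ = last∈ S ; exposed = last-visible S true }

side : ∀ {ℓ} {Y : Set ℓ} → Bool → Y → Y → Bool → Y
side false a b false = a
side false a b true = b
side true a b false = b
side true a b true = a

forkMap : ∀ {X Y : Set} → Y → Bool → (X → Y) → (X → Y) → Fork X → Y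
forkMap y f p q hub = y
forkMap y f p q (arm s x) = side f p q s x

forkPd : ∀ {X : Set} → Bool → (X → Bool) → (X → Bool) → Fork X → Bool
forkPd = forkMap false

module _ {X Y : Set} where

  side-at : ∀ f (p q : X → Y) x → side f p q f x ≡ p x
  side-at false p q x = refl
  side-at true p q x = refl

  side-off : ∀ f (p q : X → Y) x → side f p q (not f) x ≡ q x
  side-off false p q x = refl
  side-off true p q x = refl

  side-flip : ∀ f (p q : X → Y) x → side (not f) p q f x ≡ q x
  side-flip false p q x = refl
  side-flip true p q x = refl

module _ {X : Set} {r : X} where

  hubE : Bool → Edge (Fork X)
  hubE s = edge hub (arm s r) 0 false

  module _ (f : Bool) (A B : Shape X r) where

    forkIn : Fork X → Bool
    forkIn = forkMap true f (inV A) (inV B)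

    -- A strand end can be tied to a vertex of the other strand; only these edges run below the line.
    linkE : Maybe (Target B) → List (Edge (Fork X))
    linkE nothing = []
    linkE (just t) = edge (arm f (last A)) (arm (not f) (target t)) 0 true ∷ []

    forkEdges : Maybe (Target B) → List (Edge (Fork X))
    forkEdges l = linkE l ++ hubE f ∷ hubE (not f) ∷
      map (mapE (arm f)) (edges A) ++ map (mapE (arm (not f))) (edges B)

    data ForkView (l : Maybe (Target B)) : Edge (Fork X) → Set where
      linked : ∀ {e} → e ∈ linkE l → ForkView l e
      spokeA : ForkView l (hubE f)
      spokeB : ForkView l (hubE (not f))
      inA    : ∀ {e} → e ∈ edges A → ForkView l (mapE (arm f) e)
      inB    : ∀ {e} → e ∈ edges B → ForkView l (mapE (arm (not f)) e)

    forkView : ∀ l {e} → e ∈ forkEdges l → ForkView l e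
    forkView l p with ∈-++⁻ (linkE l) p
    ... | inj₁ q = linked q
    ... | inj₂ (here refl) = spokeA
    ... | inj₂ (there (here refl)) = spokeB
    ... | inj₂ (there (there q)) with ∈-++⁻ (map (mapE (arm f)) (edges A)) q
    ...   | inj₁ a with _ , b , refl ← ∈-map⁻ (mapE (arm f)) a = inA b
    ...   | inj₂ a with _ , b , refl ← ∈-map⁻ (mapE (arm (not f))) a = inB b

    link∈ : ∀ l {e} → e ∈ linkE l → e ∈ forkEdges l
    link∈ l = ∈-++⁺ˡ

    spokeA∈ : ∀ l → hubE f ∈ forkEdges l
    spokeA∈ l = ∈-++⁺ʳ (linkE l) (here refl)

    spokeB∈ : ∀ l → hubE (not f) ∈ forkEdges l
    spokeB∈ l = ∈-++⁺ʳ (linkE l) (there (here refl))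

    inA∈ : ∀ l {e} → e ∈ edges A → mapE (arm f) e ∈ forkEdges l
    inA∈ l p = ∈-++⁺ʳ (linkE l) (there (there (∈-++⁺ˡ (∈-map⁺ (mapE (arm f)) p))))

    inB∈ : ∀ l {e} → e ∈ edges B → mapE (arm (not f)) e ∈ forkEdges l
    inB∈ l p = ∈-++⁺ʳ (linkE l)
      (there (there (∈-++⁺ʳ (map (mapE (arm f)) (edges A)) (∈-map⁺ (mapE (arm (not f))) p))))

    private
      U : Set
      U = (⊤ ⊎ X) ⊎ X

      to : U → Fork X
      to (inj₁ (inj₁ _)) = hub
      to (inj₁ (inj₂ x)) = arm f x
      to (inj₂ x) = arm (not f) x

    private
      J₁ : Shape (⊤ ⊎ X) (inj₁ tt)
      J₁ = join single A (bridge tt r 0 false tt (root∈ A) (root-visible single false) (root-visible A false) ∷ [])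
        λ { (here refl) (here refl) _ (p , _) → <-irrefl refl p }

    private
      fromA fromB : X → Maybe U
      fromA x = just (inj₁ (inj₂ x))
      fromB x = just (inj₂ x)

      from : Fork X → Maybe U
      from = forkMap (just (inj₁ (inj₁ tt))) f fromA fromB

      from-to : ∀ u → from (to u) ≡ just u
      from-to (inj₁ (inj₁ _)) = refl
      from-to (inj₁ (inj₂ x)) = side-at f fromA fromB x
      from-to (inj₂ x) = side-off f fromA fromB x

      stem : Bridge J₁ B
      stem = bridge (inj₁ tt) r 0 false tt (root∈ B) (root-visible J₁ false) (root-visible B false)

      bridges : Maybe (Target B) → List (Bridge J₁ B)
      bridges nothing = stem ∷ []
      bridges (just t) = stem ∷
        bridge (inj₂ (last A)) (target t) 0 true (last∈ A) (target∈ t) (last-visible J₁ true) (exposed t) ∷ []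

      ok : ∀ l → Compatible J₁ B (bridges l)
      ok nothing (here refl) (here refl) _ (p , _) = <-irrefl refl p
      ok (just t) (here refl) (here refl) _ (p , _) = <-irrefl refl p
      ok (just t) (here refl) (there (here refl)) ()
      ok (just t) (there (here refl)) (here refl) ()
      ok (just t) (there (here refl)) (there (here refl)) _ (p , _) = <-irrefl refl p

      J : Maybe (Target B) → Shape U (inj₁ (inj₁ tt))
      J l = join J₁ B (bridges l) (ok l)

      image : ∀ f {p q : X → Bool} {v} → T (forkMap true f p q v) →
        v ≡ hub ⊎ (∃[ x ] arm f x ≡ v × T (p x)) ⊎ (∃[ x ] arm (not f) x ≡ v × T (q x))
      image f {v = hub} _ = inj₁ refl
      image false {v = arm false x} p = inj₂ (inj₁ (x , refl , p))
      image false {v = arm true x} p = inj₂ (inj₂ (x , refl , p))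
      image true {v = arm false x} p = inj₂ (inj₂ (x , refl , p))
      image true {v = arm true x} p = inj₂ (inj₁ (x , refl , p))

      sub : ∀ l {e} → ForkView l e → ∃[ e₀ ] e₀ ∈ edges (J l) × e ≡ mapE to e₀
      sub (just t) (linked (here refl)) = _ , there (here refl) , refl
      sub l spokeA = _ , ∈-++⁺ʳ (map _ (bridges l)) (∈-++⁺ˡ {xs = map (mapE inj₁) (edges J₁)} (here refl)) , refl
      sub nothing spokeB = _ , here refl , refl
      sub (just _) spokeB = _ , here refl , refl
      sub l (inA p) = _ , ∈-++⁺ʳ (map _ (bridges l)) (∈-++⁺ˡ (∈-map⁺ (mapE inj₁) (there (∈-map⁺ (mapE inj₂) p)))) , refl
      sub l (inB p) = _ , ∈-++⁺ʳ (map _ (bridges l)) (∈-++⁺ʳ (map (mapE inj₁) (edges J₁)) (∈-map⁺ (mapE inj₂) p)) , refl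

    fork-in : ∀ {v} → T (forkIn v) → v ≡ hub ⊎ (∃[ x ] arm f x ≡ v × In A x) ⊎ (∃[ x ] arm (not f) x ≡ v × In B x)
    fork-in = image f

    in-fork-A : ∀ {x} → In A x → T (forkIn (arm f x))
    in-fork-A {x} = subst T (sym (side-at f (inV A) (inV B) x))

    in-fork-B : ∀ {x} → In B x → T (forkIn (arm (not f) x))
    in-fork-B {x} = subst T (sym (side-off f (inV A) (inV B) x))

    fork : Maybe (Target B) → Shape (Fork X) hub
    fork l = reshape (J l) to from from-to forkIn (forkEdges l)
      (λ {v} p → back′ (fork-in {v} p))
      (λ { {inj₁ (inj₁ _)} _ → tt ; {inj₁ (inj₂ x)} p → in-fork-A {x} p ; {inj₂ x} p → in-fork-B {x} p })
      (λ p → sub l (forkView l p))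
      where
      back′ : ∀ {v} → v ≡ hub ⊎ (∃[ x ] arm f x ≡ v × In A x) ⊎ (∃[ x ] arm (not f) x ≡ v × In B x) →
        ∃[ u ] to u ≡ v × T (inV (J l) u)
      back′ (inj₁ refl) = inj₁ (inj₁ tt) , refl , tt
      back′ (inj₂ (inj₁ (x , eq , p))) = inj₁ (inj₂ x) , eq , p
      back′ (inj₂ (inj₂ (x , eq , p))) = inj₂ x , eq , p

    fork-lip : ∀ l {η p q} → Lips p (edges A) → Lips q (edges B) → p r ≡ η → q r ≡ η →
      (∀ t → l ≡ just t → p (last A) ≡ q (target t)) → Lips (forkMap η f p q) (forkEdges l)
    fork-lip l {η} {p} {q} lp lq refl eq links e∈ with forkView l e∈
    ... | spokeA = ≤-trans (≤-reflexive (sym (side-at f p q r))) (m≤m+n _ 0) ,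
                   ≤-trans (≤-reflexive (side-at f p q r)) (m≤m+n _ 0)
    ... | spokeB = ≤-trans (≤-reflexive (trans (sym eq) (sym (side-off f p q r)))) (m≤m+n _ 0) ,
                   ≤-trans (≤-reflexive (trans (side-off f p q r) eq)) (m≤m+n _ 0)
    ... | inA {e} m = subst₂ (λ a b → a ≤ b + wt e × b ≤ a + wt e) (sym (side-at f p q (src e))) (sym (side-at f p q (tgt e))) (lp m)
    ... | inB {e} m = subst₂ (λ a b → a ≤ b + wt e × b ≤ a + wt e) (sym (side-off f p q (src e))) (sym (side-off f p q (tgt e))) (lq m)
    fork-lip (just t) {η} {p} {q} lp lq refl eq links e∈ | linked (here refl) =
      ≤-trans (≤-reflexive ends) (m≤m+n _ 0) , ≤-trans (≤-reflexive (sym ends)) (m≤m+n _ 0)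
      where
      ends : forkMap η f p q (arm f (last A)) ≡ forkMap η f p q (arm (not f) (target t))
      ends = trans (side-at f p q (last A)) (trans (links t refl) (sym (side-off f p q (target t))))

    armA : ∀ l {u v k C} → Tour (edges A) u v k C →
      Tour (forkEdges l) (arm f u) (arm f v) k (λ y → ∃[ x ] arm f x ≡ y × C x)
    armA l = mapT (arm f) (inA∈ l)

    armB : ∀ l {u v k C} → Tour (edges B) u v k C →
      Tour (forkEdges l) (arm (not f) u) (arm (not f) v) k (λ y → ∃[ x ] arm (not f) x ≡ y × C x)
    armB l = mapT (arm (not f)) (inB∈ l)

    spokeAT : ∀ l → Tour (forkEdges l) hub (arm f r) 0 (λ y → y ≡ hub ⊎ y ≡ arm f r)
    spokeAT l = stepT (spokeA∈ l)

    spokeBT : ∀ l → Tour (forkEdges l) hub (arm (not f) r) 0 (λ y → y ≡ hub ⊎ y ≡ arm (not f) r)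
    spokeBT l = stepT (spokeB∈ l)

    fork-cover : ∀ l {k j i} → Tour (edges A) r (last A) k (In A) →
      Tour (edges A) (last A) r j (λ _ → ⊥) → Tour (edges B) r (last B) i (In B) →
      Tour (forkEdges l) hub (arm (not f) (last B)) (k + j + i) (T ∘ forkIn)
    fork-cover l {k} {j} {i} a b c = costT (rot k j i) (weaken (λ {v} p → pick (fork-in {v} p))
      (seqT (spokeAT l) (seqT (armA l a) (seqT (armA l b) (seqT (revT (spokeAT l)) (seqT (spokeBT l) (armB l c)))))))
      where
      rot : ∀ k j i → k + (j + i) ≡ k + j + i
      rot = solveℕ 3 (λ k j i → k ⊕ (j ⊕ i) ⊜ k ⊕ j ⊕ i) refl
      pick : ∀ {y} → y ≡ hub ⊎ (∃[ x ] arm f x ≡ y × In A x) ⊎ (∃[ x ] arm (not f) x ≡ y × In B x) →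
        (y ≡ hub ⊎ y ≡ arm f r) ⊎ ((∃[ x ] arm f x ≡ y × In A x) ⊎ ((∃[ x ] arm f x ≡ y × ⊥) ⊎ ((y ≡ hub ⊎ y ≡ arm f r) ⊎ ((y ≡ hub ⊎ y ≡ arm (not f) r) ⊎ (∃[ x ] arm (not f) x ≡ y × In B x)))))
      pick (inj₁ eq) = inj₁ (inj₁ eq)
      pick (inj₂ (inj₁ p)) = inj₂ (inj₁ p)
      pick (inj₂ (inj₂ p)) = inj₂ (inj₂ (inj₂ (inj₂ (inj₂ p))))

    fork-return : ∀ l {k} → Tour (edges B) (last B) r k (λ _ → ⊥) →
      Tour (forkEdges l) (arm (not f) (last B)) hub k (λ _ → ⊥)
    fork-return l {k} a = costT (+-identityʳ k) (weaken (λ ()) (seqT (armB l a) (revT (spokeBT l))))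

  module _ {f : Bool} {A B : Shape X r} {pA pB : X → Bool} {l : Maybe (Target B)} where

    open-A : ∀ {x} → Open A pA x → Open (fork f A B l) (forkPd f pA pB) (arm f x)
    open-A {x} (inj₁ p) = inj₁ (subst T (sym (side-at f pA pB x)) p)
    open-A {x} (inj₂ p) = inj₂ (p ∘ subst T (side-at f (inV A) (inV B) x))

    open-B : ∀ {x} → Open B pB x → Open (fork f A B l) (forkPd f pA pB) (arm (not f) x)
    open-B {x} (inj₁ p) = inj₁ (subst T (sym (side-off f pA pB x)) p)
    open-B {x} (inj₂ p) = inj₂ (p ∘ subst T (side-off f (inV A) (inV B) x))

    fork-grow : ∀ {A′ B′ : Shape X r} {l′} → Grow A A′ pA → Grow B B′ pB →
      (∀ {e} → e ∈ linkE f A B l → e ∈ forkEdges f A′ B′ l′) →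
      (∀ t → l′ ≡ just t → Open A pA (last A′) × Open B pB (target t)) →
      Grow (fork f A B l) (fork f A′ B′ l′) (forkPd f pA pB)
    fork-grow {A′} {B′} {l′} gA gB keep new = record
      { inV-mono = λ {v} p → in-mono (fork-in f A B {v} p)
      ; edge-mono = λ p → mono (forkView f A B l p)
      ; edge-new = λ p → fresh l′ new (forkView f A′ B′ l′ p)
      }
      where
      in-mono : ∀ {v} → v ≡ hub ⊎ (∃[ x ] arm f x ≡ v × In A x) ⊎ (∃[ x ] arm (not f) x ≡ v × In B x) → T (forkIn f A′ B′ v)
      in-mono (inj₁ refl) = tt
      in-mono (inj₂ (inj₁ (x , refl , p))) = in-fork-A f A′ B′ {x} (inV-mono gA p)
      in-mono (inj₂ (inj₂ (x , refl , p))) = in-fork-B f A′ B′ {x} (inV-mono gB p)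
      mono : ∀ {e} → ForkView f A B l e → e ∈ forkEdges f A′ B′ l′
      mono (linked p) = keep p
      mono spokeA = spokeA∈ f A′ B′ l′
      mono spokeB = spokeB∈ f A′ B′ l′
      mono (inA p) = inA∈ f A′ B′ l′ (edge-mono gA p)
      mono (inB p) = inB∈ f A′ B′ l′ (edge-mono gB p)
      fresh : ∀ l′ → (∀ t → l′ ≡ just t → Open A pA (last A′) × Open B pB (target t)) → ∀ {e} → ForkView f A′ B′ l′ e →
        e ∈ forkEdges f A B l ⊎
        (Open (fork f A B l) (forkPd f pA pB) (src e) × Open (fork f A B l) (forkPd f pA pB) (tgt e))
      fresh (just t) new (linked (here refl)) = inj₂ (open-A (proj₁ (new t refl)) , open-B (proj₂ (new t refl)))
      fresh _ _ spokeA = inj₁ (spokeA∈ f A B l)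
      fresh _ _ spokeB = inj₁ (spokeB∈ f A B l)
      fresh _ _ (inA p) with edge-new gA p
      ... | inj₁ q = inj₁ (inA∈ f A B l q)
      ... | inj₂ (a , b) = inj₂ (open-A a , open-A b)
      fresh _ _ (inB p) with edge-new gB p
      ... | inj₁ q = inj₁ (inB∈ f A B l q)
      ... | inj₂ (a , b) = inj₂ (open-B a , open-B b)

  -- Exchanging the roles of the two strands changes the layout only.
  fork-flip : ∀ f {A B : Shape X r} {pd} → Grow (fork f A B nothing) (fork (not f) B A nothing) pd
  fork-flip f {A} {B} {pd} = record
    { inV-mono = λ {v} → subst T (flip-in f v)
    ; edge-mono = λ p → mono f (forkView f A B nothing p)
    ; edge-new = λ p → inj₁ (mono′ f (forkView (not f) B A nothing p))
    }
    where
    flip-in : ∀ f v → forkIn f A B v ≡ forkIn (not f) B A v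
    flip-in f hub = refl
    flip-in false (arm false _) = refl
    flip-in false (arm true _) = refl
    flip-in true (arm false _) = refl
    flip-in true (arm true _) = refl
    mono : ∀ f {e} → ForkView f A B nothing e → e ∈ forkEdges (not f) B A nothing
    mono false spokeA = there (here refl)
    mono true spokeA = there (here refl)
    mono f spokeB = here refl
    mono false (inA p) = inB∈ true B A nothing p
    mono true (inA p) = inB∈ false B A nothing p
    mono f (inB p) = inA∈ (not f) B A nothing p
    mono′ : ∀ f {e} → ForkView (not f) B A nothing e → e ∈ forkEdges f A B nothing
    mono′ f spokeA = there (here refl)
    mono′ false spokeB = here refl
    mono′ true spokeB = here refl
    mono′ f (inA p) = inB∈ f A B nothing p
    mono′ false (inB p) = inA∈ false A B nothing p
    mono′ true (inB p) = inA∈ true A B nothing p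

grow-trans : ∀ {V r} {S S′ S″ : Shape V r} {pd} → Grow S S′ pd → (∀ {pd} → Grow S′ S″ pd) → Grow S S″ pd
grow-trans {S = S} {S′} {pd = pd} g h = record
  { inV-mono = inV-mono (h {pd}) ∘ inV-mono g
  ; edge-mono = edge-mono (h {pd}) ∘ edge-mono g
  ; edge-new = λ p → new (edge-new (h {λ _ → false}) p)
  }
  where
  new : ∀ {e} → e ∈ edges S′ ⊎ (Open S′ (λ _ → false) (src e) × Open S′ (λ _ → false) (tgt e)) →
    e ∈ edges S ⊎ (Open S pd (src e) × Open S pd (tgt e))
  new (inj₁ p) = edge-new g p
  new (inj₂ (inj₂ a , inj₂ b)) = inj₂ (inj₂ (a ∘ inV-mono g) , inj₂ (b ∘ inV-mono g))

-- Ensures that a vertex once visited never becomes pending again: `x` is dropped, and whatever is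
-- newly pending lies outside the old graph.
Pend : ∀ {V r} → Shape V r → (pd pd′ : V → Bool) → V → Set
Pend S pd pd′ x = ∀ {v} → T (pd′ v) → (T (pd v) × v ≢ x) ⊎ ¬ In S v

Keep : ∀ {V r} → Shape V r → (pd pd′ : V → Bool) → Set
Keep S pd pd′ = ∀ {v} → T (pd′ v) → T (pd v) ⊎ ¬ In S v

module _ {X : Set} {r : X} {A B : Shape X r} {pA pB pA′ pB′ : X → Bool} where

  private
    apart : ∀ f {x y : X} → arm f x ≢ arm (not f) y
    apart false ()
    apart true ()

    split : ∀ f {v} → T (forkPd f pA′ pB′ v) → (∃[ y ] v ≡ arm f y × T (pA′ y)) ⊎ (∃[ y ] v ≡ arm (not f) y × T (pB′ y))
    split false {arm false y} p = inj₁ (y , refl , p)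
    split false {arm true y} p = inj₂ (y , refl , p)
    split true {arm false y} p = inj₂ (y , refl , p)
    split true {arm true y} p = inj₁ (y , refl , p)

    out-A : ∀ f l {y} → ¬ In A y → ¬ In (fork f A B l) (arm f y)
    out-A f l {y} n = n ∘ subst T (side-at f (inV A) (inV B) y)

    out-B : ∀ f l {y} → ¬ In B y → ¬ In (fork f A B l) (arm (not f) y)
    out-B f l {y} n = n ∘ subst T (side-off f (inV A) (inV B) y)

  pend-A : ∀ f l {x} → Pend A pA pA′ x → Keep B pB pB′ → Pend (fork f A B l) (forkPd f pA pB) (forkPd f pA′ pB′) (arm f x)
  pend-A f l a b {v} p with split f {v} p
  ... | inj₁ (y , refl , q) = [ (λ { (u , n) → inj₁ (subst T (sym (side-at f pA pB y)) u , n ∘ arm-injective) }) , (λ n → inj₂ (out-A f l n)) ]′ (a q)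
  ... | inj₂ (y , refl , q) = [ (λ u → inj₁ (subst T (sym (side-off f pA pB y)) u , apart f ∘ sym)) , (λ n → inj₂ (out-B f l n)) ]′ (b q)

  pend-B : ∀ f l {x} → Keep A pA pA′ → Pend B pB pB′ x → Pend (fork f A B l) (forkPd f pA pB) (forkPd f pA′ pB′) (arm (not f) x)
  pend-B f l a b {v} p with split f {v} p
  ... | inj₁ (y , refl , q) = [ (λ u → inj₁ (subst T (sym (side-at f pA pB y)) u , apart f)) , (λ n → inj₂ (out-A f l n)) ]′ (a q)
  ... | inj₂ (y , refl , q) = [ (λ { (u , n) → inj₁ (subst T (sym (side-off f pA pB y)) u , n ∘ arm-injective) }) , (λ n → inj₂ (out-B f l n)) ]′ (b q)

forkPd-flip : ∀ {X : Set} f {p q : X → Bool} v → T (forkPd (not f) q p v) → T (forkPd f p q v)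
forkPd-flip false (arm false _) t = t
forkPd-flip false (arm true _) t = t
forkPd-flip true (arm false _) t = t
forkPd-flip true (arm true _) t = t

hubShape : ∀ {X} → Shape (Fork X) hub
hubShape = reshape single (λ _ → hub) (λ { hub → just tt ; (arm _ _) → nothing }) (λ _ → refl)
  (λ { hub → true ; (arm _ _) → false }) [] (λ { {hub} _ → tt , refl , tt }) (λ _ → tt) (λ ())

hubPd : ∀ {X} → Fork X → Bool
hubPd hub = true
hubPd (arm _ _) = false

ring-tour : ∀ {X r} f (A B : Shape X r) {k j} → Tour (edges A) r (last A) k (In A) → Tour (edges B) r (last B) j (In B) →
  Tour (forkEdges f A B (just (last-target B))) hub hub (k + j) (T ∘ forkIn f A B)
ring-tour {X} {r} f A B {k} {j} a b = costT (rot k j) (weaken (λ {v} p → pick (fork-in f A B {v} p))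
  (seqT (spokeAT f A B l) (seqT (armA f A B l a) (seqT (stepT {e = bond} (link∈ f A B l (here refl)))
    (seqT (armB f A B l (revT b)) (revT (spokeBT f A B l)))))))
  where
  l = just (last-target B)
  bond = edge (arm f (last A)) (arm (not f) (last B)) 0 true
  rot : ∀ k j → k + (j + 0) ≡ k + j
  rot = solveℕ 2 (λ k j → k ⊕ (j ⊕ lit 0) ⊜ k ⊕ j) refl
  pick : ∀ {v} → v ≡ hub ⊎ (∃[ x ] arm f x ≡ v × In A x) ⊎ (∃[ x ] arm (not f) x ≡ v × In B x) → _
  pick (inj₁ eq) = inj₁ (inj₁ eq)
  pick (inj₂ (inj₁ p)) = inj₂ (inj₁ p)
  pick (inj₂ (inj₂ p)) = inj₂ (inj₂ (inj₂ (inj₁ p)))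

-- Termination: completing a block of length d pays for a fresh block of rank r′ ≤ R.
budget : ∀ {S R z k d l r r′} → 1 ≤ d → k + d ≤ S → l ≡ k + d →
  z + (R + r′) + (S ∸ l) * suc R < z + (r + r′) + (S ∸ k) * suc R
budget {S} {R} {z} {k} {d} {_} {r} {r′} 1≤d le refl = lin r (eq R r r′ (S ∸ (k + d)) (S ∸ k) z) (*-monoˡ-≤ (suc R) gap)
  where
  gap : suc (S ∸ (k + d)) ≤ S ∸ k
  gap = ∸-monoʳ-< (m<m+n k 1≤d) le
  eq : ∀ R r r′ s t z → (1 + (z + (R + r′) + s * (1 + R))) + t * (1 + R) + r ≡ z + (r + r′) + t * (1 + R) + (1 + s) * (1 + R)
  eq = solveℕ 6 (λ R r r′ s t z → (lit 1 ⊕ (z ⊕ (R ⊕ r′) ⊕ s ⊗ (lit 1 ⊕ R))) ⊕ t ⊗ (lit 1 ⊕ R) ⊕ r ⊜ z ⊕ (r ⊕ r′) ⊕ t ⊗ (lit 1 ⊕ R) ⊕ (lit 1 ⊕ s) ⊗ (lit 1 ⊕ R)) refl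

-- Strands: a chain, possibly ending in two heavy edges of equal weight

module Plain {C Y : Set} {r : C} where

  private
    X : Set
    X = C ⊎ Y

    from₁ : X → Maybe C
    from₁ (inj₁ p) = just p
    from₁ (inj₂ _) = nothing

    in₁ : Shape C r → X → Bool
    in₁ S (inj₁ p) = inV S p
    in₁ S (inj₂ _) = false

  plain : Shape C r → Shape X (inj₁ r)
  plain S = reshape S inj₁ from₁ (λ _ → refl) (in₁ S) (map (mapE inj₁) (edges S))
    (λ { {inj₁ p} q → p , refl , q ; {inj₂ _} () }) id (λ p → ∈-map⁻ (mapE inj₁) p)

  plainT : ∀ S {u v k P} → Tour (edges S) u v k P → Tour (edges (plain S)) (inj₁ u) (inj₁ v) k (λ y → ∃[ x ] inj₁ x ≡ y × P x)
  plainT S = mapT inj₁ (∈-map⁺ (mapE inj₁))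

  plain-cover : ∀ S {k} → Tour (edges S) r (last S) k (In S) →
    Tour (edges (plain S)) (inj₁ r) (inj₁ (last S)) k (In (plain S))
  plain-cover S c = weaken (λ { {inj₁ p} q → p , refl , q ; {inj₂ _} () }) (plainT S c)

  plain-return : ∀ S {k} → Tour (edges S) (last S) r k (λ _ → ⊥) →
    Tour (edges (plain S)) (inj₁ (last S)) (inj₁ r) k (λ _ → ⊥)
  plain-return S c = weaken (λ ()) (plainT S c)

  plain-lip : ∀ {S p y} → Lips p (edges S) → Lips [ p , y ]′ (edges (plain S))
  plain-lip {p = p} {y} l = lip-map {f = inj₁} {p = [ p , y ]′} l

  plain-grow : ∀ {S S′ pd pd′} → (∀ p → T (pd p) → T (pd′ (inj₁ p))) → Grow S S′ pd → Grow (plain S) (plain S′) pd′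
  plain-grow {S} {S′} {pd} {pd′} sub g = record
    { inV-mono = λ { {inj₁ p} q → inV-mono g q ; {inj₂ _} () }
    ; edge-mono = mono
    ; edge-new = new
    }
    where
    opn : ∀ v → Open S pd v → Open (plain S) pd′ (inj₁ v)
    opn v (inj₁ p) = inj₁ (sub v p)
    opn v (inj₂ p) = inj₂ p
    mono : ∀ {e} → e ∈ edges (plain S) → e ∈ edges (plain S′)
    mono p with _ , q , refl ← ∈-map⁻ (mapE inj₁) p = ∈-map⁺ (mapE inj₁) (edge-mono g q)
    new : ∀ {e} → e ∈ edges (plain S′) → e ∈ edges (plain S) ⊎ (Open (plain S) pd′ (src e) × Open (plain S) pd′ (tgt e))
    new p with e₀ , q , refl ← ∈-map⁻ (mapE inj₁) p with edge-new g q
    ... | inj₁ a = inj₁ (∈-map⁺ (mapE inj₁) a)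
    ... | inj₂ (a , b) = inj₂ (opn (src e₀) a , opn (tgt e₀) b)

  plain-pend : ∀ {S : Shape C r} {pd pd′ x} → Pend S pd pd′ x → Pend (plain S) [ pd , (λ _ → false) ]′ [ pd′ , (λ _ → false) ]′ (inj₁ x)
  plain-pend pend {inj₁ y} t with pend t
  ... | inj₁ (a , ne) = inj₁ (a , λ { refl → ne refl })
  ... | inj₂ b = inj₂ b

  plain-fresh : ∀ {S : Shape C r} {pd pd′ x} → (∀ {v} → T (pd′ v) → ¬ In S v) → Pend (plain S) [ pd , (λ _ → false) ]′ [ pd′ , (λ _ → false) ]′ (inj₁ x)
  plain-fresh new {inj₁ y} t = inj₂ (new t)

module Strand {C : Set} {r : C} where
  open Plain {C} {Bool} {r} public

  X : Set
  X = C ⊎ Bool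

  private
    in₂ : Shape C r → X → Bool
    in₂ S (inj₁ p) = inV S p
    in₂ S (inj₂ _) = true

  module _ (S : Shape C r) (W : ℕ) where

    rungE : Bool → Edge X
    rungE b = edge (inj₁ (last S)) (inj₂ b) W false

    tieE : Bool → Bool → List (Edge X)
    tieE false z = []
    tieE true z = edge (inj₂ (not z)) (inj₂ z) 0 false ∷ []

    heavyEdges : Bool → Bool → List (Edge X)
    heavyEdges t z = tieE t z ++ rungE false ∷ rungE true ∷ map (mapE inj₁) (edges S)

    data HeavyView (t z : Bool) : Edge X → Set where
      tied   : ∀ {e} → e ∈ tieE t z → HeavyView t z e
      rung   : ∀ b → HeavyView t z (rungE b)
      inside : ∀ {e} → e ∈ edges S → HeavyView t z (mapE inj₁ e)

    heavyView : ∀ t z {e} → e ∈ heavyEdges t z → HeavyView t z e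
    heavyView t z p with ∈-++⁻ (tieE t z) p
    ... | inj₁ q = tied q
    ... | inj₂ (here refl) = rung false
    ... | inj₂ (there (here refl)) = rung true
    ... | inj₂ (there (there q)) with _ , a , refl ← ∈-map⁻ (mapE inj₁) q = inside a

    rung∈ : ∀ t z b → rungE b ∈ heavyEdges t z
    rung∈ t z false = ∈-++⁺ʳ (tieE t z) (here refl)
    rung∈ t z true = ∈-++⁺ʳ (tieE t z) (there (here refl))

    base∈ : ∀ t z {e} → e ∈ edges S → mapE inj₁ e ∈ heavyEdges t z
    base∈ t z p = ∈-++⁺ʳ (tieE t z) (there (there (∈-map⁺ (mapE inj₁) p)))

    private
      U : Set
      U = (C ⊎ ⊤) ⊎ ⊤

      to : Bool → U → X
      to z (inj₁ (inj₁ p)) = inj₁ p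
      to z (inj₁ (inj₂ _)) = inj₂ (not z)
      to z (inj₂ _) = inj₂ z

      from : Bool → X → Maybe U
      from z (inj₁ p) = just (inj₁ (inj₁ p))
      from false (inj₂ false) = just (inj₂ tt)
      from false (inj₂ true) = just (inj₁ (inj₂ tt))
      from true (inj₂ false) = just (inj₁ (inj₂ tt))
      from true (inj₂ true) = just (inj₂ tt)

      from-to : ∀ z u → from z (to z u) ≡ just u
      from-to z (inj₁ (inj₁ _)) = refl
      from-to false (inj₁ (inj₂ _)) = refl
      from-to true (inj₁ (inj₂ _)) = refl
      from-to false (inj₂ _) = refl
      from-to true (inj₂ _) = refl

      b₁ : Bridge S single
      b₁ = bridge (last S) tt W false (last∈ S) tt (last-visible S false) (last-visible single false)

      J₁ : Shape (C ⊎ ⊤) (inj₁ r)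
      J₁ = join S single (b₁ ∷ []) λ { (here refl) (here refl) _ (p , _) → <-irrefl refl p }

      vis : Visible J₁ false (inj₁ (last S))
      vis p l (a , b) with joinView S single (b₁ ∷ []) p
      ... | between (here refl) = <-irrefl refl a
      ... | left q = last-visible S false q l (a , b)

      b₂ b₃ : Bridge J₁ single
      b₂ = bridge (inj₁ (last S)) tt W false (last∈ S) tt vis (last-visible single false)
      b₃ = bridge (inj₂ tt) tt 0 false tt tt (last-visible J₁ false) (last-visible single false)

      bridges : Bool → List (Bridge J₁ single)
      bridges false = b₂ ∷ []
      bridges true = b₃ ∷ b₂ ∷ []

      J : Bool → Shape U (inj₁ (inj₁ r))
      J t = join J₁ single (bridges t) λ _ _ _ (_ , p) → n≮0 p

      image : ∀ z {v} → T (in₂ S v) → ∃[ u ] to z u ≡ v × T ([ [ inV S , (λ _ → true) ]′ , (λ _ → true) ]′ u)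
      image z {inj₁ p} q = inj₁ (inj₁ p) , refl , q
      image false {inj₂ false} _ = inj₂ tt , refl , tt
      image false {inj₂ true} _ = inj₁ (inj₂ tt) , refl , tt
      image true {inj₂ false} _ = inj₁ (inj₂ tt) , refl , tt
      image true {inj₂ true} _ = inj₂ tt , refl , tt

      rung₁ : ∀ t → edge (inj₁ (inj₁ (last S))) (inj₁ (inj₂ tt)) W false ∈ edges (J t)
      rung₁ t = ∈-++⁺ʳ (map _ (bridges t)) (∈-++⁺ˡ {xs = map (mapE inj₁) (edges J₁)} (here refl))

      rung₂ : ∀ t → edge (inj₁ (inj₁ (last S))) (inj₂ tt) W false ∈ edges (J t)
      rung₂ false = here refl
      rung₂ true = there (here refl)

      sub : ∀ t z {e} → HeavyView t z e → ∃[ e₀ ] e₀ ∈ edges (J t) × e ≡ mapE (to z) e₀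
      sub true z (tied (here refl)) = _ , here refl , refl
      sub t false (rung false) = _ , rung₂ t , refl
      sub t false (rung true) = _ , rung₁ t , refl
      sub t true (rung false) = _ , rung₁ t , refl
      sub t true (rung true) = _ , rung₂ t , refl
      sub t z (inside p) = _ , ∈-++⁺ʳ (map _ (bridges t))
        (∈-++⁺ˡ (∈-map⁺ (mapE inj₁) (there (∈-++⁺ˡ (∈-map⁺ (mapE inj₁) p))))) , refl

    -- z is the heavy end placed last; t tells whether the two ends are tied by a weight 0 edge.
    heavy : (t z : Bool) → Shape X (inj₁ r)
    heavy t z = reshape (J t) (to z) (from z) (from-to z) (in₂ S) (heavyEdges t z) (image z)
      (λ { {inj₁ (inj₁ _)} p → p ; {inj₁ (inj₂ _)} _ → tt ; {inj₂ _} _ → tt })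
      (λ p → sub t z (heavyView t z p))

    heavy-lip : ∀ t z {p y} → Lips p (edges S) → (∀ b → p (last S) ≤ y b + W × y b ≤ p (last S) + W) →
      (T t → y false ≡ y true) → Lips [ p , y ]′ (heavyEdges t z)
    heavy-lip t z l w q e∈ with heavyView t z e∈
    heavy-lip true false l w q e∈ | tied (here refl) =
      ≤-trans (≤-reflexive (sym (q tt))) (m≤m+n _ 0) , ≤-trans (≤-reflexive (q tt)) (m≤m+n _ 0)
    heavy-lip true true l w q e∈ | tied (here refl) =
      ≤-trans (≤-reflexive (q tt)) (m≤m+n _ 0) , ≤-trans (≤-reflexive (sym (q tt))) (m≤m+n _ 0)
    ... | rung b = w b
    ... | inside p = l p

    heavyT : ∀ t z {u v k P} → Tour (edges S) u v k P →
      Tour (heavyEdges t z) (inj₁ u) (inj₁ v) k (λ y → ∃[ x ] inj₁ x ≡ y × P x)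
    heavyT t z = mapT inj₁ (base∈ t z)

    -- The end `inj₂ (not z)` is left out because in the crossed case it is visited from the end of
    -- the other strand, through the tie of weight 0.
    heavy-cover′ : ∀ t z {k} → Tour (edges S) r (last S) k (In S) →
      Tour (heavyEdges t z) (inj₁ r) (inj₂ z) (k + W) (λ y → T (in₂ S y) × y ≢ inj₂ (not z))
    heavy-cover′ t z c = weaken (pick z) (seqT (heavyT t z c) (stepT (rung∈ t z z)))
      where
      pick : ∀ z {y} → T (in₂ S y) × y ≢ inj₂ (not z) → (∃[ x ] inj₁ x ≡ y × In S x) ⊎ (y ≡ inj₁ (last S) ⊎ y ≡ inj₂ z)
      pick z {inj₁ p} (q , _) = inj₁ (p , refl , q)
      pick false {inj₂ false} _ = inj₂ (inj₂ refl)
      pick true {inj₂ true} _ = inj₂ (inj₂ refl)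
      pick false {inj₂ true} (_ , n) = ⊥-elim (n refl)
      pick true {inj₂ false} (_ , n) = ⊥-elim (n refl)

    heavy-cover : ∀ t z {k} → Tour (edges S) r (last S) k (In S) →
      Tour (heavyEdges t z) (inj₁ r) (inj₂ z) (k + (W + (W + W))) (T ∘ in₂ S)
    heavy-cover t z {k} c = weaken (λ {y} → pick z {y})
      (seqT (heavyT t z c) (seqT (stepT (rung∈ t z (not z))) (seqT (revT (stepT (rung∈ t z (not z)))) (stepT (rung∈ t z z)))))
      where
      pick : ∀ z {y} → T (in₂ S y) → (∃[ x ] inj₁ x ≡ y × In S x) ⊎
        ((y ≡ inj₁ (last S) ⊎ y ≡ inj₂ (not z)) ⊎ ((y ≡ inj₁ (last S) ⊎ y ≡ inj₂ (not z)) ⊎ (y ≡ inj₁ (last S) ⊎ y ≡ inj₂ z)))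
      pick z {inj₁ p} q = inj₁ (p , refl , q)
      pick false {inj₂ false} _ = inj₂ (inj₂ (inj₂ (inj₂ refl)))
      pick true {inj₂ true} _ = inj₂ (inj₂ (inj₂ (inj₂ refl)))
      pick false {inj₂ true} _ = inj₂ (inj₁ (inj₂ refl))
      pick true {inj₂ false} _ = inj₂ (inj₁ (inj₂ refl))

    tied-cover : ∀ z {k} → Tour (edges S) r (last S) k (In S) →
      Tour (heavyEdges true z) (inj₁ r) (inj₂ z) (k + (W + 0)) (T ∘ in₂ S)
    tied-cover z {k} c = weaken (λ {y} → pick z {y})
      (seqT (heavyT true z c) (seqT (stepT (rung∈ true z (not z))) (stepT (here refl))))
      where
      pick : ∀ z {y} → T (in₂ S y) → (∃[ x ] inj₁ x ≡ y × In S x) ⊎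
        ((y ≡ inj₁ (last S) ⊎ y ≡ inj₂ (not z)) ⊎ (y ≡ inj₂ (not z) ⊎ y ≡ inj₂ z))
      pick z {inj₁ p} q = inj₁ (p , refl , q)
      pick false {inj₂ false} _ = inj₂ (inj₂ (inj₂ refl))
      pick true {inj₂ true} _ = inj₂ (inj₂ (inj₂ refl))
      pick false {inj₂ true} _ = inj₂ (inj₁ (inj₂ refl))
      pick true {inj₂ false} _ = inj₂ (inj₁ (inj₂ refl))

    heavy-return : ∀ t z {k} → Tour (edges S) (last S) r k (λ _ → ⊥) →
      Tour (heavyEdges t z) (inj₂ z) (inj₁ r) (W + k) (λ _ → ⊥)
    heavy-return t z c = weaken (λ ()) (seqT (revT (stepT (rung∈ t z z))) (heavyT t z c))

    -- The edges at the heavy ends run above the line, and everything else of the strand lies to the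
    -- left, so the end placed first can be tied from below.
    heavy-target : ∀ t z → Target (heavy t z)
    heavy-target t z = record { target = inj₂ (not z) ; target∈ = tt ; exposed = λ p → exp t (heavyView t z p) }
      where
      at : ∀ t z → pos (heavy t z) (inj₂ (not z)) ≡ width S + 0
      at t false = refl
      at t true = refl
      exp : ∀ t {e} → HeavyView t z e → low e ≡ true →
        ¬ (pos (heavy t z) (src e) < pos (heavy t z) (inj₂ (not z)) × pos (heavy t z) (inj₂ (not z)) < pos (heavy t z) (tgt e))
      exp true (tied (here refl)) ()
      exp _ (rung _) ()
      exp t (inside {e} p) l (_ , b) = <-asym b
        (subst (pos S (tgt e) <_) (sym (at t z)) (m≤n⇒m≤n+o _ (pos-bound S (tgt∈ S p))))

    heavy-retie : ∀ {t z t′ z′ pd} → (∀ {e} → e ∈ tieE t z → e ∈ heavyEdges t′ z′) →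
      (T t′ → ∀ b → T (pd (inj₂ b))) → Grow (heavy t z) (heavy t′ z′) pd
    heavy-retie {t} {z} {t′} {z′} {pd} keep pend = record
      { inV-mono = id
      ; edge-mono = λ p → mono (heavyView t z p)
      ; edge-new = λ p → new t′ pend (heavyView t′ z′ p)
      }
      where
      mono : ∀ {e} → HeavyView t z e → e ∈ heavyEdges t′ z′
      mono (tied p) = keep p
      mono (rung b) = rung∈ t′ z′ b
      mono (inside p) = base∈ t′ z′ p
      new : ∀ t′ → (T t′ → ∀ b → T (pd (inj₂ b))) → ∀ {e} → HeavyView t′ z′ e → e ∈ heavyEdges t z ⊎ (Open (heavy t z) pd (src e) × Open (heavy t z) pd (tgt e))
      new true pend (tied (here refl)) = inj₂ (inj₁ (pend tt (not z′)) , inj₁ (pend tt z′))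
      new _ _ (rung b) = inj₁ (rung∈ t z b)
      new _ _ (inside p) = inj₁ (base∈ t z p)

  plain-heavy : ∀ {S S′ pd pd′ W z} → (∀ p → T (pd p) → T (pd′ (inj₁ p))) → Grow S S′ pd → T (pd (last S′)) →
    Grow (plain S) (heavy S′ W false z) pd′
  plain-heavy {S} {S′} {pd} {pd′} {W} {z} sub g x∈ = record
    { inV-mono = λ { {inj₁ p} q → inV-mono g q ; {inj₂ _} () }
    ; edge-mono = mono
    ; edge-new = λ p → new (heavyView S′ W false z p)
    }
    where
    opn : ∀ v → Open S pd v → Open (plain S) pd′ (inj₁ v)
    opn v (inj₁ p) = inj₁ (sub v p)
    opn v (inj₂ p) = inj₂ p
    mono : ∀ {e} → e ∈ edges (plain S) → e ∈ heavyEdges S′ W false z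
    mono p with _ , q , refl ← ∈-map⁻ (mapE inj₁) p = base∈ S′ W false z (edge-mono g q)
    new : ∀ {e} → HeavyView S′ W false z e →
      e ∈ edges (plain S) ⊎ (Open (plain S) pd′ (src e) × Open (plain S) pd′ (tgt e))
    new (rung b) = inj₂ (inj₁ (sub _ x∈) , inj₂ (λ ()))
    new (inside {e} q) with edge-new g q
    ... | inj₁ a = inj₁ (∈-map⁺ (mapE inj₁) a)
    ... | inj₂ (a , b) = inj₂ (opn (src e) a , opn (tgt e) b)

-- Linear arithmetic for the zigzag phase

module Arith (n m Λ : ℕ) (1≤n : 1 ≤ n) (1≤m : 1 ≤ m) (m≤2n : m ≤ 2 * n) (1≤Λ : 1 ≤ Λ) where

  -- With a, c the lengths of the two sides and w the cost of walking so far,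
  -- leaving the block along the side of length c gives a block of quality (19 m) / (20 n).
  Leave : ℕ → ℕ → ℕ → Set
  Leave a c w = 80 * (n * a) + 20 * (m * a) + m * c + m * Λ ≤ 20 * (n * w) + 20 * (n * c)

  leave? : ∀ a c w → Dec (Leave a c w)
  leave? a c w = _ ≤? _

  -- Here `o + d` is the new length of the strand whose end was just reached, and the walk has grown
  -- by the way `c + o` between the ends. Using `m ≤ 2n` and `d ≤ Λ` and cancelling `n` removes the
  -- quality from the failed inequality; what remains bounds `38c` by `100o - 20w`, up to a multiple
  -- of `Λ`.
  stay-bound : ∀ {o c w d} → d ≤ Λ → ¬ Leave (o + d) c (w + (c + o)) → 20 * w + 38 * c ≤ 100 * o + 122 * Λ
  stay-bound {o} {c} {w} {d} d≤Λ ¬leave = lin 0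
    (eq₂ o c w d Λ) (+-mono-≤ (*-monoʳ-≤ 120 d≤Λ) (<⇒≤ (*-cancelˡ-< n _ _ below)))
    where
    eq₁ : ∀ n o c w d Λ → 20 * (n * (w + (c + o))) + 20 * (n * c) ≡ n * (20 * (w + (c + o)) + 20 * c)
    eq₁ = solveℕ 6 (λ n o c w d Λ → lit 20 ⊗ (n ⊗ (w ⊕ (c ⊕ o))) ⊕ lit 20 ⊗ (n ⊗ c) ⊜ n ⊗ (lit 20 ⊗ (w ⊕ (c ⊕ o)) ⊕ lit 20 ⊗ c)) refl
    eq₃ : ∀ n a c Λ → 80 * (n * a) + 2 * n * (20 * a + c + Λ) ≡ n * (120 * a + 2 * c + 2 * Λ)
    eq₃ = solveℕ 4 (λ n a c Λ → lit 80 ⊗ (n ⊗ a) ⊕ lit 2 ⊗ n ⊗ (lit 20 ⊗ a ⊕ c ⊕ Λ) ⊜ n ⊗ (lit 120 ⊗ a ⊕ lit 2 ⊗ c ⊕ lit 2 ⊗ Λ)) refl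
    eq₄ : ∀ n m a c Λ → 80 * (n * a) + 20 * (m * a) + m * c + m * Λ ≡ 80 * (n * a) + m * (20 * a + c + Λ)
    eq₄ = solveℕ 5 (λ n m a c Λ → lit 80 ⊗ (n ⊗ a) ⊕ lit 20 ⊗ (m ⊗ a) ⊕ m ⊗ c ⊕ m ⊗ Λ ⊜ lit 80 ⊗ (n ⊗ a) ⊕ m ⊗ (lit 20 ⊗ a ⊕ c ⊕ Λ)) refl
    eq₂ : ∀ o c w d Λ → 20 * w + 38 * c + (120 * Λ + (120 * (o + d) + 2 * c + 2 * Λ)) + 0
      ≡ 100 * o + 122 * Λ + (120 * d + (20 * (w + (c + o)) + 20 * c))
    eq₂ = solveℕ 5 (λ o c w d Λ → lit 20 ⊗ w ⊕ lit 38 ⊗ c ⊕ (lit 120 ⊗ Λ ⊕ (lit 120 ⊗ (o ⊕ d) ⊕ lit 2 ⊗ c ⊕ lit 2 ⊗ Λ)) ⊕ lit 0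
      ⊜ lit 100 ⊗ o ⊕ lit 122 ⊗ Λ ⊕ (lit 120 ⊗ d ⊕ (lit 20 ⊗ (w ⊕ (c ⊕ o)) ⊕ lit 20 ⊗ c))) refl
    below : n * (20 * (w + (c + o)) + 20 * c) < n * (120 * (o + d) + 2 * c + 2 * Λ)
    below = ≤-trans (s≤s (≤-reflexive (sym (eq₁ n o c w d Λ)))) (≤-trans (≰⇒> ¬leave)
      (≤-trans (≤-reflexive (eq₄ n m (o + d) c Λ))
        (≤-trans (+-monoʳ-≤ (80 * (n * (o + d))) (*-monoˡ-≤ (20 * (o + d) + c + Λ) m≤2n)) (≤-reflexive (eq₃ n (o + d) c Λ)))))

  -- The start of the count, with only `o ≤ w` known. A strand of length `400Λ` forces the other one
  -- to be long as well, so that multiples of `Λ` are small from here on.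
  early-step : ∀ {o c w} → 20 * w + 38 * c ≤ 100 * o + 122 * Λ → o ≤ w → 400 * Λ ≤ c →
    100 * Λ ≤ o × 9 * c ≤ 5 * (w + (c + o))
  early-step {o} {c} {w} h o≤w k = *-cancelˡ-≤ 80 (lin (7078 * Λ) (eq₁ o c w Λ) (+-mono-≤ (+-mono-≤ h (*-monoʳ-≤ 20 o≤w)) (*-monoʳ-≤ 38 k)))
    , *-cancelˡ-≤ 40 (lin (11390 * Λ) (eq₂ o c w Λ) (+-mono-≤ (+-mono-≤ (*-monoʳ-≤ 5 h) (*-monoʳ-≤ 300 o≤w)) (*-monoʳ-≤ 30 k)))
    where
    eq₁ : ∀ o c w Λ → 80 * (100 * Λ) + (100 * o + 122 * Λ + 20 * w + 38 * c) + 7078 * Λ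
      ≡ 80 * o + (20 * w + 38 * c + 20 * o + 38 * (400 * Λ))
    eq₁ = solveℕ 4 (λ o c w Λ → lit 80 ⊗ (lit 100 ⊗ Λ) ⊕ (lit 100 ⊗ o ⊕ lit 122 ⊗ Λ ⊕ lit 20 ⊗ w ⊕ lit 38 ⊗ c) ⊕ lit 7078 ⊗ Λ
      ⊜ lit 80 ⊗ o ⊕ (lit 20 ⊗ w ⊕ lit 38 ⊗ c ⊕ lit 20 ⊗ o ⊕ lit 38 ⊗ (lit 400 ⊗ Λ))) refl
    eq₂ : ∀ o c w Λ → 40 * (9 * c) + (5 * (100 * o + 122 * Λ) + 300 * w + 30 * c) + 11390 * Λ
      ≡ 40 * (5 * (w + (c + o))) + (5 * (20 * w + 38 * c) + 300 * o + 30 * (400 * Λ))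
    eq₂ = solveℕ 4 (λ o c w Λ → lit 40 ⊗ (lit 9 ⊗ c) ⊕ (lit 5 ⊗ (lit 100 ⊗ o ⊕ lit 122 ⊗ Λ) ⊕ lit 300 ⊗ w ⊕ lit 30 ⊗ c) ⊕ lit 11390 ⊗ Λ
      ⊜ lit 40 ⊗ (lit 5 ⊗ (w ⊕ (c ⊕ o))) ⊕ (lit 5 ⊗ (lit 20 ⊗ w ⊕ lit 38 ⊗ c) ⊕ lit 300 ⊗ o ⊕ lit 30 ⊗ (lit 400 ⊗ Λ))) refl

  -- Let w ≥ g o. Up to terms in Λ, `stay-bound` gives (w + c + o)/c ≥ 1 + 38(g + 1)/(100 - 20g).
  -- For g = 1 + 4j/5 with 1 ≤ j ≤ 4 this exceeds g + 4/5, and `o ≥ 100Λ` leaves room for the terms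
  -- in Λ.
  late-step : ∀ j {o c w} → 1 ≤ j → j ≤ 4 → 20 * w + 38 * c ≤ 100 * o + 122 * Λ → (5 + 4 * j) * o ≤ 5 * w → 100 * Λ ≤ o →
    (5 + 4 * suc j) * c ≤ 5 * (w + (c + o))
  late-step 0 () _ _ _ _
  late-step 1 {o} {c} {w} _ _ h g s = *-cancelˡ-≤ 38
    (lin (24 * Λ + 10 * o) (eq1′ o c w Λ) (+-mono-≤ (+-mono-≤ (*-monoʳ-≤ 8 h) (*-monoʳ-≤ 70 g)) (*-monoʳ-≤ 10 s)))
    where
    eq1′ : ∀ o c w Λ → 38 * (13 * c) + (8 * (100 * o + 122 * Λ) + 70 * (5 * w) + 10 * o) + (24 * Λ + 10 * o)
      ≡ 38 * (5 * (w + (c + o))) + (8 * (20 * w + 38 * c) + 70 * (9 * o) + 10 * (100 * Λ))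
    eq1′ = solveℕ 4 (λ o c w Λ → lit 38 ⊗ (lit 13 ⊗ c) ⊕ (lit 8 ⊗ (lit 100 ⊗ o ⊕ lit 122 ⊗ Λ) ⊕ lit 70 ⊗ (lit 5 ⊗ w) ⊕ lit 10 ⊗ o) ⊕ (lit 24 ⊗ Λ ⊕ lit 10 ⊗ o)
      ⊜ lit 38 ⊗ (lit 5 ⊗ (w ⊕ (c ⊕ o))) ⊕ (lit 8 ⊗ (lit 20 ⊗ w ⊕ lit 38 ⊗ c) ⊕ lit 70 ⊗ (lit 9 ⊗ o) ⊕ lit 10 ⊗ (lit 100 ⊗ Λ))) refl
  late-step 2 {o} {c} {w} _ _ h g s = *-cancelˡ-≤ 38
    (lin (36 * Λ + 93 * o) (eq2′ o c w Λ) (+-mono-≤ (+-mono-≤ (*-monoʳ-≤ 12 h) (*-monoʳ-≤ 86 g)) (*-monoʳ-≤ 15 s)))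
    where
    eq2′ : ∀ o c w Λ → 38 * (17 * c) + (12 * (100 * o + 122 * Λ) + 86 * (5 * w) + 15 * o) + (36 * Λ + 93 * o)
      ≡ 38 * (5 * (w + (c + o))) + (12 * (20 * w + 38 * c) + 86 * (13 * o) + 15 * (100 * Λ))
    eq2′ = solveℕ 4 (λ o c w Λ → lit 38 ⊗ (lit 17 ⊗ c) ⊕ (lit 12 ⊗ (lit 100 ⊗ o ⊕ lit 122 ⊗ Λ) ⊕ lit 86 ⊗ (lit 5 ⊗ w) ⊕ lit 15 ⊗ o) ⊕ (lit 36 ⊗ Λ ⊕ lit 93 ⊗ o)
      ⊜ lit 38 ⊗ (lit 5 ⊗ (w ⊕ (c ⊕ o))) ⊕ (lit 12 ⊗ (lit 20 ⊗ w ⊕ lit 38 ⊗ c) ⊕ lit 86 ⊗ (lit 13 ⊗ o) ⊕ lit 15 ⊗ (lit 100 ⊗ Λ))) refl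
  late-step 3 {o} {c} {w} _ _ h g s = *-cancelˡ-≤ 38
    (lin (48 * Λ + 304 * o) (eq3′ o c w Λ) (+-mono-≤ (+-mono-≤ (*-monoʳ-≤ 16 h) (*-monoʳ-≤ 102 g)) (*-monoʳ-≤ 20 s)))
    where
    eq3′ : ∀ o c w Λ → 38 * (21 * c) + (16 * (100 * o + 122 * Λ) + 102 * (5 * w) + 20 * o) + (48 * Λ + 304 * o)
      ≡ 38 * (5 * (w + (c + o))) + (16 * (20 * w + 38 * c) + 102 * (17 * o) + 20 * (100 * Λ))
    eq3′ = solveℕ 4 (λ o c w Λ → lit 38 ⊗ (lit 21 ⊗ c) ⊕ (lit 16 ⊗ (lit 100 ⊗ o ⊕ lit 122 ⊗ Λ) ⊕ lit 102 ⊗ (lit 5 ⊗ w) ⊕ lit 20 ⊗ o) ⊕ (lit 48 ⊗ Λ ⊕ lit 304 ⊗ o)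
      ⊜ lit 38 ⊗ (lit 5 ⊗ (w ⊕ (c ⊕ o))) ⊕ (lit 16 ⊗ (lit 20 ⊗ w ⊕ lit 38 ⊗ c) ⊕ lit 102 ⊗ (lit 17 ⊗ o) ⊕ lit 20 ⊗ (lit 100 ⊗ Λ))) refl
  late-step 4 {o} {c} {w} _ _ h g s = *-cancelˡ-≤ 38
    (lin (60 * Λ + 643 * o) (eq4′ o c w Λ) (+-mono-≤ (+-mono-≤ (*-monoʳ-≤ 20 h) (*-monoʳ-≤ 118 g)) (*-monoʳ-≤ 25 s)))
    where
    eq4′ : ∀ o c w Λ → 38 * (25 * c) + (20 * (100 * o + 122 * Λ) + 118 * (5 * w) + 25 * o) + (60 * Λ + 643 * o)
      ≡ 38 * (5 * (w + (c + o))) + (20 * (20 * w + 38 * c) + 118 * (21 * o) + 25 * (100 * Λ))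
    eq4′ = solveℕ 4 (λ o c w Λ → lit 38 ⊗ (lit 25 ⊗ c) ⊕ (lit 20 ⊗ (lit 100 ⊗ o ⊕ lit 122 ⊗ Λ) ⊕ lit 118 ⊗ (lit 5 ⊗ w) ⊕ lit 25 ⊗ o) ⊕ (lit 60 ⊗ Λ ⊕ lit 643 ⊗ o)
      ⊜ lit 38 ⊗ (lit 5 ⊗ (w ⊕ (c ⊕ o))) ⊕ (lit 20 ⊗ (lit 20 ⊗ w ⊕ lit 38 ⊗ c) ⊕ lit 118 ⊗ (lit 21 ⊗ o) ⊕ lit 25 ⊗ (lit 100 ⊗ Λ))) refl
  late-step (suc (suc (suc (suc (suc j))))) _ (s≤s (s≤s (s≤s (s≤s ())))) _ _ _

  -- Once w ≥ 5o, `stay-bound` leaves only 38c ≤ 122Λ. Hence the counter cannot pass five.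
  late-stop : ∀ {o c w} → 20 * w + 38 * c ≤ 100 * o + 122 * Λ → 25 * o ≤ 5 * w → 100 * Λ ≤ c → ⊥
  late-stop {o} {c} {w} h g k = <⇒≱ 1≤Λ (*-cancelˡ-≤ {Λ} {0} 3678 (lin 0 (eq o c w Λ) (+-mono-≤ (+-mono-≤ h (*-monoʳ-≤ 4 g)) (*-monoʳ-≤ 38 k))))
    where
    eq : ∀ o c w Λ → 3678 * Λ + (100 * o + 122 * Λ + 4 * (5 * w) + 38 * c) + 0 ≡ 3678 * 0 + (20 * w + 38 * c + 4 * (25 * o) + 38 * (100 * Λ))
    eq = solveℕ 4 (λ o c w Λ → lit 3678 ⊗ Λ ⊕ (lit 100 ⊗ o ⊕ lit 122 ⊗ Λ ⊕ lit 4 ⊗ (lit 5 ⊗ w) ⊕ lit 38 ⊗ c) ⊕ lit 0 ⊜ lit 3678 ⊗ lit 0 ⊕ (lit 20 ⊗ w ⊕ lit 38 ⊗ c ⊕ lit 4 ⊗ (lit 25 ⊗ o) ⊕ lit 38 ⊗ (lit 100 ⊗ Λ))) refl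

  -- `Leave` is what remains of the claim after 20 times the qualities of both strands. The way back
  -- out of `A` costs the optimum `a`, hence `4a`; against it stand the walk `w` and the repeated
  -- way `c` along `B`. The terms `m * c` and `m * Λ` pay for the loss from 20 to 19.
  leave-quality : ∀ {kA XA a kB XB c x d w} → 4 * (n * kA) ≤ n * XA + (n + m) * a →
    4 * (n * kB) ≤ n * (XB + x) + (n + m) * (c + d) → d ≤ Λ → Leave a c w →
    4 * (20 * n * (kA + a + kB)) ≤ 20 * n * (XA + XB + w + (a + (c + x))) + (20 * n + 19 * m) * (c + d)
  leave-quality {kA} {XA} {a} {kB} {XB} {c} {x} {d} {w} qA qB d≤Λ l =
    lin 0 (eq n m kA XA a kB XB c x d w Λ) (+-mono-≤ (+-mono-≤ (+-mono-≤ (*-monoʳ-≤ 20 qA) (*-monoʳ-≤ 20 qB)) l) (*-monoʳ-≤ m d≤Λ))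
    where
    eq : ∀ n m kA XA a kB XB c x d w Λ → 4 * (20 * n * (kA + a + kB)) +
      (20 * (n * XA + (n + m) * a) + 20 * (n * (XB + x) + (n + m) * (c + d)) + (20 * (n * w) + 20 * (n * c)) + m * Λ) + 0
      ≡ 20 * n * (XA + XB + w + (a + (c + x))) + (20 * n + 19 * m) * (c + d) +
      (20 * (4 * (n * kA)) + 20 * (4 * (n * kB)) + (80 * (n * a) + 20 * (m * a) + m * c + m * Λ) + m * d)
    eq = solveℕ 12 (λ n m kA XA a kB XB c x d w Λ → lit 4 ⊗ (lit 20 ⊗ n ⊗ (kA ⊕ a ⊕ kB)) ⊕
      (lit 20 ⊗ (n ⊗ XA ⊕ (n ⊕ m) ⊗ a) ⊕ lit 20 ⊗ (n ⊗ (XB ⊕ x) ⊕ (n ⊕ m) ⊗ (c ⊕ d)) ⊕ (lit 20 ⊗ (n ⊗ w) ⊕ lit 20 ⊗ (n ⊗ c)) ⊕ m ⊗ Λ) ⊕ lit 0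
      ⊜ lit 20 ⊗ n ⊗ (XA ⊕ XB ⊕ w ⊕ (a ⊕ (c ⊕ x))) ⊕ (lit 20 ⊗ n ⊕ lit 19 ⊗ m) ⊗ (c ⊕ d) ⊕
      (lit 20 ⊗ (lit 4 ⊗ (n ⊗ kA)) ⊕ lit 20 ⊗ (lit 4 ⊗ (n ⊗ kB)) ⊕ (lit 80 ⊗ (n ⊗ a) ⊕ lit 20 ⊗ (m ⊗ a) ⊕ m ⊗ c ⊕ m ⊗ Λ) ⊕ m ⊗ d)) refl

  -- What the qualities of the strands leave open when `A` is a dead end and the exit is a tied
  -- heavy end. Of the `4W` charged for the optimum, one `W` is paid by the agent and one is part of
  -- the distance to the exit, which leaves `40 * (n * W)` and the gain `19 * (m * W)`.
  Return : ℕ → ℕ → ℕ → ℕ → Set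
  Return a c W w = 80 * (n * a) + 40 * (n * W) + 20 * (m * a) + m * c ≤ 20 * (n * w) + 20 * (n * c) + 19 * (m * W)

  return-quality : ∀ {kA XA a kB XB c W w} → 4 * (n * kA) ≤ n * XA + (n + m) * a →
    4 * (n * kB) ≤ n * XB + (n + m) * c → Return a c W w →
    4 * (20 * n * (kA + a + (kB + (W + 0)))) ≤ 20 * n * (XA + XB + w + (a + (c + W))) + (20 * n + 19 * m) * (W + c)
  return-quality {kA} {XA} {a} {kB} {XB} {c} {W} {w} qA qB r =
    lin 0 (eq n m kA XA a kB XB c W w) (+-mono-≤ (+-mono-≤ (*-monoʳ-≤ 20 qA) (*-monoʳ-≤ 20 qB)) r)
    where
    eq : ∀ n m kA XA a kB XB c W w → 4 * (20 * n * (kA + a + (kB + (W + 0)))) +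
      (20 * (n * XA + (n + m) * a) + 20 * (n * XB + (n + m) * c) + (20 * (n * w) + 20 * (n * c) + 19 * (m * W))) + 0
      ≡ 20 * n * (XA + XB + w + (a + (c + W))) + (20 * n + 19 * m) * (W + c) +
      (20 * (4 * (n * kA)) + 20 * (4 * (n * kB)) + (80 * (n * a) + 40 * (n * W) + 20 * (m * a) + m * c))
    eq = solveℕ 10 (λ n m kA XA a kB XB c W w → lit 4 ⊗ (lit 20 ⊗ n ⊗ (kA ⊕ a ⊕ (kB ⊕ (W ⊕ lit 0)))) ⊕
      (lit 20 ⊗ (n ⊗ XA ⊕ (n ⊕ m) ⊗ a) ⊕ lit 20 ⊗ (n ⊗ XB ⊕ (n ⊕ m) ⊗ c) ⊕ (lit 20 ⊗ (n ⊗ w) ⊕ lit 20 ⊗ (n ⊗ c) ⊕ lit 19 ⊗ (m ⊗ W))) ⊕ lit 0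
      ⊜ lit 20 ⊗ n ⊗ (XA ⊕ XB ⊕ w ⊕ (a ⊕ (c ⊕ W))) ⊕ (lit 20 ⊗ n ⊕ lit 19 ⊗ m) ⊗ (W ⊕ c) ⊕
      (lit 20 ⊗ (lit 4 ⊗ (n ⊗ kA)) ⊕ lit 20 ⊗ (lit 4 ⊗ (n ⊗ kB)) ⊕ (lit 80 ⊗ (n ⊗ a) ⊕ lit 40 ⊗ (n ⊗ W) ⊕ lit 20 ⊗ (m ⊗ a) ⊕ m ⊗ c))) refl

  -- In both uses the passage from 20m to 19m leaves a surplus of `18 * (m * c)`, since the heavy
  -- edge adds at least `c` to the distance of the exit. The remaining terms are multiples of
  -- `n * (o + Λ)` or `m * (o + Λ)`. As `m` and `n` are at least 1, they are bounded by multiples of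
  -- `m * n * (o + Λ)`; this is the origin of the factor `n`.
  Far : ℕ → ℕ → Set
  Far o c = 10 * (n * (o + Λ)) ≤ c

  private
    n≤mn : ∀ u → n * u ≤ m * (n * u)
    n≤mn u = ≤-trans (≤-reflexive (sym (*-identityˡ (n * u)))) (*-monoˡ-≤ (n * u) 1≤m)

    m≤mn : ∀ u → m * u ≤ m * (n * u)
    m≤mn u = *-monoʳ-≤ m (≤-trans (≤-reflexive (sym (*-identityˡ u))) (*-monoˡ-≤ u 1≤n))

  far-return : ∀ {o c w a} → Far o c → a ≤ o + Λ → Return a c (c + o) (w + (c + o))
  far-return {o} {c} {w} {a} h a≤u = lin (20 * (n * w) + 19 * (m * o) + 60 * (m * (n * (o + Λ)))) (eq n m o c w a (o + Λ))
    (+-mono-≤ (+-mono-≤ (+-mono-≤ (+-mono-≤ (+-mono-≤ (*-monoʳ-≤ 80 (*-monoʳ-≤ n a≤u)) (*-monoʳ-≤ 20 (*-monoʳ-≤ m a≤u)))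
      (*-monoʳ-≤ 20 (*-monoʳ-≤ n (m≤m+n o Λ)))) (*-monoʳ-≤ 100 (n≤mn (o + Λ)))) (*-monoʳ-≤ 20 (m≤mn (o + Λ)))) (*-monoʳ-≤ 18 (*-monoʳ-≤ m h)))
    where
    eq : ∀ n m o c w a u → 80 * (n * a) + 40 * (n * (c + o)) + 20 * (m * a) + m * c +
      (80 * (n * u) + 20 * (m * u) + 20 * (n * u) + 100 * (m * (n * u)) + 20 * (m * (n * u)) + 18 * (m * c)) +
      (20 * (n * w) + 19 * (m * o) + 60 * (m * (n * u)))
      ≡ 20 * (n * (w + (c + o))) + 20 * (n * c) + 19 * (m * (c + o)) +
      (80 * (n * a) + 20 * (m * a) + 20 * (n * o) + 100 * (n * u) + 20 * (m * u) + 18 * (m * (10 * (n * u))))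
    eq = solveℕ 7 (λ n m o c w a u → lit 80 ⊗ (n ⊗ a) ⊕ lit 40 ⊗ (n ⊗ (c ⊕ o)) ⊕ lit 20 ⊗ (m ⊗ a) ⊕ m ⊗ c ⊕
      (lit 80 ⊗ (n ⊗ u) ⊕ lit 20 ⊗ (m ⊗ u) ⊕ lit 20 ⊗ (n ⊗ u) ⊕ lit 100 ⊗ (m ⊗ (n ⊗ u)) ⊕ lit 20 ⊗ (m ⊗ (n ⊗ u)) ⊕ lit 18 ⊗ (m ⊗ c)) ⊕
      (lit 20 ⊗ (n ⊗ w) ⊕ lit 19 ⊗ (m ⊗ o) ⊕ lit 60 ⊗ (m ⊗ (n ⊗ u)))
      ⊜ lit 20 ⊗ (n ⊗ (w ⊕ (c ⊕ o))) ⊕ lit 20 ⊗ (n ⊗ c) ⊕ lit 19 ⊗ (m ⊗ (c ⊕ o)) ⊕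
      (lit 80 ⊗ (n ⊗ a) ⊕ lit 20 ⊗ (m ⊗ a) ⊕ lit 20 ⊗ (n ⊗ o) ⊕ lit 100 ⊗ (n ⊗ u) ⊕ lit 20 ⊗ (m ⊗ u) ⊕ lit 18 ⊗ (m ⊗ (lit 10 ⊗ (n ⊗ u))))) refl

  -- With W = c + o the agent pays for three traversals of heavy edges, and the fourth W comes from
  -- the distance W + c of the exit. The optimum uses one heavy edge, as the other end is reached
  -- through `A`.
  cross-quality : ∀ {kA XA o kB XB c w s t} → 4 * (n * kA) ≤ n * XA + (n + m) * o →
    4 * (n * kB) ≤ n * XB + (n + m) * c → Far o c → s ≤ Λ → t ≤ Λ →
    4 * (20 * n * (kA + s + (o + t) + (kB + (c + o)))) ≤
      20 * n * (XA + XB + w + (c + o) + ((c + o) + (c + o))) + (20 * n + 19 * m) * ((c + o) + c)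
  cross-quality {kA} {XA} {o} {kB} {XB} {c} {w} {s} {t} qA qB h s≤Λ t≤Λ =
    lin (20 * (n * w) + 60 * (n * o) + m * Λ + 19 * (m * (n * (o + Λ)))) (eq n m kA XA o kB XB c w s t Λ)
    (+-mono-≤ (+-mono-≤ (+-mono-≤ (+-mono-≤ (+-mono-≤ (+-mono-≤ (*-monoʳ-≤ 20 qA) (*-monoʳ-≤ 20 qB))
      (*-monoʳ-≤ 80 (*-monoʳ-≤ n s≤Λ))) (*-monoʳ-≤ 80 (*-monoʳ-≤ n t≤Λ))) (*-monoʳ-≤ 160 (n≤mn (o + Λ)))) (m≤mn (o + Λ)))
      (*-monoʳ-≤ 18 (*-monoʳ-≤ m h)))
    where
    eq : ∀ n m kA XA o kB XB c w s t Λ → 4 * (20 * n * (kA + s + (o + t) + (kB + (c + o)))) +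
      (20 * (n * XA + (n + m) * o) + 20 * (n * XB + (n + m) * c) + 80 * (n * Λ) + 80 * (n * Λ) +
        160 * (m * (n * (o + Λ))) + m * (n * (o + Λ)) + 18 * (m * c)) +
      (20 * (n * w) + 60 * (n * o) + m * Λ + 19 * (m * (n * (o + Λ))))
      ≡ 20 * n * (XA + XB + w + (c + o) + ((c + o) + (c + o))) + (20 * n + 19 * m) * ((c + o) + c) +
      (20 * (4 * (n * kA)) + 20 * (4 * (n * kB)) + 80 * (n * s) + 80 * (n * t) + 160 * (n * (o + Λ)) + m * (o + Λ) +
        18 * (m * (10 * (n * (o + Λ)))))
    eq = solveℕ 12 (λ n m kA XA o kB XB c w s t Λ → lit 4 ⊗ (lit 20 ⊗ n ⊗ (kA ⊕ s ⊕ (o ⊕ t) ⊕ (kB ⊕ (c ⊕ o)))) ⊕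
      (lit 20 ⊗ (n ⊗ XA ⊕ (n ⊕ m) ⊗ o) ⊕ lit 20 ⊗ (n ⊗ XB ⊕ (n ⊕ m) ⊗ c) ⊕ lit 80 ⊗ (n ⊗ Λ) ⊕ lit 80 ⊗ (n ⊗ Λ) ⊕
        lit 160 ⊗ (m ⊗ (n ⊗ (o ⊕ Λ))) ⊕ m ⊗ (n ⊗ (o ⊕ Λ)) ⊕ lit 18 ⊗ (m ⊗ c)) ⊕
      (lit 20 ⊗ (n ⊗ w) ⊕ lit 60 ⊗ (n ⊗ o) ⊕ m ⊗ Λ ⊕ lit 19 ⊗ (m ⊗ (n ⊗ (o ⊕ Λ))))
      ⊜ lit 20 ⊗ n ⊗ (XA ⊕ XB ⊕ w ⊕ (c ⊕ o) ⊕ ((c ⊕ o) ⊕ (c ⊕ o))) ⊕ (lit 20 ⊗ n ⊕ lit 19 ⊗ m) ⊗ ((c ⊕ o) ⊕ c) ⊕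
      (lit 20 ⊗ (lit 4 ⊗ (n ⊗ kA)) ⊕ lit 20 ⊗ (lit 4 ⊗ (n ⊗ kB)) ⊕ lit 80 ⊗ (n ⊗ s) ⊕ lit 80 ⊗ (n ⊗ t) ⊕ lit 160 ⊗ (n ⊗ (o ⊕ Λ)) ⊕ m ⊗ (o ⊕ Λ) ⊕
        lit 18 ⊗ (m ⊗ (lit 10 ⊗ (n ⊗ (o ⊕ Λ)))))) refl

-- Arms: chains whose final block is open (a state) or closed (a completed block)

module Arms (P : Proc) where
  open Proc P
  open Core core
  open Chain core

  -- Two continuations are offered when the final block is completed, because only then is it
  -- decided which one is used: the chain may end at `x`, or a fresh block may start there. The cost
  -- of the block is given relative to the root of the chain and to the entry of the block.
  data ArmStep (ds : List D) (s : St) (x : C) : Set where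
    next : (s′ : St) → Grow (chain ds (sh s)) (chain ds (sh s′)) (pdC (pd s) ds) →
           Pend (chain ds (sh s)) (pdC (pd s) ds) (pdC (pd s′) ds) x →
           up (Φ s′) ds x ≤ up (Φ s) ds x → down (Φ s′) ds x ≤ down (Φ s) ds x →
           rank s′ < rank s → ArmStep ds s x
    full : (δ : D) → Grow (chain ds (sh s)) (chain ds (Done.shape δ)) (pdC (pd s) ds) →
           Grow (chain ds (sh s)) (chain (ds ∷ʳ δ) (sh start)) (pdC (pd s) ds) →
           last (chain ds (Done.shape δ)) ≡ x →
           len ds + Done.X δ ≤ up (Φ s) ds x → Done.X δ ≤ down (Φ s) ds x → ArmStep ds s x

  armStep : ∀ ds s x → T (pdC (pd s) ds x) → ArmStep ds s x
  armStep ds s (i , v) t with refl , tv ← pdC-tip (pd s) ds t with step s v tv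
  ... | next s′ g pend le rk = next s′ (grow-chain g ds) pend′
    (subst₂ _≤_ (sym (up-tip (Φ s′) ds v)) (sym (up-tip (Φ s) ds v)) (+-monoʳ-≤ (len ds) le))
    (subst₂ _≤_ (sym (down-tip (Φ s′) ds v)) (sym (down-tip (Φ s) ds v)) le) rk
    where
    pend′ : Pend (chain ds (sh s)) (pdC (pd s) ds) (pdC (pd s′) ds) (length ds , v)
    pend′ {i , u} t′ with refl , tu ← pdC-tip (pd s′) ds t′ with pend tu
    ... | inj₁ (p , u≢v) = inj₁ (tip-pdC (pd s) ds p , u≢v ∘ cong proj₂)
    ... | inj₂ p = inj₂ (p ∘ in-tip ds)
  ... | done δ g refl le = full δ (grow-chain g ds) (grow-extend {δ = δ} g tv ds) (last-chain ds (Done.shape δ))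
    (≤-trans (+-monoʳ-≤ (len ds) le) (≤-reflexive (sym (up-tip (Φ s) ds v))))
    (≤-trans le (≤-reflexive (sym (down-tip (Φ s) ds v))))

  module Closed (ds : List D) (δ : D) where
    S : Shape C croot
    S = chain ds (Done.shape δ)

    length′ cost′ ccs′ : ℕ
    length′ = len ds + Done.rr δ
    cost′ = cost ds + Done.X δ
    ccs′ = ccs ds + Done.cc δ

    in-up in-down : C → ℕ
    in-up = up (Done.h δ) ds
    in-down = down (λ v → Done.rr δ ∸ Done.h δ v) ds

    lip-up : Lips in-up (edges S)
    lip-up = up-lip (Done.h-lip δ) ds

    lip-down : Lips in-down (edges S)
    lip-down = down-lip (λ {e} p → lip-∸ {p = Done.h δ} (Done.rr δ) {e} (Done.h-lip δ p)) ds

    up-at-root : in-up croot ≡ 0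
    up-at-root = trans (up-root _ ds) (Done.h-root δ)

    up-at-last : in-up (last S) ≡ length′
    up-at-last = trans (cong in-up (last-chain ds _)) (trans (up-tip _ ds _) (cong (len ds +_) (Done.h-last δ)))

    down-at-root : in-down croot ≡ length′
    down-at-root = trans (down-root _ ds) (cong (λ k → len ds + (Done.rr δ ∸ k)) (Done.h-root δ))

    down-at-last : in-down (last S) ≡ 0
    down-at-last = trans (cong in-down (last-chain ds _)) (trans (down-tip _ ds _)
      (trans (cong (Done.rr δ ∸_) (Done.h-last δ)) (n∸n≡0 (Done.rr δ))))

    cover′ : Tour (edges S) croot (last S) ccs′ (In S)
    cover′ = chain-cover (Done.cover δ) ds

    return′ : Tour (edges S) (last S) croot length′ (λ _ → ⊥)
    return′ = chain-return (Done.return δ) ds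

    quality′ : 4 * (n * ccs′) ≤ n * cost′ + (n + m) * length′
    quality′ = subst₂ _≤_ (eq₁ n (ccs ds) (Done.cc δ)) (eq₂ n m (cost ds) (Done.X δ) (len ds) (Done.rr δ))
      (+-mono-≤ (chain-quality ds) (Done.quality δ))
      where
      eq₁ : ∀ n a b → 4 * (n * a) + 4 * (n * b) ≡ 4 * (n * (a + b))
      eq₁ = solveℕ 3 (λ n a b → lit 4 ⊗ (n ⊗ a) ⊕ lit 4 ⊗ (n ⊗ b) ⊜ lit 4 ⊗ (n ⊗ (a ⊕ b))) refl
      eq₂ : ∀ n m a b c d → n * a + (n + m) * c + (n * b + (n + m) * d) ≡ n * (a + b) + (n + m) * (c + d)
      eq₂ = solveℕ 6 (λ n m a b c d → n ⊗ a ⊕ (n ⊕ m) ⊗ c ⊕ (n ⊗ b ⊕ (n ⊕ m) ⊗ d) ⊜ n ⊗ (a ⊕ b) ⊕ (n ⊕ m) ⊗ (c ⊕ d)) refl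

    ccs≤ : ccs′ ≤ Λ * length′
    ccs≤ = ≤-trans (+-mono-≤ (ccs≤len ds) (≤-trans (Done.cc≤Λ δ)
      (≤-trans (≤-reflexive (sym (*-identityʳ Λ))) (*-monoʳ-≤ Λ (Done.1≤rr δ)))))
      (≤-reflexive (sym (*-distribˡ-+ Λ (len ds) (Done.rr δ))))

    length≤ccs : length′ ≤ ccs′
    length≤ccs = +-mono-≤ (len≤ccs ds) (Done.rr≤cc δ)

    rr≤Λ′ : Done.rr δ ≤ Λ
    rr≤Λ′ = ≤-trans (Done.rr≤cc δ) (Done.cc≤Λ δ)

    length≤ : length′ ≤ len ds + Λ
    length≤ = +-monoʳ-≤ (len ds) rr≤Λ′

    -- From the exit of the completed block a joint of weight 0 leads to the fresh block, which
    -- starts with potential 0.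
    ext-down : down (Φ start) (ds ∷ʳ δ) (last S) ≡ 0
    ext-down = trans (cong (down (Φ start) (ds ∷ʳ δ)) (last-chain ds _)) (at ds)
      where
      at : ∀ ds → down (Φ start) (ds ∷ʳ δ) (length ds , last (Done.shape δ)) ≡ 0
      at [] = cong₂ _+_ (trans (cong (Done.rr δ ∸_) (Done.h-last δ)) (n∸n≡0 (Done.rr δ))) Φ-start
      at (ε ∷ ds) = at ds

  O : Set
  O = List D × St

  K : Set
  K = List D × D

  oC : O → Shape C croot
  oC (ds , s) = chain ds (sh s)

  kC : K → Shape C croot
  kC (ds , δ) = Closed.S ds δ

  lenO costO ccO rrO rankO : O → ℕ
  lenO (ds , s) = len ds
  costO (ds , s) = cost ds
  ccO (ds , s) = ccs ds + cc s
  rrO (ds , s) = len ds + rr s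
  rankO (ds , s) = rank s

  lenK costK ccK : K → ℕ
  lenK (ds , δ) = Closed.length′ ds δ
  costK (ds , δ) = Closed.cost′ ds δ
  ccK (ds , δ) = Closed.ccs′ ds δ

  -- `uO` and `dO` include the cost spent in the open final block. `u₀` and `d₀` treat this block as
  -- a single point, for use when nothing more is charged inside it.
  uO dO u₀ d₀ : O → C → ℕ
  uO (ds , s) = up (Φ s) ds
  dO (ds , s) = down (Φ s) ds
  u₀ (ds , s) = up (λ _ → 0) ds
  d₀ (ds , s) = down (λ _ → 0) ds

  uK dK : K → C → ℕ
  uK (ds , δ) = Closed.in-up ds δ
  dK (ds , δ) = Closed.in-down ds δ

  oPd : O → C → Bool
  oPd (ds , s) = pdC (pd s) ds

  extend : K → O
  extend (ds , δ) = ds ∷ʳ δ , start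

  fresh : O
  fresh = [] , start

  lenO-extend : ∀ B → lenO (extend B) ≡ lenK B
  lenO-extend (ds , δ) = len-snoc ds δ

  costO-extend : ∀ B → costO (extend B) ≡ costK B
  costO-extend (ds , δ) = cost-snoc ds δ

  oPd-last : ∀ A → T (oPd A (last (oC A)))
  oPd-last (ds , s) = subst (λ x → T (pdC (pd s) ds x)) (sym (last-chain ds (sh s))) (tip-pdC (pd s) ds (pd-last s))

  oPd⊆ : ∀ A {x} → T (oPd A x) → In (oC A) x
  oPd⊆ (ds , s) {i , v} t with refl , tv ← pdC-tip (pd s) ds t = tip-in ds (pd⊆ {s} tv)

  uO-lip : ∀ A → Lips (uO A) (edges (oC A))
  uO-lip (ds , s) = up-lip (Φ-lip s) ds

  dO-lip : ∀ A → Lips (dO A) (edges (oC A))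
  dO-lip (ds , s) = down-lip (Φ-lip s) ds

  u₀-lip : ∀ A → Lips (u₀ A) (edges (oC A))
  u₀-lip (ds , s) = up-lip (lip-const 0) ds

  d₀-lip : ∀ A → Lips (d₀ A) (edges (oC A))
  d₀-lip (ds , s) = down-lip (lip-const 0) ds

  oCover : ∀ A → Tour (edges (oC A)) croot (last (oC A)) (ccO A) (In (oC A))
  oCover (ds , s) = chain-cover (cover s) ds

  oReturn : ∀ A → Tour (edges (oC A)) (last (oC A)) croot (rrO A) (λ _ → ⊥)
  oReturn (ds , s) = chain-return (return s) ds

  ccO≤ : ∀ A → ccO A ≤ Λ * lenO A + Λ
  ccO≤ (ds , s) = +-mono-≤ (ccs≤len ds) (cc≤Λ s)

  rrO≤ : ∀ A → rrO A ≤ lenO A + Λ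
  rrO≤ (ds , s) = +-monoʳ-≤ (len ds) (rr≤Λ s)

  u₀-root : ∀ A → u₀ A croot ≡ 0
  u₀-root (ds , s) = up-root _ ds

  u₀-last : ∀ A → u₀ A (last (oC A)) ≡ lenO A
  u₀-last (ds , s) = trans (cong (up _ ds) (last-chain ds _)) (trans (up-tip _ ds _) (+-identityʳ _))

  d₀-root : ∀ A → d₀ A croot ≡ lenO A
  d₀-root (ds , s) = trans (down-root _ ds) (+-identityʳ _)

  d₀-last : ∀ A → d₀ A (last (oC A)) ≡ 0
  d₀-last (ds , s) = trans (cong (down _ ds) (last-chain ds _)) (down-tip _ ds _)

  len≤dO-root : ∀ A → dO A croot ≡ lenO A + uO A croot
  len≤dO-root (ds , s) = trans (down-root _ ds) (cong (len ds +_) (sym (up-root _ ds)))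

-- From blocks of one level to blocks of the next level

sameBool : Bool → Bool → Bool
sameBool true b = b
sameBool false b = not b

sameBool-refl : ∀ z → T (sameBool z z)
sameBool-refl true = tt
sameBool-refl false = tt

sameBool-sound : ∀ z {b} → T (sameBool z b) → b ≢ not z
sameBool-sound true {true} _ ()
sameBool-sound false {false} _ ()

module _ {X : Set} where

  -- The walk so far ended at the end of the strand measured by p or q; the
  -- potentials of the two strands add up.
  pairΦ : X → Bool → ℕ → (p q : X → ℕ) → Fork X → ℕ
  pairΦ ρ f κ p q = forkMap (κ + (p ρ + q ρ)) f (λ x → κ + (p x + q ρ)) (λ x → κ + (p ρ + q x))

  module _ (ρ : X) (f : Bool) (κ : ℕ) (p q : X → ℕ) where

    pairΦ-at : ∀ x → pairΦ ρ f κ p q (arm f x) ≡ κ + (p x + q ρ)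
    pairΦ-at = side-at f _ _

    pairΦ-off : ∀ x → pairΦ ρ f κ p q (arm (not f) x) ≡ κ + (p ρ + q x)
    pairΦ-off = side-off f _ _

    pairΦ-flip : ∀ x → pairΦ ρ (not f) κ p q (arm f x) ≡ κ + (p ρ + q x)
    pairΦ-flip = side-flip f _ _

    pairΦ-lip : ∀ {A B : Shape X ρ} → Lips p (edges A) → Lips q (edges B) → Lips (pairΦ ρ f κ p q) (forkEdges f A B nothing)
    pairΦ-lip {A} {B} lp lq = fork-lip f A B nothing
      (λ {e} m → lip-shift {p = λ x → p x + q ρ} κ {e} (lip-shiftʳ {p = p} (q ρ) {e} (lp m)))
      (λ {e} m → lip-shift {p = λ x → p ρ + q x} κ {e} (lip-shift {p = q} (p ρ) {e} (lq m)))
      refl refl (λ _ ())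

module Lift (P : Proc) where
  open Proc P
  open Core core
  open Chain core
  open Arms P
  open Strand {C} {croot}
  open Arith n m Λ 1≤n 1≤m m≤2n 1≤Λ

  ρ : X
  ρ = inj₁ croot

  UO DO U₀ D₀ : O → X → ℕ
  UO A = [ uO A , (λ _ → 0) ]′
  DO A = [ dO A , (λ _ → 0) ]′
  U₀ A = [ u₀ A , (λ _ → 0) ]′
  D₀ A = [ d₀ A , (λ _ → 0) ]′

  UK DK : K → X → ℕ
  UK A = [ uK A , (λ _ → 0) ]′
  DK A = [ dK A , (λ _ → 0) ]′

  oS : O → Shape X ρ
  oS A = plain (oC A)

  kS : K → Shape X ρ
  kS A = plain (kC A)

  abstract

    -- After j turns the shorter side has length at most Bd j and the longer one at most Bd (suc j).
    Bd : ℕ → ℕ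
    Bd zero = 400 * Λ
    Bd (suc j) = 10 * (n * (Bd j + Λ)) + Λ

    Bd-zero : Bd 0 ≡ 400 * Λ
    Bd-zero = refl

    Bd-near : ∀ {j o} → o ≤ Bd j → 10 * (n * (o + Λ)) ≤ Bd (suc j)
    Bd-near o≤ = ≤-trans (*-monoʳ-≤ 10 (*-monoʳ-≤ n (+-monoˡ-≤ Λ o≤))) (m≤m+n _ Λ)

    Bd-step : ∀ j → Bd j + Λ ≤ Bd (suc j)
    Bd-step j = ≤-trans (n*≥ (Bd j + Λ)) (m≤m+n _ Λ)
      where
      n*≥ : ∀ k → k ≤ 10 * (n * k)
      n*≥ k = ≤-trans (≤-reflexive (sym (*-identityˡ k))) (≤-trans (*-monoˡ-≤ k 1≤n) (m≤m+n (n * k) _))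

    Bd-mono : ∀ {i j} → i ≤ j → Bd i ≤ Bd j
    Bd-mono {zero} {zero} _ = ≤-refl
    Bd-mono {zero} {suc j} _ = ≤-trans (Bd-mono {zero} {j} z≤n) (≤-trans (m≤m+n _ Λ) (Bd-step j))
    Bd-mono {suc i} {suc j} (s≤s le) = +-monoˡ-≤ Λ (*-monoʳ-≤ 10 (*-monoʳ-≤ n (+-monoˡ-≤ Λ (Bd-mono le))))

    -- The bound must not depend on the algorithm, because the constant `Λ` of the next level has to
    -- be fixed in advance.
    Size : ℕ
    Size = Bd 6 + Bd 6 + Λ

    within : ∀ {o c} → o ≤ Bd 6 → c ≤ Bd 6 → o + c + Λ ≤ Size
    within o≤ c≤ = +-monoˡ-≤ Λ (+-mono-≤ o≤ c≤)

  -- The turn counter j measures how much walking has been wasted: w ≥ (1 + 4j/5) o.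
  record Inv (o c w : ℕ) : Set where
    field
      j     : ℕ
      j≤5   : j ≤ 5
      o≤    : o ≤ Bd j
      c≤    : c ≤ Bd (suc j)
      phase : (j ≡ 0 × o ≤ w) ⊎ (1 ≤ j × 100 * Λ ≤ o × 100 * Λ ≤ c × (5 + 4 * j) * o ≤ 5 * w)

    size : o + c + Λ ≤ Size
    size = within (≤-trans o≤ (Bd-mono (m≤n⇒m≤1+n j≤5))) (≤-trans c≤ (Bd-mono (s≤s j≤5)))

  inv-start : Inv 0 0 0
  inv-start = record { j = 0 ; j≤5 = z≤n ; o≤ = z≤n ; c≤ = z≤n ; phase = inj₁ (refl , z≤n) }

  inv-advance : ∀ {o c w d} → d ≤ Λ → ¬ Far o (c + d) → Inv o c w → Inv o (c + d) w
  inv-advance {o} {c} {w} {d} d≤Λ near I = record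
    { j = j ; j≤5 = j≤5 ; o≤ = o≤
    ; c≤ = ≤-trans (<⇒≤ (≰⇒> near)) (Bd-near o≤)
    ; phase = [ inj₁ , (λ { (a , b , k , e) → inj₂ (a , b , ≤-trans k (m≤m+n c d) , e) }) ]′ phase }
    where open Inv I

  private
    m≤w+m+o : ∀ w c o → c ≤ w + (c + o)
    m≤w+m+o w c o = ≤-trans (m≤m+n c o) (m≤n+m (c + o) w)

  -- The strands exchange roles: `c` becomes the length of the strand left behind and `o + d` that
  -- of the current one. While the counter is 0, a turn with `c ≤ 400Λ` leaves it at 0; such turns
  -- come to an end because each of them lengthens a strand.
  inv-turn : ∀ {o c w d} → d ≤ Λ → Inv o c w →
    Leave (o + d) c (w + (c + o)) ⊎ Inv c (o + d) (w + (c + o))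
  inv-turn {o} {c} {w} {d} d≤Λ I = decide (leave? (o + d) c (w + (c + o)))
    where
    open Inv I
    new≤ : o + d ≤ Bd (suc j)
    new≤ = ≤-trans (+-mono-≤ o≤ d≤Λ) (Bd-step j)
    new≤′ : o + d ≤ Bd (suc (suc j))
    new≤′ = ≤-trans new≤ (≤-trans (m≤m+n _ Λ) (Bd-step (suc j)))
    400Λ : 100 * Λ ≤ 400 * Λ
    400Λ = *-monoˡ-≤ Λ (m≤m+n 100 300)
    early : 20 * w + 38 * c ≤ 100 * o + 122 * Λ → j ≡ 0 → o ≤ w → Dec (c ≤ 400 * Λ) → Inv c (o + d) (w + (c + o))
    early h refl o≤w (yes c≤K) = record
      { j = 0 ; j≤5 = z≤n ; o≤ = ≤-trans c≤K (≤-reflexive (sym Bd-zero)) ; c≤ = new≤ ; phase = inj₁ (refl , m≤w+m+o w c o) }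
    early h refl o≤w (no c≰K) = record
      { j = 1 ; j≤5 = s≤s z≤n ; o≤ = c≤ ; c≤ = new≤′
      ; phase = inj₂ (≤-refl , ≤-trans 400Λ (<⇒≤ (≰⇒> c≰K)) , ≤-trans (proj₁ ab) (m≤m+n o d) , proj₂ ab) }
      where ab = early-step {o} {c} {w} h o≤w (<⇒≤ (≰⇒> c≰K))
    late : 20 * w + 38 * c ≤ 100 * o + 122 * Λ → 1 ≤ j → 100 * Λ ≤ o → 100 * Λ ≤ c → (5 + 4 * j) * o ≤ 5 * w →
      Dec (j ≤ 4) → Inv c (o + d) (w + (c + o))
    late h 1≤j a b e (yes j≤4) = record
      { j = suc j ; j≤5 = s≤s j≤4 ; o≤ = c≤ ; c≤ = new≤′
      ; phase = inj₂ (s≤s z≤n , b , ≤-trans a (m≤m+n o d) , late-step j {o} {c} {w} 1≤j j≤4 h e a) }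
    late h 1≤j a b e (no j≰4) =
      ⊥-elim (late-stop {o} {c} {w} h (subst (λ i → (5 + 4 * i) * o ≤ 5 * w) (≤-antisym j≤5 (≰⇒> j≰4)) e) b)
    result : 20 * w + 38 * c ≤ 100 * o + 122 * Λ → (j ≡ 0 × o ≤ w) ⊎ (1 ≤ j × 100 * Λ ≤ o × 100 * Λ ≤ c × (5 + 4 * j) * o ≤ 5 * w) →
      Inv c (o + d) (w + (c + o))
    result h (inj₁ (j≡0 , o≤w)) = early h j≡0 o≤w (c ≤? 400 * Λ)
    result h (inj₂ (1≤j , a , b , e)) = late h 1≤j a b e (j ≤? 4)
    decide : Dec (Leave (o + d) c (w + (c + o))) → _ ⊎ Inv c (o + d) (w + (c + o))
    decide (yes leave) = inj₁ leave
    decide (no ¬leave) = inj₂ (result (stay-bound {o} {c} {w} {d} d≤Λ ¬leave) phase)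

  -- The Boolean f names the strand A; the agent has just been at the end of B.
  -- zigzag: both strands grow.  leaving: A ends in a dead end and the exit of the
  -- block will be on B.  waiting: B has been pursued so far that it is ended by two
  -- heavy edges.  ringing: the end of A was reached before a heavy end; whichever
  -- heavy end is reached first is the exit and is tied to the other one.  crossed: a
  -- heavy end was reached first and is tied to the end of A; the other one, z, is
  -- the exit.
  data LSt : Set where
    idle    : LSt
    zigzag  : (f : Bool) (A B : O) (w : ℕ) → Inv (lenO A) (lenO B) w → LSt
    leaving : (f : Bool) (A : K) (B : O) (w : ℕ) → Leave (lenK A) (lenO B) w → lenK A + lenO B ≤ Size → LSt
    waiting : (f : Bool) (A : O) (B : K) (w : ℕ) → Far (lenO A) (lenK B) → lenO A + lenK B ≤ Size → LSt
    ringing : (f : Bool) (A B : K) (W w : ℕ) → Return (lenK A) (lenK B) W w → lenK A + lenK B ≤ Size + Λ → W ≤ Size → LSt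
    crossed : (f : Bool) (A : O) (B : K) (w : ℕ) (z : Bool) → Far (lenO A) (lenK B) → lenO A + lenK B ≤ Size → LSt

  -- The distance between the ends of the two strands. With this weight, the way from the first
  -- heavy end to the other one has length 2W both over the two heavy edges and through the tie, the
  -- strand `A`, the hub and `B`.
  weight : O → K → ℕ
  weight A B = lenK B + lenO A

  openPd : O → X → Bool
  openPd A = [ oPd A , (λ _ → false) ]′

  noPd endsPd : X → Bool
  noPd _ = false
  endsPd = [ (λ _ → false) , (λ _ → true) ]′

  endPd : Bool → X → Bool
  endPd z = [ (λ _ → false) , sameBool z ]′

  idleShape : Shape (Fork X) hub
  idleShape = hubShape

  crossShape : Bool → O → K → Bool → Shape (Fork X) hub
  crossShape f A B z = fork f (oS A) (heavy (kC B) (weight A B) false z) (just (heavy-target (kC B) (weight A B) false z))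

  shL : LSt → Shape (Fork X) hub
  shL idle = idleShape
  shL (zigzag f A B _ _) = fork f (oS A) (oS B) nothing
  shL (leaving f A B _ _ _) = fork f (kS A) (oS B) nothing
  shL (waiting f A B _ _ _) = fork f (oS A) (heavy (kC B) (weight A B) false true) nothing
  shL (ringing f A B W _ _ _ _) = fork f (kS A) (heavy (kC B) W false true) nothing
  shL (crossed f A B _ z _ _) = crossShape f A B z

  pdL : LSt → Fork X → Bool
  pdL idle = hubPd
  pdL (zigzag f A B _ _) = forkPd f (openPd A) (openPd B)
  pdL (leaving f A B _ _ _) = forkPd f noPd (openPd B)
  pdL (waiting f A B _ _ _) = forkPd f (openPd A) endsPd
  pdL (ringing f A B W _ _ _ _) = forkPd f noPd endsPd
  pdL (crossed f A B _ z _ _) = forkPd f noPd (endPd z)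

  waitQ : K → ℕ → X → ℕ
  waitQ B W = [ dK B , (λ _ → W) ]′

  ringQ : K → ℕ → X → ℕ
  ringQ B W = [ uK B , (λ _ → lenK B + W) ]′

  -- Distances from the first heavy end. The end of the strand `B` is W away both along the heavy
  -- edge and through the tie and the hub, so on `B` it suffices to count from the hub, which is at
  -- `lenO A`.
  crossQ : O → K → Bool → X → ℕ
  crossQ A B z = [ (λ p → lenO A + uK B p) , (λ b → if sameBool z b then weight A B + weight A B else 0) ]′

  ΦL : LSt → Fork X → ℕ
  ΦL idle = λ _ → 0
  ΦL (zigzag f A B w _) = pairΦ ρ f (costO A + costO B + w) (UO A) (DO B)
  ΦL (leaving f A B w _ _) = pairΦ ρ f (costK A + costO B + w) (DK A) (UO B)
  ΦL (waiting f A B w _ _) = pairΦ ρ f (costO A + costK B + w) (UO A) (waitQ B (weight A B))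
  ΦL (ringing f A B W w _ _ _) = pairΦ ρ f (costK A + costK B + w) (DK A) (ringQ B W)
  ΦL (crossed f A B w z _ _) = forkMap (costO A + costK B + w + weight A B + lenO A) f
    (λ x → costO A + costK B + w + weight A B + D₀ A x) (λ x → costO A + costK B + w + weight A B + crossQ A B z x)

  ccL rrL : LSt → ℕ
  ccL idle = 0
  ccL (zigzag f A B _ _) = ccO A + rrO A + ccO B
  ccL (leaving f A B _ _ _) = ccK A + lenK A + ccO B
  ccL (waiting f A B _ _ _) = ccO A + rrO A + (ccK B + (weight A B + (weight A B + weight A B)))
  ccL (ringing f A B W _ _ _ _) = ccK A + lenK A + (ccK B + (W + (W + W)))
  ccL (crossed f A B _ z _ _) = ccO A + rrO A + (ccK B + weight A B)
  rrL idle = 0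
  rrL (zigzag f A B _ _) = rrO B
  rrL (leaving f A B _ _ _) = rrO B
  rrL (waiting f A B _ _ _) = weight A B + lenK B
  rrL (ringing f A B W _ _ _ _) = W + lenK B
  rrL (crossed f A B _ z _ _) = weight A B + lenK B

  R : ℕ
  R = rank start

  rankL : LSt → ℕ
  rankL idle = 4 + (R + R) + Size * suc R
  rankL (zigzag f A B _ _) = 3 + (rankO A + rankO B) + (Size ∸ (lenO A + lenO B)) * suc R
  rankL (leaving f A B _ _ _) = 1 + rankO B
  rankL (waiting f A B _ _ _) = 2 + rankO A
  rankL (ringing _ _ _ _ _ _ _ _) = 1
  rankL (crossed _ _ _ _ _ _ _) = 1

  ΛL : ℕ
  ΛL = Λ * (Size + Λ) + 3 * Λ + 4 * (Size + Λ)

  pd-lastL : ∀ s → T (pdL s (last (shL s)))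
  pd-lastL idle = tt
  pd-lastL (zigzag f A B _ _) = subst T (sym (side-off f (openPd A) (openPd B) _)) (oPd-last B)
  pd-lastL (leaving f A B _ _ _) = subst T (sym (side-off f noPd (openPd B) _)) (oPd-last B)
  pd-lastL (waiting f A B _ _ _) = subst T (sym (side-off f (openPd A) endsPd (inj₂ true))) tt
  pd-lastL (ringing f A B _ _ _ _ _) = subst T (sym (side-off f noPd endsPd (inj₂ true))) tt
  pd-lastL (crossed f A B _ z _ _) = subst T (sym (side-off f noPd (endPd z) (inj₂ z))) (sameBool-refl z)

  pd-arms : ∀ f {p q p′ q′ : X → Bool} → (∀ x → T (p x) → T (p′ x)) → (∀ x → T (q x) → T (q′ x)) →
    ∀ {v} → T (forkPd f p q v) → T (forkMap true f p′ q′ v)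
  pd-arms f a b {hub} ()
  pd-arms false a b {arm false x} t = a x t
  pd-arms false a b {arm true x} t = b x t
  pd-arms true a b {arm false x} t = b x t
  pd-arms true a b {arm true x} t = a x t

  open⊆ : ∀ A x → T (openPd A x) → In (oS A) x
  open⊆ A (inj₁ _) = oPd⊆ A

  ends⊆ : ∀ S W t z x → T (endsPd x) → In (heavy S W t z) x
  ends⊆ S W t z (inj₂ _) _ = tt

  end⊆ : ∀ S W t z x → T (endPd z x) → In (heavy S W t z) x
  end⊆ S W t z (inj₂ _) _ = tt

  pd⊆L : ∀ {s v} → T (pdL s v) → In (shL s) v
  pd⊆L {idle} {hub} _ = tt
  pd⊆L {zigzag f A B _ _} {v} = pd-arms f (open⊆ A) (open⊆ B) {v}
  pd⊆L {leaving f A B _ _ _} {v} = pd-arms f (λ _ ()) (open⊆ B) {v}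
  pd⊆L {waiting f A B _ _ _} {v} = pd-arms f (open⊆ A) (ends⊆ (kC B) (weight A B) false true) {v}
  pd⊆L {ringing f A B W _ _ _ _} {v} = pd-arms f (λ _ ()) (ends⊆ (kC B) W false true) {v}
  pd⊆L {crossed f A B _ z _ _} {v} = pd-arms f (λ _ ()) (end⊆ (kC B) (weight A B) false z) {v}

-- The block of the next level: potentials, tours and size bounds

module LiftCore (P : Proc) where
  open Proc P
  open Core core
  open Chain core
  open Arms P
  open Strand {C} {croot}
  open Arith n m Λ 1≤n 1≤m m≤2n 1≤Λ
  open Lift P

  UO-lip : ∀ A → Lips (UO A) (edges (oS A))
  UO-lip A = plain-lip {oC A} {p = uO A} {y = λ _ → 0} (uO-lip A)

  DO-lip : ∀ A → Lips (DO A) (edges (oS A))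
  DO-lip A = plain-lip {oC A} {p = dO A} {y = λ _ → 0} (dO-lip A)

  UK-lip : ∀ A → Lips (UK A) (edges (kS A))
  UK-lip A@(ds , δ) = plain-lip {kC A} {p = uK A} {y = λ _ → 0} (Closed.lip-up ds δ)

  DK-lip : ∀ A → Lips (DK A) (edges (kS A))
  DK-lip A@(ds , δ) = plain-lip {kC A} {p = dK A} {y = λ _ → 0} (Closed.lip-down ds δ)

  D₀-lip : ∀ A → Lips (D₀ A) (edges (oS A))
  D₀-lip A = plain-lip {oC A} {p = d₀ A} {y = λ _ → 0} (d₀-lip A)

  U₀-lip : ∀ A → Lips (U₀ A) (edges (oS A))
  U₀-lip A = plain-lip {oC A} {p = u₀ A} {y = λ _ → 0} (u₀-lip A)

  waitQ-lip : ∀ B W {t z} → Lips (waitQ B W) (heavyEdges (kC B) W t z)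
  waitQ-lip B@(ds , δ) W {t} {z} = heavy-lip (kC B) W t z (Closed.lip-down ds δ)
    (λ b → ≤-trans (≤-reflexive (Closed.down-at-last ds δ)) z≤n ,
      ≤-reflexive (cong (_+ W) (sym (Closed.down-at-last ds δ)))) (λ _ → refl)

  -- y is the common value of the potential uK B at the two heavy ends
  riseQ-lip : ∀ B W y {t z} → y ≡ lenK B + W → Lips [ uK B , (λ _ → y) ]′ (heavyEdges (kC B) W t z)
  riseQ-lip B@(ds , δ) W _ {t} {z} refl = heavy-lip (kC B) W t z (Closed.lip-up ds δ)
    (λ b → ≤-trans (≤-reflexive (Closed.up-at-last ds δ)) (≤-trans (m≤m+n _ W) (m≤m+n _ W)) ,
      ≤-reflexive (cong (_+ W) (sym (Closed.up-at-last ds δ)))) (λ _ → refl)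

  crossQ-lip : ∀ A B z → Lips (crossQ A B z) (heavyEdges (kC B) (weight A B) false z)
  crossQ-lip A B@(ds , δ) z = heavy-lip (kC B) W false z
    (λ {e} m → lip-shift {p = uK B} (lenO A) {e} (Closed.lip-up ds δ m))
    (λ b → at (sameBool z b)) (λ ())
    where
    W = weight A B
    top : lenO A + uK B (last (kC B)) ≡ W
    top = trans (cong (lenO A +_) (Closed.up-at-last ds δ)) (+-comm (lenO A) _)
    at : ∀ v → lenO A + uK B (last (kC B)) ≤ (if v then W + W else 0) + W × (if v then W + W else 0) ≤ lenO A + uK B (last (kC B)) + W
    at true = ≤-trans (≤-reflexive top) (m≤n+m W (W + W)) , ≤-reflexive (cong (_+ W) (sym top))
    at false = ≤-reflexive top , z≤n

  ΦL-lip : ∀ s → Lips (ΦL s) (edges (shL s))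
  ΦL-lip idle ()
  ΦL-lip (zigzag f A B w _) = pairΦ-lip ρ f (costO A + costO B + w) (UO A) (DO B) {oS A} {oS B} (UO-lip A) (DO-lip B)
  ΦL-lip (leaving f A B w _ _) = pairΦ-lip ρ f (costK A + costO B + w) (DK A) (UO B) {kS A} {oS B} (DK-lip A) (UO-lip B)
  ΦL-lip (waiting f A B w _ _) = pairΦ-lip ρ f (costO A + costK B + w) (UO A) (waitQ B (weight A B)) {oS A} {heavy (kC B) (weight A B) false true}
    (UO-lip A) (waitQ-lip B (weight A B) {false} {true})
  ΦL-lip (ringing f A B W w _ _ _) = pairΦ-lip ρ f (costK A + costK B + w) (DK A) (ringQ B W) {kS A} {heavy (kC B) W false true}
    (DK-lip A) (riseQ-lip B W (lenK B + W) {false} {true} refl)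
  ΦL-lip (crossed f A B@(ds , δ) w z _ _) = fork-lip f (oS A) (heavy (kC B) (weight A B) false z) (just (heavy-target (kC B) (weight A B) false z))
    {κ + lenO A} {λ x → κ + D₀ A x} {λ x → κ + crossQ A B z x}
    (λ {e} m → lip-shift {p = D₀ A} κ {e} (D₀-lip A m))
    (λ {e} m → lip-shift {p = crossQ A B z} κ {e} (crossQ-lip A B z m))
    (cong (κ +_) (d₀-root A))
    (cong (κ +_) (trans (cong (lenO A +_) (Closed.up-at-root ds δ)) (+-identityʳ _)))
    λ { t refl → cong (κ +_) (trans (d₀-last A) (sym (other z))) }
    where
    κ = costO A + costK B + w + weight A B
    other : ∀ z → crossQ A B z (inj₂ (not z)) ≡ 0
    other true = refl
    other false = refl

  oSCover : ∀ A → Tour (edges (oS A)) ρ (inj₁ (last (oC A))) (ccO A) (In (oS A))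
  oSCover A = plain-cover (oC A) (oCover A)

  oSReturn : ∀ A → Tour (edges (oS A)) (inj₁ (last (oC A))) ρ (rrO A) (λ _ → ⊥)
  oSReturn A = plain-return (oC A) (oReturn A)

  kSCover : ∀ A → Tour (edges (kS A)) ρ (inj₁ (last (kC A))) (ccK A) (In (kS A))
  kSCover A@(ds , δ) = plain-cover (kC A) (Closed.cover′ ds δ)

  kSReturn : ∀ A → Tour (edges (kS A)) (inj₁ (last (kC A))) ρ (lenK A) (λ _ → ⊥)
  kSReturn A@(ds , δ) = plain-return (kC A) (Closed.return′ ds δ)

  heavyCover : ∀ B W t z → Tour (heavyEdges (kC B) W t z) ρ (inj₂ z) (ccK B + (W + (W + W))) (In (heavy (kC B) W t z))
  heavyCover B@(ds , δ) W t z = heavy-cover (kC B) W t z (Closed.cover′ ds δ)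

  heavyReturn : ∀ B W t z → Tour (heavyEdges (kC B) W t z) (inj₂ z) ρ (W + lenK B) (λ _ → ⊥)
  heavyReturn B@(ds , δ) W t z = heavy-return (kC B) W t z (Closed.return′ ds δ)

  module _ (f : Bool) (A : O) (B : K) (z : Bool) where

    private
      W = weight A B
      H = heavy (kC B) W false z
      l = just (heavy-target (kC B) W false z)
      E = forkEdges f (oS A) H l

    -- From the end of `A` the tie leads to the first heavy end and back at no cost, so only one
    -- heavy edge is paid for.
    crossCover : Tour E hub (arm (not f) (inj₂ z)) (ccO A + rrO A + (ccK B + W)) (In (crossShape f A B z))
    crossCover = costT (rot (ccO A) (rrO A) (ccK B + W)) (weaken (λ {v} p → pick (fork-in f (oS A) H {v} p))
      (seqT (spokeAT f (oS A) H l) (seqT (armA f (oS A) H l (oSCover A)) (seqT link (seqT (revT link)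
        (seqT (armA f (oS A) H l (oSReturn A)) (seqT (revT (spokeAT f (oS A) H l)) (seqT (spokeBT f (oS A) H l)
          (armB f (oS A) H l (heavy-cover′ (kC B) W false z (Closed.cover′ (proj₁ B) (proj₂ B))))))))))))
      where
      rot : ∀ a b c → a + (b + c) ≡ a + b + c
      rot = solveℕ 3 (λ a b c → a ⊕ (b ⊕ c) ⊜ a ⊕ b ⊕ c) refl
      link : Tour E (arm f (inj₁ (last (oC A)))) (arm (not f) (inj₂ (not z))) 0 _
      link = stepT (link∈ f (oS A) H l (here refl))
      end : ∀ z (x : X) → x ≡ inj₂ (not z) ⊎ x ≢ inj₂ (not z)
      end z (inj₁ _) = inj₂ (λ ())
      end true (inj₂ false) = inj₁ refl
      end true (inj₂ true) = inj₂ (λ ())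
      end false (inj₂ true) = inj₁ refl
      end false (inj₂ false) = inj₂ (λ ())
      pick : ∀ {v} → v ≡ hub ⊎ (∃[ x ] arm f x ≡ v × In (oS A) x) ⊎ (∃[ x ] arm (not f) x ≡ v × In H x) → _
      pick (inj₁ eq) = inj₁ (inj₁ eq)
      pick (inj₂ (inj₁ p)) = inj₂ (inj₁ p)
      pick (inj₂ (inj₂ (x , eq , p))) with end z x
      ... | inj₁ refl = inj₂ (inj₂ (inj₁ (inj₂ (sym eq))))
      ... | inj₂ ne = inj₂ (inj₂ (inj₂ (inj₂ (inj₂ (inj₂ (inj₂ (x , eq , p , ne)))))))

    crossReturn : Tour E (arm (not f) (inj₂ z)) hub (W + lenK B) (λ _ → ⊥)
    crossReturn = fork-return f (oS A) H l (heavyReturn B W false z)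

  coverL : ∀ s → Tour (edges (shL s)) hub (last (shL s)) (ccL s) (In (shL s))
  coverL idle = weaken (λ { {hub} _ → refl ; {arm _ _} () }) (stayT hub)
  coverL (zigzag f A B _ _) = fork-cover f (oS A) (oS B) nothing (oSCover A) (oSReturn A) (oSCover B)
  coverL (leaving f A B _ _ _) = fork-cover f (kS A) (oS B) nothing (kSCover A) (kSReturn A) (oSCover B)
  coverL (waiting f A B _ _ _) = fork-cover f (oS A) (heavy (kC B) (weight A B) false true) nothing
    (oSCover A) (oSReturn A) (heavyCover B (weight A B) false true)
  coverL (ringing f A B W _ _ _ _) = fork-cover f (kS A) (heavy (kC B) W false true) nothing
    (kSCover A) (kSReturn A) (heavyCover B W false true)
  coverL (crossed f A B _ z _ _) = crossCover f A B z

  returnL : ∀ s → Tour (edges (shL s)) (last (shL s)) hub (rrL s) (λ _ → ⊥)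
  returnL idle = weaken (λ ()) (stayT hub)
  returnL (zigzag f A B _ _) = fork-return f (oS A) (oS B) nothing (oSReturn B)
  returnL (leaving f A B _ _ _) = fork-return f (kS A) (oS B) nothing (oSReturn B)
  returnL (waiting f A B _ _ _) = fork-return f (oS A) (heavy (kC B) (weight A B) false true) nothing (heavyReturn B (weight A B) false true)
  returnL (ringing f A B W _ _ _ _) = fork-return f (kS A) (heavy (kC B) W false true) nothing (heavyReturn B W false true)
  returnL (crossed f A B _ z _ _) = crossReturn f A B z

  module _ where
    S′ : ℕ
    S′ = Size + Λ

    Size≤S′ : Size ≤ S′
    Size≤S′ = m≤m+n Size Λ

    bound : ∀ a b W → a + b ≤ S′ → W ≤ S′ → (Λ * a + Λ) + (a + Λ) + ((Λ * b + Λ) + (W + (W + W))) ≤ ΛL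
    bound a b W le W≤ = lin b (eq Λ S′ a b W) (+-mono-≤ (+-mono-≤ (*-monoʳ-≤ Λ le) le) (*-monoʳ-≤ 3 W≤))
      where
      eq : ∀ Λ S a b W → (Λ * a + Λ) + (a + Λ) + ((Λ * b + Λ) + (W + (W + W))) + (Λ * S + S + 3 * S) + b
        ≡ Λ * S + 3 * Λ + 4 * S + (Λ * (a + b) + (a + b) + 3 * W)
      eq = solveℕ 5 (λ Λ S a b W → (Λ ⊗ a ⊕ Λ) ⊕ (a ⊕ Λ) ⊕ ((Λ ⊗ b ⊕ Λ) ⊕ (W ⊕ (W ⊕ W))) ⊕ (Λ ⊗ S ⊕ S ⊕ lit 3 ⊗ S) ⊕ b
        ⊜ Λ ⊗ S ⊕ lit 3 ⊗ Λ ⊕ lit 4 ⊗ S ⊕ (Λ ⊗ (a ⊕ b) ⊕ (a ⊕ b) ⊕ lit 3 ⊗ W)) refl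

    bound-rr : ∀ a W → a ≤ S′ → W ≤ S′ → W + a ≤ ΛL
    bound-rr a W a≤ W≤ = lin (Λ * S′ + 3 * Λ + 2 * S′) (eq Λ S′ a W) (+-mono-≤ W≤ a≤)
      where
      eq : ∀ Λ S a W → W + a + (S + S) + (Λ * S + 3 * Λ + 2 * S) ≡ Λ * S + 3 * Λ + 4 * S + (W + a)
      eq = solveℕ 4 (λ Λ S a W → W ⊕ a ⊕ (S ⊕ S) ⊕ (Λ ⊗ S ⊕ lit 3 ⊗ Λ ⊕ lit 2 ⊗ S) ⊜ Λ ⊗ S ⊕ lit 3 ⊗ Λ ⊕ lit 4 ⊗ S ⊕ (W ⊕ a)) refl

    ccK≤ : ∀ A → ccK A ≤ Λ * lenK A + Λ
    ccK≤ (ds , δ) = ≤-trans (Closed.ccs≤ ds δ) (m≤m+n _ Λ)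

    size₁ : ∀ a → a + Λ ≤ Size → a ≤ S′
    size₁ a le = ≤-trans (≤-trans (m≤m+n a Λ) le) Size≤S′

    weight≤ : ∀ A B → lenO A + lenK B ≤ Size → weight A B ≤ S′
    weight≤ A B le = ≤-trans (≤-reflexive (+-comm (lenK B) (lenO A))) (≤-trans le Size≤S′)

    part : ∀ a b {c} → a + b ≤ c → b ≤ c
    part a b = ≤-trans (m≤n+m b a)

  ccL≤ : ∀ s → ccL s ≤ ΛL
  ccL≤ idle = z≤n
  ccL≤ (zigzag f A B _ I) = ≤-trans (+-mono-≤ (+-mono-≤ (ccO≤ A) (rrO≤ A)) (≤-trans (ccO≤ B) (m≤m+n _ 0)))
    (bound (lenO A) (lenO B) 0 (size₁ (lenO A + lenO B) (Inv.size I)) z≤n)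
  ccL≤ (leaving f A B _ _ le) = ≤-trans (+-mono-≤ (+-mono-≤ (ccK≤ A) (m≤m+n _ Λ)) (≤-trans (ccO≤ B) (m≤m+n _ 0)))
    (bound (lenK A) (lenO B) 0 (≤-trans le Size≤S′) z≤n)
  ccL≤ (waiting f A B _ _ le) = ≤-trans (+-mono-≤ (+-mono-≤ (ccO≤ A) (rrO≤ A)) (+-monoˡ-≤ _ (ccK≤ B)))
    (bound (lenO A) (lenK B) (weight A B) (≤-trans le Size≤S′) (weight≤ A B le))
  ccL≤ (ringing f A B W _ _ le W≤) = ≤-trans (+-mono-≤ (+-mono-≤ (ccK≤ A) (m≤m+n _ Λ)) (+-monoˡ-≤ _ (ccK≤ B)))
    (bound (lenK A) (lenK B) W le (≤-trans W≤ Size≤S′))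
  ccL≤ (crossed f A B _ z _ le) = ≤-trans (+-mono-≤ (+-mono-≤ (ccO≤ A) (rrO≤ A)) (+-mono-≤ (ccK≤ B) (m≤m+n (weight A B) _)))
    (bound (lenO A) (lenK B) (weight A B) (≤-trans le Size≤S′) (weight≤ A B le))

  rrL≤ : ∀ s → rrL s ≤ ΛL
  rrL≤ idle = z≤n
  rrL≤ (zigzag f A B _ I) = ≤-trans (rrO≤ B) (≤-trans (≤-reflexive (+-comm (lenO B) Λ))
    (bound-rr (lenO B) Λ (part (lenO A) (lenO B) (size₁ (lenO A + lenO B) (Inv.size I))) (m≤n+m Λ Size)))
  rrL≤ (leaving f A B _ _ le) = ≤-trans (rrO≤ B) (≤-trans (≤-reflexive (+-comm (lenO B) Λ))
    (bound-rr (lenO B) Λ (part (lenK A) (lenO B) (≤-trans le Size≤S′)) (m≤n+m Λ Size)))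
  rrL≤ (waiting f A B _ _ le) = bound-rr (lenK B) (weight A B) (part (lenO A) (lenK B) (≤-trans le Size≤S′)) (weight≤ A B le)
  rrL≤ (ringing f A B W _ _ le W≤) = bound-rr (lenK B) W (part (lenK A) (lenK B) le) (≤-trans W≤ Size≤S′)
  rrL≤ (crossed f A B _ z _ le) = bound-rr (lenK B) (weight A B) (part (lenO A) (lenK B) (≤-trans le Size≤S′)) (weight≤ A B le)

  decX : (x y : X) → Dec (x ≡ y)
  decX (inj₁ (i , u)) (inj₁ (j , v)) with i ≟ j | dec u v
  ... | yes refl | yes refl = yes refl
  ... | no ne | _ = no λ { refl → ne refl }
  ... | _ | no ne = no λ { refl → ne refl }
  decX (inj₂ a) (inj₂ b) with a ≟ᵇ b
  ... | yes refl = yes refl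
  ... | no ne = no λ { refl → ne refl }
  decX (inj₁ _) (inj₂ _) = no λ ()
  decX (inj₂ _) (inj₁ _) = no λ ()

  core′ : Core
  core′ = record
    { V = Fork X ; dec = decFork decX ; root = hub
    ; n = 20 * n ; m = 19 * m ; Λ = ΛL
    ; 1≤n = ≤-trans 1≤n (m≤m+n n _) ; 1≤m = ≤-trans 1≤m (m≤m+n m _)
    ; m≤2n = lin (2 * n) (eq n m) (*-monoʳ-≤ 19 m≤2n)
    ; 1≤Λ = ≤-trans 1≤Λ (≤-trans (≤-trans (m≤m+n Λ (2 * Λ)) (m≤n+m (3 * Λ) (Λ * (Size + Λ)))) (m≤m+n _ _))
    ; St = LSt ; start = idle ; sh = shL ; pd = pdL
    ; pd⊆ = λ {s} {v} → pd⊆L {s} {v} ; pd-last = pd-lastL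
    ; Φ = ΦL ; Φ-lip = ΦL-lip ; Φ-start = refl
    ; cc = ccL ; rr = rrL ; cover = coverL ; return = returnL ; cc≤Λ = ccL≤ ; rr≤Λ = rrL≤
    ; rank = rankL
    }
    where
    eq : ∀ n m → 19 * m + 19 * (2 * n) + 2 * n ≡ 2 * (20 * n) + 19 * m
    eq = solveℕ 2 (λ n m → lit 19 ⊗ m ⊕ lit 19 ⊗ (lit 2 ⊗ n) ⊕ lit 2 ⊗ n ⊜ lit 2 ⊗ (lit 20 ⊗ n) ⊕ lit 19 ⊗ m) refl

-- The reactions of the adversary inside a block of the next level

module LiftStep (P : Proc) where
  open Proc P
  open Core core
  open Chain core
  open Arms P
  open Strand {C} {croot}
  open Arith n m Λ 1≤n 1≤m m≤2n 1≤Λ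
  open Lift P
  open LiftCore P

  grow-open : ∀ {A A′ : O} → Grow (oC A) (oC A′) (oPd A) → Grow (oS A) (oS A′) (openPd A)
  grow-open {A} = plain-grow {pd′ = openPd A} (λ _ → id)

  grow-close : ∀ {A : O} {A′ : K} → Grow (oC A) (kC A′) (oPd A) → Grow (oS A) (kS A′) (openPd A)
  grow-close {A} = plain-grow {pd′ = openPd A} (λ _ → id)

  private
    left-out : ∀ {k r} → 2 + k ≤ 3 + (r + k)
    left-out {k} {r} = s≤s (s≤s (≤-trans (m≤n+m k (1 + r)) ≤-refl))

  module _ (f : Bool) (ds : List D) (s : St) (B : O) (w : ℕ) (I : Inv (len ds) (lenO B) w) where

    private
      A = ds , s
      state = zigzag f A B w I
      κ = cost ds + costO B + w

    zigzag-A : ∀ x → T (oPd A x) → Outcome core′ state (arm f (inj₁ x))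
    zigzag-A x t with armStep ds s x t
    ... | next s′ g pend u≤ _ rk = next (zigzag f (ds , s′) B w I)
      (fork-grow {f = f} {oS A} {oS B} {openPd A} {openPd B} {nothing} {oS (ds , s′)} {oS B} {nothing} (grow-open {A} {ds , s′} g) (grow-refl (oS B) (openPd B)) (λ ()) (λ _ ()))
      (pend-A {A = oS A} {oS B} {openPd A} {openPd B} {openPd (ds , s′)} {openPd B} f nothing (plain-pend {oC A} pend) inj₁)
      (subst₂ _≤_ (sym (pairΦ-at ρ f κ (UO (ds , s′)) (DO B) (inj₁ x))) (sym (pairΦ-at ρ f κ (UO A) (DO B) (inj₁ x)))
        (+-monoʳ-≤ κ (+-monoˡ-≤ (dO B croot) u≤)))
      (s≤s (s≤s (s≤s (+-monoˡ-< _ (+-monoˡ-< (rankO B) rk)))))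
    ... | full δ g ge refl u≥ _ with inv-turn (Closed.rr≤Λ′ ds δ) I
    -- The walk is long enough for `A` to become a dead end. The agent stands at its end and has to
    -- go back to `B`, so the potential now falls towards the end of `A` and rises along `B`.
    ...   | inj₁ leave = next (leaving f (ds , δ) B (w + (lenO B + len ds)) leave fits)
      (fork-grow (grow-close {A} {ds , δ} g) (grow-refl (oS B) _) (λ ()) (λ _ ()))
      (pend-A {A = oS A} {oS B} {openPd A} {openPd B} {noPd} {openPd B} f nothing (λ ()) inj₁)
      (subst₂ _≤_ (sym (pairΦ-at ρ f (costK (ds , δ) + costO B + (w + (lenO B + len ds))) (DK (ds , δ)) (UO B) (inj₁ x))) (sym (pairΦ-at ρ f κ (UO A) (DO B) (inj₁ x)))
        (subst₂ (λ a b → costK (ds , δ) + costO B + (w + (lenO B + len ds)) + (a + uO B croot) ≤ κ + (uO A x + b))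
          (sym (Closed.down-at-last ds δ)) (sym (len≤dO-root B))
          (lin 0 (eq (cost ds) (Done.X δ) (costO B) w (lenO B) (len ds) (uO B croot) (uO A x)) u≥)))
      (≤-trans (left-out {rankO B} {rank s}) (m≤m+n _ _))
      where
      fits : lenK (ds , δ) + lenO B ≤ Size
      fits = lin 0 (eq′ (len ds) (Done.rr δ) (lenO B) Λ Size) (+-mono-≤ (Closed.rr≤Λ′ ds δ) (Inv.size I))
        where
        eq′ : ∀ o d c Λ S → o + d + c + (Λ + S) + 0 ≡ S + (d + (o + c + Λ))
        eq′ = solveℕ 5 (λ o d c Λ S → o ⊕ d ⊕ c ⊕ (Λ ⊕ S) ⊕ lit 0 ⊜ S ⊕ (d ⊕ (o ⊕ c ⊕ Λ))) refl
      eq : ∀ a x b w c o u v → a + x + b + (w + (c + o)) + (0 + u) + v + 0 ≡ a + b + w + (v + (c + u)) + (o + x)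
      eq = solveℕ 8 (λ a x b w c o u v → a ⊕ x ⊕ b ⊕ (w ⊕ (c ⊕ o)) ⊕ (lit 0 ⊕ u) ⊕ v ⊕ lit 0 ⊜ a ⊕ b ⊕ w ⊕ (v ⊕ (c ⊕ u)) ⊕ (o ⊕ x)) refl
    -- The way `lenO B + len ds` from one end to the other moves from the potentials into the
    -- constant `w`.
    ...   | inj₂ I′ = next (zigzag (not f) B (extend (ds , δ)) (w + (lenO B + len ds)) I″)
      (grow-trans (fork-grow (grow-open {A} {extend (ds , δ)} ge) (grow-refl (oS B) _) (λ ()) (λ _ ())) (fork-flip f))
      (λ {v} t′ → pend-A {A = oS A} {oS B} {openPd A} {openPd B} {openPd (extend (ds , δ))} {openPd B} f nothing (plain-fresh {oC A} {oPd A} (λ {v} → extend-fresh {sh s} {δ} ds {v})) inj₁ (forkPd-flip f v t′))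
      (subst₂ _≤_ (sym (pairΦ-flip ρ f (costO B + costO (extend (ds , δ)) + (w + (lenO B + len ds))) (UO B) (DO (extend (ds , δ))) (inj₁ x))) (sym (pairΦ-at ρ f κ (UO A) (DO B) (inj₁ x)))
        (subst₂ (λ a b → costO B + costO (extend (ds , δ)) + (w + (lenO B + len ds)) + (uO B croot + a) ≤ κ + (uO A x + b))
          (sym (Closed.ext-down ds δ)) (sym (len≤dO-root B))
          (subst (λ k → costO B + k + (w + (lenO B + len ds)) + (uO B croot + 0) ≤ κ + (uO A x + (lenO B + uO B croot)))
            (sym (costO-extend (ds , δ)))
            (lin 0 (eq (cost ds) (Done.X δ) (costO B) w (lenO B) (len ds) (uO B croot) (uO A x)) u≥))))
      (subst (λ k → 3 + k + (Size ∸ (lenO B + lenO (extend (ds , δ)))) * suc R < rankL state) (+-comm R (rankO B))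
        (budget {Size} {R} {3} {len ds + lenO B} {Done.rr δ} {_} {rank s} {rankO B} (Done.1≤rr δ) (≤-trans (+-monoʳ-≤ _ (Closed.rr≤Λ′ ds δ)) (Inv.size I))
          (trans (cong (lenO B +_) (lenO-extend (ds , δ))) (eq′ (lenO B) (len ds) (Done.rr δ)))))
      where
      I″ = subst (λ k → Inv (lenO B) k _) (sym (lenO-extend (ds , δ))) I′
      eq : ∀ a x b w c o u v → b + (a + x) + (w + (c + o)) + (u + 0) + v + 0 ≡ a + b + w + (v + (c + u)) + (o + x)
      eq = solveℕ 8 (λ a x b w c o u v → b ⊕ (a ⊕ x) ⊕ (w ⊕ (c ⊕ o)) ⊕ (u ⊕ lit 0) ⊕ v ⊕ lit 0 ⊜ a ⊕ b ⊕ w ⊕ (v ⊕ (c ⊕ u)) ⊕ (o ⊕ x)) refl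
      eq′ : ∀ c o d → c + (o + d) ≡ o + c + d
      eq′ = solveℕ 3 (λ c o d → c ⊕ (o ⊕ d) ⊜ o ⊕ c ⊕ d) refl

  module _ (f : Bool) (A : O) (ds : List D) (s : St) (w : ℕ) (I : Inv (lenO A) (len ds) w) where

    private
      B = ds , s
      state = zigzag f A B w I
      κ = costO A + cost ds + w

    zigzag-B : ∀ x → T (oPd B x) → Outcome core′ state (arm (not f) (inj₁ x))
    zigzag-B x t with armStep ds s x t
    ... | next s′ g pend _ d≤ rk = next (zigzag f A (ds , s′) w I)
      (fork-grow (grow-refl (oS A) _) (grow-open {B} {ds , s′} g) (λ ()) (λ _ ()))
      (pend-B {A = oS A} {oS B} {openPd A} {openPd B} {openPd A} {openPd (ds , s′)} f nothing inj₁ (plain-pend {oC B} pend))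
      (subst₂ _≤_ (sym (pairΦ-off ρ f κ (UO A) (DO (ds , s′)) (inj₁ x))) (sym (pairΦ-off ρ f κ (UO A) (DO B) (inj₁ x)))
        (+-monoʳ-≤ κ (+-monoʳ-≤ (uO A croot) d≤)))
      (s≤s (s≤s (s≤s (+-monoˡ-< _ (+-monoʳ-< (rankO A) rk)))))
    ... | full δ g ge refl _ d≥ with 10 * (n * (lenO A + Λ)) ≤? len ds + Done.rr δ
    -- The two heavy ends are new vertices, attached to the pending vertex that the agent has just
    -- reached.
    ...   | yes far = next (waiting f A (ds , δ) w far fits)
      (fork-grow (grow-refl (oS A) _) (plain-heavy {pd′ = openPd B} (λ _ → id) g t) (λ ()) (λ _ ()))
      (pend-B {A = oS A} {oS B} {openPd A} {openPd B} {openPd A} {endsPd} f nothing inj₁ (λ { {inj₂ b} _ → inj₂ (λ ()) }))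
      (subst₂ _≤_ (sym (pairΦ-off ρ f (costO A + costK (ds , δ) + w) (UO A) (waitQ (ds , δ) (weight A (ds , δ))) (inj₁ x))) (sym (pairΦ-off ρ f κ (UO A) (DO B) (inj₁ x)))
        (subst (λ a → costO A + costK (ds , δ) + w + (uO A croot + a) ≤ κ + (uO A croot + dO B x))
          (sym (Closed.down-at-last ds δ))
          (lin 0 (eq (costO A) (cost ds) (Done.X δ) w (uO A croot) (dO B x)) d≥)))
      (≤-trans (≤-trans (s≤s (s≤s (s≤s (m≤m+n (rankO A) (rank s))))) ≤-refl) (m≤m+n _ _))
      where
      fits : lenO A + lenK (ds , δ) ≤ Size
      fits = lin 0 (eq′ (lenO A) (len ds) (Done.rr δ) Λ Size) (+-mono-≤ (Closed.rr≤Λ′ ds δ) (Inv.size I))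
        where
        eq′ : ∀ o c d Λ S → o + (c + d) + (Λ + S) + 0 ≡ S + (d + (o + c + Λ))
        eq′ = solveℕ 5 (λ o c d Λ S → o ⊕ (c ⊕ d) ⊕ (Λ ⊕ S) ⊕ lit 0 ⊜ S ⊕ (d ⊕ (o ⊕ c ⊕ Λ))) refl
      eq : ∀ a b x w u v → a + (b + x) + w + (u + 0) + v + 0 ≡ a + b + w + (u + v) + x
      eq = solveℕ 6 (λ a b x w u v → a ⊕ (b ⊕ x) ⊕ w ⊕ (u ⊕ lit 0) ⊕ v ⊕ lit 0 ⊜ a ⊕ b ⊕ w ⊕ (u ⊕ v) ⊕ x) refl
    ...   | no near = next (zigzag f A (extend (ds , δ)) w I′)
      (fork-grow (grow-refl (oS A) _) (grow-open {B} {extend (ds , δ)} ge) (λ ()) (λ _ ()))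
      (pend-B {A = oS A} {oS B} {openPd A} {openPd B} {openPd A} {openPd (extend (ds , δ))} f nothing inj₁ (plain-fresh {oC B} {oPd B} (λ {v} → extend-fresh {sh s} {δ} ds {v})))
      (subst₂ _≤_ (sym (pairΦ-off ρ f (costO A + costO (extend (ds , δ)) + w) (UO A) (DO (extend (ds , δ))) (inj₁ x))) (sym (pairΦ-off ρ f κ (UO A) (DO B) (inj₁ x)))
        (subst₂ (λ k a → costO A + k + w + (uO A croot + a) ≤ κ + (uO A croot + dO B x))
          (sym (costO-extend (ds , δ))) (sym (Closed.ext-down ds δ))
          (lin 0 (eq (costO A) (cost ds) (Done.X δ) w (uO A croot) (dO B x)) d≥)))
      (subst₂ (λ i k → 3 + i + (Size ∸ (lenO A + lenO (extend (ds , δ)))) * suc R < 3 + k + (Size ∸ (lenO A + len ds)) * suc R)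
        (+-comm R (rankO A)) (+-comm (rank s) (rankO A))
        (budget {Size} {R} {3} {lenO A + len ds} {Done.rr δ} {_} {rank s} {rankO A} (Done.1≤rr δ) (≤-trans (+-monoʳ-≤ _ (Closed.rr≤Λ′ ds δ)) (Inv.size I))
          (trans (cong (lenO A +_) (lenO-extend (ds , δ))) (sym (+-assoc (lenO A) (len ds) (Done.rr δ))))))
      where
      I′ = subst (λ k → Inv (lenO A) k w) (sym (lenO-extend (ds , δ))) (inv-advance (Closed.rr≤Λ′ ds δ) near I)
      eq : ∀ a b x w u v → a + (b + x) + w + (u + 0) + v + 0 ≡ a + b + w + (u + v) + x
      eq = solveℕ 6 (λ a b x w u v → a ⊕ (b ⊕ x) ⊕ w ⊕ (u ⊕ lit 0) ⊕ v ⊕ lit 0 ⊜ a ⊕ b ⊕ w ⊕ (u ⊕ v) ⊕ x) refl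

  module _ (f : Bool) (A : K) (ds : List D) (s : St) (w : ℕ) (leave : Leave (lenK A) (len ds) w) (le : lenK A + len ds ≤ Size) where

    private
      B = ds , s
      state = leaving f A B w leave le
      κ = costK A + cost ds + w

      module Exit (δ : D) where
        E = ds , δ
        S = fork f (kS A) (kS E) nothing
        distance : Fork X → ℕ
        distance = forkMap 0 f (UK A) (UK E)

        exitBlock : Done (Fork X) hub (20 * n) (19 * m) ΛL
        exitBlock = record
          { shape = S ; cc = ccK A + lenK A + ccK E ; rr = lenK E
          ; X = κ + (lenK A + (len ds + Done.X δ))
          ; cover = fork-cover f (kS A) (kS E) nothing (kSCover A) (kSReturn A) (kSCover E)
          ; return = fork-return f (kS A) (kS E) nothing (kSReturn E)
          ; h = distance
          ; h-lip = fork-lip f (kS A) (kS E) nothing {0} {UK A} {UK E} (UK-lip A) (UK-lip E)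
              (Closed.up-at-root (proj₁ A) (proj₂ A)) (Closed.up-at-root ds δ) (λ _ ())
          ; h-root = refl
          ; h-last = trans (side-off f (UK A) (UK E) (inj₁ (last (kC E)))) (Closed.up-at-last ds δ)
          ; cc≤Λ = ≤-trans (+-mono-≤ (+-mono-≤ (ccK≤ A) (m≤m+n _ Λ)) (≤-trans (ccK≤ E) (m≤m+n _ 0)))
              (bound (lenK A) (lenK E) 0 fits z≤n)
          ; 1≤rr = ≤-trans (Done.1≤rr δ) (m≤n+m _ (len ds))
          ; quality = leave-quality {ccK A} {costK A} {lenK A} {ccK E} {cost ds} {len ds} {Done.X δ} {Done.rr δ} {w}
              (Closed.quality′ (proj₁ A) (proj₂ A)) (Closed.quality′ ds δ) (Closed.rr≤Λ′ ds δ) leave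
          }
          where
          fits : lenK A + lenK E ≤ Size + Λ
          fits = ≤-trans (≤-reflexive (sym (+-assoc (lenK A) (len ds) (Done.rr δ)))) (+-mono-≤ le (Closed.rr≤Λ′ ds δ))

    leaving-B : ∀ x → T (oPd B x) → Outcome core′ state (arm (not f) (inj₁ x))
    leaving-B x t with armStep ds s x t
    ... | next s′ g pend u≤ _ rk = next (leaving f A (ds , s′) w leave le)
      (fork-grow (grow-refl (kS A) _) (grow-open {B} {ds , s′} g) (λ ()) (λ _ ()))
      (pend-B {A = kS A} {oS B} {noPd} {openPd B} {noPd} {openPd (ds , s′)} f nothing inj₁ (plain-pend {oC B} pend))
      (subst₂ _≤_ (sym (pairΦ-off ρ f κ (DK A) (UO (ds , s′)) (inj₁ x))) (sym (pairΦ-off ρ f κ (DK A) (UO B) (inj₁ x)))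
        (+-monoʳ-≤ κ (+-monoʳ-≤ (dK A croot) u≤)))
      (s≤s rk)
    ... | full δ g _ refl u≥ _ = done (Exit.exitBlock δ)
      (fork-grow (grow-refl (kS A) _) (grow-close {B} {ds , δ} g) (λ ()) (λ _ ())) refl
      (subst (κ + (lenK A + (len ds + Done.X δ)) ≤_) (sym (pairΦ-off ρ f κ (DK A) (UO B) (inj₁ x)))
        (subst (λ a → κ + (lenK A + (len ds + Done.X δ)) ≤ κ + (a + uO B x)) (sym (Closed.down-at-root (proj₁ A) (proj₂ A)))
          (+-monoʳ-≤ κ (+-monoʳ-≤ (lenK A) u≥))))

  module _ (f : Bool) (ds : List D) (s : St) (B : K) (w : ℕ) (far : Far (len ds) (lenK B)) (le : len ds + lenK B ≤ Size) where

    private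
      A = ds , s
      W = weight A B
      H = heavy (kC B) W false true
      state = waiting f A B w far le
      κ = cost ds + costK B + w

    waiting-A : ∀ x → T (oPd A x) → Outcome core′ state (arm f (inj₁ x))
    waiting-A x t with armStep ds s x t
    ... | next s′ g pend u≤ _ rk = next (waiting f (ds , s′) B w far le)
      (fork-grow (grow-open {A} {ds , s′} g) (grow-refl H _) (λ ()) (λ _ ()))
      (pend-A {A = oS A} {H} {openPd A} {endsPd} {openPd (ds , s′)} {endsPd} f nothing (plain-pend {oC A} pend) inj₁)
      (subst₂ _≤_ (sym (pairΦ-at ρ f κ (UO (ds , s′)) (waitQ B W) (inj₁ x))) (sym (pairΦ-at ρ f κ (UO A) (waitQ B W) (inj₁ x)))
        (+-monoʳ-≤ κ (+-monoˡ-≤ (dK B croot) u≤)))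
      (s≤s (s≤s rk))
    -- The summand `W` of the new walk is the distance from the end of `B`, where the agent was
    -- before, to the entry of the last block of `A`.
    ... | full δ g _ refl u≥ _ = next (ringing f Ā B W (w + W) (far-return {len ds} {lenK B} {w} {lenK Ā} far (Closed.length≤ ds δ)) fits W≤)
      (fork-grow (grow-close {A} {Ā} g) (grow-refl H _) (λ ()) (λ _ ()))
      (pend-A {A = oS A} {H} {openPd A} {endsPd} {noPd} {endsPd} f nothing (λ ()) inj₁)
      (subst₂ _≤_ (sym (pairΦ-at ρ f (costK Ā + costK B + (w + W)) (DK Ā) (ringQ B W) (inj₁ x))) (sym (pairΦ-at ρ f κ (UO A) (waitQ B W) (inj₁ x)))
        (subst₂ (λ a b → costK Ā + costK B + (w + W) + (a + b) ≤ κ + (uO A x + dK B croot))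
          (sym (Closed.down-at-last ds δ)) (sym (Closed.up-at-root (proj₁ B) (proj₂ B)))
          (subst (λ c → costK Ā + costK B + (w + W) + 0 ≤ κ + (uO A x + c)) (sym (Closed.down-at-root (proj₁ B) (proj₂ B)))
            (lin 0 (eq (cost ds) (Done.X δ) (costK B) w (len ds) (lenK B) (uO A x)) u≥))))
      (s≤s (s≤s z≤n))
      where
      Ā = ds , δ
      fits : lenK Ā + lenK B ≤ Size + Λ
      fits = lin 0 (eq′ (len ds) (Done.rr δ) (lenK B) Λ Size) (+-mono-≤ (Closed.rr≤Λ′ ds δ) le)
        where
        eq′ : ∀ o d c Λ S → o + d + c + (Λ + S) + 0 ≡ S + Λ + (d + (o + c))
        eq′ = solveℕ 5 (λ o d c Λ S → o ⊕ d ⊕ c ⊕ (Λ ⊕ S) ⊕ lit 0 ⊜ S ⊕ Λ ⊕ (d ⊕ (o ⊕ c))) refl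
      W≤ : W ≤ Size
      W≤ = ≤-trans (≤-reflexive (+-comm (lenK B) (len ds))) le
      eq : ∀ a x b w o c u → a + x + b + (w + (c + o)) + 0 + u + 0 ≡ a + b + w + (u + c) + (o + x)
      eq = solveℕ 7 (λ a x b w o c u → a ⊕ x ⊕ b ⊕ (w ⊕ (c ⊕ o)) ⊕ lit 0 ⊕ u ⊕ lit 0 ⊜ a ⊕ b ⊕ w ⊕ (u ⊕ c) ⊕ (o ⊕ x)) refl

    waiting-end : ∀ z → Outcome core′ state (arm (not f) (inj₂ (not z)))
    waiting-end z = next (crossed f A B w z far le)
      (fork-grow (grow-refl (oS A) _) (heavy-retie (kC B) W (λ ()) (λ ())) (λ ())
        (λ { t refl → inj₁ (oPd-last A) , inj₁ tt }))
      (pend-B {A = oS A} {H} {openPd A} {endsPd} {noPd} {endPd z} f nothing (λ ())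
        (λ { {inj₂ b} t → inj₁ (tt , λ { refl → sameBool-sound z t refl }) }))
      (subst₂ _≤_ (sym (side-off f _ _ (inj₂ (not z)))) (sym (pairΦ-off ρ f κ (UO A) (waitQ B W) (inj₂ (not z))))
        (≤-trans (≤-reflexive (trans (cong (κ + W +_) (other z)) (+-identityʳ _)))
          (+-monoʳ-≤ κ (m≤n+m W (uO A croot)))))
      (s≤s (s≤s z≤n))
      where
      other : ∀ z → crossQ A B z (inj₂ (not z)) ≡ 0
      other true = refl
      other false = refl

  module _ (f : Bool) (A B : K) (W w : ℕ) (ret : Return (lenK A) (lenK B) W w) (le : lenK A + lenK B ≤ Size + Λ) (W≤ : W ≤ Size) where

    private
      state = ringing f A B W w ret le W≤
      κ = costK A + costK B + w
      H = heavy (kC B) W true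
      Q : X → ℕ
      Q = [ uK B , (λ _ → W + lenK B) ]′

      ringBlock : Bool → Done (Fork X) hub (20 * n) (19 * m) ΛL
      ringBlock z = record
        { shape = fork f (kS A) (H z) nothing
        ; cc = ccK A + lenK A + (ccK B + (W + 0)) ; rr = W + lenK B ; X = κ + (lenK A + (lenK B + W))
        ; cover = fork-cover f (kS A) (H z) nothing (kSCover A) (kSReturn A)
            (tied-cover (kC B) W z (Closed.cover′ (proj₁ B) (proj₂ B)))
        ; return = fork-return f (kS A) (H z) nothing (heavyReturn B W true z)
        ; h = forkMap 0 f (UK A) Q
        ; h-lip = fork-lip f (kS A) (H z) nothing {0} {UK A} {Q} (UK-lip A) (riseQ-lip B W _ {true} {z} (+-comm W (lenK B)))
            (Closed.up-at-root (proj₁ A) (proj₂ A)) (Closed.up-at-root (proj₁ B) (proj₂ B)) (λ _ ())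
        ; h-root = refl
        ; h-last = side-off f (UK A) Q (inj₂ z)
        ; cc≤Λ = ≤-trans (+-mono-≤ (+-mono-≤ (ccK≤ A) (m≤m+n _ Λ)) (+-mono-≤ (ccK≤ B) (+-monoʳ-≤ W z≤n)))
            (bound (lenK A) (lenK B) W le (≤-trans W≤ Size≤S′))
        ; 1≤rr = ≤-trans (Done.1≤rr (proj₂ B)) (≤-trans (m≤n+m _ (len (proj₁ B))) (m≤n+m _ W))
        ; quality = return-quality {ccK A} {costK A} {lenK A} {ccK B} {costK B} {lenK B} {W} {w}
            (Closed.quality′ (proj₁ A) (proj₂ A)) (Closed.quality′ (proj₁ B) (proj₂ B)) ret
        }

    ringing-end : ∀ z → Outcome core′ state (arm (not f) (inj₂ z))
    ringing-end z = done (ringBlock z)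
      (fork-grow (grow-refl (kS A) _) (heavy-retie (kC B) W (λ ()) (λ _ _ → tt)) (λ ()) (λ _ ())) refl
      (subst (κ + (lenK A + (lenK B + W)) ≤_) (sym (pairΦ-off ρ f κ (DK A) (ringQ B W) (inj₂ z)))
        (≤-reflexive (cong (λ a → κ + (a + (lenK B + W))) (sym (Closed.down-at-root (proj₁ A) (proj₂ A))))))

  module _ (f : Bool) (A : O) (B : K) (w : ℕ) (z : Bool) (far : Far (lenO A) (lenK B)) (le : lenO A + lenK B ≤ Size) where

    private
      W = weight A B
      state = crossed f A B w z far le
      κ = costO A + costK B + w + W
      H = heavy (kC B) W false z

      -- The tie puts the first heavy end at distance `lenO A` from the hub. This is no shortcut to
      -- the exit, since the way on leads over two heavy edges.
      y : Bool → ℕ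
      y b = if sameBool z b then W + lenK B else lenO A

      Q : X → ℕ
      Q = [ uK B , y ]′

      o≤c : lenO A ≤ lenK B
      o≤c = ≤-trans (≤-trans (m≤m+n (lenO A) Λ) (≤-trans (≤-reflexive (sym (*-identityˡ _)))
        (*-monoˡ-≤ (lenO A + Λ) (≤-trans 1≤n (m≤m+n n (9 * n)))))) (≤-trans (≤-reflexive (*-assoc 10 n _)) far)

      Q-lip : Lips Q (heavyEdges (kC B) W false z)
      Q-lip = heavy-lip (kC B) W false z (Closed.lip-up (proj₁ B) (proj₂ B)) (λ b → at (sameBool z b)) (λ ())
        where
        top : uK B (last (kC B)) ≡ lenK B
        top = Closed.up-at-last (proj₁ B) (proj₂ B)
        at : ∀ v → uK B (last (kC B)) ≤ (if v then W + lenK B else lenO A) + W × (if v then W + lenK B else lenO A) ≤ uK B (last (kC B)) + W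
        at true = subst (λ t → t ≤ W + lenK B + W × W + lenK B ≤ t + W) (sym top)
          (≤-trans (m≤n+m (lenK B) W) (m≤m+n _ W) , ≤-reflexive (+-comm W (lenK B)))
        at false = subst (λ t → t ≤ lenO A + W × lenO A ≤ t + W) (sym top)
          (≤-trans (m≤m+n (lenK B) (lenO A)) (m≤n+m W (lenO A)) , ≤-trans o≤c (m≤m+n (lenK B) W))

      crossBlock : Done (Fork X) hub (20 * n) (19 * m) ΛL
      crossBlock = record
        { shape = crossShape f A B z
        ; cc = ccO A + rrO A + (ccK B + W) ; rr = W + lenK B ; X = κ + (W + W)
        ; cover = crossCover f A B z
        ; return = crossReturn f A B z
        ; h = forkMap 0 f (U₀ A) Q
        ; h-lip = fork-lip f (oS A) H (just (heavy-target (kC B) W false z)) {0} {U₀ A} {Q} (U₀-lip A) Q-lip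
            (u₀-root A) (Closed.up-at-root (proj₁ B) (proj₂ B)) (λ { t refl → trans (u₀-last A) (sym (other z)) })
        ; h-root = refl
        ; h-last = trans (side-off f (U₀ A) Q (inj₂ z)) (same z)
        ; cc≤Λ = ccL≤ state
        ; 1≤rr = ≤-trans (Done.1≤rr (proj₂ B)) (≤-trans (m≤n+m _ (len (proj₁ B))) (m≤n+m _ W))
        ; quality = cross-quality {ccs (proj₁ A)} {costO A} {lenO A} {ccK B} {costK B} {lenK B} {w} {cc (proj₂ A)} {rr (proj₂ A)}
            (chain-quality (proj₁ A)) (Closed.quality′ (proj₁ B) (proj₂ B)) far (cc≤Λ (proj₂ A)) (rr≤Λ (proj₂ A))
        }
        where
        other : ∀ z → (if sameBool z (not z) then W + lenK B else lenO A) ≡ lenO A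
        other true = refl
        other false = refl
        same : ∀ z → (if sameBool z z then W + lenK B else lenO A) ≡ W + lenK B
        same true = refl
        same false = refl

    crossed-end : Outcome core′ state (arm (not f) (inj₂ z))
    crossed-end = done crossBlock (grow-refl (crossShape f A B z) _) refl
      (≤-reflexive (sym (trans (side-off f _ _ (inj₂ z)) (cong (κ +_) (same z)))))
      where
      same : ∀ z → (if sameBool z z then W + W else 0) ≡ W + W
      same true = refl
      same false = refl

  idle-hub : Outcome core′ idle hub
  idle-hub = next (zigzag false fresh fresh 0 inv-start)
    (record { inV-mono = λ { {hub} _ → tt ; {arm _ _} () } ; edge-mono = λ ()
            ; edge-new = λ p → inj₂ (ends (forkView false (oS fresh) (oS fresh) nothing p)) })
    (λ { {arm _ _} _ → inj₂ (λ ()) })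
    (≤-reflexive (cong₂ _+_ Φ-start Φ-start))
    ≤-refl
    where
    ends : ∀ {e} → ForkView false (oS fresh) (oS fresh) nothing e → Open idleShape (pdL idle) (src e) × Open idleShape (pdL idle) (tgt e)
    ends spokeA = inj₁ tt , inj₂ (λ ())
    ends spokeB = inj₁ tt , inj₂ (λ ())
    ends (inA _) = inj₂ (λ ()) , inj₂ (λ ())
    ends (inB _) = inj₂ (λ ()) , inj₂ (λ ())

  step′ : ∀ s x → T (pdL s x) → Outcome core′ s x
  step′ idle hub _ = idle-hub
  step′ (zigzag false (ds , s) B w I) (arm false (inj₁ x)) t = zigzag-A false ds s B w I x t
  step′ (zigzag true (ds , s) B w I) (arm true (inj₁ x)) t = zigzag-A true ds s B w I x t
  step′ (zigzag false A (ds , s) w I) (arm true (inj₁ x)) t = zigzag-B false A ds s w I x t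
  step′ (zigzag true A (ds , s) w I) (arm false (inj₁ x)) t = zigzag-B true A ds s w I x t
  step′ (zigzag false A B w I) (arm false (inj₂ _)) ()
  step′ (zigzag false A B w I) (arm true (inj₂ _)) ()
  step′ (zigzag true A B w I) (arm false (inj₂ _)) ()
  step′ (zigzag true A B w I) (arm true (inj₂ _)) ()
  step′ (leaving false A (ds , s) w l le) (arm true (inj₁ x)) t = leaving-B false A ds s w l le x t
  step′ (leaving true A (ds , s) w l le) (arm false (inj₁ x)) t = leaving-B true A ds s w l le x t
  step′ (leaving false A B w l le) (arm true (inj₂ _)) ()
  step′ (leaving true A B w l le) (arm false (inj₂ _)) ()
  step′ (waiting false (ds , s) B w far le) (arm false (inj₁ x)) t = waiting-A false ds s B w far le x t
  step′ (waiting true (ds , s) B w far le) (arm true (inj₁ x)) t = waiting-A true ds s B w far le x t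
  step′ (waiting false (ds , s) B w far le) (arm true (inj₂ false)) t = waiting-end false ds s B w far le true
  step′ (waiting false (ds , s) B w far le) (arm true (inj₂ true)) t = waiting-end false ds s B w far le false
  step′ (waiting true (ds , s) B w far le) (arm false (inj₂ false)) t = waiting-end true ds s B w far le true
  step′ (waiting true (ds , s) B w far le) (arm false (inj₂ true)) t = waiting-end true ds s B w far le false
  step′ (waiting false A B w far le) (arm false (inj₂ _)) ()
  step′ (waiting false A B w far le) (arm true (inj₁ _)) ()
  step′ (waiting true A B w far le) (arm true (inj₂ _)) ()
  step′ (waiting true A B w far le) (arm false (inj₁ _)) ()
  step′ (ringing false A B W w r le W≤) (arm true (inj₂ z)) t = ringing-end false A B W w r le W≤ z
  step′ (ringing true A B W w r le W≤) (arm false (inj₂ z)) t = ringing-end true A B W w r le W≤ z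
  step′ (ringing false A B W w r le W≤) (arm true (inj₁ _)) ()
  step′ (ringing true A B W w r le W≤) (arm false (inj₁ _)) ()
  step′ (crossed false A B w true far le) (arm true (inj₂ true)) t = crossed-end false A B w true far le
  step′ (crossed false A B w false far le) (arm true (inj₂ false)) t = crossed-end false A B w false far le
  step′ (crossed true A B w true far le) (arm false (inj₂ true)) t = crossed-end true A B w true far le
  step′ (crossed true A B w false far le) (arm false (inj₂ false)) t = crossed-end true A B w false far le
  step′ (crossed false A B w true far le) (arm true (inj₂ false)) ()
  step′ (crossed false A B w false far le) (arm true (inj₂ true)) ()
  step′ (crossed true A B w true far le) (arm false (inj₂ false)) ()
  step′ (crossed true A B w false far le) (arm false (inj₂ true)) ()
  step′ (crossed false A B w z far le) (arm true (inj₁ _)) ()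
  step′ (crossed true A B w z far le) (arm false (inj₁ _)) ()

  lift : Proc
  lift = record { core = core′ ; step = step′ }

-- A closed chain followed by another block

module Series {C Y : Set} {r : C} {ρ : Y} where
  open Plain {C} {Y} {r}

  private
    link : (S : Shape C r) (S₂ : Shape Y ρ) → Bridge S S₂
    link S S₂ = bridge (last S) ρ 0 false (last∈ S) (root∈ S₂) (last-visible S false) (root-visible S₂ false)

    link-ok : ∀ S S₂ → Compatible S S₂ (link S S₂ ∷ [])
    link-ok S S₂ (here refl) (here refl) _ (p , _) = <-irrefl refl p

  series : Shape C r → Shape Y ρ → Shape (C ⊎ Y) (inj₁ r)
  series S S₂ = join S S₂ (link S S₂ ∷ []) (link-ok S S₂)

  module _ (S : Shape C r) (S₂ : Shape Y ρ) where

    joint : Edge (C ⊎ Y)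
    joint = edge (inj₁ (last S)) (inj₂ ρ) 0 false

    first∈ : ∀ {e} → e ∈ edges S → mapE inj₁ e ∈ edges (series S S₂)
    first∈ p = there (∈-++⁺ˡ (∈-map⁺ (mapE inj₁) p))

    second∈ : ∀ {e} → e ∈ edges S₂ → mapE inj₂ e ∈ edges (series S S₂)
    second∈ p = there (∈-++⁺ʳ (map (mapE inj₁) (edges S)) (∈-map⁺ (mapE inj₂) p))

    series-lip : ∀ {p q} → Lips p (edges S) → Lips q (edges S₂) → p (last S) ≡ q ρ → Lips [ p , q ]′ (edges (series S S₂))
    series-lip lp lq eq e∈ with joinView S S₂ (link S S₂ ∷ []) e∈
    ... | between (here refl) = ≤-trans (≤-reflexive eq) (m≤m+n _ 0) , ≤-trans (≤-reflexive (sym eq)) (m≤m+n _ 0)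
    ... | left p = lp p
    ... | right p = lq p

    series-cover : ∀ {k j} → Tour (edges S) r (last S) k (In S) → Tour (edges S₂) ρ (last S₂) j (In S₂) →
      Tour (edges (series S S₂)) (inj₁ r) (inj₂ (last S₂)) (k + j) (In (series S S₂))
    series-cover {k} {j} a b = weaken (λ { {inj₁ p} q → inj₁ (p , refl , q) ; {inj₂ p} q → inj₂ (inj₂ (p , refl , q)) })
      (seqT (mapT inj₁ first∈ a) (seqT (stepT {e = joint} (here refl)) (mapT inj₂ second∈ b)))

  series-grow : ∀ {S S₂ S₂′ pd pd′} → (∀ p → T (pd p) → T (pd′ (inj₂ p))) → Grow S₂ S₂′ pd → Grow (series S S₂) (series S S₂′) pd′
  series-grow {S} {S₂} {S₂′} {pd} {pd′} sub g = record
    { inV-mono = λ { {inj₁ _} p → p ; {inj₂ _} p → inV-mono g p }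
    ; edge-mono = λ p → mono (joinView S S₂ (link S S₂ ∷ []) p)
    ; edge-new = λ p → new (joinView S S₂′ (link S S₂′ ∷ []) p)
    }
    where
    opn : ∀ v → Open S₂ pd v → Open (series S S₂) pd′ (inj₂ v)
    opn v (inj₁ p) = inj₁ (sub v p)
    opn v (inj₂ p) = inj₂ p
    mono : ∀ {e} → JoinView S S₂ (link S S₂ ∷ []) e → e ∈ edges (series S S₂′)
    mono (between (here refl)) = here refl
    mono (left p) = first∈ S S₂′ p
    mono (right p) = second∈ S S₂′ (edge-mono g p)
    new : ∀ {e} → JoinView S S₂′ (link S S₂′ ∷ []) e →
      e ∈ edges (series S S₂) ⊎ (Open (series S S₂) pd′ (src e) × Open (series S S₂) pd′ (tgt e))
    new (between (here refl)) = inj₁ (here refl)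
    new (left p) = inj₁ (first∈ S S₂ p)
    new (right {e} p) with edge-new g p
    ... | inj₁ q = inj₁ (second∈ S S₂ q)
    ... | inj₂ (a , b) = inj₂ (opn (src e) a , opn (tgt e) b)

  plain-series : ∀ {S S′ S₂ pd pd′} → (∀ p → T (pd p) → T (pd′ (inj₁ p))) → Grow S S′ pd → T (pd (last S′)) →
    Grow (plain S) (series S′ S₂) pd′
  plain-series {S} {S′} {S₂} {pd} {pd′} sub g x∈ = record
    { inV-mono = λ { {inj₁ _} p → inV-mono g p ; {inj₂ _} () }
    ; edge-mono = mono
    ; edge-new = λ p → new (joinView S′ S₂ (link S′ S₂ ∷ []) p)
    }
    where
    opn : ∀ v → Open S pd v → Open (plain S) pd′ (inj₁ v)
    opn v (inj₁ p) = inj₁ (sub v p)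
    opn v (inj₂ p) = inj₂ p
    mono : ∀ {e} → e ∈ edges (plain S) → e ∈ edges (series S′ S₂)
    mono p with _ , q , refl ← ∈-map⁻ (mapE inj₁) p = first∈ S′ S₂ (edge-mono g q)
    new : ∀ {e} → JoinView S′ S₂ (link S′ S₂ ∷ []) e →
      e ∈ edges (plain S) ⊎ (Open (plain S) pd′ (src e) × Open (plain S) pd′ (tgt e))
    new (between (here refl)) = inj₂ (inj₁ (sub _ x∈) , inj₂ (λ ()))
    new (left {e} p) with edge-new g p
    ... | inj₁ q = inj₁ (∈-map⁺ (mapE inj₁) q)
    ... | inj₂ (a , b) = inj₂ (opn (src e) a , opn (tgt e) b)
    new (right p) = inj₂ (inj₂ (λ ()) , inj₂ (λ ()))

-- The hierarchy of blocks

private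
  pointShape : Shape Bool false
  pointShape = reshape single (λ _ → false) (λ { false → just tt ; true → nothing }) (λ _ → refl)
    not [] (λ { {false} _ → tt , refl , tt }) (λ _ → tt) (λ ())

  stickEdge : Edge Bool
  stickEdge = edge false true 1 false

  stickShape : Shape Bool false
  stickShape = reshape two (λ { (inj₁ _) → false ; (inj₂ _) → true }) (λ { false → just (inj₁ tt) ; true → just (inj₂ tt) })
    (λ { (inj₁ _) → refl ; (inj₂ _) → refl }) (λ _ → true) (stickEdge ∷ [])
    (λ { {false} _ → inj₁ tt , refl , tt ; {true} _ → inj₂ tt , refl , tt }) (λ _ → tt) (λ { (here refl) → _ , here refl , refl })
    where
    two : Shape (⊤ ⊎ ⊤) (inj₁ tt)
    two = join single single
      (bridge tt tt 1 false tt tt (last-visible single false) (last-visible single false) ∷ [])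
      (λ { (here refl) (here refl) _ (p , _) → n≮0 p })

  height : Bool → ℕ
  height false = 0
  height true = 1

  height-lip : Lips height (edges stickShape)
  height-lip (here refl) = z≤n , ≤-refl

  stickCover : Tour (edges stickShape) false true 1 (In stickShape)
  stickCover = weaken (λ { {false} _ → inj₁ refl ; {true} _ → inj₂ refl }) (stepT (here refl))

  stickReturn : Tour (edges stickShape) true false 1 (λ _ → ⊥)
  stickReturn = weaken (λ ()) (revT (stepT (here refl)))

  baseShape : Bool → Shape Bool false
  baseShape false = pointShape
  baseShape true = stickShape

  baseCore : Core
  baseCore = record
    { V = Bool ; dec = _≟ᵇ_ ; root = false ; n = 1 ; m = 2 ; Λ = 1
    ; 1≤n = ≤-refl ; 1≤m = s≤s z≤n ; m≤2n = ≤-refl ; 1≤Λ = ≤-refl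
    ; St = Bool ; start = false ; sh = baseShape ; pd = λ { false → not ; true → id }
    ; pd⊆ = λ { {false} {false} _ → tt ; {true} _ → tt }
    ; pd-last = λ { false → tt ; true → tt }
    ; Φ = λ { false _ → 0 ; true v → height v }
    ; Φ-lip = λ { false () ; true → height-lip }
    ; Φ-start = refl
    ; cc = λ { false → 0 ; true → 1 } ; rr = λ { false → 0 ; true → 1 }
    ; cover = λ { false → weaken (λ { {false} _ → refl ; {true} () }) (stayT false) ; true → stickCover }
    ; return = λ { false → weaken (λ ()) (stayT false) ; true → stickReturn }
    ; cc≤Λ = λ { false → z≤n ; true → ≤-refl } ; rr≤Λ = λ { false → z≤n ; true → ≤-refl }
    ; rank = λ { false → 1 ; true → 0 }
    }

  baseStep : ∀ s x → T (Core.pd baseCore s x) → Outcome baseCore s x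
  baseStep false false _ = next true
    (record { inV-mono = λ _ → tt ; edge-mono = λ () ; edge-new = λ { (here refl) → inj₂ (inj₁ tt , inj₂ (λ ())) } })
    (λ { {true} _ → inj₂ (λ ()) }) z≤n ≤-refl
  baseStep true true _ = done
    (record { shape = stickShape ; cc = 1 ; rr = 1 ; X = 1 ; cover = stickCover ; return = stickReturn
            ; h = height ; h-lip = height-lip ; h-root = refl ; h-last = refl ; cc≤Λ = ≤-refl ; 1≤rr = ≤-refl ; quality = ≤-refl })
    (grow-refl stickShape _) refl ≤-refl

level : ℕ → Proc
level zero = record { core = baseCore ; step = baseStep }
level (suc k) = LiftStep.lift (level k)

-- On level k the ratio m/n is 2 (19/20)^k. The weaker bound 38/(19 + k) follows by induction from
-- 19 (20 + k) ≤ 20 (19 + k) and is sufficient.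
quality-limit : ∀ N → ∃[ k ] N * Core.m (Proc.core (level k)) ≤ Core.n (Proc.core (level k))
quality-limit N = 38 * N , *-cancelˡ-≤ 38 (≤-trans (≤-reflexive (sym (*-assoc 38 N _)))
  (≤-trans (*-monoˡ-≤ (M (38 * N)) (m≤n+m (38 * N) 19)) (bound (38 * N))))
  where
  M Q : ℕ → ℕ
  M k = Core.m (Proc.core (level k))
  Q k = Core.n (Proc.core (level k))
  bound : ∀ k → (19 + k) * M k ≤ 38 * Q k
  bound zero = ≤-refl
  bound (suc k) = lin (k * M k) (eq k (M k) (Q k)) (*-monoʳ-≤ 20 (bound k))
    where
    eq : ∀ k m n → (20 + k) * (19 * m) + 20 * (38 * n) + k * m ≡ 38 * (20 * n) + 20 * ((19 + k) * m)
    eq = solveℕ 3 (λ k m n → (lit 20 ⊕ k) ⊗ (lit 19 ⊗ m) ⊕ lit 20 ⊗ (lit 38 ⊗ n) ⊕ k ⊗ m ⊜ lit 38 ⊗ (lit 20 ⊗ n) ⊕ lit 20 ⊗ ((lit 19 ⊕ k) ⊗ m)) refl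

-- The adversary against a ratio below 10/3

module Endgame (N n m Λ : ℕ) (1≤n : 1 ≤ n) (few : 6 * (N * m) ≤ n) where

  private
    instance
      n-nonZero : NonZero n
      n-nonZero = >-nonZero 1≤n

    final : ∀ {κ Φ} → 2 * (n * (10 * (N * κ))) ≤ 2 * (n * (3 * (N * Φ) + κ)) → 10 * (N * κ) ≤ 3 * (N * Φ) + κ
    final le = *-cancelˡ-≤ n (*-cancelˡ-≤ 2 le)

  -- a ring closes while the agent is at its first turn
  ring-ratio : ∀ {k X a c o w t} → 1 ≤ N → 4 * (n * k) ≤ n * X + (n + m) * (a + c) → a + c ≤ k → a ≤ o + Λ → t ≤ Λ → 14 * Λ ≤ c →
    10 * (N * (k + t)) ≤ 3 * (N * (X + w + (c + o) + 1)) + (k + t)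
  ring-ratio {k} {X} {a} {c} {o} {w} {t} 1≤N q S≤k a≤ t≤ c≥ =
    ≤-trans (≤-reflexive (swap N 10 (k + t)))
      (≤-trans (*-monoʳ-≤ N plain) (≤-trans (≤-reflexive (swap′ N (X + w + (c + o)))) (≤-trans (*-monoʳ-≤ 3 (*-monoʳ-≤ N (m≤m+n _ 1))) (m≤m+n _ _))))
    where
    swap : ∀ N a b → a * (N * b) ≡ N * (a * b)
    swap = solveℕ 3 (λ N a b → a ⊗ (N ⊗ b) ⊜ N ⊗ (a ⊗ b)) refl
    swap′ : ∀ N b → N * (3 * b) ≡ 3 * (N * b)
    swap′ = solveℕ 2 (λ N b → N ⊗ (lit 3 ⊗ b) ⊜ lit 3 ⊗ (N ⊗ b)) refl
    few′ : 6 * m ≤ n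
    few′ = ≤-trans (*-monoʳ-≤ 6 (≤-trans (≤-reflexive (sym (*-identityˡ m))) (*-monoˡ-≤ m 1≤N))) few
    eq : ∀ n m k X a c o w t Λ → 2 * (n * (10 * (k + t))) +
      (6 * (n * X + (n + m) * (a + c)) + 3 * (n * k) + 6 * (n * (o + Λ)) + 20 * (n * Λ) + 2 * (n * c) + n * (a + c)) +
      (2 * (n * a) + n * k + 2 * (n * Λ) + 6 * (n * w))
      ≡ 2 * (n * (3 * (X + w + (c + o)))) +
      (6 * (4 * (n * k)) + 3 * (n * (a + c)) + 6 * (n * a) + 20 * (n * t) + 2 * (n * (14 * Λ)) + 6 * m * (a + c))
    eq = solveℕ 10 (λ n m k X a c o w t Λ → lit 2 ⊗ (n ⊗ (lit 10 ⊗ (k ⊕ t))) ⊕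
      (lit 6 ⊗ (n ⊗ X ⊕ (n ⊕ m) ⊗ (a ⊕ c)) ⊕ lit 3 ⊗ (n ⊗ k) ⊕ lit 6 ⊗ (n ⊗ (o ⊕ Λ)) ⊕ lit 20 ⊗ (n ⊗ Λ) ⊕ lit 2 ⊗ (n ⊗ c) ⊕ n ⊗ (a ⊕ c)) ⊕
      (lit 2 ⊗ (n ⊗ a) ⊕ n ⊗ k ⊕ lit 2 ⊗ (n ⊗ Λ) ⊕ lit 6 ⊗ (n ⊗ w))
      ⊜ lit 2 ⊗ (n ⊗ (lit 3 ⊗ (X ⊕ w ⊕ (c ⊕ o)))) ⊕
      (lit 6 ⊗ (lit 4 ⊗ (n ⊗ k)) ⊕ lit 3 ⊗ (n ⊗ (a ⊕ c)) ⊕ lit 6 ⊗ (n ⊗ a) ⊕ lit 20 ⊗ (n ⊗ t) ⊕ lit 2 ⊗ (n ⊗ (lit 14 ⊗ Λ)) ⊕ lit 6 ⊗ m ⊗ (a ⊕ c))) refl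
    plain : 10 * (k + t) ≤ 3 * (X + w + (c + o))
    plain = *-cancelˡ-≤ n (*-cancelˡ-≤ 2 (lin _ (eq n m k X a c o w t Λ)
      (+-mono-≤ (+-mono-≤ (+-mono-≤ (+-mono-≤ (+-mono-≤ (*-monoʳ-≤ 6 q) (*-monoʳ-≤ 3 (*-monoʳ-≤ n S≤k))) (*-monoʳ-≤ 6 (*-monoʳ-≤ n a≤)))
        (*-monoʳ-≤ 20 (*-monoʳ-≤ n t≤))) (*-monoʳ-≤ 2 (*-monoʳ-≤ n c≥))) (*-monoˡ-≤ (a + c) few′))))

  -- the ring closes at the end of one of the two late arms
  ring-ratio₂ : ∀ {k X a p o b c e w t} → 4 * (n * k) ≤ n * X + (n + m) * (a + p + (b + c)) → a + p + (b + c) ≤ k →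
    a ≤ o + Λ → t ≤ 3 * Λ → b ≤ w → 3 * e ≤ p → 2 * e ≤ b + c → 100 * (N * Λ) ≤ p →
    10 * (N * (k + e + t)) ≤ 3 * (N * (X + w + (o + (p + c)) + 1)) + (k + e + t)
  ring-ratio₂ {k} {X} {a} {p} {o} {b} {c} {e} {w} {t} q S≤k a≤ t≤ b≤w e≤p e≤u p≥ =
    ≤-trans (final {k + e + t} {X + w + (o + (p + c))} (lin _ (eq N n m k X a p o b c e w t Λ)
      (+-mono-≤ (+-mono-≤ (+-mono-≤ (+-mono-≤ (+-mono-≤ (+-mono-≤ (+-mono-≤ (+-mono-≤ (+-mono-≤ (*-monoʳ-≤ 6 (*-monoʳ-≤ N q))
        (*-monoʳ-≤ 4 (*-monoʳ-≤ N (*-monoʳ-≤ n S≤k)))) (*-monoʳ-≤ 20 (*-monoʳ-≤ N (*-monoʳ-≤ n t≤))))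
        (*-monoʳ-≤ 2 (*-monoʳ-≤ N (*-monoʳ-≤ n a≤)))) (*-monoʳ-≤ 4 (*-monoʳ-≤ N (*-monoʳ-≤ n e≤p))))
        (*-monoʳ-≤ 4 (*-monoʳ-≤ N (*-monoʳ-≤ n e≤u)))) (*-monoʳ-≤ 6 (*-monoʳ-≤ N (*-monoʳ-≤ n b≤w))))
        (*-monoʳ-≤ n p≥)) (*-monoˡ-≤ (a + p + (b + c)) few)) (*-monoʳ-≤ 2 (*-monoʳ-≤ n S≤k)))))
      (+-monoˡ-≤ (k + e + t) (*-monoʳ-≤ 3 (*-monoʳ-≤ N (m≤m+n _ 1))))
    where
    eq : ∀ N n m k X a p o b c e w t Λ → 2 * (n * (10 * (N * (k + e + t)))) +
      (6 * (N * (n * X + (n + m) * (a + p + (b + c)))) + 4 * (N * (n * k)) + 20 * (N * (n * (3 * Λ))) + 2 * (N * (n * (o + Λ))) +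
        4 * (N * (n * p)) + 4 * (N * (n * (b + c))) + 6 * (N * (n * w)) + n * p + n * (a + p + (b + c)) + 2 * (n * k)) +
      (4 * (N * (n * o)) + 38 * (N * (n * Λ)) + n * (a + b + c) + 2 * (n * (e + t)))
      ≡ 2 * (n * (3 * (N * (X + w + (o + (p + c)))) + (k + e + t))) +
      (6 * (N * (4 * (n * k))) + 4 * (N * (n * (a + p + (b + c)))) + 20 * (N * (n * t)) + 2 * (N * (n * a)) +
        4 * (N * (n * (3 * e))) + 4 * (N * (n * (2 * e))) + 6 * (N * (n * b)) + n * (100 * (N * Λ)) +
        6 * (N * m) * (a + p + (b + c)) + 2 * (n * (a + p + (b + c))))
    eq = solveℕ 14 (λ N n m k X a p o b c e w t Λ → lit 2 ⊗ (n ⊗ (lit 10 ⊗ (N ⊗ (k ⊕ e ⊕ t)))) ⊕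
      (lit 6 ⊗ (N ⊗ (n ⊗ X ⊕ (n ⊕ m) ⊗ (a ⊕ p ⊕ (b ⊕ c)))) ⊕ lit 4 ⊗ (N ⊗ (n ⊗ k)) ⊕ lit 20 ⊗ (N ⊗ (n ⊗ (lit 3 ⊗ Λ))) ⊕ lit 2 ⊗ (N ⊗ (n ⊗ (o ⊕ Λ))) ⊕
        lit 4 ⊗ (N ⊗ (n ⊗ p)) ⊕ lit 4 ⊗ (N ⊗ (n ⊗ (b ⊕ c))) ⊕ lit 6 ⊗ (N ⊗ (n ⊗ w)) ⊕ n ⊗ p ⊕ n ⊗ (a ⊕ p ⊕ (b ⊕ c)) ⊕ lit 2 ⊗ (n ⊗ k)) ⊕
      (lit 4 ⊗ (N ⊗ (n ⊗ o)) ⊕ lit 38 ⊗ (N ⊗ (n ⊗ Λ)) ⊕ n ⊗ (a ⊕ b ⊕ c) ⊕ lit 2 ⊗ (n ⊗ (e ⊕ t)))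
      ⊜ lit 2 ⊗ (n ⊗ (lit 3 ⊗ (N ⊗ (X ⊕ w ⊕ (o ⊕ (p ⊕ c)))) ⊕ (k ⊕ e ⊕ t))) ⊕
      (lit 6 ⊗ (N ⊗ (lit 4 ⊗ (n ⊗ k))) ⊕ lit 4 ⊗ (N ⊗ (n ⊗ (a ⊕ p ⊕ (b ⊕ c)))) ⊕ lit 20 ⊗ (N ⊗ (n ⊗ t)) ⊕ lit 2 ⊗ (N ⊗ (n ⊗ a)) ⊕
        lit 4 ⊗ (N ⊗ (n ⊗ (lit 3 ⊗ e))) ⊕ lit 4 ⊗ (N ⊗ (n ⊗ (lit 2 ⊗ e))) ⊕ lit 6 ⊗ (N ⊗ (n ⊗ b)) ⊕ n ⊗ (lit 100 ⊗ (N ⊗ Λ)) ⊕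
        lit 6 ⊗ (N ⊗ m) ⊗ (a ⊕ p ⊕ (b ⊕ c)) ⊕ lit 2 ⊗ (n ⊗ (a ⊕ p ⊕ (b ⊕ c))))) refl

  -- the ring closes behind the agent, who still has to visit the end of the other late arm and to return
  detour-ratio : ∀ {k X o p b c w t} → 4 * (n * k) ≤ n * X + (n + m) * (o + p + (b + c)) → o + p + (b + c) ≤ k →
    o ≤ 14 * Λ → t ≤ 3 * Λ → b ≤ w → 3 * b ≤ p → p ≤ 3 * c → 100 * (N * Λ) ≤ p →
    10 * (N * (k + b + t)) ≤ 3 * (N * (X + w + (c + b) + (c + b))) + (k + b + t)
  detour-ratio {k} {X} {o} {p} {b} {c} {w} {t} q S≤k o≤ t≤ b≤w b≤p p≤c p≥ =
    final {k + b + t} {X + w + (c + b) + (c + b)} (lin _ (eq N n m k X o p b c w t Λ)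
      (+-mono-≤ (+-mono-≤ (+-mono-≤ (+-mono-≤ (+-mono-≤ (+-mono-≤ (+-mono-≤ (+-mono-≤ (+-mono-≤ (*-monoʳ-≤ 6 (*-monoʳ-≤ N q))
        (*-monoʳ-≤ 4 (*-monoʳ-≤ N (*-monoʳ-≤ n S≤k)))) (*-monoʳ-≤ 20 (*-monoʳ-≤ N (*-monoʳ-≤ n t≤))))
        (*-monoʳ-≤ 2 (*-monoʳ-≤ N (*-monoʳ-≤ n o≤)))) (*-monoʳ-≤ 2 (*-monoʳ-≤ N (*-monoʳ-≤ n p≤c))))
        (*-monoʳ-≤ 4 (*-monoʳ-≤ N (*-monoʳ-≤ n b≤c)))) (*-monoʳ-≤ 6 (*-monoʳ-≤ N (*-monoʳ-≤ n b≤w))))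
        (*-monoʳ-≤ n p≥)) (*-monoˡ-≤ (o + p + (b + c)) few)) (*-monoʳ-≤ 2 (*-monoʳ-≤ n S≤k))))
    where
    b≤c : b ≤ c
    b≤c = *-cancelˡ-≤ 3 (≤-trans b≤p p≤c)
    eq : ∀ N n m k X o p b c w t Λ → 2 * (n * (10 * (N * (k + b + t)))) +
      (6 * (N * (n * X + (n + m) * (o + p + (b + c)))) + 4 * (N * (n * k)) + 20 * (N * (n * (3 * Λ))) + 2 * (N * (n * (14 * Λ))) +
        2 * (N * (n * (3 * c))) + 4 * (N * (n * c)) + 6 * (N * (n * w)) + n * p + n * (o + p + (b + c)) + 2 * (n * k)) +
      (12 * (N * (n * Λ)) + n * (o + b + c) + 2 * (n * (b + t)))
      ≡ 2 * (n * (3 * (N * (X + w + (c + b) + (c + b))) + (k + b + t))) +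
      (6 * (N * (4 * (n * k))) + 4 * (N * (n * (o + p + (b + c)))) + 20 * (N * (n * t)) + 2 * (N * (n * o)) +
        2 * (N * (n * p)) + 4 * (N * (n * b)) + 6 * (N * (n * b)) + n * (100 * (N * Λ)) +
        6 * (N * m) * (o + p + (b + c)) + 2 * (n * (o + p + (b + c))))
    eq = solveℕ 12 (λ N n m k X o p b c w t Λ → lit 2 ⊗ (n ⊗ (lit 10 ⊗ (N ⊗ (k ⊕ b ⊕ t)))) ⊕
      (lit 6 ⊗ (N ⊗ (n ⊗ X ⊕ (n ⊕ m) ⊗ (o ⊕ p ⊕ (b ⊕ c)))) ⊕ lit 4 ⊗ (N ⊗ (n ⊗ k)) ⊕ lit 20 ⊗ (N ⊗ (n ⊗ (lit 3 ⊗ Λ))) ⊕ lit 2 ⊗ (N ⊗ (n ⊗ (lit 14 ⊗ Λ))) ⊕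
        lit 2 ⊗ (N ⊗ (n ⊗ (lit 3 ⊗ c))) ⊕ lit 4 ⊗ (N ⊗ (n ⊗ c)) ⊕ lit 6 ⊗ (N ⊗ (n ⊗ w)) ⊕ n ⊗ p ⊕ n ⊗ (o ⊕ p ⊕ (b ⊕ c)) ⊕ lit 2 ⊗ (n ⊗ k)) ⊕
      (lit 12 ⊗ (N ⊗ (n ⊗ Λ)) ⊕ n ⊗ (o ⊕ b ⊕ c) ⊕ lit 2 ⊗ (n ⊗ (b ⊕ t)))
      ⊜ lit 2 ⊗ (n ⊗ (lit 3 ⊗ (N ⊗ (X ⊕ w ⊕ (c ⊕ b) ⊕ (c ⊕ b))) ⊕ (k ⊕ b ⊕ t))) ⊕
      (lit 6 ⊗ (N ⊗ (lit 4 ⊗ (n ⊗ k))) ⊕ lit 4 ⊗ (N ⊗ (n ⊗ (o ⊕ p ⊕ (b ⊕ c)))) ⊕ lit 20 ⊗ (N ⊗ (n ⊗ t)) ⊕ lit 2 ⊗ (N ⊗ (n ⊗ o)) ⊕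
        lit 2 ⊗ (N ⊗ (n ⊗ p)) ⊕ lit 4 ⊗ (N ⊗ (n ⊗ b)) ⊕ lit 6 ⊗ (N ⊗ (n ⊗ b)) ⊕ n ⊗ (lit 100 ⊗ (N ⊗ Λ)) ⊕
        lit 6 ⊗ (N ⊗ m) ⊗ (o ⊕ p ⊕ (b ⊕ c)) ⊕ lit 2 ⊗ (n ⊗ (o ⊕ p ⊕ (b ⊕ c))))) refl

-- A final position of the game, where Φ root bounds the cost of the algorithm.
record Final (N : ℕ) (V : Set) (r : V) : Set where
  field
    shape : Shape V r
    κ     : ℕ
    tour  : Tour (edges shape) r r κ (In shape)
    Φ     : V → ℕ
    Φ-lip : Lips Φ (edges shape)
    ratio : 10 * (N * κ) ≤ 3 * (N * Φ r) + κ
    low′  : V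
    low∈  : In shape low′
    low<  : Φ low′ < Φ r

-- `reach` supplies a walk through all vertices, from which the vertex list and the connectedness of
-- the instance are obtained. By `status` a position without pending vertices is decided: its ratio
-- is at least 10/3 - 1/(3N), and the vertex with a smaller potential than the root shows that the
-- optimum is positive.
record Game (N : ℕ) : Set₁ where
  field
    V       : Set
    dec     : (u v : V) → Dec (u ≡ v)
    root    : V
    St      : Set
    start   : St
    sh      : St → Shape V root
    pd      : St → V → Bool
    pd⊆     : ∀ {s v} → T (pd s v) → In (sh s) v
    Φ       : St → V → ℕ
    Φ-lip   : ∀ s → Lips (Φ s) (edges (sh s))
    reach   : ∀ s → ∃[ u ] ∃[ k ] Tour (edges (sh s)) root u k (In (sh s))
    rank    : St → ℕ
    Φ-start  : Φ start root ≡ 0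
    pd-start : ¬ T (pd start root)
    step    : ∀ s x → T (pd s x) → ∃[ s′ ] Grow (sh s) (sh s′) (pd s) × Pend (sh s) (pd s) (pd s′) x ×
              Φ s′ x ≤ Φ s x × rank s′ < rank s
    status  : ∀ s → (∃[ v ] T (pd s v)) ⊎
              (∃[ κ ] Tour (edges (sh s)) root root κ (In (sh s)) × 10 * (N * κ) ≤ 3 * (N * Φ s root) + κ ×
               (∃[ v ] In (sh s) v × Φ s v < Φ s root))

module Top (N : ℕ) (1≤N : 1 ≤ N) (P : Proc)
  (few : 6 * (N * Core.m (Proc.core P)) ≤ Core.n (Proc.core P)) where
  open Proc P
  open Core core
  open Chain core
  open Arms P
  open Plain {C} {Fork C} {croot}
  open Series {C} {Fork C} {croot} {hub}
  open Endgame N n m Λ 1≤n few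

  X : Set
  X = C ⊎ Fork C

  ρ : X
  ρ = inj₁ croot

  oS : O → Shape X ρ
  oS A = plain (oC A)

  kS : K → Shape X ρ
  kS A = plain (kC A)

  UO DO : O → X → ℕ
  UO A = [ uO A , (λ _ → 0) ]′
  DO A = [ dO A , (λ _ → 0) ]′

  UK : K → X → ℕ
  UK A = [ uK A , (λ _ → 0) ]′

  openPd : O → X → Bool
  openPd A = [ oPd A , (λ _ → false) ]′

  noPd : X → Bool
  noPd _ = false

  innerPd : (Fork C → Bool) → X → Bool
  innerPd p = [ (λ _ → false) , p ]′

  abstract

    -- The additive errors of the endgame are bounded multiples of `Λ`. Against a strand of this
    -- length they are a fraction of order 1/N.
    Reach : ℕ
    Reach = 100 * (N * Λ)

    Reach≡ : Reach ≡ 100 * (N * Λ)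
    Reach≡ = refl

    Limit : ℕ
    Limit = Reach + 14 * Λ

    Limit≡ : Limit ≡ Reach + 14 * Λ
    Limit≡ = refl

    100Λ≤ : 100 * Λ ≤ Reach
    100Λ≤ = *-monoʳ-≤ 100 (≤-trans (≤-reflexive (sym (*-identityˡ Λ))) (*-monoˡ-≤ Λ 1≤N))

  final : Set
  final = Final N (Fork X) hub

  pairφ : Bool → O → O → Fork C → ℕ
  pairφ g A B = pairΦ croot g 0 (uO A) (dO B)

  lateQ : K → Bool → O → O → X → ℕ
  lateQ M g A B = [ (λ v → dK M v + pairφ g A B hub) , pairφ g A B ]′

  waitQ : K → X → ℕ
  waitQ M = [ dK M , (λ _ → 0) ]′

  -- If the ring is closed now, the agent has paid about 4k and the optimum is at most about k + e,
  -- where e is the length of the shorter arm, walked twice. Both arms are at most a third of the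
  -- long strand, so 3e ≤ p and 2e ≤ a + b; hence 5e ≤ k and 4k/(k + e) ≥ 10/3.
  record Late (M : K) (a b w : ℕ) : Set where
    field
      a≤ : 3 * a ≤ lenK M
      b≤ : 3 * b ≤ lenK M
      a≤w : a ≤ w

  -- The tie takes the optimum home from the arm of length `b`, while the agent still walks `a + b`
  -- to the end of the other arm and as much again to come home. Together with `a ≤ w` this makes
  -- about 4k - p + b + 2a, with p = `lenK M`. For k ≥ p + a + b and 3a ≤ p ≤ 3b it is at least 10/3
  -- times k + a.
  record Closing (M : K) (a b w : ℕ) : Set where
    field
      a≤ : 3 * a ≤ lenK M
      ≤b : lenK M ≤ 3 * b
      b≤ : b ≤ lenK M
      a≤w : a ≤ w

  -- opening: the strands A and B grow at the origin.  forked: the long strand has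
  -- been stopped, its last block ends in a second hub.  late: the strands A′ and B′
  -- grow there.  closing: the end of B′ has been tied to the end of A, and the agent
  -- still has to visit the end of A′.
  data TSt : Set where
    opening : (f : Bool) (A B : O) (w : ℕ) → lenO A ≤ 14 * Λ → lenO B ≤ Reach → TSt
    forked  : (f : Bool) (A : O) (M : K) (w : ℕ) → lenO A ≤ 14 * Λ → Reach ≤ lenK M → TSt
    late    : (f : Bool) (A : O) (M : K) (g : Bool) (A′ B′ : O) (w : ℕ) →
              lenO A ≤ 14 * Λ → Reach ≤ lenK M → Late M (lenO A′) (lenO B′) w → TSt
    closing : (f : Bool) (A : O) (M : K) (g : Bool) (A′ : O) (B′ : K) (w : ℕ) →
              lenO A ≤ 14 * Λ → Reach ≤ lenK M → Closing M (lenO A′) (lenK B′) w → TSt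
    ended   : final → TSt

  inner : K → Bool → O → O → Shape X ρ
  inner M g A B = series (kC M) (fork g (oC A) (oC B) nothing)

  inner′ : K → Bool → O → K → Shape X ρ
  inner′ M g A B = series (kC M) (fork g (oC A) (kC B) nothing)

  closed : Bool → (A B : Shape X ρ) → Shape (Fork X) hub
  closed f A B = fork f A B (just (last-target B))

  shT : TSt → Shape (Fork X) hub
  shT (opening f A B _ _ _) = fork f (oS A) (oS B) nothing
  shT (forked f A M _ _ _) = fork f (oS A) (series (kC M) hubShape) nothing
  shT (late f A M g A′ B′ _ _ _ _) = fork f (oS A) (inner M g A′ B′) nothing
  shT (closing f A M g A′ B′ _ _ _ _) = closed f (oS A) (inner′ M g A′ B′)
  shT (ended F) = Final.shape F

  pdT : TSt → Fork X → Bool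
  pdT (opening f A B _ _ _) = forkPd f (openPd A) (openPd B)
  pdT (forked f A M _ _ _) = forkPd f (openPd A) (innerPd hubPd)
  pdT (late f A M g A′ B′ _ _ _ _) = forkPd f (openPd A) (innerPd (forkPd g (oPd A′) (oPd B′)))
  pdT (closing f A M g A′ B′ _ _ _ _) = forkPd f noPd (innerPd (forkPd g (oPd A′) (λ _ → false)))
  pdT (ended F) = λ _ → false

  openingκ : O → O → ℕ → ℕ
  openingκ A B w = costO A + costO B + w

  forkedκ : O → K → ℕ → ℕ
  forkedκ A M w = costO A + costK M + w

  lateκ : O → K → O → O → ℕ → ℕ
  lateκ A M A′ B′ w = costO A + costK M + (costO A′ + costO B′) + w

  closingκ : O → K → O → K → ℕ → ℕ
  closingκ A M A′ B′ w = costO A + costK M + (costO A′ + costK B′) + w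

  -- The distance from the unvisited end of the arm A′ along the tree.
  module Detour (f : Bool) (A : O) (M : K) (g : Bool) (A′ : O) (B′ : K) where
    b : ℕ
    b = lenO A′

    whole : ℕ
    whole = lenK B′ + b

    treeA treeB : X → ℕ
    treeA = [ (λ v → b + lenK M + u₀ A v) , (λ _ → 0) ]′
    treeB = [ (λ v → dK M v + b) , forkMap b g (d₀ A′) (λ v → b + uK B′ v) ]′

    -- The cap at `whole` takes account of the tie: along the tree the end of `A` is at least this
    -- far away, so after capping the two tied ends have the same value.
    dA dB : X → ℕ
    dA x = whole ⊓ treeA x
    dB x = whole ⊓ treeB x

    d : Fork X → ℕ
    d = forkMap (whole ⊓ (b + lenK M)) f dA dB

    treeA-lip : Lips treeA (edges (oS A))
    treeA-lip = plain-lip {oC A} {p = λ v → b + lenK M + u₀ A v} {y = λ _ → 0}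
      (λ {e} p → lip-shift {p = u₀ A} (b + lenK M) {e} (u₀-lip A p))

    treeB-lip : Lips treeB (edges (inner′ M g A′ B′))
    treeB-lip = series-lip (kC M) (fork g (oC A′) (kC B′) nothing)
      (λ {e} p → lip-shiftʳ {p = dK M} b {e} (Closed.lip-down (proj₁ M) (proj₂ M) p))
      (fork-lip g (oC A′) (kC B′) nothing {b} {d₀ A′} {λ v → b + uK B′ v} (d₀-lip A′)
        (λ {e} p → lip-shift {p = uK B′} b {e} (Closed.lip-up (proj₁ B′) (proj₂ B′) p))
        (d₀-root A′) (trans (cong (b +_) (Closed.up-at-root (proj₁ B′) (proj₂ B′))) (+-identityʳ b)) (λ _ ()))
      (cong (_+ b) (Closed.down-at-last (proj₁ M) (proj₂ M)))

    end : dB (last (inner′ M g A′ B′)) ≡ whole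
    end = trans (cong (whole ⊓_) (trans (side-off g (d₀ A′) (λ v → b + uK B′ v) (last (kC B′)))
      (trans (cong (b +_) (Closed.up-at-last (proj₁ B′) (proj₂ B′))) (+-comm b (lenK B′))))) (⊓-idem whole)

    d-lip : lenK B′ ≤ lenK M → Lips d (edges (closed f (oS A) (inner′ M g A′ B′)))
    d-lip le = fork-lip f (oS A) (inner′ M g A′ B′) (just (last-target (inner′ M g A′ B′))) {whole ⊓ (b + lenK M)} {dA} {dB}
      (λ {e} p → lip-⊓ {p = treeA} whole {e} (treeA-lip p))
      (λ {e} p → lip-⊓ {p = treeB} whole {e} (treeB-lip p))
      (cong (whole ⊓_) (trans (cong (b + lenK M +_) (u₀-root A)) (+-identityʳ _)))
      (cong (whole ⊓_) (trans (cong (_+ b) (Closed.down-at-root (proj₁ M) (proj₂ M))) (+-comm (lenK M) b)))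
      (λ { t refl → trans (m≤n⇒m⊓n≡m (≤-trans (≤-trans (≤-reflexive (+-comm (lenK B′) b)) (+-monoʳ-≤ b le))
        (m≤m+n _ (u₀ A (last (oC A)))))) (sym end) })

    at-hub : lenK B′ ≤ lenK M → d hub ≡ whole
    at-hub le = m≤n⇒m⊓n≡m (≤-trans (≤-reflexive (+-comm (lenK B′) b)) (+-monoʳ-≤ b le))

    at-tip : ∀ {v} → T (oPd A′ v) → d (arm (not f) (inj₂ (arm g v))) ≡ 0
    at-tip {v} t = trans (side-off f dA dB (inj₂ (arm g v))) (trans (cong (whole ⊓_)
      (trans (side-at g (d₀ A′) (λ v → b + uK B′ v) v) (tip A′ t))) (⊓-zeroʳ whole))
      where
      tip : ∀ A′ {v} → T (oPd A′ v) → d₀ A′ v ≡ 0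
      tip (ds , s) {i , v} t with refl , _ ← pdC-tip (pd s) ds t = down-tip (λ _ → 0) ds v

    at-end : d (arm (not f) (last (inner′ M g A′ B′))) ≡ whole
    at-end = trans (side-off f dA dB _) end

  ΦT : TSt → Fork X → ℕ
  ΦT (opening f A B w _ _) = pairΦ ρ f (openingκ A B w) (UO A) (DO B)
  ΦT (forked f A M w _ _) = pairΦ ρ f (forkedκ A M w) (UO A) (waitQ M)
  ΦT (late f A M g A′ B′ w _ _ _) = pairΦ ρ f (lateκ A M A′ B′ w) (UO A) (lateQ M g A′ B′)
  ΦT (closing f A M g A′ B′ w _ _ _) v = closingκ A M A′ B′ w + (Detour.whole f A M g A′ B′ ∸ Detour.d f A M g A′ B′ v)
  ΦT (ended F) = Final.Φ F

  UO-lip : ∀ A → Lips (UO A) (edges (oS A))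
  UO-lip A = plain-lip {oC A} {p = uO A} {y = λ _ → 0} (uO-lip A)

  DO-lip : ∀ A → Lips (DO A) (edges (oS A))
  DO-lip A = plain-lip {oC A} {p = dO A} {y = λ _ → 0} (dO-lip A)

  UK-lip : ∀ A → Lips (UK A) (edges (kS A))
  UK-lip A@(ds , δ) = plain-lip {kC A} {p = uK A} {y = λ _ → 0} (Closed.lip-up ds δ)

  waitQ-lip : ∀ M → Lips (waitQ M) (edges (series (kC M) hubShape))
  waitQ-lip M@(ds , δ) = series-lip (kC M) hubShape {q = λ _ → 0} (Closed.lip-down ds δ) (λ ()) (Closed.down-at-last ds δ)

  lateQ-lip : ∀ M g A B → Lips (lateQ M g A B) (edges (inner M g A B))
  lateQ-lip M@(ds , δ) g A B = series-lip (kC M) (fork g (oC A) (oC B) nothing)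
    (λ {e} p → lip-shiftʳ {p = dK M} (pairφ g A B hub) {e} (Closed.lip-down ds δ p))
    (pairΦ-lip croot g 0 (uO A) (dO B) {oC A} {oC B} (uO-lip A) (dO-lip B))
    (cong (_+ pairφ g A B hub) (Closed.down-at-last ds δ))

  ΦT-lip : ∀ s → Lips (ΦT s) (edges (shT s))
  ΦT-lip (opening f A B w _ _) = pairΦ-lip ρ f (openingκ A B w) (UO A) (DO B) {oS A} {oS B} (UO-lip A) (DO-lip B)
  ΦT-lip (forked f A M w _ _) = pairΦ-lip ρ f (forkedκ A M w) (UO A) (waitQ M) {oS A} {series (kC M) hubShape} (UO-lip A) (waitQ-lip M)
  ΦT-lip (late f A M g A′ B′ w _ _ _) = pairΦ-lip ρ f (lateκ A M A′ B′ w) (UO A) (lateQ M g A′ B′) {oS A} {inner M g A′ B′}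
    (UO-lip A) (lateQ-lip M g A′ B′)
  ΦT-lip (closing f A M g A′ B′ w _ _ I) {e} p = lip-shift {p = λ v → D.whole ∸ D.d v} (closingκ A M A′ B′ w) {e}
    (lip-∸ {p = D.d} D.whole {e} (D.d-lip (Closing.b≤ I) p))
    where module D = Detour f A M g A′ B′
  ΦT-lip (ended F) = Final.Φ-lip F

  oSCover : ∀ A → Tour (edges (oS A)) ρ (inj₁ (last (oC A))) (ccO A) (In (oS A))
  oSCover A = plain-cover (oC A) (oCover A)

  oSReturn : ∀ A → Tour (edges (oS A)) (inj₁ (last (oC A))) ρ (rrO A) (λ _ → ⊥)
  oSReturn A = plain-return (oC A) (oReturn A)

  kSCover : ∀ A → Tour (edges (kS A)) ρ (inj₁ (last (kC A))) (ccK A) (In (kS A))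
  kSCover A@(ds , δ) = plain-cover (kC A) (Closed.cover′ ds δ)

  hubCover : Tour (edges hubShape) hub hub 0 (In (hubShape {C}))
  hubCover = weaken (λ { {hub} _ → refl ; {arm _ _} () }) (stayT hub)

  forkedCover : ∀ M → Tour (edges (series (kC M) hubShape)) ρ (inj₂ hub) (ccK M + 0) (In (series (kC M) hubShape))
  forkedCover M@(ds , δ) = series-cover (kC M) hubShape (Closed.cover′ ds δ) hubCover

  innerCover : ∀ M g A B → Tour (edges (inner M g A B)) ρ (last (inner M g A B)) (ccK M + (ccO A + rrO A + ccO B)) (In (inner M g A B))
  innerCover M@(ds , δ) g A B = series-cover (kC M) (fork g (oC A) (oC B) nothing) (Closed.cover′ ds δ)
    (fork-cover g (oC A) (oC B) nothing (oCover A) (oReturn A) (oCover B))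

  innerCover′ : ∀ M g A B → Tour (edges (inner′ M g A B)) ρ (last (inner′ M g A B)) (ccK M + (ccO A + rrO A + ccK B)) (In (inner′ M g A B))
  innerCover′ M@(ds , δ) g A B@(es , ε) = series-cover (kC M) (fork g (oC A) (kC B) nothing) (Closed.cover′ ds δ)
    (fork-cover g (oC A) (kC B) nothing (oCover A) (oReturn A) (Closed.cover′ es ε))

  reachT : ∀ s → ∃[ u ] ∃[ k ] Tour (edges (shT s)) hub u k (In (shT s))
  reachT (opening f A B _ _ _) = _ , _ , fork-cover f (oS A) (oS B) nothing (oSCover A) (oSReturn A) (oSCover B)
  reachT (forked f A M _ _ _) = _ , _ , fork-cover f (oS A) (series (kC M) hubShape) nothing (oSCover A) (oSReturn A) (forkedCover M)
  reachT (late f A M g A′ B′ _ _ _ _) = _ , _ , fork-cover f (oS A) (inner M g A′ B′) nothing (oSCover A) (oSReturn A) (innerCover M g A′ B′)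
  reachT (closing f A M g A′ B′ _ _ _ _) = _ , _ , ring-tour f (oS A) (inner′ M g A′ B′) (oSCover A) (innerCover′ M g A′ B′)
  reachT (ended F) = _ , _ , Final.tour F

  R : ℕ
  R = rank start

  rankT : TSt → ℕ
  rankT (opening f A B _ _ _) = 5 + (R + R) + (Reach + Λ) * suc R + (rankO A + rankO B) + (Limit ∸ (lenO A + lenO B)) * suc R
  rankT (forked f A M _ _ _) = rankO A + 4 + (R + R) + lenK M * suc R
  rankT (late f A M g A′ B′ _ _ _ _) = rankO A + 3 + (rankO A′ + rankO B′) + (lenK M ∸ (lenO A′ + lenO B′)) * suc R
  rankT (closing f A M g A′ B′ _ _ _ _) = 1
  rankT (ended F) = 0

  open⊆ : ∀ A x → T (openPd A x) → In (oS A) x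
  open⊆ A (inj₁ _) = oPd⊆ A

  fork⊆ : ∀ f {Y : Set} {p q p′ q′ : Y → Bool} → (∀ x → T (p x) → T (p′ x)) → (∀ x → T (q x) → T (q′ x)) →
    ∀ v → T (forkPd f p q v) → T (forkMap true f p′ q′ v)
  fork⊆ false a b (arm false x) t = a x t
  fork⊆ false a b (arm true x) t = b x t
  fork⊆ true a b (arm false x) t = b x t
  fork⊆ true a b (arm true x) t = a x t

  inner⊆ : ∀ {S : Shape C croot} {S₂ : Shape (Fork C) hub} {p} → (∀ v → T (p v) → In S₂ v) → ∀ x → T (innerPd p x) → In (series S S₂) x
  inner⊆ h (inj₂ v) t = h v t

  pd⊆T : ∀ {s v} → T (pdT s v) → In (shT s) v
  pd⊆T {opening f A B _ _ _} {v} = fork⊆ f (open⊆ A) (open⊆ B) v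
  pd⊆T {forked f A M _ _ _} {v} = fork⊆ f (open⊆ A) (inner⊆ {kC M} {hubShape} (λ { hub _ → tt ; (arm _ _) () })) v
  pd⊆T {late f A M g A′ B′ _ _ _ _} {v} = fork⊆ f (open⊆ A)
    (inner⊆ {kC M} {fork g (oC A′) (oC B′) nothing} (fork⊆ g (λ _ → oPd⊆ A′) (λ _ → oPd⊆ B′))) v
  pd⊆T {closing f A M g A′ B′ _ _ _ _} {v} = fork⊆ f {p = noPd} {q = innerPd (forkPd g (oPd A′) (λ _ → false))} (λ _ ())
    (inner⊆ {kC M} {fork g (oC A′) (kC B′) nothing} (fork⊆ g (λ _ → oPd⊆ A′) (λ _ ()))) v

-- The opening phase at the origin

module TopStep (N : ℕ) (1≤N : 1 ≤ N) (P : Proc)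
  (few : 6 * (N * Core.m (Proc.core P)) ≤ Core.n (Proc.core P)) where
  open Proc P
  open Core core
  open Chain core
  open Arms P
  open Plain {C} {Fork C} {croot}
  open Series {C} {Fork C} {croot} {hub}
  open Endgame N n m Λ 1≤n few
  open Top N 1≤N P few

  Move : TSt → Fork X → Set
  Move s x = ∃[ s′ ] Grow (shT s) (shT s′) (pdT s) × Pend (shT s) (pdT s) (pdT s′) x × ΦT s′ x ≤ ΦT s x × rankT s′ < rankT s

  add : ∀ {k₁ X₁ l₁ k₂ X₂ l₂} → 4 * (n * k₁) ≤ n * X₁ + (n + m) * l₁ → 4 * (n * k₂) ≤ n * X₂ + (n + m) * l₂ →
    4 * (n * (k₁ + k₂)) ≤ n * (X₁ + X₂) + (n + m) * (l₁ + l₂)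
  add {k₁} {X₁} {l₁} {k₂} {X₂} {l₂} a b = subst₂ _≤_ (eq₁ n k₁ k₂) (eq₂ n m X₁ X₂ l₁ l₂) (+-mono-≤ a b)
    where
    eq₁ : ∀ n a b → 4 * (n * a) + 4 * (n * b) ≡ 4 * (n * (a + b))
    eq₁ = solveℕ 3 (λ n a b → lit 4 ⊗ (n ⊗ a) ⊕ lit 4 ⊗ (n ⊗ b) ⊜ lit 4 ⊗ (n ⊗ (a ⊕ b))) refl
    eq₂ : ∀ n m a b c d → n * a + (n + m) * c + (n * b + (n + m) * d) ≡ n * (a + b) + (n + m) * (c + d)
    eq₂ = solveℕ 6 (λ n m a b c d → n ⊗ a ⊕ (n ⊕ m) ⊗ c ⊕ (n ⊗ b ⊕ (n ⊕ m) ⊗ d) ⊜ n ⊗ (a ⊕ b) ⊕ (n ⊕ m) ⊗ (c ⊕ d)) refl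

  qualK : ∀ A → 4 * (n * ccK A) ≤ n * costK A + (n + m) * lenK A
  qualK (ds , δ) = Closed.quality′ ds δ

  qualO : ∀ A → 4 * (n * ccs (proj₁ A)) ≤ n * costO A + (n + m) * lenO A
  qualO (ds , s) = chain-quality ds

  len≤K : ∀ A → lenK A ≤ ccK A
  len≤K (ds , δ) = Closed.length≤ccs ds δ

  1≤lenK : ∀ A → 1 ≤ lenK A
  1≤lenK (ds , δ) = ≤-trans (Done.1≤rr δ) (m≤n+m _ (len ds))

  1≤14Λ : 1 ≤ 14 * Λ
  1≤14Λ = ≤-trans 1≤Λ (m≤m+n Λ _)

  Λ≤Reach : ∀ k → k ≤ 100 → k * Λ ≤ Reach
  Λ≤Reach k le = ≤-trans (*-monoˡ-≤ Λ le) 100Λ≤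

  grow-open : ∀ {A A′ : O} → Grow (oC A) (oC A′) (oPd A) → Grow (oS A) (oS A′) (openPd A)
  grow-open {A} = plain-grow {pd′ = openPd A} (λ _ → id)

  grow-close : ∀ {A : O} {A′ : K} → Grow (oC A) (kC A′) (oPd A) → Grow (oS A) (kS A′) (openPd A)
  grow-close {A} = plain-grow {pd′ = openPd A} (λ _ → id)

  module Ring (f : Bool) (A B : Shape X ρ) (hA hB : X → ℕ) (lA : Lips hA (edges A)) (lB : Lips hB (edges B))
    (rA : hA ρ ≡ 0) (rB : hB ρ ≡ 0) (eA : 1 ≤ hA (last A)) (eB : 1 ≤ hB (last B)) (k j : ℕ)
    (tA : Tour (edges A) ρ (last A) k (In A)) (tB : Tour (edges B) ρ (last B) j (In B))
    (c : ℕ) (bound : 10 * (N * (k + j)) ≤ 3 * (N * (c + 1)) + (k + j)) where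

    -- Only one unit of the way home is charged. The cap at 1 makes the potential equal at the two
    -- tied ends whatever their distances from the hub, and the drop from `c + 1` at the hub to `c`
    -- shows that the optimum is positive.
    pA pB : X → ℕ
    pA x = c + (1 ∸ (1 ⊓ hA x))
    pB x = c + (1 ∸ (1 ⊓ hB x))

    private
      one : ∀ {a} → 1 ≤ a → c + (1 ∸ (1 ⊓ a)) ≡ c
      one le = trans (cong (λ b → c + (1 ∸ b)) (m≤n⇒m⊓n≡m le)) (+-identityʳ c)

      lips : ∀ {S : Shape X ρ} {h : X → ℕ} → Lips h (edges S) → Lips (λ x → c + (1 ∸ (1 ⊓ h x))) (edges S)
      lips {S} {h} l {e} p = lip-shift {p = λ x → 1 ∸ (1 ⊓ h x)} c {e} (lip-∸ {p = λ x → 1 ⊓ h x} 1 {e} (lip-⊓ {p = h} 1 {e} (l p)))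

    at-last : forkMap (c + 1) f pA pB (arm f (last A)) ≡ c
    at-last = trans (side-at f pA pB (last A)) (one eA)

    result : final
    result = record
      { shape = closed f A B ; κ = k + j ; tour = ring-tour f A B tA tB
      ; Φ = forkMap (c + 1) f pA pB
      ; Φ-lip = fork-lip f A B (just (last-target B)) {c + 1} {pA} {pB} (lips {A} {hA} lA) (lips {B} {hB} lB)
          (cong (λ b → c + (1 ∸ (1 ⊓ b))) rA) (cong (λ b → c + (1 ∸ (1 ⊓ b))) rB)
          (λ { t refl → trans (one eA) (sym (one eB)) })
      ; ratio = bound
      ; low′ = arm f (last A) ; low∈ = in-fork-A f A B {last A} (last∈ A)
      ; low< = subst (_< c + 1) (sym at-last) (m<m+n c (s≤s z≤n))
      }

  U₀-lip : ∀ A → Lips [ u₀ A , (λ _ → 0) ]′ (edges (oS A))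
  U₀-lip A = plain-lip {oC A} {p = u₀ A} {y = λ _ → 0} (u₀-lip A)

  riseQ : K → X → ℕ
  riseQ M = [ uK M , (λ _ → lenK M) ]′

  riseQ-lip : ∀ M (S : Shape (Fork C) hub) → Lips (riseQ M) (edges (series (kC M) S))
  riseQ-lip M@(ds , δ) S = series-lip (kC M) S {q = λ _ → lenK M} (Closed.lip-up ds δ) (lip-const (lenK M)) (Closed.up-at-last ds δ)

  module _ (f : Bool) (ds : List D) (s : St) (B : O) (w : ℕ) (oA : len ds ≤ 14 * Λ) (oB : lenO B ≤ Reach) where

    private
      A = ds , s
      state = opening f A B w oA oB
      κ = openingκ A B w

    opening-A : ∀ x → T (oPd A x) → Move state (arm f (inj₁ x))
    opening-A x t with armStep ds s x t
    ... | next s′ g pend u≤ _ rk = opening f (ds , s′) B w oA oB ,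
      fork-grow (grow-open {A} {ds , s′} g) (grow-refl (oS B) _) (λ ()) (λ _ ()) ,
      pend-A {A = oS A} {oS B} {openPd A} {openPd B} {openPd (ds , s′)} {openPd B} f nothing (plain-pend {oC A} pend) inj₁ ,
      subst₂ _≤_ (sym (pairΦ-at ρ f κ (UO (ds , s′)) (DO B) (inj₁ x))) (sym (pairΦ-at ρ f κ (UO A) (DO B) (inj₁ x)))
        (+-monoʳ-≤ κ (+-monoˡ-≤ (dO B croot) u≤)) ,
      +-monoˡ-< _ (+-monoʳ-< (5 + (R + R) + (Reach + Λ) * suc R) (+-monoˡ-< (rankO B) rk))
    ... | full δ g ge refl u≥ _ with 14 * Λ ≤? lenO B
    -- A turn while `B` has length at least `14Λ`. This outweighs the errors in the ratio, namely
    -- `10Λ` for the open block of `B` and `3Λ` for the last block of `A`.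
    ...   | yes far = ended Rg.result ,
      fork-grow (grow-close {A} {Ā} g) (grow-refl (oS B) _) (λ ()) (λ { _ refl → inj₁ t , inj₁ (oPd-last B) }) ,
      (λ ()) ,
      subst₂ _≤_ (sym Rg.at-last) (sym (pairΦ-at ρ f κ (UO A) (DO B) (inj₁ x)))
        (subst (λ b → c ≤ κ + (uO A x + b)) (sym (len≤dO-root B))
          (lin (uO B croot) (eq (cost ds) (Done.X δ) (costO B) w (lenO B) (len ds) (uO B croot) (uO A x)) u≥)) ,
      s≤s z≤n
      where
      Ā = ds , δ
      c = costK Ā + costO B + w + (lenO B + len ds)
      ratio : 10 * (N * (ccK Ā + ccO B)) ≤ 3 * (N * (c + 1)) + (ccK Ā + ccO B)
      ratio = subst (λ k → 10 * (N * k) ≤ 3 * (N * (c + 1)) + k) (+-assoc (ccK Ā) (ccs (proj₁ B)) (cc (proj₂ B)))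
        (ring-ratio {ccK Ā + ccs (proj₁ B)} {costK Ā + costO B} {lenK Ā} {lenO B} {len ds} {w} {cc (proj₂ B)} 1≤N
          (add {ccK Ā} {costK Ā} {lenK Ā} {ccs (proj₁ B)} {costO B} {lenO B} (qualK Ā) (qualO B))
          (+-mono-≤ (len≤K Ā) (len≤ccs (proj₁ B))) (Closed.length≤ ds δ) (cc≤Λ (proj₂ B)) far)
      module Rg = Ring f (kS Ā) (oS B) (UK Ā) [ u₀ B , (λ _ → 0) ]′ (UK-lip Ā) (U₀-lip B) (Closed.up-at-root ds δ) (u₀-root B)
        (≤-trans (1≤lenK Ā) (≤-reflexive (sym (Closed.up-at-last ds δ)))) (≤-trans 1≤14Λ (≤-trans far (≤-reflexive (sym (u₀-last B)))))
        (ccK Ā) (ccO B) (kSCover Ā) (oSCover B) c ratio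
      eq : ∀ a x b w c o u v → a + x + b + w + (c + o) + v + u ≡ a + b + w + (v + (c + u)) + (o + x)
      eq = solveℕ 8 (λ a x b w c o u v → a ⊕ x ⊕ b ⊕ w ⊕ (c ⊕ o) ⊕ v ⊕ u ⊜ a ⊕ b ⊕ w ⊕ (v ⊕ (c ⊕ u)) ⊕ (o ⊕ x)) refl
    -- Both strands still have length of order `Λ`, so the turn is harmless and the roles are
    -- exchanged.
    ...   | no near = opening (not f) B (extend Ā) (w + (lenO B + len ds)) (<⇒≤ (≰⇒> near)) fits ,
      grow-trans (fork-grow (grow-open {A} {extend Ā} ge) (grow-refl (oS B) _) (λ ()) (λ _ ())) (fork-flip f) ,
      (λ {v} t′ → pend-A {A = oS A} {oS B} {openPd A} {openPd B} {openPd (extend Ā)} {openPd B} f nothing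
        (plain-fresh {oC A} {oPd A} (λ {v} → extend-fresh {sh s} {δ} ds {v})) inj₁ (forkPd-flip f v t′)) ,
      subst₂ _≤_ (sym (pairΦ-flip ρ f (costO B + costO (extend Ā) + (w + (lenO B + len ds))) (UO B) (DO (extend Ā)) (inj₁ x)))
        (sym (pairΦ-at ρ f κ (UO A) (DO B) (inj₁ x)))
        (subst₂ (λ a b → costO B + costO (extend Ā) + (w + (lenO B + len ds)) + (uO B croot + a) ≤ κ + (uO A x + b))
          (sym (Closed.ext-down ds δ)) (sym (len≤dO-root B))
          (subst (λ k → costO B + k + (w + (lenO B + len ds)) + (uO B croot + 0) ≤ κ + (uO A x + (lenO B + uO B croot)))
            (sym (costO-extend Ā))
            (lin 0 (eq (cost ds) (Done.X δ) (costO B) w (lenO B) (len ds) (uO B croot) (uO A x)) u≥))) ,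
      subst (λ k → 5 + (R + R) + (Reach + Λ) * suc R + k + (Limit ∸ (lenO B + lenO (extend Ā))) * suc R < rankT state) (+-comm R (rankO B))
        (budget {Limit} {R} {5 + (R + R) + (Reach + Λ) * suc R} {len ds + lenO B} {Done.rr δ} {_} {rank s} {rankO B} (Done.1≤rr δ) room
          (trans (cong (lenO B +_) (lenO-extend Ā)) (eq′ (lenO B) (len ds) (Done.rr δ))))
      where
      Ā = ds , δ
      fits : lenO (extend Ā) ≤ Reach
      fits = ≤-trans (≤-reflexive (lenO-extend Ā)) (≤-trans (+-mono-≤ oA (Closed.rr≤Λ′ ds δ))
        (≤-trans (≤-reflexive (+-comm (14 * Λ) Λ)) (Λ≤Reach 15 (m≤m+n 15 85))))
      room : len ds + lenO B + Done.rr δ ≤ Limit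
      room = ≤-trans (≤-trans (≤-reflexive (eq″ (len ds) (lenO B) (Done.rr δ))) (+-mono-≤ (≤-trans (≤-reflexive (sym (lenO-extend Ā))) fits) (<⇒≤ (≰⇒> near))))
        (≤-reflexive (sym Limit≡))
        where
        eq″ : ∀ a b c → a + b + c ≡ a + c + b
        eq″ = solveℕ 3 (λ a b c → a ⊕ b ⊕ c ⊜ a ⊕ c ⊕ b) refl
      eq : ∀ a x b w c o u v → b + (a + x) + (w + (c + o)) + (u + 0) + v + 0 ≡ a + b + w + (v + (c + u)) + (o + x)
      eq = solveℕ 8 (λ a x b w c o u v → b ⊕ (a ⊕ x) ⊕ (w ⊕ (c ⊕ o)) ⊕ (u ⊕ lit 0) ⊕ v ⊕ lit 0 ⊜ a ⊕ b ⊕ w ⊕ (v ⊕ (c ⊕ u)) ⊕ (o ⊕ x)) refl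
      eq′ : ∀ c o d → c + (o + d) ≡ o + c + d
      eq′ = solveℕ 3 (λ c o d → c ⊕ (o ⊕ d) ⊜ o ⊕ c ⊕ d) refl

  module _ (f : Bool) (A : O) (ds : List D) (s : St) (w : ℕ) (oA : lenO A ≤ 14 * Λ) (oB : len ds ≤ Reach) where

    private
      B = ds , s
      state = opening f A B w oA oB
      κ = openingκ A B w

    opening-B : ∀ x → T (oPd B x) → Move state (arm (not f) (inj₁ x))
    opening-B x t with armStep ds s x t
    ... | next s′ g pend _ d≤ rk = opening f A (ds , s′) w oA oB ,
      fork-grow (grow-refl (oS A) _) (grow-open {B} {ds , s′} g) (λ ()) (λ _ ()) ,
      pend-B {A = oS A} {oS B} {openPd A} {openPd B} {openPd A} {openPd (ds , s′)} f nothing inj₁ (plain-pend {oC B} pend) ,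
      subst₂ _≤_ (sym (pairΦ-off ρ f κ (UO A) (DO (ds , s′)) (inj₁ x))) (sym (pairΦ-off ρ f κ (UO A) (DO B) (inj₁ x)))
        (+-monoʳ-≤ κ (+-monoʳ-≤ (uO A croot) d≤)) ,
      +-monoˡ-< _ (+-monoʳ-< (5 + (R + R) + (Reach + Λ) * suc R) (+-monoʳ-< (rankO A) rk))
    ... | full δ g ge refl _ d≥ with Reach ≤? len ds + Done.rr δ
    ...   | yes long = forked f A M w oA long ,
      fork-grow (grow-refl (oS A) _) (plain-series {pd′ = openPd B} (λ _ → id) g t) (λ ()) (λ _ ()) ,
      pend-B {A = oS A} {oS B} {openPd A} {openPd B} {openPd A} {innerPd hubPd} f nothing inj₁ (λ { {inj₂ _} _ → inj₂ (λ ()) }) ,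
      subst₂ _≤_ (sym (pairΦ-off ρ f (forkedκ A M w) (UO A) (waitQ M) (inj₁ x))) (sym (pairΦ-off ρ f κ (UO A) (DO B) (inj₁ x)))
        (subst (λ a → forkedκ A M w + (uO A croot + a) ≤ κ + (uO A croot + dO B x)) (sym (Closed.down-at-last ds δ))
          (lin 0 (eq (costO A) (cost ds) (Done.X δ) w (uO A croot) (dO B x)) d≥)) ,
      lin (rank s + (Limit ∸ (lenO A + len ds)) * suc R) (eq′ (rankO A) R (lenK M * suc R) ((Reach + Λ) * suc R) (rank s) ((Limit ∸ (lenO A + len ds)) * suc R))
        (*-monoˡ-≤ (suc R) (+-mono-≤ oB (Closed.rr≤Λ′ ds δ)))
      where
      M = ds , δ
      eq : ∀ a b x w u v → a + (b + x) + w + (u + 0) + v + 0 ≡ a + b + w + (u + v) + x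
      eq = solveℕ 6 (λ a b x w u v → a ⊕ (b ⊕ x) ⊕ w ⊕ (u ⊕ lit 0) ⊕ v ⊕ lit 0 ⊜ a ⊕ b ⊕ w ⊕ (u ⊕ v) ⊕ x) refl
      eq′ : ∀ a r q q′ b l → 1 + (a + 4 + (r + r) + q) + q′ + (b + l) ≡ 5 + (r + r) + q′ + (a + b) + l + q
      eq′ = solveℕ 6 (λ a r q q′ b l → lit 1 ⊕ (a ⊕ lit 4 ⊕ (r ⊕ r) ⊕ q) ⊕ q′ ⊕ (b ⊕ l) ⊜ lit 5 ⊕ (r ⊕ r) ⊕ q′ ⊕ (a ⊕ b) ⊕ l ⊕ q) refl
    ...   | no short = opening f A (extend M) w oA fits ,
      fork-grow (grow-refl (oS A) _) (grow-open {B} {extend M} ge) (λ ()) (λ _ ()) ,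
      pend-B {A = oS A} {oS B} {openPd A} {openPd B} {openPd A} {openPd (extend M)} f nothing inj₁
        (plain-fresh {oC B} {oPd B} (λ {v} → extend-fresh {sh s} {δ} ds {v})) ,
      subst₂ _≤_ (sym (pairΦ-off ρ f (costO A + costO (extend M) + w) (UO A) (DO (extend M)) (inj₁ x))) (sym (pairΦ-off ρ f κ (UO A) (DO B) (inj₁ x)))
        (subst₂ (λ k a → costO A + k + w + (uO A croot + a) ≤ κ + (uO A croot + dO B x))
          (sym (costO-extend M)) (sym (Closed.ext-down ds δ))
          (lin 0 (eq (costO A) (cost ds) (Done.X δ) w (uO A croot) (dO B x)) d≥)) ,
      subst₂ (λ i k → 5 + (R + R) + (Reach + Λ) * suc R + i + (Limit ∸ (lenO A + lenO (extend M))) * suc R <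
          5 + (R + R) + (Reach + Λ) * suc R + k + (Limit ∸ (lenO A + len ds)) * suc R)
        (+-comm R (rankO A)) (+-comm (rank s) (rankO A))
        (budget {Limit} {R} {5 + (R + R) + (Reach + Λ) * suc R} {lenO A + len ds} {Done.rr δ} {_} {rank s} {rankO A} (Done.1≤rr δ) room
          (trans (cong (lenO A +_) (lenO-extend M)) (sym (+-assoc (lenO A) (len ds) (Done.rr δ)))))
      where
      M = ds , δ
      fits : lenO (extend M) ≤ Reach
      fits = ≤-trans (≤-reflexive (lenO-extend M)) (<⇒≤ (≰⇒> short))
      room : lenO A + len ds + Done.rr δ ≤ Limit
      room = ≤-trans (≤-reflexive (eq″ (lenO A) (len ds) (Done.rr δ))) (≤-trans (+-mono-≤ (<⇒≤ (≰⇒> short)) oA) (≤-reflexive (sym Limit≡)))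
        where
        eq″ : ∀ a b c → a + b + c ≡ b + c + a
        eq″ = solveℕ 3 (λ a b c → a ⊕ b ⊕ c ⊜ b ⊕ c ⊕ a) refl
      eq : ∀ a b x w u v → a + (b + x) + w + (u + 0) + v + 0 ≡ a + b + w + (u + v) + x
      eq = solveℕ 6 (λ a b x w u v → a ⊕ (b ⊕ x) ⊕ w ⊕ (u ⊕ lit 0) ⊕ v ⊕ lit 0 ⊜ a ⊕ b ⊕ w ⊕ (u ⊕ v) ⊕ x) refl

-- The phases after the fork and the assembled game

module TopGame (N : ℕ) (1≤N : 1 ≤ N) (P : Proc)
  (few : 6 * (N * Core.m (Proc.core P)) ≤ Core.n (Proc.core P)) where
  open Proc P
  open Core core
  open Chain core
  open Arms P
  open Plain {C} {Fork C} {croot}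
  open Series {C} {Fork C} {croot} {hub}
  open Endgame N n m Λ 1≤n few
  open Top N 1≤N P few
  open TopStep N 1≤N P few

  module _ (f : Bool) (ds : List D) (s : St) (M : K) (w : ℕ) (oA : len ds ≤ 14 * Λ) (long : Reach ≤ lenK M) where

    private
      A = ds , s
      B = series (kC M) hubShape
      state = forked f A M w oA long
      κ = forkedκ A M w

    forked-A : ∀ x → T (oPd A x) → Move state (arm f (inj₁ x))
    forked-A x t with armStep ds s x t
    ... | next s′ g pend u≤ _ rk = forked f (ds , s′) M w oA long ,
      fork-grow (grow-open {A} {ds , s′} g) (grow-refl B _) (λ ()) (λ _ ()) ,
      pend-A {A = oS A} {B} {openPd A} {innerPd hubPd} {openPd (ds , s′)} {innerPd hubPd} f nothing (plain-pend {oC A} pend) inj₁ ,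
      subst₂ _≤_ (sym (pairΦ-at ρ f κ (UO (ds , s′)) (waitQ M) (inj₁ x))) (sym (pairΦ-at ρ f κ (UO A) (waitQ M) (inj₁ x)))
        (+-monoʳ-≤ κ (+-monoˡ-≤ (dK M croot) u≤)) ,
      +-monoˡ-< _ (+-monoˡ-< (R + R) (+-monoˡ-< 4 rk))
    ... | full δ g _ refl u≥ _ = ended Rg.result ,
      fork-grow (grow-close {A} {Ā} g) (grow-refl B _) (λ ()) (λ { _ refl → inj₁ t , inj₁ tt }) ,
      (λ ()) ,
      subst₂ _≤_ (sym Rg.at-last) (sym (pairΦ-at ρ f κ (UO A) (waitQ M) (inj₁ x)))
        (subst (λ b → c ≤ κ + (uO A x + b)) (sym (Closed.down-at-root (proj₁ M) (proj₂ M)))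
          (lin 0 (eq (cost ds) (Done.X δ) (costK M) w (lenK M) (len ds) (uO A x)) u≥)) ,
      ≤-trans (s≤s z≤n) (≤-trans (m≤n+m 4 (rank s)) (≤-trans (m≤m+n _ (R + R)) (m≤m+n _ _)))
      where
      Ā = ds , δ
      c = costK Ā + costK M + w + (lenK M + len ds)
      14Λ≤ : 14 * Λ ≤ lenK M
      14Λ≤ = ≤-trans (Λ≤Reach 14 (m≤m+n 14 86)) long
      ratio : 10 * (N * (ccK Ā + (ccK M + 0))) ≤ 3 * (N * (c + 1)) + (ccK Ā + (ccK M + 0))
      ratio = subst (λ k → 10 * (N * k) ≤ 3 * (N * (c + 1)) + k) (+-assoc (ccK Ā) (ccK M) 0)
        (ring-ratio {ccK Ā + ccK M} {costK Ā + costK M} {lenK Ā} {lenK M} {len ds} {w} {0} 1≤N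
          (add {ccK Ā} {costK Ā} {lenK Ā} {ccK M} {costK M} {lenK M} (qualK Ā) (qualK M))
          (+-mono-≤ (len≤K Ā) (len≤K M)) (Closed.length≤ ds δ) z≤n 14Λ≤)
      module Rg = Ring f (kS Ā) B (UK Ā) (riseQ M) (UK-lip Ā) (riseQ-lip M hubShape) (Closed.up-at-root ds δ) (Closed.up-at-root (proj₁ M) (proj₂ M))
        (≤-trans (1≤lenK Ā) (≤-reflexive (sym (Closed.up-at-last ds δ)))) (1≤lenK M)
        (ccK Ā) (ccK M + 0) (kSCover Ā) (forkedCover M) c ratio
      eq : ∀ a x b w c o v → a + x + b + w + (c + o) + v + 0 ≡ a + b + w + (v + c) + (o + x)
      eq = solveℕ 7 (λ a x b w c o v → a ⊕ x ⊕ b ⊕ w ⊕ (c ⊕ o) ⊕ v ⊕ lit 0 ⊜ a ⊕ b ⊕ w ⊕ (v ⊕ c) ⊕ (o ⊕ x)) refl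

  module _ {S : Shape C croot} {S₂ : Shape (Fork C) hub} where

    series-pend : ∀ {p p′ y} → Pend S₂ p p′ y → Pend (series S S₂) (innerPd p) (innerPd p′) (inj₂ y)
    series-pend pend {inj₂ v} t with pend t
    ... | inj₁ (a , ne) = inj₁ (a , λ { refl → ne refl })
    ... | inj₂ b = inj₂ b

  forked-hub : ∀ f A M w oA long → Move (forked f A M w oA long) (arm (not f) (inj₂ hub))
  forked-hub f A M w oA long = late f A M false fresh fresh w oA long (record { a≤ = z≤n ; b≤ = z≤n ; a≤w = z≤n }) ,
    fork-grow (grow-refl (oS A) _) (series-grow {S₂′ = fork false (oC fresh) (oC fresh) nothing} {pd′ = innerPd hubPd} (λ _ → id) opens) (λ ()) (λ _ ()) ,
    pend-B {A = oS A} {series (kC M) hubShape} {openPd A} {innerPd hubPd} {openPd A} {innerPd late₀} f nothing inj₁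
      (series-pend {kC M} {hubShape} (λ { {hub} () ; {arm _ _} _ → inj₂ (λ ()) })) ,
    subst₂ _≤_ (sym (pairΦ-off ρ f (lateκ A M fresh fresh w) (UO A) (lateQ M false fresh fresh) (inj₂ hub)))
      (sym (pairΦ-off ρ f (forkedκ A M w) (UO A) (waitQ M) (inj₂ hub)))
      (≤-reflexive (cong₂ (λ a b → a + w + (uO A croot + b)) (+-identityʳ (costO A + costK M)) zero-start)) ,
    ≤-reflexive (eq (rankO A) (R + R) (lenK M * suc R))
    where
    late₀ = forkPd false (oPd fresh) (oPd fresh)
    zero-start : Φ start root + Φ start root ≡ 0
    zero-start = cong₂ _+_ Φ-start Φ-start
    opens : Grow hubShape (fork false (oC fresh) (oC fresh) nothing) hubPd
    opens = record { inV-mono = λ { {hub} _ → tt ; {arm _ _} () } ; edge-mono = λ ()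
                   ; edge-new = λ p → inj₂ (ends (forkView false (oC fresh) (oC fresh) nothing p)) }
      where
      ends : ∀ {e} → ForkView false (oC fresh) (oC fresh) nothing e → Open hubShape hubPd (src e) × Open hubShape hubPd (tgt e)
      ends spokeA = inj₁ tt , inj₂ (λ ())
      ends spokeB = inj₁ tt , inj₂ (λ ())
      ends (inA _) = inj₂ (λ ()) , inj₂ (λ ())
      ends (inB _) = inj₂ (λ ()) , inj₂ (λ ())
    eq : ∀ a r q → 1 + (a + 3 + r + q) ≡ a + 4 + r + q
    eq = solveℕ 3 (λ a r q → lit 1 ⊕ (a ⊕ lit 3 ⊕ r ⊕ q) ⊜ a ⊕ lit 4 ⊕ r ⊕ q) refl

  -- `F` is the shorter late arm, which the optimum walks twice, and the ring closes at the end of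
  -- the longer arm `L`. In contrast `b` and `c` are the lengths of the arm that the agent left
  -- behind and of its current arm, so the two orders need not agree.
  module LateFinal (f : Bool) (Ā : K) (M : K) (g : Bool) (F L : O) (w o b c X₂ : ℕ)
    (lenĀ : lenK Ā ≤ o + Λ) (long : Reach ≤ lenK M) (b≤w : b ≤ w) (e≤p : 3 * lenO F ≤ lenK M) (e≤u : 2 * lenO F ≤ b + c)
    (sum : lenO F + lenO L ≡ b + c) (costs : costO F + costO L ≡ X₂) where

    total : ℕ
    total = costK Ā + costK M + X₂ + w + (o + (lenK M + c))

    private
      t = cc (proj₂ F) + rr (proj₂ F) + cc (proj₂ L)
      k = ccK Ā + ccK M + (ccs (proj₁ F) + ccs (proj₁ L))
      j = ccK M + (ccO F + rrO F + ccO L)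

      t≤ : t ≤ 3 * Λ
      t≤ = ≤-trans (+-mono-≤ (+-mono-≤ (cc≤Λ (proj₂ F)) (rr≤Λ (proj₂ F))) (cc≤Λ (proj₂ L))) (≤-reflexive (eq Λ))
        where
        eq : ∀ l → l + l + l ≡ 3 * l
        eq = solveℕ 1 (λ l → l ⊕ l ⊕ l ⊜ lit 3 ⊗ l) refl

      ratio : 10 * (N * (ccK Ā + j)) ≤ 3 * (N * (total + 1)) + (ccK Ā + j)
      ratio = subst (λ k → 10 * (N * k) ≤ 3 * (N * (total + 1)) + k)
        (eq (ccK Ā) (ccK M) (ccs (proj₁ F)) (ccs (proj₁ L)) (lenO F) (cc (proj₂ F)) (rr (proj₂ F)) (cc (proj₂ L)))
        (ring-ratio₂ {k} {costK Ā + costK M + X₂} {lenK Ā} {lenK M} {o} {b} {c} {lenO F} {w} {t}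
          (subst₂ (λ X l → 4 * (n * k) ≤ n * (costK Ā + costK M + X) + (n + m) * (lenK Ā + lenK M + l)) costs sum
            (add {ccK Ā + ccK M} {costK Ā + costK M} {lenK Ā + lenK M} {ccs (proj₁ F) + ccs (proj₁ L)} {costO F + costO L} {lenO F + lenO L}
              (add {ccK Ā} {costK Ā} {lenK Ā} {ccK M} {costK M} {lenK M} (qualK Ā) (qualK M))
              (add {ccs (proj₁ F)} {costO F} {lenO F} {ccs (proj₁ L)} {costO L} {lenO L} (qualO F) (qualO L))))
          (subst (λ l → lenK Ā + lenK M + l ≤ k) sum
            (+-mono-≤ (+-mono-≤ (len≤K Ā) (len≤K M)) (+-mono-≤ (len≤ccs (proj₁ F)) (len≤ccs (proj₁ L)))))
          lenĀ t≤ b≤w e≤p e≤u (≤-trans (≤-reflexive (sym Reach≡)) long))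
        where
        eq : ∀ a m f l e x y z → a + m + (f + l) + e + (x + y + z) ≡ a + (m + (f + x + (e + y) + (l + z)))
        eq = solveℕ 8 (λ a m f l e x y z → a ⊕ m ⊕ (f ⊕ l) ⊕ e ⊕ (x ⊕ y ⊕ z) ⊜ a ⊕ (m ⊕ (f ⊕ x ⊕ (e ⊕ y) ⊕ (l ⊕ z)))) refl

    open Ring f (kS Ā) (inner M g F L) (UK Ā) (riseQ M) (UK-lip Ā) (riseQ-lip M (fork g (oC F) (oC L) nothing))
      (Closed.up-at-root (proj₁ Ā) (proj₂ Ā)) (Closed.up-at-root (proj₁ M) (proj₂ M))
      (≤-trans (1≤lenK Ā) (≤-reflexive (sym (Closed.up-at-last (proj₁ Ā) (proj₂ Ā))))) (1≤lenK M)
      (ccK Ā) j (kSCover Ā) (innerCover M g F L) total ratio public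

  module _ (f : Bool) (ds : List D) (s : St) (M : K) (g : Bool) (A′ B′ : O) (w : ℕ)
    (oA : len ds ≤ 14 * Λ) (long : Reach ≤ lenK M) (I : Late M (lenO A′) (lenO B′) w) where

    private
      A = ds , s
      B = inner M g A′ B′
      iPd = innerPd (forkPd g (oPd A′) (oPd B′))
      state = late f A M g A′ B′ w oA long I
      κ = lateκ A M A′ B′ w
      Q = lateQ M g A′ B′

    late-A : ∀ x → T (oPd A x) → Move state (arm f (inj₁ x))
    late-A x t with armStep ds s x t
    ... | next s′ gr pend u≤ _ rk = late f (ds , s′) M g A′ B′ w oA long I ,
      fork-grow (grow-open {A} {ds , s′} gr) (grow-refl B _) (λ ()) (λ _ ()) ,
      pend-A {A = oS A} {B} {openPd A} {iPd} {openPd (ds , s′)} {iPd} f nothing (plain-pend {oC A} pend) inj₁ ,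
      subst₂ _≤_ (sym (pairΦ-at ρ f κ (UO (ds , s′)) Q (inj₁ x))) (sym (pairΦ-at ρ f κ (UO A) Q (inj₁ x)))
        (+-monoʳ-≤ κ (+-monoˡ-≤ (Q ρ) u≤)) ,
      +-monoˡ-< _ (+-monoˡ-< (rankO A′ + rankO B′) (+-monoˡ-< 3 rk))
    ... | full δ gr _ refl u≥ _ = finish (≤-total (lenO A′) (lenO B′))
      where
      Ā = ds , δ
      c = costK Ā + costK M + (costO A′ + costO B′) + w + (len ds + (lenK M + lenO B′))
      enough : c ≤ κ + (uO A x + Q ρ)
      enough = subst₂ (λ p q → c ≤ κ + (uO A x + (p + (uO A′ croot + q)))) (sym (Closed.down-at-root (proj₁ M) (proj₂ M))) (sym (len≤dO-root B′))
        (lin (uO A′ croot + uO B′ croot) (eq (cost ds) (Done.X δ) (costK M) (costO A′ + costO B′) w (lenK M) (len ds) (lenO B′) (uO A′ croot) (uO B′ croot) (uO A x)) u≥)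
        where
        eq : ∀ a x m y w p o c u u′ v → a + x + m + y + w + (o + (p + c)) + v + (u + u′) ≡ a + m + y + w + (v + (p + (u + (c + u′)))) + (o + x)
        eq = solveℕ 11 (λ a x m y w p o c u u′ v → a ⊕ x ⊕ m ⊕ y ⊕ w ⊕ (o ⊕ (p ⊕ c)) ⊕ v ⊕ (u ⊕ u′) ⊜ a ⊕ m ⊕ y ⊕ w ⊕ (v ⊕ (p ⊕ (u ⊕ (c ⊕ u′)))) ⊕ (o ⊕ x)) refl
      pos-rank : 0 < rankT state
      pos-rank = ≤-trans (s≤s z≤n) (≤-trans (m≤n+m 3 (rank s)) (≤-trans (m≤m+n _ (rankO A′ + rankO B′)) (m≤m+n _ _)))
      half : ∀ {a b} → a ≤ b → 2 * a ≤ a + b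
      half {a} {b} le = ≤-trans (≤-reflexive (cong (a +_) (+-identityʳ a))) (+-monoʳ-≤ a le)
      finish : lenO A′ ≤ lenO B′ ⊎ lenO B′ ≤ lenO A′ → Move state (arm f (inj₁ x))
      finish (inj₁ le) = ended LF.result ,
        fork-grow (grow-close {A} {Ā} gr) (grow-refl B _) (λ ())
          (λ { _ refl → inj₁ t , inj₁ (subst T (sym (side-off g (oPd A′) (oPd B′) _)) (oPd-last B′)) }) ,
        (λ ()) ,
        subst₂ _≤_ (sym LF.at-last) (sym (pairΦ-at ρ f κ (UO A) Q (inj₁ x))) enough ,
        pos-rank
        where
        module LF = LateFinal f Ā M g A′ B′ w (len ds) (lenO A′) (lenO B′) (costO A′ + costO B′) (Closed.length≤ ds δ) long
          (Late.a≤w I) (Late.a≤ I) (half le) refl refl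
      finish (inj₂ le) = ended LF.result ,
        fork-grow (grow-close {A} {Ā} gr) (series-grow {pd′ = iPd} (λ _ → id) (fork-flip g)) (λ ())
          (λ { _ refl → inj₁ t , inj₁ (other g) }) ,
        (λ ()) ,
        subst₂ _≤_ (sym LF.at-last) (sym (pairΦ-at ρ f κ (UO A) Q (inj₁ x))) enough ,
        pos-rank
        where
        module LF = LateFinal f Ā M (not g) B′ A′ w (len ds) (lenO A′) (lenO B′) (costO A′ + costO B′) (Closed.length≤ ds δ) long
          (Late.a≤w I) (Late.b≤ I) (≤-trans (half le) (≤-reflexive (+-comm (lenO B′) (lenO A′)))) (+-comm (lenO B′) (lenO A′)) (+-comm (costO B′) (costO A′))
        other : ∀ g → T (forkPd g (oPd A′) (oPd B′) (arm (not (not g)) (last (oC A′))))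
        other false = oPd-last A′
        other true = oPd-last A′

  module _ (f : Bool) (A : O) (M : K) (g : Bool) (w : ℕ) (oA : lenO A ≤ 14 * Λ) (long : Reach ≤ lenK M) where

    private
      inner-room : ∀ {a b} → 3 * a ≤ lenK M → 3 * b ≤ lenK M → a + b ≤ lenK M
      inner-room {a} {b} ha hb = *-cancelˡ-≤ 3 (lin (lenK M) (eq a b (lenK M)) (+-mono-≤ ha hb))
        where
        eq : ∀ a b p → 3 * (a + b) + (p + p) + p ≡ 3 * p + (3 * a + 3 * b)
        eq = solveℕ 3 (λ a b p → lit 3 ⊗ (a ⊕ b) ⊕ (p ⊕ p) ⊕ p ⊜ lit 3 ⊗ p ⊕ (lit 3 ⊗ a ⊕ lit 3 ⊗ b)) refl

      -- The last block overshoots a third of the long strand by at most `Λ`, which is small against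
      -- `lenK M`. The bound by `lenK M` is what the cap in `Detour` relies on.
      closing-room : ∀ {c d} → 3 * c ≤ lenK M → d ≤ Λ → c + d ≤ lenK M
      closing-room {c} {d} hc hd = *-cancelˡ-≤ 3 (lin (lenK M) (eq c d (lenK M) Λ) (+-mono-≤ (+-mono-≤ hc (*-monoʳ-≤ 3 hd)) (≤-trans (Λ≤Reach 3 (m≤m+n 3 97)) long)))
        where
        eq : ∀ c d p l → 3 * (c + d) + (p + 3 * l + p) + p ≡ 3 * p + (3 * c + 3 * d + 3 * l)
        eq = solveℕ 4 (λ c d p l → lit 3 ⊗ (c ⊕ d) ⊕ (p ⊕ lit 3 ⊗ l ⊕ p) ⊕ p ⊜ lit 3 ⊗ p ⊕ (lit 3 ⊗ c ⊕ lit 3 ⊗ d ⊕ lit 3 ⊗ l)) refl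

      outer : ∀ {A′ B′ : O} {w₁ I} (y : Fork C) (g₂ : Bool) (A₂ B₂ : O) (w₂ : ℕ) (I₂ : Late M (lenO A₂) (lenO B₂) w₂) →
        Grow (fork g (oC A′) (oC B′) nothing) (fork g₂ (oC A₂) (oC B₂) nothing) (forkPd g (oPd A′) (oPd B′)) →
        Pend (fork g (oC A′) (oC B′) nothing) (forkPd g (oPd A′) (oPd B′)) (forkPd g₂ (oPd A₂) (oPd B₂)) y →
        lateκ A M A₂ B₂ w₂ + (uO A croot + pairφ g₂ A₂ B₂ y) ≤ lateκ A M A′ B′ w₁ + (uO A croot + pairφ g A′ B′ y) →
        rankT (late f A M g₂ A₂ B₂ w₂ oA long I₂) < rankT (late f A M g A′ B′ w₁ oA long I) →
        Move (late f A M g A′ B′ w₁ oA long I) (arm (not f) (inj₂ y))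
      outer {A′} {B′} {w₁} y g₂ A₂ B₂ w₂ I₂ gr pend le rk = late f A M g₂ A₂ B₂ w₂ oA long I₂ ,
        fork-grow (grow-refl (oS A) _) (series-grow {pd′ = innerPd (forkPd g (oPd A′) (oPd B′))} (λ _ → id) gr) (λ ()) (λ _ ()) ,
        pend-B {A = oS A} {inner M g A′ B′} {openPd A} {innerPd (forkPd g (oPd A′) (oPd B′))} {openPd A} {innerPd (forkPd g₂ (oPd A₂) (oPd B₂))} f nothing inj₁
          (series-pend {kC M} {fork g (oC A′) (oC B′) nothing} pend) ,
        subst₂ _≤_ (sym (pairΦ-off ρ f (lateκ A M A₂ B₂ w₂) (UO A) (lateQ M g₂ A₂ B₂) (inj₂ y)))
          (sym (pairΦ-off ρ f (lateκ A M A′ B′ w₁) (UO A) (lateQ M g A′ B′) (inj₂ y))) le ,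
        rk

      shut : ∀ {A′ B′ : O} {w₁ I} (y : Fork C) (g₂ : Bool) (A₂ : O) (B₂ : K) (w₂ : ℕ) (I₂ : Closing M (lenO A₂) (lenK B₂) w₂) →
        arm (not g₂) (last (kC B₂)) ≡ y → T (forkPd g (oPd A′) (oPd B′) y) →
        Grow (fork g (oC A′) (oC B′) nothing) (fork g₂ (oC A₂) (kC B₂) nothing) (forkPd g (oPd A′) (oPd B′)) →
        Pend (fork g (oC A′) (oC B′) nothing) (forkPd g (oPd A′) (oPd B′)) (forkPd g₂ (oPd A₂) (λ _ → false)) y →
        closingκ A M A₂ B₂ w₂ ≤ lateκ A M A′ B′ w₁ + (uO A croot + pairφ g A′ B′ y) →
        Move (late f A M g A′ B′ w₁ oA long I) (arm (not f) (inj₂ y))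
      shut {A′} {B′} {w₁} y g₂ A₂ B₂ w₂ I₂ refl t gr pend le = closing f A M g₂ A₂ B₂ w₂ oA long I₂ ,
        fork-grow (grow-refl (oS A) _) (series-grow {pd′ = innerPd (forkPd g (oPd A′) (oPd B′))} (λ _ → id) gr) (λ ())
          (λ { _ refl → inj₁ (oPd-last A) , inj₁ t }) ,
        pend-B {A = oS A} {inner M g A′ B′} {openPd A} {innerPd (forkPd g (oPd A′) (oPd B′))} {noPd} {innerPd (forkPd g₂ (oPd A₂) (λ _ → false))} f nothing (λ ())
          (series-pend {kC M} {fork g (oC A′) (oC B′) nothing} pend) ,
        subst₂ _≤_ (sym (trans (cong (λ k → closingκ A M A₂ B₂ w₂ + (De.whole ∸ k)) De.at-end)
            (trans (cong (closingκ A M A₂ B₂ w₂ +_) (n∸n≡0 De.whole)) (+-identityʳ _))))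
          (sym (pairΦ-off ρ f (lateκ A M A′ B′ w₁) (UO A) (lateQ M g A′ B′) (inj₂ y))) le ,
        ≤-trans (s≤s (s≤s z≤n)) (≤-trans (m≤n+m 3 (rankO A)) (≤-trans (m≤m+n _ (rankO A′ + rankO B′)) (m≤m+n _ _)))
        where
        module De = Detour f A M g₂ A₂ B₂

    module _ (es : List D) (s : St) (B′ : O) (w₁ : ℕ) (I : Late M (len es) (lenO B′) w₁) where

      private
        A′ = es , s
        φ = pairφ g A′ B′
        κ = lateκ A M A′ B′ w₁
        w₂ = w₁ + (lenO B′ + len es)

      private
        state = late f A M g A′ B′ w₁ oA long I

        first-next : ∀ v s′ → Grow (oC A′) (oC (es , s′)) (oPd A′) → Pend (oC A′) (oPd A′) (oPd (es , s′)) v →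
          uO (es , s′) v ≤ uO A′ v → rank s′ < rank s → Move state (arm (not f) (inj₂ (arm g v)))
        first-next v s′ gr pend u≤ rk = outer {A′} {B′} {w₁} {I} (arm g v) g (es , s′) B′ w₁ I
          (fork-grow {f = g} gr (grow-refl (oC B′) _) (λ ()) (λ _ ()))
          (pend-A {A = oC A′} {oC B′} {oPd A′} {oPd B′} {oPd (es , s′)} {oPd B′} g nothing pend inj₁)
          (+-monoʳ-≤ κ (+-monoʳ-≤ (uO A croot) (subst₂ _≤_ (sym (pairΦ-at croot g 0 (uO (es , s′)) (dO B′) v)) (sym (pairΦ-at croot g 0 (uO A′) (dO B′) v))
            (+-monoˡ-≤ (dO B′ croot) u≤))))
          (+-monoˡ-< _ (+-monoʳ-< (rankO A + 3) (+-monoˡ-< (rankO B′) rk)))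

        module _ (δ : D) (x : C) (u≥ : len es + Done.X δ ≤ uO A′ x) (last≡ : last (kC (es , δ)) ≡ x) (t : T (oPd A′ x)) where

          Ā = es , δ

          twice : ∀ g → arm (not (not g)) (last (kC Ā)) ≡ arm g x
          twice false = cong (arm false) last≡
          twice true = cong (arm true) last≡

          first-shut : Grow (oC A′) (kC Ā) (oPd A′) → lenK M ≤ 3 * lenK Ā → Move state (arm (not f) (inj₂ (arm g x)))
          first-shut gr far = shut {A′} {B′} {w₁} {I} (arm g x) (not g) B′ Ā w₂
            (record { a≤ = Late.b≤ I ; ≤b = far ; b≤ = closing-room {len es} {Done.rr δ} (Late.a≤ I) (Closed.rr≤Λ′ es δ)
                    ; a≤w = ≤-trans (m≤m+n (lenO B′) (len es)) (m≤n+m _ w₁) })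
            (twice g) (subst T (sym (side-at g (oPd A′) (oPd B′) x)) t)
            (grow-trans (fork-grow {f = g} gr (grow-refl (oC B′) _) (λ ()) (λ _ ())) (fork-flip g))
            (λ {u} t′ → pend-A {A = oC A′} {oC B′} {oPd A′} {oPd B′} {λ _ → false} {oPd B′} g nothing (λ ()) inj₁ (forkPd-flip g u t′))
            (subst (λ b → closingκ A M B′ Ā w₂ ≤ κ + (uO A croot + b)) (sym (pairΦ-at croot g 0 (uO A′) (dO B′) x))
              (subst (λ b → closingκ A M B′ Ā w₂ ≤ κ + (uO A croot + (uO A′ x + b))) (sym (len≤dO-root B′))
                (lin (uO A croot + uO B′ croot) (eq (costO A) (costK M) (cost es) (Done.X δ) (costO B′) w₁ (lenO B′) (len es) (uO A croot) (uO B′ croot) (uO A′ x)) u≥)))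
            where
            eq : ∀ a m x d b w c o u u′ v → a + m + (b + (x + d)) + (w + (c + o)) + v + (u + u′) ≡ a + m + (x + b) + w + (u + (v + (c + u′))) + (o + d)
            eq = solveℕ 11 (λ a m x d b w c o u u′ v → a ⊕ m ⊕ (b ⊕ (x ⊕ d)) ⊕ (w ⊕ (c ⊕ o)) ⊕ v ⊕ (u ⊕ u′) ⊜ a ⊕ m ⊕ (x ⊕ b) ⊕ w ⊕ (u ⊕ (v ⊕ (c ⊕ u′))) ⊕ (o ⊕ d)) refl

          first-turn : Grow (oC A′) (oC (extend Ā)) (oPd A′) → ¬ lenK M ≤ 3 * lenK Ā → Move state (arm (not f) (inj₂ (arm g x)))
          first-turn ge near = outer {A′} {B′} {w₁} {I} (arm g x) (not g) B′ (extend Ā) w₂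
            (record { a≤ = Late.b≤ I ; b≤ = small ; a≤w = ≤-trans (m≤m+n (lenO B′) (len es)) (m≤n+m _ w₁) })
            (grow-trans (fork-grow {f = g} {A′ = oC (extend Ā)} ge (grow-refl (oC B′) _) (λ ()) (λ _ ())) (fork-flip g))
            (λ {u} t′ → pend-A {A = oC A′} {oC B′} {oPd A′} {oPd B′} {oPd (extend Ā)} {oPd B′} g nothing
              (λ {u} t → inj₂ (extend-fresh {sh s} {δ} es {u} t)) inj₁ (forkPd-flip g u t′))
            (subst₂ (λ a b → lateκ A M B′ (extend Ā) w₂ + (uO A croot + a) ≤ κ + (uO A croot + b))
              (sym (trans (pairΦ-flip croot g 0 (uO B′) (dO (extend Ā)) x) (cong (uO B′ croot +_) (trans (cong (dO (extend Ā)) (sym last≡)) (Closed.ext-down es δ)))))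
              (sym (trans (pairΦ-at croot g 0 (uO A′) (dO B′) x) (cong (uO A′ x +_) (len≤dO-root B′))))
              (subst (λ k → costO A + costK M + (costO B′ + k) + w₂ + (uO A croot + (uO B′ croot + 0)) ≤ κ + (uO A croot + (uO A′ x + (lenO B′ + uO B′ croot))))
                (sym (costO-extend Ā))
                (lin 0 (eq (costO A) (costK M) (cost es) (Done.X δ) (costO B′) w₁ (lenO B′) (len es) (uO A croot) (uO B′ croot) (uO A′ x)) u≥)))
            (subst (λ k → rankO A + 3 + k + (lenK M ∸ (lenO B′ + lenO (extend Ā))) * suc R < rankT state) (+-comm R (rankO B′))
              (budget {lenK M} {R} {rankO A + 3} {len es + lenO B′} {Done.rr δ} {_} {rank s} {rankO B′} (Done.1≤rr δ)
                (≤-trans (≤-reflexive (eq″ (len es) (lenO B′) (Done.rr δ))) (inner-room {len es + Done.rr δ} {lenO B′} (<⇒≤ (≰⇒> near)) (Late.b≤ I)))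
                (trans (cong (lenO B′ +_) (lenO-extend Ā)) (eq′ (lenO B′) (len es) (Done.rr δ)))))
            where
            small : 3 * lenO (extend Ā) ≤ lenK M
            small = subst (λ k → 3 * k ≤ lenK M) (sym (lenO-extend Ā)) (<⇒≤ (≰⇒> near))
            eq : ∀ a m x d b w c o u u′ v → a + m + (b + (x + d)) + (w + (c + o)) + (u + (u′ + 0)) + v + 0 ≡ a + m + (x + b) + w + (u + (v + (c + u′))) + (o + d)
            eq = solveℕ 11 (λ a m x d b w c o u u′ v → a ⊕ m ⊕ (b ⊕ (x ⊕ d)) ⊕ (w ⊕ (c ⊕ o)) ⊕ (u ⊕ (u′ ⊕ lit 0)) ⊕ v ⊕ lit 0 ⊜ a ⊕ m ⊕ (x ⊕ b) ⊕ w ⊕ (u ⊕ (v ⊕ (c ⊕ u′))) ⊕ (o ⊕ d)) refl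
            eq′ : ∀ c o d → c + (o + d) ≡ o + c + d
            eq′ = solveℕ 3 (λ c o d → c ⊕ (o ⊕ d) ⊜ o ⊕ c ⊕ d) refl
            eq″ : ∀ a b c → a + b + c ≡ a + c + b
            eq″ = solveℕ 3 (λ a b c → a ⊕ b ⊕ c ⊜ a ⊕ c ⊕ b) refl

      late-first : ∀ v → T (oPd A′ v) → Move state (arm (not f) (inj₂ (arm g v)))
      late-first v t = react (armStep es s v t)
        where
        react : ArmStep es s v → Move state (arm (not f) (inj₂ (arm g v)))
        react (next s′ gr pend u≤ _ rk) = first-next v s′ gr pend u≤ rk
        react (full δ gr ge last≡ u≥ _) = decide (lenK M ≤? 3 * (len es + Done.rr δ))
          where
          decide : Dec (lenK M ≤ 3 * (len es + Done.rr δ)) → Move state (arm (not f) (inj₂ (arm g v)))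
          decide (yes far) = first-shut δ v u≥ last≡ t gr far
          decide (no near) = first-turn δ v u≥ last≡ t ge near

    module _ (A′ : O) (es : List D) (s : St) (w₁ : ℕ) (I : Late M (lenO A′) (len es) w₁) where

      private
        B′ = es , s
        κ = lateκ A M A′ B′ w₁
        state = late f A M g A′ B′ w₁ oA long I

        second-next : ∀ v s′ → Grow (oC B′) (oC (es , s′)) (oPd B′) → Pend (oC B′) (oPd B′) (oPd (es , s′)) v →
          dO (es , s′) v ≤ dO B′ v → rank s′ < rank s → Move state (arm (not f) (inj₂ (arm (not g) v)))
        second-next v s′ gr pend d≤ rk = outer {A′} {B′} {w₁} {I} (arm (not g) v) g A′ (es , s′) w₁ I
          (fork-grow {f = g} (grow-refl (oC A′) _) gr (λ ()) (λ _ ()))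
          (pend-B {A = oC A′} {oC B′} {oPd A′} {oPd B′} {oPd A′} {oPd (es , s′)} g nothing inj₁ pend)
          (+-monoʳ-≤ κ (+-monoʳ-≤ (uO A croot) (subst₂ _≤_ (sym (pairΦ-off croot g 0 (uO A′) (dO (es , s′)) v)) (sym (pairΦ-off croot g 0 (uO A′) (dO B′) v))
            (+-monoʳ-≤ (uO A′ croot) d≤))))
          (+-monoˡ-< _ (+-monoʳ-< (rankO A + 3) (+-monoʳ-< (rankO A′) rk)))

        module _ (δ : D) (x : C) (d≥ : Done.X δ ≤ dO B′ x) (last≡ : last (kC (es , δ)) ≡ x) (t : T (oPd B′ x)) where

          B̄ = es , δ

          second-shut : Grow (oC B′) (kC B̄) (oPd B′) → lenK M ≤ 3 * lenK B̄ → Move state (arm (not f) (inj₂ (arm (not g) x)))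
          second-shut gr far = shut {A′} {B′} {w₁} {I} (arm (not g) x) g A′ B̄ w₁
            (record { a≤ = Late.a≤ I ; ≤b = far ; b≤ = closing-room {len es} {Done.rr δ} (Late.b≤ I) (Closed.rr≤Λ′ es δ) ; a≤w = Late.a≤w I })
            (cong (arm (not g)) last≡) (subst T (sym (side-off g (oPd A′) (oPd B′) x)) t)
            (fork-grow {f = g} (grow-refl (oC A′) _) gr (λ ()) (λ _ ()))
            (pend-B {A = oC A′} {oC B′} {oPd A′} {oPd B′} {oPd A′} {λ _ → false} g nothing inj₁ (λ ()))
            (subst (λ b → closingκ A M A′ B̄ w₁ ≤ κ + (uO A croot + b)) (sym (pairΦ-off croot g 0 (uO A′) (dO B′) x))
              (lin (uO A croot + uO A′ croot) (eq (costO A) (costK M) (costO A′) (cost es) (Done.X δ) w₁ (uO A croot) (uO A′ croot) (dO B′ x)) d≥))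
            where
            eq : ∀ a m b x d w u u′ v → a + m + (b + (x + d)) + w + v + (u + u′) ≡ a + m + (b + x) + w + (u + (u′ + v)) + d
            eq = solveℕ 9 (λ a m b x d w u u′ v → a ⊕ m ⊕ (b ⊕ (x ⊕ d)) ⊕ w ⊕ v ⊕ (u ⊕ u′) ⊜ a ⊕ m ⊕ (b ⊕ x) ⊕ w ⊕ (u ⊕ (u′ ⊕ v)) ⊕ d) refl

          second-more : Grow (oC B′) (oC (extend B̄)) (oPd B′) → ¬ lenK M ≤ 3 * lenK B̄ → Move state (arm (not f) (inj₂ (arm (not g) x)))
          second-more ge near = outer {A′} {B′} {w₁} {I} (arm (not g) x) g A′ (extend B̄) w₁
            (record { a≤ = Late.a≤ I ; b≤ = small ; a≤w = Late.a≤w I })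
            (fork-grow {f = g} {B′ = oC (extend B̄)} (grow-refl (oC A′) _) ge (λ ()) (λ _ ()))
            (pend-B {A = oC A′} {oC B′} {oPd A′} {oPd B′} {oPd A′} {oPd (extend B̄)} g nothing inj₁
              (λ {u} t → inj₂ (extend-fresh {sh s} {δ} es {u} t)))
            (subst₂ (λ a b → lateκ A M A′ (extend B̄) w₁ + (uO A croot + a) ≤ κ + (uO A croot + b))
              (sym (trans (pairΦ-off croot g 0 (uO A′) (dO (extend B̄)) x) (cong (uO A′ croot +_) (trans (cong (dO (extend B̄)) (sym last≡)) (Closed.ext-down es δ)))))
              (sym (pairΦ-off croot g 0 (uO A′) (dO B′) x))
              (subst (λ k → costO A + costK M + (costO A′ + k) + w₁ + (uO A croot + (uO A′ croot + 0)) ≤ κ + (uO A croot + (uO A′ croot + dO B′ x)))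
                (sym (costO-extend B̄))
                (lin 0 (eq (costO A) (costK M) (costO A′) (cost es) (Done.X δ) w₁ (uO A croot) (uO A′ croot) (dO B′ x)) d≥)))
            (subst₂ (λ i k → rankO A + 3 + i + (lenK M ∸ (lenO A′ + lenO (extend B̄))) * suc R < rankO A + 3 + k + (lenK M ∸ (lenO A′ + len es)) * suc R)
              (+-comm R (rankO A′)) (+-comm (rank s) (rankO A′))
              (budget {lenK M} {R} {rankO A + 3} {lenO A′ + len es} {Done.rr δ} {_} {rank s} {rankO A′} (Done.1≤rr δ)
                (≤-trans (≤-reflexive (+-assoc (lenO A′) (len es) (Done.rr δ))) (inner-room {lenO A′} {len es + Done.rr δ} (Late.a≤ I) (<⇒≤ (≰⇒> near))))
                (trans (cong (lenO A′ +_) (lenO-extend B̄)) (sym (+-assoc (lenO A′) (len es) (Done.rr δ))))))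
            where
            small : 3 * lenO (extend B̄) ≤ lenK M
            small = subst (λ k → 3 * k ≤ lenK M) (sym (lenO-extend B̄)) (<⇒≤ (≰⇒> near))
            eq : ∀ a m b x d w u u′ v → a + m + (b + (x + d)) + w + (u + (u′ + 0)) + v + 0 ≡ a + m + (b + x) + w + (u + (u′ + v)) + d
            eq = solveℕ 9 (λ a m b x d w u u′ v → a ⊕ m ⊕ (b ⊕ (x ⊕ d)) ⊕ w ⊕ (u ⊕ (u′ ⊕ lit 0)) ⊕ v ⊕ lit 0 ⊜ a ⊕ m ⊕ (b ⊕ x) ⊕ w ⊕ (u ⊕ (u′ ⊕ v)) ⊕ d) refl

      late-second : ∀ v → T (oPd B′ v) → Move state (arm (not f) (inj₂ (arm (not g) v)))
      late-second v t = react (armStep es s v t)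
        where
        react : ArmStep es s v → Move state (arm (not f) (inj₂ (arm (not g) v)))
        react (next s′ gr pend _ d≤ rk) = second-next v s′ gr pend d≤ rk
        react (full δ gr ge last≡ _ d≥) = decide (lenK M ≤? 3 * (len es + Done.rr δ))
          where
          decide : Dec (lenK M ≤ 3 * (len es + Done.rr δ)) → Move state (arm (not f) (inj₂ (arm (not g) v)))
          decide (yes far) = second-shut δ v d≥ last≡ t gr far
          decide (no near) = second-more δ v d≥ last≡ t ge near

  module _ (f : Bool) (A : O) (M : K) (g : Bool) (A′ : O) (B′ : K) (w : ℕ) (oA : lenO A ≤ 14 * Λ) (long : Reach ≤ lenK M)
    (I : Closing M (lenO A′) (lenK B′) w) where

    private
      state = closing f A M g A′ B′ w oA long I
      κ = closingκ A M A′ B′ w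
      S₂ = inner′ M g A′ B′
      module De = Detour f A M g A′ B′
      k = ccs (proj₁ A) + ccK M + (ccs (proj₁ A′) + ccK B′)
      t = cc (proj₂ A) + cc (proj₂ A′) + rr (proj₂ A′)
      j = ccK M + (ccO A′ + rrO A′ + ccK B′)

      t≤ : t ≤ 3 * Λ
      t≤ = ≤-trans (+-mono-≤ (+-mono-≤ (cc≤Λ (proj₂ A)) (cc≤Λ (proj₂ A′))) (rr≤Λ (proj₂ A′))) (≤-reflexive (eq Λ))
        where
        eq : ∀ l → l + l + l ≡ 3 * l
        eq = solveℕ 1 (λ l → l ⊕ l ⊕ l ⊜ lit 3 ⊗ l) refl

      ratio : 10 * (N * (ccO A + j)) ≤ 3 * (N * (κ + De.whole + De.d hub)) + (ccO A + j)
      ratio = subst₂ (λ k d → 10 * (N * k) ≤ 3 * (N * (κ + De.whole + d)) + k)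
        (eq (ccs (proj₁ A)) (ccK M) (ccs (proj₁ A′)) (ccK B′) (lenO A′) (cc (proj₂ A)) (cc (proj₂ A′)) (rr (proj₂ A′)))
        (sym (De.at-hub (Closing.b≤ I)))
        (detour-ratio {k} {costO A + costK M + (costO A′ + costK B′)} {lenO A} {lenK M} {lenO A′} {lenK B′} {w} {t}
          (add {ccs (proj₁ A) + ccK M} {costO A + costK M} {lenO A + lenK M} {ccs (proj₁ A′) + ccK B′} {costO A′ + costK B′} {lenO A′ + lenK B′}
            (add {ccs (proj₁ A)} {costO A} {lenO A} {ccK M} {costK M} {lenK M} (qualO A) (qualK M))
            (add {ccs (proj₁ A′)} {costO A′} {lenO A′} {ccK B′} {costK B′} {lenK B′} (qualO A′) (qualK B′)))
          (+-mono-≤ (+-mono-≤ (len≤ccs (proj₁ A)) (len≤K M)) (+-mono-≤ (len≤ccs (proj₁ A′)) (len≤K B′)))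
          oA t≤ (Closing.a≤w I) (Closing.a≤ I) (Closing.≤b I) (≤-trans (≤-reflexive (sym Reach≡)) long))
        where
        eq : ∀ a m f l e x y z → a + m + (f + l) + e + (x + y + z) ≡ a + x + (m + (f + y + (e + z) + l))
        eq = solveℕ 8 (λ a m f l e x y z → a ⊕ m ⊕ (f ⊕ l) ⊕ e ⊕ (x ⊕ y ⊕ z) ⊜ a ⊕ x ⊕ (m ⊕ (f ⊕ y ⊕ (e ⊕ z) ⊕ l))) refl

      result : ∀ v → T (oPd A′ v) → final
      result v tv = record
        { shape = closed f (oS A) S₂ ; κ = ccO A + j
        ; tour = ring-tour f (oS A) S₂ (oSCover A) (innerCover′ M g A′ B′)
        ; Φ = λ u → κ + De.whole + De.d u
        ; Φ-lip = λ {e} p → lip-shift {p = De.d} (κ + De.whole) {e} (De.d-lip (Closing.b≤ I) p)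
        ; ratio = ratio
        ; low′ = arm (not f) (inj₂ (arm g v))
        ; low∈ = in-fork-B f (oS A) S₂ {inj₂ (arm g v)} (in-fork-A g (oC A′) (kC B′) {v} (oPd⊆ A′ tv))
        ; low< = subst₂ _<_ (cong (κ + De.whole +_) (sym (De.at-tip tv))) (cong (κ + De.whole +_) (sym (De.at-hub (Closing.b≤ I))))
            (+-monoʳ-< (κ + De.whole) (≤-trans (1≤lenK B′) (m≤m+n _ _)))
        }

    closing-end : ∀ v → T (oPd A′ v) → Move state (arm (not f) (inj₂ (arm g v)))
    closing-end v t = ended (result v t) , grow-refl (closed f (oS A) S₂) _ , (λ ()) ,
      ≤-reflexive (trans (cong (κ + De.whole +_) (De.at-tip t)) (trans (+-identityʳ _) (cong (λ d → κ + (De.whole ∸ d)) (sym (De.at-tip t))))) ,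
      s≤s z≤n

  stepT′ : ∀ s x → T (pdT s x) → Move s x
  stepT′ (opening false (ds , s) B w oA oB) (arm false (inj₁ x)) t = opening-A false ds s B w oA oB x t
  stepT′ (opening true (ds , s) B w oA oB) (arm true (inj₁ x)) t = opening-A true ds s B w oA oB x t
  stepT′ (opening false A (ds , s) w oA oB) (arm true (inj₁ x)) t = opening-B false A ds s w oA oB x t
  stepT′ (opening true A (ds , s) w oA oB) (arm false (inj₁ x)) t = opening-B true A ds s w oA oB x t
  stepT′ (opening false A B w oA oB) (arm false (inj₂ _)) ()
  stepT′ (opening false A B w oA oB) (arm true (inj₂ _)) ()
  stepT′ (opening true A B w oA oB) (arm false (inj₂ _)) ()
  stepT′ (opening true A B w oA oB) (arm true (inj₂ _)) ()
  stepT′ (forked false (ds , s) M w oA l) (arm false (inj₁ x)) t = forked-A false ds s M w oA l x t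
  stepT′ (forked true (ds , s) M w oA l) (arm true (inj₁ x)) t = forked-A true ds s M w oA l x t
  stepT′ (forked false A M w oA l) (arm true (inj₂ hub)) t = forked-hub false A M w oA l
  stepT′ (forked true A M w oA l) (arm false (inj₂ hub)) t = forked-hub true A M w oA l
  stepT′ (forked false A M w oA l) (arm true (inj₂ (arm _ _))) ()
  stepT′ (forked true A M w oA l) (arm false (inj₂ (arm _ _))) ()
  stepT′ (forked false A M w oA l) (arm false (inj₂ _)) ()
  stepT′ (forked true A M w oA l) (arm true (inj₂ _)) ()
  stepT′ (forked false A M w oA l) (arm true (inj₁ _)) ()
  stepT′ (forked true A M w oA l) (arm false (inj₁ _)) ()
  stepT′ (late false (ds , s) M g A′ B′ w oA l I) (arm false (inj₁ x)) t = late-A false ds s M g A′ B′ w oA l I x t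
  stepT′ (late true (ds , s) M g A′ B′ w oA l I) (arm true (inj₁ x)) t = late-A true ds s M g A′ B′ w oA l I x t
  stepT′ (late false A M false (es , s) B′ w oA l I) (arm true (inj₂ (arm false v))) t = late-first false A M false w oA l es s B′ w I v t
  stepT′ (late false A M true (es , s) B′ w oA l I) (arm true (inj₂ (arm true v))) t = late-first false A M true w oA l es s B′ w I v t
  stepT′ (late false A M false A′ (es , s) w oA l I) (arm true (inj₂ (arm true v))) t = late-second false A M false w oA l A′ es s w I v t
  stepT′ (late false A M true A′ (es , s) w oA l I) (arm true (inj₂ (arm false v))) t = late-second false A M true w oA l A′ es s w I v t
  stepT′ (late true A M false (es , s) B′ w oA l I) (arm false (inj₂ (arm false v))) t = late-first true A M false w oA l es s B′ w I v t
  stepT′ (late true A M true (es , s) B′ w oA l I) (arm false (inj₂ (arm true v))) t = late-first true A M true w oA l es s B′ w I v t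
  stepT′ (late true A M false A′ (es , s) w oA l I) (arm false (inj₂ (arm true v))) t = late-second true A M false w oA l A′ es s w I v t
  stepT′ (late true A M true A′ (es , s) w oA l I) (arm false (inj₂ (arm false v))) t = late-second true A M true w oA l A′ es s w I v t
  stepT′ (late false A M g A′ B′ w oA l I) (arm true (inj₂ hub)) ()
  stepT′ (late true A M g A′ B′ w oA l I) (arm false (inj₂ hub)) ()
  stepT′ (late false A M g A′ B′ w oA l I) (arm false (inj₂ _)) ()
  stepT′ (late true A M g A′ B′ w oA l I) (arm true (inj₂ _)) ()
  stepT′ (late false A M g A′ B′ w oA l I) (arm true (inj₁ _)) ()
  stepT′ (late true A M g A′ B′ w oA l I) (arm false (inj₁ _)) ()
  stepT′ (closing false A M false A′ B′ w oA l I) (arm true (inj₂ (arm false v))) t = closing-end false A M false A′ B′ w oA l I v t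
  stepT′ (closing false A M true A′ B′ w oA l I) (arm true (inj₂ (arm true v))) t = closing-end false A M true A′ B′ w oA l I v t
  stepT′ (closing true A M false A′ B′ w oA l I) (arm false (inj₂ (arm false v))) t = closing-end true A M false A′ B′ w oA l I v t
  stepT′ (closing true A M true A′ B′ w oA l I) (arm false (inj₂ (arm true v))) t = closing-end true A M true A′ B′ w oA l I v t
  stepT′ (closing false A M false A′ B′ w oA l I) (arm true (inj₂ (arm true v))) ()
  stepT′ (closing false A M true A′ B′ w oA l I) (arm true (inj₂ (arm false v))) ()
  stepT′ (closing true A M false A′ B′ w oA l I) (arm false (inj₂ (arm true v))) ()
  stepT′ (closing true A M true A′ B′ w oA l I) (arm false (inj₂ (arm false v))) ()
  stepT′ (closing false A M g A′ B′ w oA l I) (arm true (inj₂ hub)) ()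
  stepT′ (closing true A M g A′ B′ w oA l I) (arm false (inj₂ hub)) ()
  stepT′ (closing false A M g A′ B′ w oA l I) (arm true (inj₁ _)) ()
  stepT′ (closing true A M g A′ B′ w oA l I) (arm false (inj₁ _)) ()
  stepT′ (closing false A M g A′ B′ w oA l I) (arm false _) ()
  stepT′ (closing true A M g A′ B′ w oA l I) (arm true _) ()

  statusT : ∀ s → (∃[ v ] T (pdT s v)) ⊎
    (∃[ κ ] Tour (edges (shT s)) hub hub κ (In (shT s)) × 10 * (N * κ) ≤ 3 * (N * ΦT s hub) + κ ×
      (∃[ v ] In (shT s) v × ΦT s v < ΦT s hub))
  statusT (opening f A B _ _ _) = inj₁ (arm f (inj₁ (last (oC A))) , subst T (sym (side-at f (openPd A) (openPd B) _)) (oPd-last A))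
  statusT (forked f A M _ _ _) = inj₁ (arm f (inj₁ (last (oC A))) , subst T (sym (side-at f (openPd A) (innerPd hubPd) _)) (oPd-last A))
  statusT (late f A M g A′ B′ _ _ _ _) = inj₁ (arm f (inj₁ (last (oC A))) ,
    subst T (sym (side-at f (openPd A) (innerPd (forkPd g (oPd A′) (oPd B′))) _)) (oPd-last A))
  statusT (closing f A M g A′ B′ _ _ _ _) = inj₁ (arm (not f) (inj₂ (arm g (last (oC A′)))) ,
    subst T (sym (side-off f noPd (innerPd (forkPd g (oPd A′) (λ _ → false))) _)) (subst T (sym (side-at g (oPd A′) (λ _ → false) _)) (oPd-last A′)))
  statusT (ended F) = inj₂ (Final.κ F , Final.tour F , Final.ratio F , Final.low′ F , Final.low∈ F , Final.low< F)

  decC : (x y : C) → Dec (x ≡ y)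
  decC (i , u) (j , v) with i ≟ j | dec u v
  ... | yes refl | yes refl = yes refl
  ... | no ne | _ = no λ { refl → ne refl }
  ... | _ | no ne = no λ { refl → ne refl }

  decX : (x y : X) → Dec (x ≡ y)
  decX (inj₁ a) (inj₁ b) with decC a b
  ... | yes refl = yes refl
  ... | no ne = no λ { refl → ne refl }
  decX (inj₂ a) (inj₂ b) with decFork decC a b
  ... | yes refl = yes refl
  ... | no ne = no λ { refl → ne refl }
  decX (inj₁ _) (inj₂ _) = no λ ()
  decX (inj₂ _) (inj₁ _) = no λ ()

  game : Game N
  game = record
    { V = Fork X ; dec = decFork decX ; root = hub ; St = TSt ; start = opening false fresh fresh 0 z≤n z≤n
    ; sh = shT ; pd = pdT ; pd⊆ = λ {s} {v} → pd⊆T {s} {v} ; Φ = ΦT ; Φ-lip = ΦT-lip ; reach = reachT ; rank = rankT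
    ; Φ-start = cong₂ _+_ Φ-start Φ-start ; pd-start = λ () ; step = stepT′ ; status = statusT }

open import Defs hiding (_+_; _*_; _≤_; _<_; _≈_)
open import Data.Integer using (+_)
open import Data.Rational using (ℚ; 0ℚ; 1ℚ; _/_)

-- The instance given by a weighted graph and an enumeration of its vertices

nat : ℕ → ℚ
nat zero = 0ℚ
nat (suc k) = 1ℚ ℚ.+ nat k

nat-+ : ∀ a b → nat (a + b) ≡ nat a ℚ.+ nat b
nat-+ zero b = sym (ℚₚ.+-identityˡ (nat b))
nat-+ (suc a) b = trans (cong (1ℚ ℚ.+_) (nat-+ a b)) (sym (ℚₚ.+-assoc 1ℚ (nat a) (nat b)))

nat-nonNeg : ∀ a → 0ℚ ℚ.≤ nat a
nat-nonNeg zero = ℚₚ.≤-refl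
nat-nonNeg (suc a) = ℚₚ.≤-trans (ℚₚ.≤-reflexive (sym (ℚₚ.+-identityˡ 0ℚ)))
  (ℚₚ.+-mono-≤ (ℚₚ.<⇒≤ (ℚₚ.positive⁻¹ 1ℚ)) (nat-nonNeg a))

nat-mono : ∀ {a b} → a ≤ b → nat a ℚ.≤ nat b
nat-mono {b = b} z≤n = nat-nonNeg b
nat-mono (s≤s le) = ℚₚ.+-monoʳ-≤ 1ℚ (nat-mono le)

≤-slack : ∀ q {ε} → 0ℚ ℚ.< ε → q ℚ.≤ q ℚ.+ ε
≤-slack q 0<ε = ℚₚ.≤-trans (ℚₚ.≤-reflexive (sym (ℚₚ.+-identityʳ q))) (ℚₚ.+-monoʳ-≤ q (ℚₚ.<⇒≤ 0<ε))

module Weights {V : Set} (dec : (u v : V) → Dec (u ≡ v)) where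

  Joins : Edge V → V → V → Set
  Joins e u v = (src e ≡ u × tgt e ≡ v) ⊎ (src e ≡ v × tgt e ≡ u)

  joins? : ∀ e u v → Dec (Joins e u v)
  joins? e u v with dec (src e) u | dec (tgt e) v | dec (src e) v | dec (tgt e) u
  ... | yes a | yes b | _ | _ = yes (inj₁ (a , b))
  ... | _ | _ | yes c | yes d = yes (inj₂ (c , d))
  ... | no a | _ | no c | _ = no λ { (inj₁ (p , _)) → a p ; (inj₂ (p , _)) → c p }
  ... | no a | _ | _ | no d = no λ { (inj₁ (p , _)) → a p ; (inj₂ (_ , p)) → d p }
  ... | _ | no b | no c | _ = no λ { (inj₁ (_ , p)) → b p ; (inj₂ (p , _)) → c p }
  ... | _ | no b | _ | no d = no λ { (inj₁ (_ , p)) → b p ; (inj₂ (_ , p)) → d p }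

  -- Of parallel edges only a lightest one matters.
  best : List (Edge V) → V → V → Maybe ℕ
  best [] u v = nothing
  best (e ∷ E) u v with joins? e u v
  ... | no _ = best E u v
  ... | yes _ with best E u v
  ...   | nothing = just (wt e)
  ...   | just k = just (wt e ⊓ k)

  best-sound : ∀ E {u v k} → best E u v ≡ just k → ∃[ e ] e ∈ E × Joins e u v × wt e ≡ k
  best-sound (e ∷ E) {u} {v} eq with joins? e u v
  best-sound (e ∷ E) {u} {v} eq | no _ with e′ , p , j , w ← best-sound E eq = e′ , there p , j , w
  best-sound (e ∷ E) {u} {v} eq | yes j with best E u v in b
  best-sound (e ∷ E) {u} {v} refl | yes j | nothing = e , here refl , j , refl
  best-sound (e ∷ E) {u} {v} refl | yes j | just k with ≤-total (wt e) k
  ... | inj₁ le = e , here refl , j , sym (m≤n⇒m⊓n≡m le)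
  ... | inj₂ ge with e′ , p , j′ , w ← best-sound E b = e′ , there p , j′ , trans w (sym (m≥n⇒m⊓n≡n ge))

  best-least : ∀ E {e u v} → e ∈ E → Joins e u v → ∃[ k ] best E u v ≡ just k × k ≤ wt e
  best-least (e ∷ E) {e′} {u} {v} p j with joins? e u v
  best-least (e ∷ E) {e′} {u} {v} (here refl) j | no n = ⊥-elim (n j)
  best-least (e ∷ E) {e′} {u} {v} (there p) j | no n = best-least E p j
  best-least (e ∷ E) {e′} {u} {v} p j | yes _ with best E u v in b
  best-least (e ∷ E) {e′} {u} {v} (here refl) j | yes _ | nothing = wt e , refl , ≤-refl
  best-least (e ∷ E) {e′} {u} {v} (here refl) j | yes _ | just k = wt e ⊓ k , refl , m⊓n≤m _ _
  best-least (e ∷ E) {e′} {u} {v} (there p) j | yes _ | nothing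
    with _ , eq , _ ← best-least E p j with () ← trans (sym b) eq
  best-least (e ∷ E) {e′} {u} {v} (there p) j | yes _ | just k
    with l , eq , le ← best-least E p j with refl ← trans (sym b) eq = wt e ⊓ k , refl , ≤-trans (m⊓n≤n _ _) le

  best-agree : ∀ E E′ {u v u′ v′} → (∀ {e} → Joins e u v → e ∈ E → Joins e u′ v′ × e ∈ E′) →
    (∀ {e} → Joins e u′ v′ → e ∈ E′ → Joins e u v × e ∈ E) → best E u v ≡ best E′ u′ v′
  best-agree E E′ {u} {v} {u′} {v′} f g with best E u v in p | best E′ u′ v′ in q
  ... | nothing | nothing = refl
  ... | just k | nothing with e , i , j , _ ← best-sound E p with j′ , i′ ← f j i
    with _ , eq , _ ← best-least E′ i′ j′ with () ← trans (sym q) eq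
  ... | nothing | just k with e , i , j , _ ← best-sound E′ q with j′ , i′ ← g j i
    with _ , eq , _ ← best-least E i′ j′ with () ← trans (sym p) eq
  ... | just k | just l
    with e , i , j , w ← best-sound E p | e′ , i′ , j′ , w′ ← best-sound E′ q
    with a , b ← f j i | c , d ← g j′ i′
    with _ , eq , le ← best-least E′ b a | _ , eq′ , le′ ← best-least E d c
    with refl ← trans (sym q) eq | refl ← trans (sym p) eq′ =
    cong just (≤-antisym (≤-trans le′ (≤-reflexive w′)) (≤-trans le (≤-reflexive w)))

  joins-sym : ∀ e {u v} → Joins e u v → Joins e v u
  joins-sym e (inj₁ p) = inj₂ p
  joins-sym e (inj₂ p) = inj₁ p

  best-sym : ∀ E u v → best E u v ≡ best E v u
  best-sym E u v = best-agree E E (λ {e} j i → joins-sym e j , i) (λ {e} j i → joins-sym e j , i)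

lookup-injective : ∀ {V : Set} {vs : List V} → Unique vs → ∀ i j → lookup vs i ≡ lookup vs j → i ≡ j
lookup-injective (_ ∷ _) fzero fzero _ = refl
lookup-injective {vs = _ ∷ vs} (a ∷ _) fzero (fsuc j) eq = ⊥-elim (All.lookup a (∈-lookup {xs = vs} j) eq)
lookup-injective {vs = _ ∷ vs} (a ∷ _) (fsuc i) fzero eq = ⊥-elim (All.lookup a (∈-lookup {xs = vs} i) (sym eq))
lookup-injective (_ ∷ u) (fsuc i) (fsuc j) eq = cong fsuc (lookup-injective u i j eq)

prefix : ∀ {V} {E : List (Edge V)} {u v k vs x} → Path E u v k vs → x ∈ vs → ∃[ l ] ∃[ ws ] Path E u x l ws
prefix [] (here refl) = _ , _ , []
prefix (go e∈ p) (here refl) = _ , _ , []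
prefix (go e∈ p) (there i) with _ , _ , q ← prefix p i = _ , _ , go e∈ q
prefix (back e∈ p) (here refl) = _ , _ , []
prefix (back e∈ p) (there i) with _ , _ , q ← prefix p i = _ , _ , back e∈ q

module Network {V : Set} (dec : (u v : V) → Dec (u ≡ v)) {r : V} (S : Shape V r) (vs : List V) (unique : Unique vs)
  (complete : ∀ {v} → In S v → v ∈ vs) (sound : ∀ {v} → v ∈ vs → In S v)
  (reach : ∃[ u ] ∃[ k ] Tour (edges S) r u k (In S)) where
  open Weights dec

  E : List (Edge V)
  E = edges S

  name : Fin (length vs) → V
  name = lookup vs

  name-injective : ∀ i j → name i ≡ name j → i ≡ j
  name-injective = lookup-injective unique

  toFin : ∀ {v} → In S v → Fin (length vs)
  toFin v∈ = index (complete v∈)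

  name-toFin : ∀ {v} (v∈ : In S v) → name (toFin v∈) ≡ v
  name-toFin v∈ = sym (lookup-index (complete v∈))

  adjacent : V → V → Bool
  adjacent u v = is-just (best E u v)

  length′ : V → V → ℕ
  length′ u v = maybe id 0 (best E u v)

  no-loop : ∀ v → best E v v ≡ nothing
  no-loop v with best E v v in eq
  ... | nothing = refl
  ... | just k with e , i , j , _ ← best-sound E eq = ⊥-elim (<-irrefl refl (loop j (fwd S i)))
    where
    loop : Joins e v v → pos S (src e) < pos S (tgt e) → pos S v < pos S v
    loop (inj₁ (refl , eq)) lt = subst (λ w → pos S v < pos S w) eq lt
    loop (inj₂ (refl , eq)) lt = subst (λ w → pos S v < pos S w) eq lt

  net : Graph
  net = record
    { order = length vs
    ; edge = λ i j → adjacent (name i) (name j)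
    ; edge-sym = λ i j → cong is-just (best-sym E (name i) (name j))
    ; edge-irrefl = λ i → cong is-just (no-loop (name i)) }

  open Graph net using (Walk; []; _▷_; vertices; neighbours; Vertex)

  costN : ∀ {i j} → Walk i j → ℕ
  costN [] = 0
  costN (_▷_ {v = v} {w = w} p _) = costN p + length′ (name v) (name w)

  -- A `Path` is built at its front and a `Walk` at its end, so the path is appended step by step to
  -- a walk `p` already made. The cost may drop, because a lighter parallel edge may be used.
  record Follow {s i : Vertex} (p : Walk s i) (v : V) (k : ℕ) (us : List V) : Set where
    field
      {stop′} : Vertex
      at      : name stop′ ≡ v
      walk    : Walk s stop′
      cheap   : costN walk ≤ costN p + k
      before  : ∀ {l} → l ∈ vertices p → l ∈ vertices walk
      covers  : ∀ {x} → x ∈ us → ∃[ l ] name l ≡ x × l ∈ vertices walk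

  here∈ : ∀ {i j} (p : Walk i j) → j ∈ vertices p
  here∈ [] = here refl
  here∈ (_ ▷ _) = here refl

  mutual
    follow : ∀ {s i u v k us} (p : Walk s i) → name i ≡ u → Path E u v k us → Follow p v k us
    follow p refl [] = record { at = refl ; walk = p ; cheap = m≤m+n _ 0 ; before = id ; covers = λ { (here refl) → _ , refl , here∈ p } }
    follow p eq (go {e} e∈ q) = continue p e e∈ (inj₁ (refl , refl)) eq (tgt∈ S e∈) q
    follow p eq (back {e} e∈ q) = continue p e e∈ (inj₂ (refl , refl)) eq (src∈ S e∈) q

    continue : ∀ {s i} (p : Walk s i) e → e ∈ E → ∀ {a b k v us} → Joins e a b → name i ≡ a → In S b →
      Path E b v k us → Follow p v (wt e + k) (a ∷ us)
    continue {s} {i} p e e∈ {a} {b} {k} j refl b∈ q with l , bq , le ← best-least E e∈ j = record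
      { at = Follow.at rest ; walk = Follow.walk rest
      ; cheap = ≤-trans (Follow.cheap rest) (≤-trans (+-monoˡ-≤ k (+-monoʳ-≤ (costN p) (≤-trans (≤-reflexive (cong (maybe id 0) bq′)) le)))
          (≤-reflexive (+-assoc (costN p) (wt e) k)))
      ; before = Follow.before rest ∘ there
      ; covers = λ { (here refl) → i , refl , Follow.before rest (there (here∈ p)) ; (there m) → Follow.covers rest m } }
      where
      bq′ : best E (name i) (name (toFin b∈)) ≡ just l
      bq′ = trans (cong (best E (name i)) (name-toFin b∈)) bq
      rest = follow (_▷_ {w = toFin b∈} p (subst (T ∘ is-just) (sym bq′) tt)) (name-toFin b∈) q

  home : Vertex
  home = toFin (root∈ S)

  connected : Graph.Connected net
  connected i j = subst (Walk i) (name-injective _ _ (Follow.at two)) (Follow.walk two)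
    where
    tour = proj₂ (proj₂ (proj₂ reach))
    arrive : ∀ i → ∃[ l ] ∃[ us ] Path E r (name i) l us
    arrive i = prefix (proj₁ tour) (proj₂ tour (sound (∈-lookup i)))
    one = follow {i = i} [] refl (proj₁ (proj₂ (revT {C = λ _ → ⊥} (_ , proj₂ (proj₂ (arrive i)) , λ ()))))
    two = follow (Follow.walk one) (Follow.at one) (proj₂ (proj₂ (arrive j)))

  weightR : V → V → R.ℝ
  weightR u v = fromℚ (nat (length′ u v))

  ≤-refl-ℝ : ∀ {x y} → x ≡ y → x R.≤ y
  ≤-refl-ℝ {x} refl ε 0<ε = 0 , λ n _ → ≤-slack (seq x n) 0<ε

  instance′ : Instance
  instance′ = record
    { graph = net ; connected = connected ; origin = home
    ; ident = toℕ ; ident-unique = λ _ _ → toℕ-injective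
    ; weight = λ i j → weightR (name i) (name j)
    ; weight-sym = λ i j _ → ≤-refl-ℝ (same i j) , ≤-refl-ℝ (sym (same i j))
    ; weight-nonNeg = λ i j _ ε 0<ε → 0 , λ n _ → ℚₚ.≤-trans (nat-nonNeg (length′ (name i) (name j)))
        (≤-slack _ 0<ε)
    }
    where
    same : ∀ i j → weightR (name i) (name j) ≡ weightR (name j) (name i)
    same i j = cong (λ m → fromℚ (nat (maybe id 0 m))) (best-sym E (name i) (name j))

  cost-seq : ∀ {i j} (p : Walk i j) n → seq (Instance.cost instance′ p) n ≡ nat (costN p)
  cost-seq [] n = refl
  cost-seq (p ▷ _) n = trans (cong (ℚ._+ _) (cost-seq p n)) (sym (nat-+ (costN p) _))

  -- The identifier of a vertex is its position in vs, so that it does not change when vs is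
  -- extended by vertices that are still hidden.
  position : List V → V → ℕ
  position [] v = 0
  position (u ∷ us) v with dec u v
  ... | yes _ = 0
  ... | no _ = suc (position us v)

  entry : ℕ → V → V → List (ℕ × R.ℝ)
  entry k v u = if adjacent v u then (k , weightR v u) ∷ [] else []

  entries : ℕ → List V → V → List (ℕ × R.ℝ)
  entries k [] v = []
  entries k (u ∷ us) v = entry k v u ++ entries (suc k) us v

  -- The observation in terms of vertices of the shape instead of indices, so that observations in
  -- instances of different size can be compared.
  sight : V → Observation
  sight v = position vs v , entries 0 vs v

  position-lookup : ∀ us → Unique us → ∀ j → position us (lookup us j) ≡ toℕ j
  position-lookup (u ∷ us) (a ∷ _) fzero with dec u u
  ... | yes _ = refl
  ... | no n = ⊥-elim (n refl)
  position-lookup (u ∷ us) (a ∷ un) (fsuc j) with dec u (lookup us j)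
  ... | yes eq = ⊥-elim (All.lookup a (∈-lookup {xs = us} j) eq)
  ... | no _ = cong suc (position-lookup us un j)

  -- Generalised from the full vertex list to a suffix `us` that starts at index `k`.
  neighbour-entries : ∀ i us k (f : Fin (length us) → Vertex) → (∀ j → name (f j) ≡ lookup us j) → (∀ j → toℕ (f j) ≡ k + toℕ j) →
    map (λ w → toℕ w , weightR (name i) (name w)) (filter (λ w → T? (adjacent (name i) (name w))) (tabulate f)) ≡ entries k us (name i)
  neighbour-entries i [] k f _ _ = refl
  neighbour-entries i (u ∷ us) k f names indices with names fzero | indices fzero
  ... | refl | at0 with adjacent (name i) (name (f fzero)) | neighbour-entries i us (suc k) (f ∘ fsuc) (names ∘ fsuc) (λ j → trans (indices (fsuc j)) (+-suc k (toℕ j)))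
  ...   | true | rest = cong₂ _∷_ (cong (_, weightR (name i) (name (f fzero))) (trans at0 (+-identityʳ k))) rest
  ...   | false | rest = rest

  observe-sight : ∀ i → Instance.observe instance′ i ≡ sight (name i)
  observe-sight i = cong₂ _,_ (sym (position-lookup vs unique i)) (neighbour-entries i vs 0 id (λ _ → refl) (λ _ → refl))

-- Playing the game against an algorithm

path-in : ∀ {V r} (S : Shape V r) {u v k us} → Path (edges S) u v k us → In S u → ∀ {x} → x ∈ us → In S x
path-in S [] u∈ (here refl) = u∈
path-in S (go e∈ p) u∈ (here refl) = u∈
path-in S (go e∈ p) u∈ (there i) = path-in S p (tgt∈ S e∈) i
path-in S (back e∈ p) u∈ (here refl) = u∈
path-in S (back e∈ p) u∈ (there i) = path-in S p (src∈ S e∈) i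

member? : ∀ {V : Set} (dec : (u v : V) → Dec (u ≡ v)) x (us : List V) → Dec (x ∈ us)
member? dec x [] = no λ ()
member? dec x (u ∷ us) with dec x u | member? dec x us
... | yes eq | _ = yes (here eq)
... | no _ | yes p = yes (there p)
... | no n | no m = no λ { (here eq) → n eq ; (there p) → m p }

enlarge : ∀ {V : Set} (dec : (u v : V) → Dec (u ≡ v)) (vs us : List V) → Unique vs →
  ∃[ ws ] Unique (vs ++ ws) × (∀ {x} → x ∈ us → x ∈ vs ++ ws) × (∀ {x} → x ∈ ws → x ∈ us)
enlarge dec vs [] un = [] , subst Unique (sym (++-identityʳ vs)) un , (λ ()) , (λ ())
enlarge dec vs (u ∷ us) un with member? dec u vs
... | yes u∈ with ws , un′ , f , g ← enlarge dec vs us un =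
  ws , un′ , (λ { (here refl) → ∈-++⁺ˡ u∈ ; (there p) → f p }) , there ∘ g
... | no u∉ with ws , un′ , f , g ← enlarge dec (vs ++ u ∷ []) us
        (Uniqueₚ.++⁺ un (All.[] ∷ []) λ { (a , here refl) → u∉ a }) =
  u ∷ ws , subst Unique eq un′ ,
  (λ { (here refl) → ∈-++⁺ʳ vs (here refl) ; {x} (there p) → subst (x ∈_) eq (f p) }) ,
  (λ { (here refl) → here refl ; (there p) → there (g p) })
  where
  eq : (vs ++ u ∷ []) ++ ws ≡ vs ++ u ∷ ws
  eq = ++-assoc vs (u ∷ []) ws

-- b continues the trace a (most recent vertex first)
data Extends {V : Set} : List V → List V → Set where
  same : ∀ {t} → Extends t t
  more : ∀ {t b w} → Extends (w ∷ t) b → Extends t b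

extends-step : ∀ {V : Set} {a b : List V} {w} → Extends a b → Extends a (w ∷ b)
extends-step same = more same
extends-step (more e) = more (extends-step e)

goto-injective : ∀ {i j} → goto i ≡ goto j → i ≡ j
goto-injective refl = refl

module Play (A : Algorithm) {N : ℕ} (G : Game N) where
  open Game G
  open Weights dec
  open Algorithm A using (strategy; explores)

  record Known (s : St) : Set where
    field
      vs       : List V
      unique   : Unique vs
      complete : ∀ {v} → In (sh s) v → v ∈ vs
      sound    : ∀ {v} → v ∈ vs → In (sh s) v

  module Net (s : St) (K : Known s) where
    open Known K public
    open Network dec (sh s) vs unique complete sound (reach s) public

    -- Unlike `Follows`, a trace consists of vertices and costs only and is not tied to the walks of
    -- one instance; therefore it can be read again in a larger one.
    data Trace : List V → ℕ → Set where
      begin : Trace (root ∷ []) 0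
      move  : ∀ {v t k w c} → Trace (v ∷ t) k → strategy (map sight (v ∷ t)) ≡ goto (position vs w) →
              best E v w ≡ just c → w ∈ vs → Trace (w ∷ v ∷ t) (k + c)

    position-injective : ∀ us {u v} → u ∈ us → v ∈ us → position us u ≡ position us v → u ≡ v
    position-injective (x ∷ us) {u} {v} p q eq with dec x u | dec x v
    ... | yes a | yes b = trans (sym a) b
    ... | no n | yes _ with () ← eq
    ... | yes _ | no _ with () ← eq
    position-injective (x ∷ us) (here refl) q eq | no n | no m = ⊥-elim (n refl)
    position-injective (x ∷ us) (there p) (here refl) eq | no n | no m = ⊥-elim (m refl)
    position-injective (x ∷ us) (there p) (there q) eq | no n | no m = position-injective us p q (suc-injective eq)

    trace-cost : ∀ {t k l} → Trace t k → Trace t l → k ≡ l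
    trace-cost begin begin = refl
    trace-cost (move a _ p _) (move b _ q _) with refl ← trans (sym p) q = cong (_+ _) (trace-cost a b)

    trace-visits : ∀ {t k v} → Trace t k → v ∈ t → v ∈ vs
    trace-visits begin (here refl) = complete (root∈ (sh s))
    trace-visits (move a _ _ w∈) (here refl) = w∈
    trace-visits (move a _ _ _) (there p) = trace-visits a p

    cut : ∀ {a v b k} → Trace b k → Extends (v ∷ a) b → ∃[ l ] Trace (v ∷ a) l
    cut tr same = _ , tr
    cut tr (more e) with _ , move tr′ _ _ _ ← cut tr e = _ , tr′

    from-root : ∀ {b k} → Trace b k → Extends (root ∷ []) b
    from-root begin = same
    from-root (move tr _ _ _) = extends-step (from-root tr)

    -- The strategy is deterministic and positions identify vertices, so two traces cannot branch.
    compare-traces : ∀ {a b k l} → Trace a k → Trace b l → Extends a b ⊎ ∃[ w ] Extends (w ∷ b) a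
    compare-traces begin tr = inj₁ (from-root tr)
    compare-traces (move a s≡ _ w∈) tr with compare-traces a tr
    ... | inj₁ same = inj₂ (_ , same)
    ... | inj₂ (u , e) = inj₂ (u , extends-step e)
    ... | inj₁ (more e) with _ , move _ s≡′ _ w∈′ ← cut tr e
      with refl ← position-injective vs w∈ w∈′ (goto-injective (trans (sym s≡) s≡′)) = inj₁ e

    open Graph net using (Walk; []; _▷_; vertices; Vertex)

    tail : ∀ {i j} → Walk i j → List Vertex
    tail [] = []
    tail (p ▷ _) = vertices p

    vertices-tail : ∀ {i j} (p : Walk i j) → vertices p ≡ j ∷ tail p
    vertices-tail [] = refl
    vertices-tail (p ▷ _) = refl

    history-sight : ∀ {i j} (p : Walk i j) → Instance.history instance′ p ≡ map sight (map name (vertices p))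
    history-sight [] = cong (_∷ []) (observe-sight _)
    history-sight (p ▷ _) = cong₂ _∷_ (observe-sight _) (history-sight p)

    follows-trace : ∀ {j} {p : Walk home j} → Follows strategy instance′ p → Trace (map name (vertices p)) (costN p)
    follows-trace start = subst (λ v → Trace (v ∷ []) 0) (sym (name-toFin (root∈ (sh s)))) begin
    follows-trace (step {v = v} {w = w} {p = p} fo eq e) with best E (name v) (name w) in b | e
    ... | just c | _ = subst (λ us → Trace (name w ∷ us) (costN p + c)) (sym split)
        (move (subst (λ us → Trace us (costN p)) split (follows-trace fo))
          (trans (cong strategy (trans (cong (map sight) (sym split)) (sym (history-sight p))))
            (trans eq (cong goto (sym (position-lookup vs unique w)))))
          b (∈-lookup w))
      where
      split : map name (vertices p) ≡ name v ∷ map name (tail p)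
      split = cong (map name) (vertices-tail p)

    run : CompleteRun strategy instance′
    run = explores instance′

    final-cost : ℕ
    final-cost = costN (CompleteRun.walk run)

    full : List V
    full = map name (vertices (CompleteRun.walk run))

    full-trace : Trace full final-cost
    full-trace = follows-trace (CompleteRun.follows run)

    full-covers : ∀ {v} → In (sh s) v → v ∈ full
    full-covers v∈ = subst (_∈ full) (name-toFin v∈) (∈-map⁺ name (CompleteRun.covers run (toFin v∈)))

    full-root : ∀ {v t} → v ∷ t ≡ full → v ≡ root
    full-root eq with vertices (CompleteRun.walk run) | vertices-tail (CompleteRun.walk run)
    full-root refl | _ | refl = name-toFin (root∈ (sh s))

    -- Otherwise the trace would go on at a point where the complete run has stopped.
    extends-full : ∀ {v t k} → Trace (v ∷ t) k → Extends (v ∷ t) full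
    extends-full tr with compare-traces tr full-trace
    ... | inj₁ e = e
    ... | inj₂ (w , e) = ⊥-elim (halt (cut tr e))
      where
      halt : ¬ (∃[ l ] Trace (w ∷ full) l)
      halt (l , tr′) with full in eq
      halt (_ , begin) | _ with () ← trans (sym (cong (map name) (vertices-tail (CompleteRun.walk run)))) eq
      halt (l , move _ s≡ _ _) | v ∷ t
        with () ← trans (sym (CompleteRun.stops run)) (trans (cong strategy (trans (history-sight (CompleteRun.walk run)) (cong (map sight) eq))) s≡)

unique-disjoint : ∀ {V : Set} (us : List V) {ws x} → Unique (us ++ ws) → x ∈ us → ¬ x ∈ ws
unique-disjoint (u ∷ us) (a ∷ _) (here refl) q = All.lookup a (∈-++⁺ʳ us q) refl
unique-disjoint (u ∷ us) (_ ∷ un) (there p) q = unique-disjoint us un p q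

-- Carrying a run over to the enlarged instance

module Playing (A : Algorithm) {N : ℕ} (G : Game N) where
  open Game G
  open Weights dec
  open Algorithm A using (strategy)
  open Play A G

  module Transport (s s′ : St) (K : Known s) (g : Grow (sh s) (sh s′) (pd s)) where
    private
      tour = proj₂ (proj₂ (reach s′))
      extra = enlarge dec (Known.vs K) (proj₁ tour) (Known.unique K)
      ws = proj₁ extra

    K′ : Known s′
    K′ = record
      { vs = Known.vs K ++ ws
      ; unique = proj₁ (proj₂ extra)
      ; complete = λ v∈ → proj₁ (proj₂ (proj₂ extra)) (proj₂ (proj₂ tour) v∈)
      ; sound = λ v∈ → [ inV-mono g ∘ Known.sound K ,
          (λ p → path-in (sh s′) (proj₁ (proj₂ tour)) (root∈ (sh s′)) (proj₂ (proj₂ (proj₂ extra)) p)) ]′ (∈-++⁻ (Known.vs K) v∈) }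

    private
      module O = Net s K
      module I = Net s′ K′

    -- Nothing new is attached to such a vertex, so it offers the same observation in both
    -- instances.
    Settled : V → Set
    Settled u = In (sh s) u × ¬ T (pd s u)

    settled-edge : ∀ {u w e} → Settled u → Joins e u w → e ∈ edges (sh s′) → e ∈ edges (sh s)
    settled-edge {e = e} (u∈ , ¬pd) j e∈ with edge-new g e∈
    ... | inj₁ p = p
    ... | inj₂ (a , b) = ⊥-elim (closed j)
      where
      shut : ¬ Open (sh s) (pd s) _
      shut (inj₁ p) = ¬pd p
      shut (inj₂ n) = n u∈
      closed : ¬ Joins e _ _
      closed (inj₁ (eq , _)) = shut (subst (Open (sh s) (pd s)) eq a)
      closed (inj₂ (_ , eq)) = shut (subst (Open (sh s) (pd s)) eq b)

    settled-best : ∀ {u} → Settled u → ∀ w → best O.E u w ≡ best I.E u w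
    settled-best {u} st w = best-agree O.E I.E (λ j i → j , edge-mono g i) (λ j i → j , settled-edge st j i)

    same-position : ∀ us {u} → u ∈ us → O.position us u ≡ I.position (us ++ ws) u
    same-position (x ∷ us) {u} p with dec x u
    same-position (x ∷ us) {u} p | yes _ = refl
    same-position (x ∷ us) {u} (here refl) | no n = ⊥-elim (n refl)
    same-position (x ∷ us) {u} (there p) | no n = cong suc (same-position us p)

    best-outside : ∀ {u x} → x ∈ ws → best O.E u x ≡ nothing
    best-outside {u} {x} x∈ with best O.E u x in eq
    ... | nothing = refl
    ... | just k with e , e∈ , j , _ ← best-sound O.E eq =
      ⊥-elim (unique-disjoint (Known.vs K) (proj₁ (proj₂ extra)) (Known.complete K (end j)) x∈)
      where
      end : Joins e u x → In (sh s) x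
      end (inj₁ (_ , refl)) = tgt∈ (sh s) e∈
      end (inj₂ (refl , _)) = src∈ (sh s) e∈

    show-entry : ℕ → Maybe ℕ → List (ℕ × R.ℝ)
    show-entry k m = if is-just m then (k , fromℚ (nat (maybe id 0 m))) ∷ [] else []

    no-entries : ∀ us k {u} → Settled u → (∀ {x} → x ∈ us → x ∈ ws) → I.entries k us u ≡ []
    no-entries [] k st sub = refl
    no-entries (x ∷ us) k st sub = cong₂ _++_
      (cong (show-entry k) (trans (sym (settled-best st x)) (best-outside (sub (here refl)))))
      (no-entries us (suc k) st (sub ∘ there))

    same-entries : ∀ us k {u} → Settled u → O.entries k us u ≡ I.entries k (us ++ ws) u
    same-entries [] k st = sym (no-entries ws k st id)
    same-entries (x ∷ us) k {u} st = trans
      (cong₂ _++_ (cong (show-entry k) (settled-best st x)) (same-entries us (suc k) st)) refl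

    same-sight : ∀ {u} → Settled u → O.sight u ≡ I.sight u
    same-sight st = cong₂ _,_ (same-position (Known.vs K) (Known.complete K (proj₁ st))) (same-entries (Known.vs K) 0 st)

    same-sights : ∀ {t} → (∀ {u} → u ∈ t → Settled u) → map O.sight t ≡ map I.sight t
    same-sights {[]} st = refl
    same-sights {u ∷ t} st = cong₂ _∷_ (same-sight (st (here refl))) (same-sights (st ∘ there))

    -- The last vertex `w` need not be settled: the adversary reacts to its visit, and its
    -- observation has not yet influenced any move.
    transport : ∀ {w t k} → (∀ {u} → u ∈ t → Settled u) → O.Trace (w ∷ t) k → I.Trace (w ∷ t) k
    transport st O.begin = I.begin
    transport st (O.move {w = w} tr s≡ b≡ w∈) = I.move (transport (st ∘ there) tr)
      (trans (cong strategy (sym (same-sights st))) (trans s≡ (cong goto (same-position (Known.vs K) w∈))))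
      (trans (sym (settled-best (st (here refl)) w)) b≡) (∈-++⁺ˡ w∈)

  Winning : Set
  Winning = ∃[ s ] Σ (Known s) λ K → Φ s root ≤ Net.final-cost s K ×
    ∃[ κ ] Tour (edges (sh s)) root root κ (In (sh s)) × 10 * (N * κ) ≤ 3 * (N * Φ s root) + κ ×
      (∃[ v ] In (sh s) v × Φ s v < Φ s root)

  module _ (s : St) (K : Known s) where
    open Net s K

    -- The complete run visits every vertex. If it met no pending vertex, there is none, and
    -- `status` yields the decided case.
    finish : ∀ {v t k} → v ∷ t ≡ full → Trace (v ∷ t) k → (∀ {u} → u ∈ v ∷ t → ¬ T (pd s u)) → Φ s v ≤ k → Winning
    finish {v} {t} eq tr calm le = conclude (status s)
      where
      conclude : _ → Winning
      conclude (inj₁ (u , p)) = ⊥-elim (calm (subst (u ∈_) (sym eq) (full-covers (pd⊆ p))) p)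
      conclude (inj₂ data′) with refl ← full-root eq =
        s , K , ≤-trans le (≤-reflexive (trace-cost tr (subst (λ us → Trace us final-cost) (sym eq) full-trace))) , data′

    one-step : ∀ {v w t b} → Extends (w ∷ v ∷ t) b → b ≡ full → ∀ {k} → Trace (v ∷ t) k → Φ s v ≤ k →
      ∃[ l ] Trace (w ∷ v ∷ t) l × Φ s w ≤ l
    one-step {v} {w} e refl {k} tr le with cut full-trace e
    ... | _ , tr′@(move {c = c} tr″ _ b≡ _) with refl ← trace-cost tr tr″ with e , e∈ , j , refl ← best-sound E b≡ =
      k + c , tr′ , ≤-trans (climb j (Φ-lip s e∈)) (+-monoˡ-≤ (wt e) le)
      where
      climb : Joins e v w → Lip (Φ s) e → Φ s w ≤ Φ s v + wt e
      climb (inj₁ (refl , refl)) (_ , q) = q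
      climb (inj₂ (refl , refl)) (q , _) = q

  mutual
    -- The complete run on the current instance is followed up to the first pending vertex; then the
    -- instance changes and the part walked so far is replayed. The rank bounds the number of
    -- changes, and between two of them the recursion is on the rest of the run.
    play : ∀ fuel s (K : Known s) {v t k} → rank s < fuel → Net.Trace s K (v ∷ t) k →
      (∀ {u} → u ∈ v ∷ t → ¬ T (pd s u)) → Φ s v ≤ k → Winning
    play (suc fuel) s K r tr calm le = proceed fuel s K (≤-pred r) (Net.extends-full s K tr) refl refl tr calm le

    proceed : ∀ fuel s (K : Known s) {v t k a b} → rank s ≤ fuel → Extends a b → a ≡ v ∷ t → b ≡ Net.full s K →
      Net.Trace s K (v ∷ t) k → (∀ {u} → u ∈ v ∷ t → ¬ T (pd s u)) → Φ s v ≤ k → Winning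
    proceed fuel s K r same refl eq tr calm le = finish s K eq tr calm le
    proceed fuel s K r (more {w = w} e) refl eq tr calm le with one-step s K e eq tr le | T? (pd s w)
    ... | _ , tr′ , le′ | no n = proceed fuel s K r e refl eq tr′ (λ { (here refl) → n ; (there p) → calm p }) le′
    ... | _ , tr′ , le′ | yes p with s′ , g , pend , Φ≤ , r′ ← Game.step G s w p =
      play fuel s′ (Transport.K′ s s′ K g) (≤-trans r′ r)
        (Transport.transport s s′ K g (λ q → visited (there q) , calm q) tr′)
        calm′ (≤-trans Φ≤ le′)
      where
      visited : ∀ {u} → u ∈ w ∷ _ → In (sh s) u
      visited q = Known.sound K (Net.trace-visits s K tr′ q)
      calm′ : ∀ {u} → u ∈ w ∷ _ → ¬ T (pd s′ u)
      calm′ q t with pend t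
      ... | inj₂ n = n (visited q)
      calm′ (here refl) t | inj₁ (_ , ne) = ne refl
      calm′ (there q) t | inj₁ (p′ , _) = calm q p′

  winning : Winning
  winning = play (suc (rank (Game.start G))) (Game.start G) K₀ ≤-refl (Net.begin) (λ { (here refl) → pd-start }) (≤-reflexive Φ-start)
    where
    tour = proj₂ (proj₂ (reach (Game.start G)))
    extra = enlarge dec [] (proj₁ tour) []
    K₀ : Known (Game.start G)
    K₀ = record
      { vs = proj₁ extra ; unique = proj₁ (proj₂ extra)
      ; complete = λ v∈ → proj₁ (proj₂ (proj₂ extra)) (proj₂ (proj₂ tour) v∈)
      ; sound = λ p → path-in (sh (Game.start G)) (proj₁ (proj₂ tour)) (root∈ (sh (Game.start G))) (proj₂ (proj₂ (proj₂ extra)) p) }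

-- Optimal tours and rational arithmetic

-- `P` is not assumed to be decidable, so the minimum is obtained only up to double negation. This
-- suffices, since it is used to derive a contradiction.
least : (P : ℕ → Set) → ∀ k → P k → ¬ ¬ (∃[ m ] P m × (∀ j → P j → m ≤ j))
least P k p none = go′ (suc k) k ≤-refl p
  where
  go′ : ∀ fuel k → k < fuel → ¬ P k
  go′ (suc fuel) k lt p = none (k , p , λ j q → ≮⇒≥ λ j<k → go′ fuel j (≤-trans j<k (≤-pred lt)) q)

module Optimum {V : Set} (dec : (u v : V) → Dec (u ≡ v)) {r : V} (S : Shape V r) (vs : List V) (unique : Unique vs)
  (complete : ∀ {v} → In S v → v ∈ vs) (sound : ∀ {v} → v ∈ vs → In S v)
  (reach : ∃[ u ] ∃[ k ] Tour (edges S) r u k (In S)) where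
  open Weights dec
  open Network dec S vs unique complete sound reach
  open Graph net using (Walk; []; _▷_; vertices; Covers)

  CoverCost : ℕ → Set
  CoverCost k = Σ (Walk home home) λ p → Covers p × costN p ≡ k

  tour-walk : ∀ {κ} → Tour E r r κ (In S) → ∃[ k ] CoverCost k × k ≤ κ
  tour-walk {κ} (us , path , cov) =
    close (name-injective _ _ (trans at (sym (name-toFin (root∈ S))))) (Follow.walk f) (Follow.cheap f) (Follow.covers f)
    where
    f = follow {i = home} [] (name-toFin (root∈ S)) path
    open Follow f using (at)
    close : ∀ {l} → l ≡ home → (p : Walk home l) → costN p ≤ κ → (∀ {x} → x ∈ us → ∃[ l ] name l ≡ x × l ∈ vertices p) →
      ∃[ k ] CoverCost k × k ≤ κ
    close refl p c g = costN p , (p , visits , refl) , c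
      where
      visits : Covers p
      visits w with l , eq , m ← g (cov (sound (∈-lookup w))) with refl ← name-injective l w eq = m

  walk-lip : ∀ {Φ} → Lips Φ E → ∀ {i j} (p : Walk i j) {l} → l ∈ vertices p → Φ (name i) ≤ Φ (name l) + costN p
  walk-lip lip [] (here refl) = m≤m+n _ 0
  walk-lip {Φ} lip (p ▷ _) (there m) = ≤-trans (walk-lip {Φ} lip p m) (+-monoʳ-≤ (Φ _) (m≤m+n _ _))
  walk-lip {Φ} lip (_▷_ {v = v} {w = w} p e) (here refl) with best E (name v) (name w) in b | e
  ... | just c | _ with h , h∈ , j , refl ← best-sound E b =
    ≤-trans (walk-lip {Φ} lip p (here∈ p)) (≤-trans (+-monoˡ-≤ (costN p) (climb j (lip h∈)))
      (≤-reflexive (trans (+-assoc (Φ (name w)) (wt h) (costN p)) (cong (λ k → Φ (name w) + k) (+-comm (wt h) (costN p))))))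
    where
    climb : Joins h (name v) (name w) → Lip Φ h → Φ (name v) ≤ Φ (name w) + wt h
    climb (inj₁ (refl , refl)) (q , _) = q
    climb (inj₂ (refl , refl)) (_ , q) = q

  -- The optimum is positive because a covering walk visits `v`, where the potential is smaller than
  -- at the root.
  optimum : ∀ {κ Φ v} → Tour E r r κ (In S) → Lips Φ E → In S v → Φ v < Φ r →
    ¬ ¬ (∃[ m ] Instance.IsOPT instance′ (fromℚ (nat m)) × 1 ≤ m × m ≤ κ)
  optimum {κ} {Φ} {v} tour lip v∈ low none with k , c , k≤ ← tour-walk tour =
    least CoverCost k c λ { (m , (p , cov , refl) , small) → none (m , record
      { tour = p ; tour-covers = cov
      ; tour-cost = ≤-refl′ {Instance.cost instance′ p} {fromℚ (nat (costN p))} (cost-seq p) ,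
                    ≤-refl′ {fromℚ (nat (costN p))} {Instance.cost instance′ p} (λ n → sym (cost-seq p n))
      ; minimal = λ q covq ε 0<ε → 0 , λ n _ → ℚₚ.≤-trans (nat-mono (small _ (q , covq , refl)))
          (ℚₚ.≤-trans (≤-slack _ 0<ε) (ℚₚ.≤-reflexive (cong (ℚ._+ ε) (sym (cost-seq q n)))))
      } , positive p cov , ≤-trans (small k c) k≤) }
    where
    ≤-refl′ : ∀ {x y} → (∀ n → seq x n ≡ seq y n) → x R.≤ y
    ≤-refl′ {x} {y} eq ε 0<ε = 0 , λ n _ → ℚₚ.≤-trans (ℚₚ.≤-reflexive (eq n)) (≤-slack (seq y n) 0<ε)
    positive : ∀ p → Covers p → 1 ≤ costN p
    positive p cov with costN p | walk-lip {Φ} lip p (cov (toFin v∈))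
    ... | suc _ | _ = s≤s z≤n
    ... | zero | le = ⊥-elim (<⇒≱ low (subst₂ _≤_ (cong Φ (name-toFin (root∈ S)))
      (trans (+-identityʳ _) (cong Φ (name-toFin v∈))) le))

0≤-+ : ∀ {p q} → 0ℚ ℚ.≤ p → 0ℚ ℚ.≤ q → 0ℚ ℚ.≤ p ℚ.+ q
0≤-+ {p} {q} 0≤p 0≤q = ℚₚ.≤-trans (ℚₚ.≤-reflexive (sym (ℚₚ.+-identityˡ 0ℚ))) (ℚₚ.+-mono-≤ 0≤p 0≤q)

0≤-* : ∀ {p q} → 0ℚ ℚ.≤ p → 0ℚ ℚ.≤ q → 0ℚ ℚ.≤ p ℚ.* q
0≤-* {p} {q} 0≤p 0≤q = ℚₚ.nonNegative⁻¹ (p ℚ.* q) {{ℚₚ.nonNeg*nonNeg⇒nonNeg p {{ℚ.nonNegative 0≤p}} q {{ℚ.nonNegative 0≤q}}}}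

0<-* : ∀ {p q} → 0ℚ ℚ.< p → 0ℚ ℚ.< q → 0ℚ ℚ.< p ℚ.* q
0<-* {p} {q} 0<p 0<q = ℚₚ.positive⁻¹ (p ℚ.* q) {{ℚₚ.pos*pos⇒pos p {{ℚ.positive 0<p}} q {{ℚ.positive 0<q}}}}

gap : ∀ {p q} → p ℚ.≤ q → 0ℚ ℚ.≤ q ℚ.- p
gap {p} {q} le = ℚₚ.≤-trans (ℚₚ.≤-reflexive (sym (ℚₚ.+-inverseʳ p))) (ℚₚ.+-monoˡ-≤ (ℚ.- p) le)

≤-by : ∀ {p q} t → 0ℚ ℚ.≤ t → p ℚ.+ t ≡ q → p ℚ.≤ q
≤-by {p} t 0≤t eq = ℚₚ.≤-trans (ℚₚ.≤-reflexive (sym (ℚₚ.+-identityʳ p)))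
  (ℚₚ.≤-trans (ℚₚ.+-monoʳ-≤ p 0≤t) (ℚₚ.≤-reflexive eq))

nat-* : ∀ a b → nat (a * b) ≡ nat a ℚ.* nat b
nat-* zero b = sym (ℚₚ.*-zeroˡ (nat b))
nat-* (suc a) b = trans (nat-+ b (a * b)) (trans (cong (nat b ℚ.+_) (nat-* a b))
  (sym (trans (ℚₚ.*-distribʳ-+ (nat b) 1ℚ (nat a)) (cong (ℚ._+ nat a ℚ.* nat b) (ℚₚ.*-identityˡ (nat b))))))

below-nat : ∀ q → ∃[ k ] q ℚ.≤ nat (suc k)
below-nat q@(ℚ.mkℚ n d _) = k , ℚₚ.toℚᵘ-cancel-≤ (ℚᵘₚ.≤-trans bound (ℚᵘₚ.≤-reflexive (ℚᵘₚ.≃-sym (nat-toℚᵘ (suc k)))))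
  where
  k = ℤ.∣ n ∣
  nat-toℚᵘ : ∀ k → ℚ.toℚᵘ (nat k) ℚᵘ.≃ ℚᵘ.mkℚᵘ (+ k) 0
  nat-toℚᵘ zero = ℚᵘₚ.≃-refl
  nat-toℚᵘ (suc k) = ℚᵘₚ.≃-trans (ℚₚ.toℚᵘ-homo-+ 1ℚ (nat k)) (ℚᵘₚ.≃-trans (ℚᵘₚ.+-congʳ ℚᵘ.1ℚᵘ (nat-toℚᵘ k))
    (ℚᵘ.*≡* (cong (λ j → (+ 1 ℤ.+ j) ℤ.* + 1) (ℤₚ.*-identityʳ (+ k)))))
  bound : ℚ.toℚᵘ q ℚᵘ.≤ ℚᵘ.mkℚᵘ (+ suc k) 0
  bound = ℚᵘ.*≤* (ℤₚ.≤-trans (ℤₚ.≤-reflexive (ℤₚ.*-identityʳ n)) (below n))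
    where
    below : ∀ n → n ℤ.≤ + suc ℤ.∣ n ∣ ℤ.* + suc d
    below (+ j) = ℤ.+≤+ (≤-trans (n≤1+n j) (m≤m*n (suc j) (suc d)))
    below ℤ.-[1+ j ] = ℤ.-≤+

-- After collecting terms κ has the coefficient 10N - 1, which is nonnegative as N ≥ 1, so κ may be
-- lowered to `m`; it appears as `9 + 10 * N` once N is replaced by its successor.
drop-slack : ∀ {N a κ m Φ} → 1 ≤ N → 10 * (N * κ) ≤ 3 * (N * Φ) + κ → Φ ≤ a → m ≤ κ → 10 * (N * m) ≤ 3 * (N * a) + m
drop-slack {suc N} {a} {κ} {m} {Φ} _ f Φ≤a m≤κ = lin 0 (eq N a κ m Φ)
  (+-mono-≤ (+-mono-≤ f (*-monoʳ-≤ 3 (*-monoʳ-≤ (suc N) Φ≤a))) (*-monoʳ-≤ (9 + 10 * N) m≤κ))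
  where
  eq : ∀ N a κ m Φ → 10 * ((1 + N) * m) + (3 * ((1 + N) * Φ) + κ + 3 * ((1 + N) * a) + (9 + 10 * N) * κ) + 0 ≡
    3 * ((1 + N) * a) + m + (10 * ((1 + N) * κ) + 3 * ((1 + N) * Φ) + (9 + 10 * N) * m)
  eq = solveℕ 5 (λ N a κ m Φ → lit 10 ⊗ ((lit 1 ⊕ N) ⊗ m) ⊕ (lit 3 ⊗ ((lit 1 ⊕ N) ⊗ Φ) ⊕ κ ⊕ lit 3 ⊗ ((lit 1 ⊕ N) ⊗ a) ⊕ (lit 9 ⊕ lit 10 ⊗ N) ⊗ κ) ⊕ lit 0 ⊜
    lit 3 ⊗ ((lit 1 ⊕ N) ⊗ a) ⊕ m ⊕ (lit 10 ⊗ ((lit 1 ⊕ N) ⊗ κ) ⊕ lit 3 ⊗ ((lit 1 ⊕ N) ⊗ Φ) ⊕ (lit 9 ⊕ lit 10 ⊗ N) ⊗ m)) refl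

-- Chaining the hypotheses gives 10Nm ≤ 3N(qm + δ) + m ≤ 10Nm - 6Nmδ + 3Nδ + m. By m ≥ 1 and Nδ ≥ 1
-- the right-hand side is at most 10Nm - 2m.
clash : ∀ {N a m q δ} → 0ℚ ℚ.< δ → 1ℚ ℚ.≤ nat N ℚ.* δ → 10 * (N * m) ≤ 3 * (N * a) + m → 1 ≤ m →
  nat a ℚ.≤ q ℚ.* nat m ℚ.+ δ → q ℚ.+ (δ ℚ.+ δ) ℚ.≤ + 10 / 3 → ⊥
clash {N} {a} {m} {q} {δ} 0<δ large less 1≤m cost≤ q≤ = ℚₚ.<-irrefl refl (ℚₚ.<-≤-trans (ℚₚ.positive⁻¹ (1ℚ ℚ.+ 1ℚ))
  (≤-by _ (0≤-+ (0≤-+ (0≤-+ (0≤-+ (0≤-+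
      (0≤-* (0≤-* (nat-nonNeg 3) n≥0) (gap cost≤))
      (0≤-* (0≤-* (0≤-* (nat-nonNeg 3) n≥0) M≥0) (gap q≤)))
      (gap less′))
      (0≤-* (0≤-* (nat-nonNeg 3) (0≤-* n≥0 (ℚₚ.<⇒≤ 0<δ))) (gap 1≤M)))
      (0≤-* (0≤-* (nat-nonNeg 3) M≥0) (gap large)))
      (0≤-* (nat-nonNeg 2) (gap 1≤M)))
    (identity (nat N) (nat a) (nat m) q δ)))
  where
  n≥0 = nat-nonNeg N
  M≥0 = nat-nonNeg m
  1≤M : 1ℚ ℚ.≤ nat m
  1≤M = nat-mono {1} 1≤m
  less′ : nat 10 ℚ.* (nat N ℚ.* nat m) ℚ.≤ nat 3 ℚ.* (nat N ℚ.* nat a) ℚ.+ nat m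
  less′ = subst₂ ℚ._≤_ (trans (nat-* 10 (N * m)) (cong (nat 10 ℚ.*_) (nat-* N m)))
    (trans (nat-+ (3 * (N * a)) m) (cong (ℚ._+ nat m) (trans (nat-* 3 (N * a)) (cong (nat 3 ℚ.*_) (nat-* N a)))))
    (nat-mono less)
  open ℚSolver.+-*-Solver
  identity : ∀ n A M q δ → (1ℚ ℚ.+ 1ℚ) ℚ.+
    (nat 3 ℚ.* n ℚ.* ((q ℚ.* M ℚ.+ δ) ℚ.- A) ℚ.+ nat 3 ℚ.* n ℚ.* M ℚ.* ((+ 10 / 3) ℚ.- (q ℚ.+ (δ ℚ.+ δ))) ℚ.+
      ((nat 3 ℚ.* (n ℚ.* A) ℚ.+ M) ℚ.- nat 10 ℚ.* (n ℚ.* M)) ℚ.+ nat 3 ℚ.* (n ℚ.* δ) ℚ.* (M ℚ.- 1ℚ) ℚ.+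
      nat 3 ℚ.* M ℚ.* (n ℚ.* δ ℚ.- 1ℚ) ℚ.+ nat 2 ℚ.* (M ℚ.- 1ℚ)) ≡ 0ℚ
  identity = solve 5 (λ n A M q δ → (con 1ℚ :+ con 1ℚ) :+
    (con (nat 3) :* n :* ((q :* M :+ δ) :- A) :+ con (nat 3) :* n :* M :* (con (+ 10 / 3) :- (q :+ (δ :+ δ))) :+
      ((con (nat 3) :* (n :* A) :+ M) :- con (nat 10) :* (n :* M)) :+ con (nat 3) :* (n :* δ) :* (M :- con 1ℚ) :+
      con (nat 3) :* M :* (n :* δ :- con 1ℚ) :+ con (nat 2) :* (M :- con 1ℚ)) := con 0ℚ) refl

multiple : ∀ {δ} → 0ℚ ℚ.< δ → ∃[ k ] 1ℚ ℚ.≤ nat (suc k) ℚ.* δ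
multiple {δ} 0<δ with k , le ← below-nat ((ℚ.1/ δ) {{ℚₚ.pos⇒nonZero δ {{ℚ.positive 0<δ}}}}) =
  k , ℚₚ.≤-trans (ℚₚ.≤-reflexive (sym (ℚₚ.*-inverseˡ δ {{ℚₚ.pos⇒nonZero δ {{ℚ.positive 0<δ}}}})))
    (ℚₚ.*-monoʳ-≤-nonNeg δ {{ℚ.nonNegative (ℚₚ.<⇒≤ 0<δ)}} le)

-- Sequences that are bounded away from zero, or have a nonnegative limit

Eventually : (ℕ → Set) → Set
Eventually P = ∃[ N ] (∀ n → N ≤ n → P n)

eventually : ∀ {P Q R : ℕ → Set} → (∀ n → P n → Q n → R n) → Eventually P → Eventually Q → Eventually R
eventually f (M , p) (N , q) = M ⊔ N , λ n le → f n (p n (m⊔n≤o⇒m≤o M N le)) (q n (m⊔n≤o⇒n≤o M N le))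

Seq : Set
Seq = ℕ → ℚ

record Pos (f : Seq) : Set where
  constructor isPos
  field apart : ∃[ ε ] 0ℚ ℚ.< ε × Eventually (λ n → 0ℚ ℚ.≤ f n ℚ.- ε)

record NonNeg (f : Seq) : Set where
  constructor nonNeg
  field above : ∀ ε → 0ℚ ℚ.< ε → Eventually (λ n → 0ℚ ℚ.≤ f n ℚ.+ ε)

open NonNeg

half : ∀ {ε} → 0ℚ ℚ.< ε → ∃[ η ] 0ℚ ℚ.< η × η ℚ.+ η ≡ ε
half {ε} 0<ε = ε ℚ.* ℚ.½ , 0<-* 0<ε (ℚₚ.positive⁻¹ ℚ.½) , trans (sym (ℚₚ.*-distribˡ-+ ε ℚ.½ ℚ.½)) (ℚₚ.*-identityʳ ε)

quotient : ∀ {ε B} → 0ℚ ℚ.< ε → 0ℚ ℚ.< B → ∃[ δ ] 0ℚ ℚ.< δ × δ ℚ.* B ≡ ε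
quotient {ε} {B} 0<ε 0<B = ε ℚ.* 1/B ,
  0<-* 0<ε (ℚₚ.positive⁻¹ 1/B {{ℚₚ.1/pos⇒pos B {{ℚ.positive 0<B}}}}) ,
  trans (ℚₚ.*-assoc ε 1/B B) (trans (cong (ε ℚ.*_) (ℚₚ.*-inverseˡ B {{nz}})) (ℚₚ.*-identityʳ ε))
  where
  nz = ℚₚ.pos⇒nonZero B {{ℚ.positive 0<B}}
  1/B = (ℚ.1/ B) {{nz}}

0<gap : ∀ {p q} → p ℚ.< q → 0ℚ ℚ.< q ℚ.- p
0<gap {p} lt = ℚₚ.≤-<-trans (ℚₚ.≤-reflexive (sym (ℚₚ.+-inverseʳ p))) (ℚₚ.+-monoˡ-< (ℚ.- p) lt)

0<-suc : ∀ {p} → 0ℚ ℚ.≤ p → 0ℚ ℚ.< p ℚ.+ 1ℚ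
0<-suc {p} 0≤p = ℚₚ.<-≤-trans (ℚₚ.positive⁻¹ 1ℚ) (≤-by p 0≤p (ℚₚ.+-comm 1ℚ p))

0≤-≡ : ∀ {p q} → 0ℚ ℚ.≤ p → p ≡ q → 0ℚ ℚ.≤ q
0≤-≡ le refl = le

module _ where
  open ℚSolver.+-*-Solver

  pos-ext : ∀ {f g} → (∀ n → f n ≡ g n) → Pos f → Pos g
  pos-ext eq (isPos (ε , 0<ε , N , p)) = isPos (ε , 0<ε , N , λ n le → 0≤-≡ (p n le) (cong (ℚ._- ε) (eq n)))

  nonNeg-ext : ∀ {f g} → (∀ n → f n ≡ g n) → NonNeg f → NonNeg g
  nonNeg-ext eq p = nonNeg λ ε 0<ε → let N , q = above p ε 0<ε in N , λ n le → 0≤-≡ (q n le) (cong (ℚ._+ ε) (eq n))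

  pos-const : ∀ {q} → 0ℚ ℚ.< q → Pos (λ _ → q)
  pos-const {q} 0<q = isPos (q , 0<q , 0 , λ _ _ → gap {q} ℚₚ.≤-refl)

  nonNeg-const : ∀ {q} → 0ℚ ℚ.≤ q → NonNeg (λ _ → q)
  nonNeg-const 0≤q = nonNeg λ ε 0<ε → 0 , λ _ _ → 0≤-+ 0≤q (ℚₚ.<⇒≤ 0<ε)

  pos⇒nonNeg : ∀ {f} → Pos f → NonNeg f
  pos⇒nonNeg {f} (isPos (η , 0<η , N , p)) = nonNeg λ ε 0<ε → N , λ n le → 0≤-≡
    (0≤-+ (0≤-+ (p n le) (ℚₚ.<⇒≤ 0<η)) (ℚₚ.<⇒≤ 0<ε))
    (solve 3 (λ f η ε → f :- η :+ η :+ ε := f :+ ε) refl (f n) η ε)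

  nonNeg-+ : ∀ {f g} → NonNeg f → NonNeg g → NonNeg (λ n → f n ℚ.+ g n)
  nonNeg-+ {f} {g} (nonNeg p) (nonNeg q) .above ε 0<ε with η , 0<η , refl ← half 0<ε = eventually (λ n a b → 0≤-≡ (0≤-+ a b)
    (solve 3 (λ f g η → (f :+ η) :+ (g :+ η) := f :+ g :+ (η :+ η)) refl (f n) (g n) η)) (p η 0<η) (q η 0<η)

  pos-+ : ∀ {f g} → Pos f → NonNeg g → Pos (λ n → f n ℚ.+ g n)
  pos-+ {f} {g} (isPos (ε , 0<ε , p)) (nonNeg q) with η , 0<η , refl ← half 0<ε = isPos (η , 0<η , eventually (λ n a b → 0≤-≡ (0≤-+ a b)
    (solve 3 (λ f g η → (f :- (η :+ η)) :+ (g :+ η) := f :+ g :- η) refl (f n) (g n) η)) p (q η 0<η))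

  pos-* : ∀ {f g} → Pos f → Pos g → Pos (λ n → f n ℚ.* g n)
  pos-* {f} {g} (isPos (ε , 0<ε , p)) (isPos (η , 0<η , q)) = isPos (ε ℚ.* η , 0<-* 0<ε 0<η , eventually (λ n a b → 0≤-≡
    (0≤-+ (0≤-+ (0≤-* a b) (0≤-* a (ℚₚ.<⇒≤ 0<η))) (0≤-* (ℚₚ.<⇒≤ 0<ε) b))
    (solve 4 (λ f g ε η → (f :- ε) :* (g :- η) :+ (f :- ε) :* η :+ ε :* (g :- η) := f :* g :- ε :* η) refl (f n) (g n) ε η)) p q)

  nonNeg-scale : ∀ {f c} → 0ℚ ℚ.≤ c → NonNeg f → NonNeg (λ n → c ℚ.* f n)
  nonNeg-scale {f} {c} 0≤c (nonNeg p) .above ε 0<ε =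
    let η , 0<η , eq = quotient {ε} {c ℚ.+ 1ℚ} 0<ε (0<-suc 0≤c)
        N , q = p η 0<η
    in N , λ n le → 0≤-≡ (0≤-+ (0≤-* 0≤c (q n le)) (ℚₚ.<⇒≤ 0<η)) (trans (identity (f n) c η) (cong (c ℚ.* f n ℚ.+_) eq))
    where
    identity : ∀ f c η → c ℚ.* (f ℚ.+ η) ℚ.+ η ≡ c ℚ.* f ℚ.+ η ℚ.* (c ℚ.+ 1ℚ)
    identity = solve 3 (λ f c η → c :* (f :+ η) :+ η := c :* f :+ η :* (c :+ con 1ℚ)) refl

  nonNeg-unscale : ∀ {f c} → 0ℚ ℚ.< c → NonNeg (λ n → c ℚ.* f n) → NonNeg f
  nonNeg-unscale {f} {c} 0<c (nonNeg p) .above ε 0<ε with N , q ← p (c ℚ.* ε) (0<-* 0<c 0<ε) = N , λ n le →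
    ℚₚ.*-cancelˡ-≤-pos c {{ℚ.positive 0<c}} (ℚₚ.≤-trans (ℚₚ.≤-reflexive (ℚₚ.*-zeroʳ c))
      (0≤-≡ (q n le) (sym (ℚₚ.*-distribˡ-+ c (f n) ε))))

  absurd : ∀ {f g} → Pos f → NonNeg g → (∀ n → f n ℚ.+ g n ≡ 0ℚ) → ⊥
  absurd {f} {g} p q eq with isPos (ε , 0<ε , N , r) ← pos-+ p q = ℚₚ.<-irrefl refl (ℚₚ.<-≤-trans 0<ε
    (≤-by _ (r N ≤-refl) (trans (solve 2 (λ ε f → ε :+ (f :- ε) := f) refl ε (f N ℚ.+ g N)) (eq N))))

  -- If f and g are at least -μ and μ ≤ 1, then fg ≥ -μ(f + g) - μ² ≥ -μ(c + 1). The constant sum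
  -- replaces separate upper bounds for the two factors.
  nonNeg-* : ∀ {f g c} → 0ℚ ℚ.≤ c → (∀ n → f n ℚ.+ g n ≡ c) → NonNeg f → NonNeg g → NonNeg (λ n → f n ℚ.* g n)
  nonNeg-* {f} {g} {c} 0≤c total (nonNeg p) (nonNeg q) .above ε 0<ε =
    let η , 0<η , eq = quotient {ε} {c ℚ.+ 1ℚ} 0<ε (0<-suc 0≤c)
        μ = 1ℚ ℚ.⊓ η
        0<μ = small 0<η
    in eventually (λ n a b → 0≤-≡
        (0≤-+ (0≤-+ (0≤-* a b) (0≤-* (0≤-+ 0≤c (nat-nonNeg 1)) (gap (ℚₚ.p⊓q≤q 1ℚ η)))) (0≤-* (ℚₚ.<⇒≤ 0<μ) (gap (ℚₚ.p⊓q≤p 1ℚ η))))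
        (trans (expand (f n) (g n) c μ η) (trans (cong₂ (λ e s → f n ℚ.* g n ℚ.+ e ℚ.+ μ ℚ.* (s ℚ.- c)) eq (total n))
          (cancel (f n ℚ.* g n) c μ ε))))
      (p μ 0<μ) (q μ 0<μ)
    where
    small : ∀ {η} → 0ℚ ℚ.< η → 0ℚ ℚ.< 1ℚ ℚ.⊓ η
    small {η} 0<η with ℚₚ.⊓-sel 1ℚ η
    ... | inj₁ eq = subst (0ℚ ℚ.<_) (sym eq) (ℚₚ.positive⁻¹ 1ℚ)
    ... | inj₂ eq = subst (0ℚ ℚ.<_) (sym eq) 0<η
    expand : ∀ f g c μ η → (f ℚ.+ μ) ℚ.* (g ℚ.+ μ) ℚ.+ (c ℚ.+ 1ℚ) ℚ.* (η ℚ.- μ) ℚ.+ μ ℚ.* (1ℚ ℚ.- μ) ≡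
      f ℚ.* g ℚ.+ η ℚ.* (c ℚ.+ 1ℚ) ℚ.+ μ ℚ.* (f ℚ.+ g ℚ.- c)
    expand = solve 5 (λ f g c μ η → (f :+ μ) :* (g :+ μ) :+ (c :+ con 1ℚ) :* (η :- μ) :+ μ :* (con 1ℚ :- μ) :=
      f :* g :+ η :* (c :+ con 1ℚ) :+ μ :* (f :+ g :- c)) refl
    cancel : ∀ h c μ ε → h ℚ.+ ε ℚ.+ μ ℚ.* (c ℚ.- c) ≡ h ℚ.+ ε
    cancel = solve 4 (λ h c μ ε → h :+ ε :+ μ :* (c :- c) := h :+ ε) refl

  Bounded : ℚ → ℚ → Set
  Bounded B q = 0ℚ ℚ.≤ B ℚ.+ q × 0ℚ ℚ.≤ B ℚ.- q

  -- AB + pq and AB - pq are each half the sum of two products of nonnegative factors.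
  bounded-* : ∀ {A B p q} → Bounded A p → Bounded B q → Bounded (A ℚ.* B) (p ℚ.* q)
  bounded-* {A} {B} {p} {q} (a , b) (c , d) =
    0≤-≡ (0≤-* (ℚₚ.<⇒≤ (ℚₚ.positive⁻¹ ℚ.½)) (0≤-+ (0≤-* a c) (0≤-* b d)))
      (solve 4 (λ A B p q → con ℚ.½ :* ((A :+ p) :* (B :+ q) :+ (A :- p) :* (B :- q)) := A :* B :+ p :* q) refl A B p q) ,
    0≤-≡ (0≤-* (ℚₚ.<⇒≤ (ℚₚ.positive⁻¹ ℚ.½)) (0≤-+ (0≤-* a d) (0≤-* b c)))
      (solve 4 (λ A B p q → con ℚ.½ :* ((A :+ p) :* (B :- q) :+ (A :- p) :* (B :+ q)) := A :* B :- p :* q) refl A B p q)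

  bounded-weaken : ∀ {A B q} → A ℚ.≤ B → Bounded A q → Bounded B q
  bounded-weaken {A} {B} {q} le (a , b) =
    0≤-≡ (0≤-+ (gap le) a) (solve 3 (λ A B q → (B :- A) :+ (A :+ q) := B :+ q) refl A B q) ,
    0≤-≡ (0≤-+ (gap le) b) (solve 3 (λ A B q → (B :- A) :+ (A :- q) := B :- q) refl A B q)

  null-* : ∀ {f g : Seq} {B} → 0ℚ ℚ.≤ B → NonNeg f → NonNeg (λ n → ℚ.- f n) → NonNeg (λ n → B ℚ.+ g n) → NonNeg (λ n → B ℚ.- g n) →
    NonNeg (λ n → f n ℚ.* g n)
  null-* {f} {g} {B} 0≤B (nonNeg p) (nonNeg p′) (nonNeg q) (nonNeg q′) .above ε 0<ε =
    let η , 0<η , eq = quotient {ε} {B ℚ.+ 1ℚ} 0<ε (0<-suc 0≤B)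
    in eventually (λ n (a , b) (c , d) → 0≤-≡ (proj₁ (bounded-* {η} {B ℚ.+ 1ℚ} {f n} {g n}
        (0≤-≡ a (ℚₚ.+-comm (f n) η) , 0≤-≡ b (ℚₚ.+-comm (ℚ.- f n) η)) (0≤-≡ c (swap B (g n)) , 0≤-≡ d (swap B (ℚ.- g n)))))
        (trans (ℚₚ.+-comm (η ℚ.* (B ℚ.+ 1ℚ)) (f n ℚ.* g n)) (cong (f n ℚ.* g n ℚ.+_) eq)))
      (eventually (λ _ → _,_) (p η 0<η) (p′ η 0<η))
      (eventually (λ _ → _,_) (q 1ℚ (ℚₚ.positive⁻¹ 1ℚ)) (q′ 1ℚ (ℚₚ.positive⁻¹ 1ℚ)))
    where
    swap : ∀ B g → B ℚ.+ g ℚ.+ 1ℚ ≡ B ℚ.+ 1ℚ ℚ.+ g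
    swap = solve 2 (λ B g → B :+ g :+ con 1ℚ := B :+ con 1ℚ :+ g) refl

-- Edges are drawn as parabolas over or under the interval between their ends.
hill : ℚ → ℚ → ℚ → ℚ
hill i j x = (x ℚ.- i) ℚ.* (j ℚ.- x)

module _ {i j k l : ℚ} {x x′ : Seq} where
  open ℚSolver.+-*-Solver

  -- The difference of the two parabolas is (k - i)(j - x) + (j - l)(x - k), and also (x - i)(j - l)
  -- + (k - i)(l - x). The first summand of the former is strictly positive if i < k, that of the
  -- latter if l < j.
  hill-nested : i ℚ.≤ k → l ℚ.≤ j → i ℚ.< k ⊎ l ℚ.< j → Pos (λ n → x n ℚ.- i) → Pos (λ n → j ℚ.- x n) →
    NonNeg (λ n → x n ℚ.- k) → NonNeg (λ n → l ℚ.- x n) → Pos (λ n → hill i j (x n) ℚ.- hill k l (x n))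
  hill-nested i≤k l≤j (inj₁ i<k) p q r s = pos-ext
    (λ n → solve 5 (λ i j k l x → (k :- i) :* (j :- x) :+ (j :- l) :* (x :- k) := (x :- i) :* (j :- x) :- (x :- k) :* (l :- x)) refl i j k l (x n))
    (pos-+ (pos-* (pos-const (0<gap i<k)) q) (nonNeg-scale (gap l≤j) r))
  hill-nested i≤k l≤j (inj₂ l<j) p q r s = pos-ext
    (λ n → solve 5 (λ i j k l x → (x :- i) :* (j :- l) :+ (k :- i) :* (l :- x) := (x :- i) :* (j :- x) :- (x :- k) :* (l :- x)) refl i j k l (x n))
    (pos-+ (pos-* p (pos-const (0<gap l<j))) (nonNeg-scale (gap i≤k) s))

  -- The difference is x - x′, which tends to 0, times a bounded factor.
  hill-close : k ℚ.≤ l → NonNeg (λ n → x n ℚ.- x′ n) → NonNeg (λ n → x′ n ℚ.- x n) →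
    NonNeg (λ n → x n ℚ.- k) → NonNeg (λ n → l ℚ.- x n) → NonNeg (λ n → x′ n ℚ.- k) → NonNeg (λ n → l ℚ.- x′ n) →
    NonNeg (λ n → hill k l (x n) ℚ.- hill k l (x′ n))
  hill-close k≤l p p′ a b c d = nonNeg-ext
    (λ n → solve 4 (λ k l x y → (x :- y) :* ((l :- x) :- (y :- k)) := (x :- k) :* (l :- x) :- (y :- k) :* (l :- y)) refl k l (x n) (x′ n))
    (null-* {λ n → x n ℚ.- x′ n} {λ n → (l ℚ.- x n) ℚ.- (x′ n ℚ.- k)} (gap k≤l) p
      (nonNeg-ext (λ n → solve 2 (λ x y → y :- x := :- (x :- y)) refl (x n) (x′ n)) p′)
      (nonNeg-ext (λ n → solve 4 (λ k l x y → (l :- x) :+ (l :- y) := (l :- k) :+ ((l :- x) :- (y :- k))) refl k l (x n) (x′ n)) (nonNeg-+ b d))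
      (nonNeg-ext (λ n → solve 4 (λ k l x y → (x :- k) :+ (y :- k) := (l :- k) :- ((l :- x) :- (y :- k))) refl k l (x n) (x′ n)) (nonNeg-+ a c)))

-- A two-page book embedding is a planar drawing

Disjoint Inside : ℕ → ℕ → ℕ → ℕ → Set
Disjoint i j k l = j ≤ k ⊎ l ≤ i
Inside i j k l = i ≤ k × l ≤ j × (i < k ⊎ l < j)

arrange : ∀ {i j k l} → i < j → k < l → ¬ (i ≡ k × j ≡ l) → ¬ (i < k × k < j × j < l) → ¬ (k < i × i < l × l < j) →
  Disjoint i j k l ⊎ Inside i j k l ⊎ Inside k l i j
arrange {i} {j} {k} {l} i<j k<l distinct cross cross′ with <-cmp i k | <-cmp j l
... | tri< i<k _ _ | tri< j<l _ _ = inj₁ (inj₁ (≮⇒≥ λ k<j → cross (i<k , k<j , j<l)))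
... | tri< i<k _ _ | tri≈ _ refl _ = inj₂ (inj₁ (<⇒≤ i<k , ≤-refl , inj₁ i<k))
... | tri< i<k _ _ | tri> _ _ l<j = inj₂ (inj₁ (<⇒≤ i<k , <⇒≤ l<j , inj₁ i<k))
... | tri≈ _ refl _ | tri< j<l _ _ = inj₂ (inj₂ (≤-refl , <⇒≤ j<l , inj₂ j<l))
... | tri≈ _ i≡k _ | tri≈ _ j≡l _ = ⊥-elim (distinct (i≡k , j≡l))
... | tri≈ _ refl _ | tri> _ _ l<j = inj₂ (inj₁ (≤-refl , <⇒≤ l<j , inj₂ l<j))
... | tri> _ _ k<i | tri< j<l _ _ = inj₂ (inj₂ (<⇒≤ k<i , <⇒≤ j<l , inj₁ k<i))
... | tri> _ _ k<i | tri≈ _ refl _ = inj₂ (inj₂ (<⇒≤ k<i , ≤-refl , inj₁ k<i))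
... | tri> _ _ k<i | tri> _ _ l<j = inj₁ (inj₂ (≮⇒≥ λ i<l → cross′ (k<i , i<l , l<j)))

nat-mono-< : ∀ {a b} → a < b → nat a ℚ.< nat b
nat-mono-< {a} lt = ℚₚ.<-≤-trans (ℚₚ.≤-<-trans (ℚₚ.≤-reflexive (sym (ℚₚ.+-identityˡ (nat a))))
  (ℚₚ.+-monoˡ-< (nat a) (ℚₚ.positive⁻¹ 1ℚ))) (nat-mono lt)

module _ where
  open ℚSolver.+-*-Solver

  -- The abscissas agree only in the limit, so the comparison is moved to `x` throughout. Disjoint
  -- intervals contradict the abscissas and nested ones the heights. Only `x` has to be strictly
  -- inside its interval, so arcs with a common end are covered as well.
  separate : ∀ {i j k l} (x x′ : Seq) → k < l → Disjoint i j k l ⊎ Inside i j k l ⊎ Inside k l i j →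
    Pos (λ n → x n ℚ.- nat i) → Pos (λ n → nat j ℚ.- x n) → NonNeg (λ n → x′ n ℚ.- nat k) → NonNeg (λ n → nat l ℚ.- x′ n) →
    NonNeg (λ n → x n ℚ.- x′ n) → NonNeg (λ n → x′ n ℚ.- x n) →
    NonNeg (λ n → hill (nat i) (nat j) (x n) ℚ.- hill (nat k) (nat l) (x′ n)) →
    NonNeg (λ n → hill (nat k) (nat l) (x′ n) ℚ.- hill (nat i) (nat j) (x n)) → ⊥
  separate {i} {j} {k} {l} x x′ k<l layout p q r s e e′ h h′ = cases layout
    where
    r′ : NonNeg (λ n → x n ℚ.- nat k)
    r′ = nonNeg-ext (λ n → solve 3 (λ x y k → (x :- y) :+ (y :- k) := x :- k) refl (x n) (x′ n) (nat k)) (nonNeg-+ e r)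
    s′ : NonNeg (λ n → nat l ℚ.- x n)
    s′ = nonNeg-ext (λ n → solve 3 (λ x y l → (y :- x) :+ (l :- y) := l :- x) refl (x n) (x′ n) (nat l)) (nonNeg-+ e′ s)
    k≤l = nat-mono (<⇒≤ k<l)
    strict : ∀ {a b c d} → a < b ⊎ c < d → nat a ℚ.< nat b ⊎ nat c ℚ.< nat d
    strict (inj₁ lt) = inj₁ (nat-mono-< lt)
    strict (inj₂ lt) = inj₂ (nat-mono-< lt)
    rest : ∀ a b c → (a ℚ.- b) ℚ.+ ((b ℚ.- c) ℚ.+ (c ℚ.- a)) ≡ 0ℚ
    rest = solve 3 (λ a b c → (a :- b) :+ ((b :- c) :+ (c :- a)) := con 0ℚ) refl
    cases : Disjoint i j k l ⊎ Inside i j k l ⊎ Inside k l i j → ⊥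
    cases (inj₁ (inj₁ j≤k)) = absurd q (nonNeg-+ (nonNeg-const (gap (nat-mono j≤k))) r′)
      (λ n → solve 3 (λ x j k → (j :- x) :+ ((k :- j) :+ (x :- k)) := con 0ℚ) refl (x n) (nat j) (nat k))
    cases (inj₁ (inj₂ l≤i)) = absurd p (nonNeg-+ (nonNeg-const (gap (nat-mono l≤i))) s′)
      (λ n → solve 3 (λ x i l → (x :- i) :+ ((i :- l) :+ (l :- x)) := con 0ℚ) refl (x n) (nat i) (nat l))
    cases (inj₂ (inj₁ (i≤k , l≤j , lt))) = absurd
      (hill-nested {nat i} {nat j} {nat k} {nat l} {x} {x} (nat-mono i≤k) (nat-mono l≤j) (strict lt) p q r′ s′)
      (nonNeg-+ (hill-close {nat k} {nat l} {nat k} {nat l} {x} {x′} k≤l e e′ r′ s′ r s) h′)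
      (λ n → rest (hill (nat i) (nat j) (x n)) (hill (nat k) (nat l) (x n)) (hill (nat k) (nat l) (x′ n)))
    cases (inj₂ (inj₂ (k≤i , j≤l , lt))) = absurd
      (hill-nested {nat k} {nat l} {nat i} {nat j} {x} {x} (nat-mono k≤i) (nat-mono j≤l) (strict lt)
        (pos-ext (λ n → solve 3 (λ x i k → (x :- i) :+ (i :- k) := x :- k) refl (x n) (nat i) (nat k)) (pos-+ p (nonNeg-const (gap (nat-mono k≤i)))))
        (pos-ext (λ n → solve 3 (λ x j l → (j :- x) :+ (l :- j) := l :- x) refl (x n) (nat j) (nat l)) (pos-+ q (nonNeg-const (gap (nat-mono j≤l)))))
        (pos⇒nonNeg p) (pos⇒nonNeg q))
      (nonNeg-+ h (hill-close {nat k} {nat l} {nat k} {nat l} {x′} {x} k≤l e′ e r s r′ s′))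
      (λ n → rest (hill (nat k) (nat l) (x n)) (hill (nat i) (nat j) (x n)) (hill (nat k) (nat l) (x′ n)))

  ≤⇒nonNeg : ∀ {x y} → x R.≤ y → NonNeg (λ n → seq y n ℚ.- seq x n)
  ≤⇒nonNeg {x} {y} le .above ε 0<ε with N , p ← le ε 0<ε = N , λ n N≤n → 0≤-≡ (gap (p n N≤n))
    (solve 3 (λ x y ε → y :+ ε :- x := y :- x :+ ε) refl (seq x n) (seq y n) ε)

  nonNeg⇒≤ : ∀ {x y} → NonNeg (λ n → seq y n ℚ.- seq x n) → x R.≤ y
  nonNeg⇒≤ {x} {y} (nonNeg p) ε 0<ε with N , q ← p ε 0<ε = N , λ n N≤n → ≤-by _ (q n N≤n)
    (solve 3 (λ x y ε → x :+ (y :- x :+ ε) := y :+ ε) refl (seq x n) (seq y n) ε)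

  <⇒pos : ∀ {x y} → x R.< y → Pos (λ n → seq y n ℚ.- seq x n)
  <⇒pos {x} {y} (ε , 0<ε , N , p) = isPos (ε , 0<ε , N , λ n N≤n → 0≤-≡ (gap (p n N≤n))
    (solve 3 (λ x y ε → y :- (x :+ ε) := y :- x :- ε) refl (seq x n) (seq y n) ε))

  ≡⇒≈ : ∀ {x y} → (∀ n → seq x n ≡ seq y n) → x R.≈ y
  ≡⇒≈ {x} {y} eq = (λ ε 0<ε → 0 , λ n _ → ℚₚ.≤-trans (ℚₚ.≤-reflexive (eq n)) (≤-slack (seq y n) 0<ε)) ,
    (λ ε 0<ε → 0 , λ n _ → ℚₚ.≤-trans (ℚₚ.≤-reflexive (sym (eq n))) (≤-slack (seq x n) 0<ε))

  bounded⇒within : ∀ {ε x y} → Eventually (λ n → Bounded ε (seq y n ℚ.- seq x n)) → Within ε x y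
  bounded⇒within {ε} {x} {y} (N , b) =
    (λ η 0<η → N , λ n N≤n → ≤-by _ (0≤-+ (proj₁ (b n N≤n)) (ℚₚ.<⇒≤ 0<η))
      (solve 4 (λ x y ε η → x :+ (ε :+ (y :- x) :+ η) := y :+ ε :+ η) refl (seq x n) (seq y n) ε η)) ,
    (λ η 0<η → N , λ n N≤n → ≤-by _ (0≤-+ (proj₂ (b n N≤n)) (ℚₚ.<⇒≤ 0<η))
      (solve 4 (λ x y ε η → y :+ (ε :- (y :- x) :+ η) := x :+ ε :+ η) refl (seq x n) (seq y n) ε η))

  within⇒bounded : ∀ {δ x y} → 0ℚ ℚ.< δ → Within δ x y → Eventually (λ n → Bounded (δ ℚ.+ δ) (seq y n ℚ.- seq x n))
  within⇒bounded {δ} {x} {y} 0<δ (p , q) = eventually (λ n a b →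
      0≤-≡ (gap a) (solve 3 (λ x y δ → y :+ δ :+ δ :- x := δ :+ δ :+ (y :- x)) refl (seq x n) (seq y n) δ) ,
      0≤-≡ (gap b) (solve 3 (λ x y δ → x :+ δ :+ δ :- y := δ :+ δ :- (y :- x)) refl (seq x n) (seq y n) δ))
    (p δ 0<δ) (q δ 0<δ)

  centred : ∀ {s t} → 0ℚ ℚ.≤ s ℚ.+ 1ℚ × 0ℚ ℚ.≤ 1ℚ ℚ.- s ℚ.+ 1ℚ → 0ℚ ℚ.≤ t ℚ.+ 1ℚ × 0ℚ ℚ.≤ 1ℚ ℚ.- t ℚ.+ 1ℚ →
    Bounded (nat 3) (1ℚ ℚ.- t ℚ.- s)
  centred {s} {t} (a , b) (c , d) = 0≤-≡ (0≤-+ b d) (upper s t) , 0≤-≡ (0≤-+ a c) (lower s t)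
    where
    upper : ∀ s t → (1ℚ ℚ.- s ℚ.+ 1ℚ) ℚ.+ (1ℚ ℚ.- t ℚ.+ 1ℚ) ≡ nat 3 ℚ.+ (1ℚ ℚ.- t ℚ.- s)
    upper = solve 2 (λ s t → (con 1ℚ :- s :+ con 1ℚ) :+ (con 1ℚ :- t :+ con 1ℚ) := con (nat 3) :+ (con 1ℚ :- t :- s)) refl
    lower : ∀ s t → (s ℚ.+ 1ℚ) ℚ.+ (t ℚ.+ 1ℚ) ≡ nat 3 ℚ.- (1ℚ ℚ.- t ℚ.- s)
    lower = solve 2 (λ s t → (s :+ con 1ℚ) :+ (t :+ con 1ℚ) := con (nat 3) :- (con 1ℚ :- t :- s)) refl

  interior : ∀ {t} → ∈⟨0,1⟩ t → Pos (seq t) × Pos (λ n → 1ℚ ℚ.- seq t n)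
  interior {t} (a , b) = pos-ext (λ n → solve 1 (λ t → t :- con 0ℚ := t) refl (seq t n)) (<⇒pos {0ℝ} {t} a) , <⇒pos {t} {1ℝ} b

  closure : ∀ {t} → ∈[0,1] t → NonNeg (seq t) × NonNeg (λ n → 1ℚ ℚ.- seq t n)
  closure {t} (a , b) = nonNeg-ext (λ n → solve 1 (λ t → t :- con 0ℚ := t) refl (seq t n)) (≤⇒nonNeg {0ℝ} {t} a) , ≤⇒nonNeg {t} {1ℝ} b

module Drawing {V : Set} (dec : (u v : V) → Dec (u ≡ v)) {r : V} (S : Shape V r) (vs : List V) (unique : Unique vs)
  (complete : ∀ {v} → In S v → v ∈ vs) (sound : ∀ {v} → v ∈ vs → In S v)
  (reach : ∃[ u ] ∃[ k ] Tour (edges S) r u k (In S)) where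
  open Weights dec
  open Network dec S vs unique complete sound reach
  open Graph net using (Vertex; Adj)
  open ℚSolver.+-*-Solver

  at : V → ℚ
  at v = nat (pos S v)

  page : List (Edge V) → V → V → Bool
  page [] u v = false
  page (e ∷ es) u v with joins? e u v
  ... | yes _ = low e
  ... | no _ = page es u v

  sign : Bool → ℚ
  sign l = if l then ℚ.- 1ℚ else 1ℚ

  record Arch (u v : V) : Set where
    field
      e     : Edge V
      e∈    : e ∈ E
      joins : Joins e u v
      low≡  : low e ≡ page E u v

  arch : ∀ {i j} → Adj i j → Arch (name i) (name j)
  arch {i} {j} adj with best E (name i) (name j) in eq | adj
  ... | just k | _ = let e , e∈ , joins , low≡ = find E eq id in record { e = e ; e∈ = e∈ ; joins = joins ; low≡ = low≡ }
    where
    find : ∀ es {u v} → best es u v ≡ just k → (∀ {e} → e ∈ es → e ∈ E) → ∃[ e ] e ∈ E × Joins e u v × low e ≡ page es u v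
    find (e ∷ es) {u} {v} eq sub with joins? e u v
    ... | yes j = e , sub (here refl) , j , refl
    ... | no _ = find es eq (sub ∘ there)

  -- As a function of the abscissa, the parabola is unchanged when `u` and `v` are exchanged. This
  -- matters because arcs are directed by vertex index and edges by position on the line.
  abscissa ordinate : V → V → R.ℝ → R.ℝ
  abscissa u v t = fromℚ (at u) R.+ t R.* fromℚ (at v ℚ.- at u)
  ordinate u v t = fromℚ (sign (page E u v)) R.*
    ((abscissa u v t R.+ fromℚ (ℚ.- at u)) R.* (fromℚ (at v) R.+ fromℚ (ℚ.- 1ℚ) R.* abscissa u v t))

  X : V → V → R.ℝ → Seq
  X u v t = seq (abscissa u v t)

  module _ {u v : V} (a : Arch u v) where
    open Arch a

    H : R.ℝ → Seq
    H t n = hill (at (src e)) (at (tgt e)) (X u v t n)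

    rising : at (src e) ℚ.< at (tgt e)
    rising = nat-mono-< (fwd S e∈)

    ordinate-hill : ∀ t n → seq (ordinate u v t) n ≡ sign (low e) ℚ.* H t n
    ordinate-hill t n rewrite low≡ = cong (sign (page E u v) ℚ.*_) (shape joins)
      where
      shape : Joins e u v → (X u v t n ℚ.+ ℚ.- at u) ℚ.* (at v ℚ.+ ℚ.- 1ℚ ℚ.* X u v t n) ≡ hill (at (src e)) (at (tgt e)) (X u v t n)
      shape (inj₁ (refl , refl)) = solve 3 (λ a b x → (x :+ :- a) :* (b :+ con (ℚ.- 1ℚ) :* x) := (x :- a) :* (b :- x)) refl (at u) (at v) (X u v t n)
      shape (inj₂ (refl , refl)) = solve 3 (λ a b x → (x :+ :- a) :* (b :+ con (ℚ.- 1ℚ) :* x) := (x :- b) :* (a :- x)) refl (at u) (at v) (X u v t n)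

    -- Stated for a predicate `P` so that it serves both for interior points, with `Pos`, and for
    -- all points of the arc, with `NonNeg`.
    locate : (P : Seq → Set) → (∀ {f g} → (∀ n → f n ≡ g n) → P f → P g) → (∀ {f c} → 0ℚ ℚ.< c → P f → P (λ n → c ℚ.* f n)) →
      ∀ t → P (seq t) → P (λ n → 1ℚ ℚ.- seq t n) → P (λ n → X u v t n ℚ.- at (src e)) × P (λ n → at (tgt e) ℚ.- X u v t n)
    locate P ext scale t p q = split joins
      where
      split : Joins e u v → P (λ n → X u v t n ℚ.- at (src e)) × P (λ n → at (tgt e) ℚ.- X u v t n)
      split (inj₁ (refl , refl)) =
        ext (λ n → solve 3 (λ a b t → (b :- a) :* t := a :+ t :* (b :- a) :- a) refl (at u) (at v) (seq t n)) (scale (0<gap rising) p) ,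
        ext (λ n → solve 3 (λ a b t → (b :- a) :* (con 1ℚ :- t) := b :- (a :+ t :* (b :- a))) refl (at u) (at v) (seq t n)) (scale (0<gap rising) q)
      split (inj₂ (refl , refl)) =
        ext (λ n → solve 3 (λ a b t → (a :- b) :* (con 1ℚ :- t) := a :+ t :* (b :- a) :- b) refl (at u) (at v) (seq t n)) (scale (0<gap rising) q) ,
        ext (λ n → solve 3 (λ a b t → (a :- b) :* t := a :- (a :+ t :* (b :- a))) refl (at u) (at v) (seq t n)) (scale (0<gap rising) p)

    strictly : ∀ t → ∈⟨0,1⟩ t → Pos (λ n → X u v t n ℚ.- at (src e)) × Pos (λ n → at (tgt e) ℚ.- X u v t n)
    strictly t t∈ = locate Pos pos-ext (λ 0<c p → pos-* (pos-const 0<c) p) t (proj₁ (interior {t} t∈)) (proj₂ (interior {t} t∈))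

    weakly : ∀ t → ∈[0,1] t → NonNeg (λ n → X u v t n ℚ.- at (src e)) × NonNeg (λ n → at (tgt e) ℚ.- X u v t n)
    weakly t t∈ = locate NonNeg nonNeg-ext (λ 0<c p → nonNeg-scale (ℚₚ.<⇒≤ 0<c) p) t (proj₁ (closure {t} t∈)) (proj₂ (closure {t} t∈))

    -- Both factors of the parabola are strictly positive at interior points, whereas all vertices
    -- lie on the axis.
    above-line : ∀ t → ∈⟨0,1⟩ t → ¬ ordinate u v t R.≈ 0ℝ
    above-line t t∈ (le , ge) with low e | ordinate-hill t
    ... | false | eq = absurd (pos-* (proj₁ (strictly t t∈)) (proj₂ (strictly t t∈))) (≤⇒nonNeg {ordinate u v t} {0ℝ} le)
      (λ n → trans (cong (λ y → H t n ℚ.+ (0ℚ ℚ.- y)) (eq n)) (solve 1 (λ h → h :+ (con 0ℚ :- con 1ℚ :* h) := con 0ℚ) refl (H t n)))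
    ... | true | eq = absurd (pos-* (proj₁ (strictly t t∈)) (proj₂ (strictly t t∈))) (≤⇒nonNeg {0ℝ} {ordinate u v t} ge)
      (λ n → trans (cong (λ y → H t n ℚ.+ (y ℚ.- 0ℚ)) (eq n)) (solve 1 (λ h → h :+ (con (ℚ.- 1ℚ) :* h :- con 0ℚ) := con 0ℚ) refl (H t n)))

    one-to-one : ∀ s t → abscissa u v s R.≈ abscissa u v t → s R.≈ t
    one-to-one s t (le , ge) = split joins
      where
      p = ≤⇒nonNeg {abscissa u v s} {abscissa u v t} le
      q = ≤⇒nonNeg {abscissa u v t} {abscissa u v s} ge
      split : Joins e u v → s R.≈ t
      split (inj₁ (refl , refl)) =
        nonNeg⇒≤ {s} {t} (nonNeg-unscale (0<gap rising) (nonNeg-ext (λ n → solve 4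
          (λ a b s t → (a :+ t :* (b :- a)) :- (a :+ s :* (b :- a)) := (b :- a) :* (t :- s)) refl (at u) (at v) (seq s n) (seq t n)) p)) ,
        nonNeg⇒≤ {t} {s} (nonNeg-unscale (0<gap rising) (nonNeg-ext (λ n → solve 4
          (λ a b s t → (a :+ t :* (b :- a)) :- (a :+ s :* (b :- a)) := (b :- a) :* (t :- s)) refl (at u) (at v) (seq t n) (seq s n)) q))
      split (inj₂ (refl , refl)) =
        nonNeg⇒≤ {s} {t} (nonNeg-unscale (0<gap rising) (nonNeg-ext (λ n → solve 4
          (λ a b s t → (a :+ s :* (b :- a)) :- (a :+ t :* (b :- a)) := (a :- b) :* (t :- s)) refl (at u) (at v) (seq s n) (seq t n)) q)) ,
        nonNeg⇒≤ {t} {s} (nonNeg-unscale (0<gap rising) (nonNeg-ext (λ n → solve 4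
          (λ a b s t → (a :+ s :* (b :- a)) :- (a :+ t :* (b :- a)) := (a :- b) :* (t :- s)) refl (at u) (at v) (seq t n) (seq s n)) p))

    continuity : ∀ t → ∈[0,1] t → ∀ ε → 0ℚ ℚ.< ε → ∃[ δ ] 0ℚ ℚ.< δ × (∀ s → ∈[0,1] s → Within δ s t →
      Within ε (abscissa u v s) (abscissa u v t) × Within ε (ordinate u v s) (ordinate u v t))
    continuity t t∈ ε 0<ε = let δ , 0<δ , δB = quotient {ε} {B ℚ.+ B} 0<ε 0<2B in δ , 0<δ , λ s s∈ close → let near = difference {δ} s close 0<δ in
      bounded⇒within {ε} {abscissa u v s} {abscissa u v t} (eventually (λ n b _ → subst₂ Bounded (scaled {δ} δB)
        (solve 4 (λ a b s t → (t :- s) :* (b :- a) := a :+ t :* (b :- a) :- (a :+ s :* (b :- a))) refl (at u) (at v) (seq s n) (seq t n))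
        (bounded-* {δ ℚ.+ δ} {B} {seq t n ℚ.- seq s n} {d} b (bounded-weaken {m} {B} {d} m≤B bounded-d))) near near) ,
      bounded⇒within {ε} {ordinate u v s} {ordinate u v t} (eventually (λ n b c → subst₂ Bounded (scaled {δ} δB)
        (solve 5 (λ a b s t σ → (t :- s) :* (σ :* ((b :- a) :* (b :- a) :* (con 1ℚ :- t :- s))) :=
            σ :* ((a :+ t :* (b :- a) :+ :- a) :* (b :+ con (ℚ.- 1ℚ) :* (a :+ t :* (b :- a)))) :-
            σ :* ((a :+ s :* (b :- a) :+ :- a) :* (b :+ con (ℚ.- 1ℚ) :* (a :+ s :* (b :- a))))) refl (at u) (at v) (seq s n) (seq t n) σ)
        (bounded-* {δ ℚ.+ δ} {B} {seq t n ℚ.- seq s n} {σ ℚ.* (d ℚ.* d ℚ.* (1ℚ ℚ.- seq t n ℚ.- seq s n))} b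
          (bounded-weaken {1ℚ ℚ.* (m ℚ.* m ℚ.* nat 3)} {B} cubic≤B
          (bounded-* {1ℚ} {m ℚ.* m ℚ.* nat 3} {σ} {d ℚ.* d ℚ.* (1ℚ ℚ.- seq t n ℚ.- seq s n)} bounded-σ
            (bounded-* {m ℚ.* m} {nat 3} {d ℚ.* d} {1ℚ ℚ.- seq t n ℚ.- seq s n} (bounded-* {m} {m} {d} {d} bounded-d bounded-d) c))))) near (middle s s∈))
      where
      -- Between s and t the ordinate changes by (t - s) σ d² (1 - t - s). Here |σ| ≤ 1, |d| ≤ m and
      -- eventually |1 - t - s| ≤ 3, because the members of both sequences eventually lie between -1
      -- and 2. `B` bounds this factor as well as the factor `d` of the abscissa.
      σ d m B : ℚ
      σ = sign (page E u v)
      d = at v ℚ.- at u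
      m = 1ℚ ℚ.+ at u ℚ.+ at v
      B = m ℚ.+ m ℚ.* m ℚ.* nat 3
      0≤m : 0ℚ ℚ.≤ m
      0≤m = 0≤-+ (0≤-+ (nat-nonNeg 1) (nat-nonNeg (pos S u))) (nat-nonNeg (pos S v))
      0≤mm : 0ℚ ℚ.≤ m ℚ.* m ℚ.* nat 3
      0≤mm = 0≤-* (0≤-* 0≤m 0≤m) (nat-nonNeg 3)
      0<2B : 0ℚ ℚ.< B ℚ.+ B
      0<2B = ℚₚ.<-≤-trans (ℚₚ.positive⁻¹ 1ℚ) (≤-by (at u ℚ.+ at v ℚ.+ m ℚ.* m ℚ.* nat 3 ℚ.+ B)
        (0≤-+ (0≤-+ (0≤-+ (nat-nonNeg (pos S u)) (nat-nonNeg (pos S v))) 0≤mm) (0≤-+ 0≤m 0≤mm))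
        (solve 4 (λ a b c B → con 1ℚ :+ (a :+ b :+ c :+ B) := con 1ℚ :+ a :+ b :+ c :+ B) refl (at u) (at v) (m ℚ.* m ℚ.* nat 3) B))
      m≤B : m ℚ.≤ B
      m≤B = ≤-by (m ℚ.* m ℚ.* nat 3) 0≤mm refl
      cubic≤B : 1ℚ ℚ.* (m ℚ.* m ℚ.* nat 3) ℚ.≤ B
      cubic≤B = ≤-by m 0≤m (solve 2 (λ m c → con 1ℚ :* c :+ m := m :+ c) refl m (m ℚ.* m ℚ.* nat 3))
      scaled : ∀ {δ} → δ ℚ.* (B ℚ.+ B) ≡ ε → (δ ℚ.+ δ) ℚ.* B ≡ ε
      scaled {δ} eq = trans (solve 2 (λ δ B → (δ :+ δ) :* B := δ :* (B :+ B)) refl δ B) eq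
      difference : ∀ {δ} s → Within δ s t → 0ℚ ℚ.< δ → Eventually (λ n → Bounded (δ ℚ.+ δ) (seq t n ℚ.- seq s n))
      difference s close 0<δ = within⇒bounded {_} {s} {t} 0<δ close
      bounded-d : Bounded m d
      bounded-d = 0≤-≡ (0≤-+ (0≤-+ (nat-nonNeg 1) (nat-nonNeg (pos S v))) (nat-nonNeg (pos S v)))
          (solve 2 (λ a b → con 1ℚ :+ b :+ b := con 1ℚ :+ a :+ b :+ (b :- a)) refl (at u) (at v)) ,
        0≤-≡ (0≤-+ (0≤-+ (nat-nonNeg 1) (nat-nonNeg (pos S u))) (nat-nonNeg (pos S u)))
          (solve 2 (λ a b → con 1ℚ :+ a :+ a := con 1ℚ :+ a :+ b :- (b :- a)) refl (at u) (at v))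
      bounded-σ : Bounded 1ℚ σ
      bounded-σ with page E u v
      ... | false = nat-nonNeg 2 , nat-nonNeg 0
      ... | true = nat-nonNeg 0 , nat-nonNeg 2
      middle : ∀ s → ∈[0,1] s → Eventually (λ n → Bounded (nat 3) (1ℚ ℚ.- seq t n ℚ.- seq s n))
      middle s s∈ = eventually (λ n → centred {seq s n} {seq t n}) (unit s s∈) (unit t t∈)
        where
        unit : ∀ t → ∈[0,1] t → Eventually (λ n → 0ℚ ℚ.≤ seq t n ℚ.+ 1ℚ × 0ℚ ℚ.≤ 1ℚ ℚ.- seq t n ℚ.+ 1ℚ)
        unit t t∈ = eventually (λ _ → _,_) (above (proj₁ (closure {t} t∈)) 1ℚ (ℚₚ.positive⁻¹ 1ℚ)) (above (proj₂ (closure {t} t∈)) 1ℚ (ℚₚ.positive⁻¹ 1ℚ))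

    isArc : IsArc (fromℚ (at u) , 0ℝ) (fromℚ (at v) , 0ℝ) (λ t → abscissa u v t , ordinate u v t)
    isArc = record
      { start = ≡⇒≈ {abscissa u v 0ℝ} {fromℚ (at u)} (λ _ → solve 2 (λ a b → a :+ con 0ℚ :* (b :- a) := a) refl (at u) (at v)) ,
          ≡⇒≈ {ordinate u v 0ℝ} {0ℝ} (λ _ → solve 3 (λ a b σ → σ :* ((a :+ con 0ℚ :* (b :- a) :+ :- a) :* (b :+ con (ℚ.- 1ℚ) :* (a :+ con 0ℚ :* (b :- a)))) := con 0ℚ) refl (at u) (at v) (sign (page E u v)))
      ; end = ≡⇒≈ {abscissa u v 1ℝ} {fromℚ (at v)} (λ _ → solve 2 (λ a b → a :+ con 1ℚ :* (b :- a) := b) refl (at u) (at v)) ,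
          ≡⇒≈ {ordinate u v 1ℝ} {0ℝ} (λ _ → solve 3 (λ a b σ → σ :* ((a :+ con 1ℚ :* (b :- a) :+ :- a) :* (b :+ con (ℚ.- 1ℚ) :* (a :+ con 1ℚ :* (b :- a)))) := con 0ℚ) refl (at u) (at v) (sign (page E u v)))
      ; continuous = continuity
      ; injective = λ s t _ _ (x≈ , _) → one-to-one s t x≈
      }

  module _ {u v u′ v′ : V} (a : Arch u v) (a′ : Arch u′ v′) where
    private
      module A = Arch a
      module A′ = Arch a′

    same-page : ∀ s t → low A.e ≡ low A′.e → ordinate u v s R.≤ ordinate u′ v′ t → ordinate u′ v′ t R.≤ ordinate u v s →
      NonNeg (λ n → H a s n ℚ.- H a′ t n) × NonNeg (λ n → H a′ t n ℚ.- H a s n)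
    same-page s t eq le ge with low A.e | low A′.e | ordinate-hill a s | ordinate-hill a′ t | eq
    ... | false | _ | y≡ | y≡′ | refl =
      nonNeg-ext (λ n → trans (cong₂ ℚ._-_ (y≡ n) (y≡′ n)) (solve 2 (λ h k → con 1ℚ :* h :- con 1ℚ :* k := h :- k) refl (H a s n) (H a′ t n))) (≤⇒nonNeg {ordinate u′ v′ t} {ordinate u v s} ge) ,
      nonNeg-ext (λ n → trans (cong₂ ℚ._-_ (y≡′ n) (y≡ n)) (solve 2 (λ h k → con 1ℚ :* k :- con 1ℚ :* h := k :- h) refl (H a s n) (H a′ t n))) (≤⇒nonNeg {ordinate u v s} {ordinate u′ v′ t} le)
    ... | true | _ | y≡ | y≡′ | refl =
      nonNeg-ext (λ n → trans (cong₂ ℚ._-_ (y≡′ n) (y≡ n)) (solve 2 (λ h k → con (ℚ.- 1ℚ) :* k :- con (ℚ.- 1ℚ) :* h := h :- k) refl (H a s n) (H a′ t n))) (≤⇒nonNeg {ordinate u v s} {ordinate u′ v′ t} le) ,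
      nonNeg-ext (λ n → trans (cong₂ ℚ._-_ (y≡ n) (y≡′ n)) (solve 2 (λ h k → con (ℚ.- 1ℚ) :* h :- con (ℚ.- 1ℚ) :* k := k :- h) refl (H a s n) (H a′ t n))) (≤⇒nonNeg {ordinate u′ v′ t} {ordinate u v s} ge)

    -- At an interior point the first height is strictly on its own side of the axis, while the
    -- second is weakly on the other side.
    other-page : ∀ s t → ∈⟨0,1⟩ s → ∈[0,1] t → low A.e ≢ low A′.e → ordinate u v s R.≤ ordinate u′ v′ t → ordinate u′ v′ t R.≤ ordinate u v s → ⊥
    other-page s t s∈ t∈ ne le ge with low A.e | low A′.e | ordinate-hill a s | ordinate-hill a′ t
    ... | false | false | _ | _ = ne refl
    ... | true | true | _ | _ = ne refl
    ... | false | true | y≡ | y≡′ = absurd positive (nonNeg-+ positive′ (≤⇒nonNeg {ordinate u v s} {ordinate u′ v′ t} le))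
      (λ n → trans (cong₂ (λ y z → H a s n ℚ.+ (H a′ t n ℚ.+ (z ℚ.- y))) (y≡ n) (y≡′ n))
        (solve 2 (λ h k → h :+ (k :+ (con (ℚ.- 1ℚ) :* k :- con 1ℚ :* h)) := con 0ℚ) refl (H a s n) (H a′ t n)))
      where
      positive = pos-* (proj₁ (strictly a s s∈)) (proj₂ (strictly a s s∈))
      positive′ = nonNeg-* (gap (ℚₚ.<⇒≤ (rising a′))) (λ n → solve 3 (λ i j x → (x :- i) :+ (j :- x) := j :- i) refl (at (src A′.e)) (at (tgt A′.e)) (X u′ v′ t n))
        (proj₁ (weakly a′ t t∈)) (proj₂ (weakly a′ t t∈))
    ... | true | false | y≡ | y≡′ = absurd positive (nonNeg-+ positive′ (≤⇒nonNeg {ordinate u′ v′ t} {ordinate u v s} ge))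
      (λ n → trans (cong₂ (λ y z → H a s n ℚ.+ (H a′ t n ℚ.+ (y ℚ.- z))) (y≡ n) (y≡′ n))
        (solve 2 (λ h k → h :+ (k :+ (con (ℚ.- 1ℚ) :* h :- con 1ℚ :* k)) := con 0ℚ) refl (H a s n) (H a′ t n)))
      where
      positive = pos-* (proj₁ (strictly a s s∈)) (proj₂ (strictly a s s∈))
      positive′ = nonNeg-* (gap (ℚₚ.<⇒≤ (rising a′))) (λ n → solve 3 (λ i j x → (x :- i) :+ (j :- x) := j :- i) refl (at (src A′.e)) (at (tgt A′.e)) (X u′ v′ t n))
        (proj₁ (weakly a′ t t∈)) (proj₂ (weakly a′ t t∈))

    apart-arcs : ¬ (src A.e ≡ src A′.e × tgt A.e ≡ tgt A′.e) → ∀ s t → ∈⟨0,1⟩ s → ∈[0,1] t →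
      ¬ (abscissa u v s , ordinate u v s) ≈₂ (abscissa u′ v′ t , ordinate u′ v′ t)
    apart-arcs ne s t s∈ t∈ ((x≤ , x≥) , (y≤ , y≥)) with low A.e ≟ᵇ low A′.e
    ... | no differ = other-page s t s∈ t∈ differ y≤ y≥
    ... | yes alike = separate (X u v s) (X u′ v′ t) (fwd S A′.e∈)
      (arrange (fwd S A.e∈) (fwd S A′.e∈)
        (λ (p , q) → ne (pos-inj S (src∈ S A.e∈) (src∈ S A′.e∈) p , pos-inj S (tgt∈ S A.e∈) (tgt∈ S A′.e∈) q))
        (planar S A.e∈ A′.e∈ alike) (planar S A′.e∈ A.e∈ (sym alike)))
      (proj₁ (strictly a s s∈)) (proj₂ (strictly a s s∈)) (proj₁ (weakly a′ t t∈)) (proj₂ (weakly a′ t t∈))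
      (≤⇒nonNeg {abscissa u′ v′ t} {abscissa u v s} x≥) (≤⇒nonNeg {abscissa u v s} {abscissa u′ v′ t} x≤)
      (proj₁ (same-page s t alike y≤ y≥)) (proj₂ (same-page s t alike y≤ y≥))

  at-injective : ∀ {u v} → In S u → In S v → fromℚ (at u) R.≈ fromℚ (at v) → u ≡ v
  at-injective {u} {v} u∈ v∈ (le , ge) with <-cmp (pos S u) (pos S v)
  ... | tri≈ _ eq _ = pos-inj S u∈ v∈ eq
  ... | tri< lt _ _ = ⊥-elim (absurd (pos-const (0<gap (nat-mono-< lt))) (≤⇒nonNeg {fromℚ (at v)} {fromℚ (at u)} ge)
    (λ _ → solve 2 (λ a b → (b :- a) :+ (a :- b) := con 0ℚ) refl (at u) (at v)))
  ... | tri> _ _ gt = ⊥-elim (absurd (pos-const (0<gap (nat-mono-< gt))) (≤⇒nonNeg {fromℚ (at u)} {fromℚ (at v)} le)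
    (λ _ → solve 2 (λ a b → (a :- b) :+ (b :- a) := con 0ℚ) refl (at u) (at v)))

  drawing : Planar net
  drawing = record
    { point = λ i → fromℚ (at (name i)) , 0ℝ
    ; point-distinct = λ i j i≢j (x≈ , _) → i≢j (name-injective i j (at-injective (sound (∈-lookup i)) (sound (∈-lookup j)) x≈))
    ; arc = λ i j t → abscissa (name i) (name j) t , ordinate (name i) (name j) t
    ; arc-isArc = λ i j (adj , _) → isArc (arch {i} {j} adj)
    ; avoids-points = λ i j k (adj , _) t t∈ (_ , y≈) → above-line (arch {i} {j} adj) t t∈ y≈
    ; avoids-arcs = λ i j i′ j′ (adj , i<j) (adj′ , i′<j′) ne s t s∈ t∈ → apart-arcs (arch {i} {j} adj) (arch {i′} {j′} adj′)
        (λ (p , q) → distinct i j i′ j′ i<j i′<j′ ne {Arch.e (arch {i} {j} adj)} {Arch.e (arch {i′} {j′} adj′)}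
          (Arch.joins (arch {i} {j} adj)) (Arch.joins (arch {i′} {j′} adj′)) p q) s t s∈ t∈
    }
    where
    -- Arcs start at the smaller index. If the same ends occurred in opposite order, both i < j and
    -- j < i would hold.
    distinct : ∀ i j i′ j′ → i Fin.< j → i′ Fin.< j′ → (i , j) ≢ (i′ , j′) → ∀ {e e′} →
      Joins e (name i) (name j) → Joins e′ (name i′) (name j′) → src e ≡ src e′ → tgt e ≡ tgt e′ → ⊥
    distinct i j i′ j′ i<j i′<j′ ne (inj₁ (a , b)) (inj₁ (c , d)) p q =
      ne (cong₂ _,_ (name-injective i i′ (trans (sym a) (trans p c))) (name-injective j j′ (trans (sym b) (trans q d))))
    distinct i j i′ j′ i<j i′<j′ ne (inj₂ (a , b)) (inj₂ (c , d)) p q =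
      ne (cong₂ _,_ (name-injective i i′ (trans (sym b) (trans q d))) (name-injective j j′ (trans (sym a) (trans p c))))
    distinct i j i′ j′ i<j i′<j′ ne (inj₁ (a , b)) (inj₂ (c , d)) p q
      with refl ← name-injective i j′ (trans (sym a) (trans p c)) | refl ← name-injective j i′ (trans (sym b) (trans q d)) = <-asym i<j i′<j′
    distinct i j i′ j′ i<j i′<j′ ne (inj₂ (a , b)) (inj₁ (c , d)) p q
      with refl ← name-injective i j′ (trans (sym b) (trans q d)) | refl ← name-injective j i′ (trans (sym a) (trans p c)) = <-asym i<j i′<j′

-- The bound on the competitive ratio

p≤∣p∣ : ∀ p → p ℚ.≤ ℚ.∣ p ∣
p≤∣p∣ p with ℚₚ.≤-total 0ℚ p
... | inj₁ 0≤p = ℚₚ.≤-reflexive (sym (ℚₚ.0≤p⇒∣p∣≡p 0≤p))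
... | inj₂ p≤0 = ℚₚ.≤-trans p≤0 (ℚₚ.0≤∣p∣ p)

game-refutes : ∀ (A : Algorithm) c → RatioBound PlanarInstance A c → ∀ {N δ} → Game N → 1 ≤ N → 0ℚ ℚ.< δ → 1ℚ ℚ.≤ nat N ℚ.* δ →
  ¬ Eventually (λ n → seq c n ℚ.+ (δ ℚ.+ δ) ℚ.≤ + 10 / 3)
game-refutes A c bound {N} {δ} G 1≤N 0<δ large (N₀ , small) = refute winning
  where
  open Game G
  open Playing A G
  refute : Winning → ⊥
  refute (s , K , Φ≤ , κ , tour , ratio , v , v∈ , low<) =
    optimum tour (Φ-lip s) v∈ low< λ (m , opt , 1≤m , m≤κ) →
      let N₁ , h = bound instance′ drawing (fromℚ (nat m)) opt (1ℚ , ℚₚ.positive⁻¹ 1ℚ , 0 , λ _ _ → nat-mono {1} 1≤m) δ 0<δ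
          n = N₀ ⊔ N₁
      in clash {N} {final-cost} {m} {seq c n} 0<δ large
        (drop-slack {N} {final-cost} {κ} {m} {Φ s root} 1≤N ratio Φ≤ m≤κ) 1≤m
        (subst (ℚ._≤ seq c n ℚ.* nat m ℚ.+ δ) (cost-seq (CompleteRun.walk run) n) (h n (m≤n⊔m N₀ N₁)))
        (small n (m≤m⊔n N₀ N₁))
    where
    open Play.Net A G s K
    open Optimum dec (sh s) vs unique complete sound (reach s) using (optimum)
    open Drawing dec (sh s) vs unique complete sound (reach s) using (drawing)

adversary : ∀ N → 1 ≤ N → Game N
adversary N 1≤N = TopGame.game N 1≤N (level (proj₁ (quality-limit (6 * N))))
  (≤-trans (≤-reflexive (sym (*-assoc 6 N _))) (proj₂ (quality-limit (6 * N))))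

corollary5p1 : (A : Algorithm) → fromℚ (+ 10 / 3) ≤CompetitiveRatio[ PlanarInstance ] A
corollary5p1 A c bound ε 0<ε
  -- With ε = 4δ, the real `c` is compared with 10/3 at a single index beyond which it varies by at
  -- most δ. The margin 3δ used there becomes 4δ = ε at later indices if it suffices, and otherwise
  -- leaves a distance of 2δ below 10/3 for the contradiction.
  with η , 0<η , refl ← half 0<ε
  with δ , 0<δ , refl ← half 0<η
  with N , close ← cauchy c δ 0<δ
  with + 10 / 3 ℚₚ.≤? seq c N ℚ.+ (δ ℚ.+ δ ℚ.+ δ)
... | yes le = N , λ n N≤n → ≤-by _ (0≤-+ (gap le) (gap (ℚₚ.≤-trans (p≤∣p∣ (seq c N ℚ.- seq c n)) (close N n ≤-refl N≤n))))
    (solve 4 (λ r p q δ → r :+ ((p :+ (δ :+ δ :+ δ) :- r) :+ (δ :- (p :- q))) := q :+ (δ :+ δ :+ (δ :+ δ))) refl (+ 10 / 3) (seq c N) (seq c n) δ)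
  where
  open ℚSolver.+-*-Solver
... | no nle = let k , large = multiple 0<δ in ⊥-elim (game-refutes A c bound (adversary (suc k) (s≤s z≤n)) (s≤s z≤n) 0<δ large (N , λ n N≤n →
    ≤-by _ (0≤-+ (gap (ℚₚ.<⇒≤ (ℚₚ.≰⇒> nle))) (gap (ℚₚ.≤-trans (p≤∣p∣ (seq c n ℚ.- seq c N)) (close n N N≤n ≤-refl))))
      (solve 4 (λ r p q δ → q :+ (δ :+ δ) :+ ((r :- (p :+ (δ :+ δ :+ δ))) :+ (δ :- (q :- p))) := r) refl (+ 10 / 3) (seq c N) (seq c n) δ)))
  where
  open ℚSolver.+-*-Solver
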